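{- Let $\mathcal{C}$ be a permutation class containing only finitely many simple permutations, and let $\mathcal{C}_n$ denote the set of permutations of length $n$ in $\mathcal{C}$. Then each of the following sequences has a generating function $\sum_n a_n x^n$ that is algebraic over $\mathbb{Q}(x)$: (1) $a_n$ = the number of alternating permutations in $\mathcal{C}_n$; (2) $a_n$ = the number of even permutations in $\mathcal{C}_n$; (3) $a_n$ = the number of Dumont permutations of the first kind in $\mathcal{C}_n$; (4) $a_n$ = the number of permutations in $\mathcal{C}_n$ avoiding every member of a given finite set of blocked or barred permutations; (5) $a_n$ = the number of involutions in $\mathcal{C}_n$. Moreover, these conditions can be combined in any finite manner: for any finite collection of the conditions listed in (1)–(5), the number of permutations in $\mathcal{C}_n$ satisfying all of them simultaneously has an algebraic generating function.
   Context: A permutation $\pi$ contains $\sigma$ if $\pi$ has a subsequence order-isomorphic to $\sigma$; a permutation class is a set of permutations closed downward under containment. An interval of $\pi\in S_n$ is a set of contiguous indices $[a,b]$ whose image under $\pi$ is a set of consecutive integers; $\pi$ is simple if its only intervals have size $0$, $1$, or $n$. A permutation $\pi\in S_n$ is alternating if for every $i\in[2,n-1]$, $\pi(i)$ does not lie between $\pi(i-1)$ and $\pi(i+1)$. A permutation is Dumont of the first kind if each even entry is immediately followed by a smaller entry and each odd entry is either immediately followed by a larger entry or is the last entry. A barred permutation is a permutation with some entries barred; $\pi$ avoids it if every subsequence of $\pi$ order-isomorphic to the unbarred entries can be extended (by adding entries of $\pi$ in the positions/relative values prescribed by the barred entries) to a subsequence order-isomorphic to the whole pattern. A blocked permutation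 is a permutation pattern with dashes between some consecutive entries; an occurrence in $\pi$ is a subsequence order-isomorphic to the pattern in which any two pattern entries that are adjacent in the pattern and not separated by a dash must occupy adjacent positions of $\pi$ (e.g. $513$ is an occurrence of $3\text{ - }12$ in $51342$, but $514$ is not). -}

module Defs where

open import Data.Fin.Base using (Fin; toℕ; _<_)
open import Data.Fin.Permutation using (Permutation′; _⟨$⟩ʳ_; _≈_)
open import Data.Fin.Properties using (_<?_)
open import Data.Fin.Subset using (Subset; _∈_; _∉_; ∁)
open import Data.Integer.Base using (+_)
open import Data.List.Base
  using (List; []; _∷_; length; filter; cartesianProduct; allFin)
open import Data.List.Relation.Unary.All using (All)
open import Data.List.Relation.Unary.Any using (Any)
open import Data.Nat.Base as ℕ using (ℕ; zero; suc; pred; _∸_)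
open import Data.Nat.Divisibility using (_∣_)
open import Data.Product.Base using (∃; ∃₂; _×_; _,_; proj₁)
open import Data.Rational.Base as ℚ using (ℚ; 0ℚ)
open import Data.Rational.Properties using (+-0-commutativeMonoid)
open import Data.Sum.Base using (_⊎_)
open import Function.Base using (id)
open import Function.Bundles using (_⇔_; Inverse)
open import Level using (0ℓ)
open import Relation.Binary.Bundles using (Setoid)
open import Relation.Binary.PropositionalEquality
  using (_≡_; _≢_; refl; sym; trans; setoid)
import Relation.Binary.Construct.On as On
open import Relation.Nullary using (¬_)
open import Relation.Nullary.Decidable using (_×-dec_)

open import Algebra.Properties.CommutativeMonoid.Sum +-0-commutativeMonoid
  using (sum)

private
  variable
    k n : ℕ

-- Positions and values are 0-based.  Permutations are compared by the
-- library's pointwise equality _≈_.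

permSetoid : ℕ → Setoid 0ℓ 0ℓ
permSetoid n = record
  { Carrier       = Permutation′ n
  ; _≈_           = _≈_
  ; isEquivalence = record
    { refl  = λ i → refl
    ; sym   = λ p i → sym (p i)
    ; trans = λ p q i → trans (p i) (q i)
    }
  }

-- f sends the entries of σ at the positions ι a to entries of π, the
-- image being a subsequence of π order-isomorphic to those entries of σ.
record OrderIso {A : Set} (ι : A → Fin k)
                (σ : Permutation′ k) (π : Permutation′ n)
                (f : A → Fin n) : Set where
  field
    positions : ∀ a b → ι a < ι b → f a < f b
    values    : ∀ a b →
                (σ ⟨$⟩ʳ ι a < σ ⟨$⟩ʳ ι b) ⇔ (π ⟨$⟩ʳ f a < π ⟨$⟩ʳ f b)

IsOccurrence : Permutation′ k → Permutation′ n → (Fin k → Fin n) → Set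
IsOccurrence = OrderIso id

_Contains_ : Permutation′ n → Permutation′ k → Set
π Contains σ = ∃ (IsOccurrence σ π)

record PermClass : Set₁ where
  field
    Member : Permutation′ n → Set
    closed : (π : Permutation′ n) (σ : Permutation′ k) →
             π Contains σ → Member π → Member σ

_∈[_,_⟩ : Fin n → ℕ → ℕ → Set
i ∈[ a , b ⟩ = a ℕ.≤ toℕ i × toℕ i ℕ.< b

-- The positions a, …, b - 1 form an interval of π; a ≡ b gives the
-- empty interval.
record IsInterval (π : Permutation′ n) (a b : ℕ) : Set where
  field
    ordered     : a ℕ.≤ b
    bounded     : b ℕ.≤ n
    consecutive : ∃₂ λ c d → ∀ v →
                  (∃ λ i → i ∈[ a , b ⟩ × π ⟨$⟩ʳ i ≡ v) ⇔ (v ∈[ c , d ⟩)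

Simple : Permutation′ n → Set
Simple {n} π = ∀ a b → IsInterval π a b →
               b ∸ a ≡ 0 ⊎ b ∸ a ≡ 1 ⊎ b ∸ a ≡ n

data _≅_ : ∃ Permutation′ → ∃ Permutation′ → Set where
  same : {π σ : Permutation′ n} → π ≈ σ → (n , π) ≅ (n , σ)

FinitelyManySimples : PermClass → Set
FinitelyManySimples C =
  ∃ λ (simples : List (∃ Permutation′)) →
    ∀ {n} (π : Permutation′ n) → Member π → Simple π →
    Any ((n , π) ≅_) simples
  where open PermClass C

_NextTo_ : Fin n → Fin n → Set
j NextTo i = toℕ j ≡ suc (toℕ i)

Between : Fin n → Fin n → Fin n → Set
Between u v w = (u < v × v < w) ⊎ (w < v × v < u)

Alternating : Permutation′ n → Set
Alternating π = ∀ i j k → j NextTo i → k NextTo j →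
                ¬ Between (π ⟨$⟩ʳ i) (π ⟨$⟩ʳ j) (π ⟨$⟩ʳ k)

inversions : Permutation′ n → ℕ
inversions {n} π =
  length (filter (λ (i , j) → (i <? j) ×-dec (π ⟨$⟩ʳ j <? π ⟨$⟩ʳ i))
                 (cartesianProduct (allFin n) (allFin n)))

EvenPerm : Permutation′ n → Set
EvenPerm π = 2 ∣ inversions π

-- The entry at position i in the usual numbering 1, …, n, on which the
-- parities in the definition of Dumont permutations depend.
entry : Permutation′ n → Fin n → ℕ
entry π i = suc (toℕ (π ⟨$⟩ʳ i))

record Dumont₁ (π : Permutation′ n) : Set where
  field
    even : ∀ i → 2 ∣ entry π i →
           ∃ λ j → j NextTo i × entry π j ℕ.< entry π i
    odd  : ∀ i → ¬ (2 ∣ entry π i) →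
           (∃ λ j → j NextTo i × entry π i ℕ.< entry π j)
           ⊎ suc (toℕ i) ≡ n

Involution : Permutation′ n → Set
Involution π = ∀ i → π ⟨$⟩ʳ (π ⟨$⟩ʳ i) ≡ i

-- The gap g lies between the pattern positions g and g + 1; it belongs
-- to dashes when it carries a dash.
record Blocked : Set where
  field
    size     : ℕ
    perm     : Permutation′ size
    dashes   : Subset (pred size)

AvoidsBlocked : Permutation′ n → Blocked → Set
AvoidsBlocked {n} π β = ¬ ∃ λ (f : Fin size → Fin n) →
    IsOccurrence perm π f
  × (∀ g i j → g ∉ dashes → toℕ i ≡ toℕ g → j NextTo i → f j NextTo f i)
  where open Blocked β

-- Bars are recorded by the positions of the barred entries.
record Barred : Set where
  field
    size     : ℕ
    perm     : Permutation′ size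
    barred   : Subset size

  Unbarred : Set
  Unbarred = ∃ λ i → i ∈ ∁ barred

AvoidsBarred : Permutation′ n → Barred → Set
AvoidsBarred {n} π β =
  (f : Unbarred → Fin n) → OrderIso proj₁ perm π f →
  ∃ λ (g : Fin size → Fin n) →
    IsOccurrence perm π g × (∀ u → g (proj₁ u) ≡ f u)
  where open Barred β

data Pattern : Set where
  blocked : Blocked → Pattern
  barred  : Barred → Pattern

Avoids : Permutation′ n → Pattern → Set
Avoids π (blocked β) = AvoidsBlocked π β
Avoids π (barred β)  = AvoidsBarred π β

AvoidsAll : List Pattern → Permutation′ n → Set
AvoidsAll B π = All (Avoids π) B

data Condition : Set where
  alternating evenPerm dumont₁ involution : Condition
  avoiding                                : List Pattern → Condition

Satisfies : Permutation′ n → Condition → Set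
Satisfies π alternating  = Alternating π
Satisfies π evenPerm     = EvenPerm π
Satisfies π dumont₁      = Dumont₁ π
Satisfies π involution   = Involution π
Satisfies π (avoiding B) = AvoidsAll B π

SatisfiesAll : List Condition → Permutation′ n → Set
SatisfiesAll cs π = All (Satisfies π) cs

PowerSeries : Set
PowerSeries = ℕ → ℚ

-- Coefficient lists, constant term first: ℚ[x], and ℚ[x][y] with y the
-- outer variable.
Poly : Set
Poly = List ℚ

Poly₂ : Set
Poly₂ = List Poly

NonZeroPoly₂ : Poly₂ → Set
NonZeroPoly₂ = Any (Any (_≢ 0ℚ))

coeff : Poly → PowerSeries
coeff []      _       = 0ℚ
coeff (c ∷ p) zero    = c
coeff (c ∷ p) (suc n) = coeff p n

_⊕_ : PowerSeries → PowerSeries → PowerSeries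
(f ⊕ g) n = f n ℚ.+ g n

_⊛_ : PowerSeries → PowerSeries → PowerSeries
(f ⊛ g) n = sum {suc n} λ i → f (toℕ i) ℚ.* g (n ∸ toℕ i)

-- Horner evaluation of P(x , y) at y = f(x).
eval : Poly₂ → PowerSeries → PowerSeries
eval []      f = λ _ → 0ℚ
eval (p ∷ P) f = coeff p ⊕ (f ⊛ eval P f)

-- Algebraicity over ℚ(x): a nonzero polynomial in y annihilating f, its
-- coefficients in ℚ(x) being brought into ℚ[x] by clearing denominators.
Algebraic : PowerSeries → Set
Algebraic f = ∃ λ P → NonZeroPoly₂ P × (∀ n → eval P f n ≡ 0ℚ)

-- There are exactly k permutations of length n satisfying P.  Inverses
-- are taken between setoids so that pointwise equal permutations, and
-- different proofs of P, are counted once.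
HasCount : (Permutation′ n → Set) → ℕ → Set
HasCount {n} P k =
  Inverse (On.setoid (permSetoid n) (proj₁ {B = P})) (setoid (Fin k))

generatingFunction : (ℕ → ℕ) → PowerSeries
generatingFunction a n = + a n ℚ./ 1

AlgebraicCount : PermClass → (∀ {n} → Permutation′ n → Set) → Set
AlgebraicCount C P =
  (a : ℕ → ℕ) →
  (∀ n → HasCount {n} (λ π → Member π × P π) (a n)) →
  Algebraic (generatingFunction a)
  where open PermClass C

{-# OPTIONS --safe #-}

-- Every permutation is uniquely an inflation s[b₁, …, bₘ] of a simple
-- permutation s once, for m = 2, the first block is required to be
-- indecomposable.  If only finitely many s occur, Nash-Williams' minimal
-- bad sequence argument shows that containment is a well-quasi-order, so
-- the class is cut out by finitely many excluded patterns, which are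
-- blocked patterns with all dashes.  Conditions (1)–(4) are unions of
-- classes of a congruence for inflation of finite index: the parities of
-- the length and of the number of inversions, or equivalence in an
-- Ehrenfeucht–Fraïssé game.  So the generating functions of the classes
-- satisfy a finite polynomial system; involutions are added by pairing
-- the blocks at i and s(i), which contributes the generating functions of
-- the same classes with all weights doubled.
--
-- Such a system y = e(x, y) is solved without elimination theory by
-- deforming it to y = e(x, y) + t y^N with N larger than the degree of e.
-- Up to powers of t, all polynomials in the solution are then
-- combinations over ℚ[x][[t]] of finitely many monomials, so the powers
-- of any one of them are linearly dependent, and the lowest coefficient
-- in t of a dependency is an algebraic equation for the value at t = 0.

module Submission where

open import Algebra.Bundles using (CommutativeRing)
open import Level using (0ℓ)
open import Axiom.ExcludedMiddle using (ExcludedMiddle)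
import Data.Nat.Base
import Algebra.Properties.Semiring.Exp
import Algebra.Properties.Semiring.Sum

-- Power series and systems of polynomial equations

-- The class itself is in general not closed under inflation, so the equations are written for a
-- larger set: the nonempty permutations whose simple patterns all have length at most two, lie in
-- the class, or have their inverse in it. This set is closed under inflation and under inversion;
-- the latter is needed since the blocks of an involution at `i` and `s i` are inverse to each
-- other. The finite basis turns membership in the class into one more avoidance condition. A
-- degenerate system offers no leading terms by which to eliminate unknowns. The deformation
-- supplies one in every equation: y^N can be rewritten in lower degree at the price of a factor
-- `t`, harmless in a domain. Existence and uniqueness of solutions rest on x-adic contraction, so
-- no right-hand side may have a bare unknown as a summand. For this reason the empty permutation is
-- left out and restored as a constant at the end, and the series with doubled weights enter the
-- equations for involutions through their own right-hand sides.

module PowerSeriesRing (A : CommutativeRing 0ℓ 0ℓ) where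
  open import Data.Nat.Base using (ℕ; zero; suc) renaming (_+_ to _+ℕ_; _<_ to _<ℕ_; _≤_ to _≤ℕ_; z≤n to z≤ℕn; s≤s to s≤ℕs)
  open import Data.Product.Base using (_,_)
  open CommutativeRing A
  open import Algebra.Properties.CommutativeSemigroup +-commutativeSemigroup using (interchange; x∙yz≈y∙xz)
  open import Relation.Binary.Reasoning.Setoid setoid

  Series : Set
  Series = ℕ → Carrier

  infix 4 _≋_
  _≋_ : Series → Series → Set
  f ≋ g = ∀ n → f n ≈ g n

  tail : Series → Series
  tail f n = f (suc n)

  infixl 6 _⊞_
  infixl 7 _⊠_
  infixr 7 _·_

  _⊞_ : Series → Series → Series
  (f ⊞ g) n = f n + g n

  _·_ : Carrier → Series → Series
  (c · f) n = c * f n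

  -- The recursion f · g = f 0 · g + x · (tail f · g) replaces the finite sum: the ring laws become
  -- inductions on the index, and the counting of pairs by total weight follows the same recursion.
  _⊠_ : Series → Series → Series
  (f ⊠ g) zero    = f 0 * g 0
  (f ⊠ g) (suc n) = f 0 * g (suc n) + (tail f ⊠ g) n

  const : Carrier → Series
  const c zero    = c
  const c (suc _) = 0#

  zeroSeries : Series
  zeroSeries _ = 0#

  shift : Series → Series
  shift f zero    = 0#
  shift f (suc n) = f n

  indeterminate : Series
  indeterminate = shift (const 1#)

  ⊠-cong : ∀ {f f' g g'} → f ≋ f' → g ≋ g' → f ⊠ g ≋ f' ⊠ g'
  ⊠-cong p q zero    = *-cong (p 0) (q 0)
  ⊠-cong p q (suc n) = +-cong (*-cong (p 0) (q (suc n))) (⊠-cong (λ i → p (suc i)) q n)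

  ⊠-zeroˡ-upto : ∀ f g n → (∀ i → i ≤ℕ n → f i ≈ 0#) → (f ⊠ g) n ≈ 0#
  ⊠-zeroˡ-upto f g zero    z = trans (*-congʳ (z 0 z≤ℕn)) (zeroˡ _)
  ⊠-zeroˡ-upto f g (suc n) z = begin
    f 0 * g (suc n) + (tail f ⊠ g) n
      ≈⟨ +-cong (trans (*-congʳ (z 0 z≤ℕn)) (zeroˡ _))
                (⊠-zeroˡ-upto (tail f) g n (λ i i≤n → z (suc i) (s≤ℕs i≤n))) ⟩
    0# + 0# ≈⟨ +-identityˡ 0# ⟩
    0# ∎

  ⊠-zeroˡ : ∀ f g n → (∀ i → f i ≈ 0#) → (f ⊠ g) n ≈ 0#
  ⊠-zeroˡ f g n z = ⊠-zeroˡ-upto f g n (λ i _ → z i)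

  ⊠-distribʳ : ∀ h f g → (f ⊞ g) ⊠ h ≋ (f ⊠ h) ⊞ (g ⊠ h)
  ⊠-distribʳ h f g zero    = distribʳ _ _ _
  ⊠-distribʳ h f g (suc n) = begin
    (f 0 + g 0) * h (suc n) + ((tail f ⊞ tail g) ⊠ h) n
      ≈⟨ +-cong (distribʳ _ _ _) (⊠-distribʳ h (tail f) (tail g) n) ⟩
    f 0 * h (suc n) + g 0 * h (suc n) + ((tail f ⊠ h) n + (tail g ⊠ h) n)
      ≈⟨ interchange _ _ _ _ ⟩
    f 0 * h (suc n) + (tail f ⊠ h) n + (g 0 * h (suc n) + (tail g ⊠ h) n) ∎

  ·-⊠ : ∀ c f g → (c · f) ⊠ g ≋ c · (f ⊠ g)
  ·-⊠ c f g zero    = *-assoc _ _ _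
  ·-⊠ c f g (suc n) = begin
    c * f 0 * g (suc n) + ((c · tail f) ⊠ g) n
      ≈⟨ +-cong (*-assoc _ _ _) (·-⊠ c (tail f) g n) ⟩
    c * (f 0 * g (suc n)) + c * (tail f ⊠ g) n
      ≈⟨ sym (distribˡ _ _ _) ⟩
    c * (f 0 * g (suc n) + (tail f ⊠ g) n) ∎

  -- The mirror image of the defining recursion, peeling off the second factor; commutativity
  -- compares the two.
  ⊠-sucʳ : ∀ f g n → (f ⊠ g) (suc n) ≈ f (suc n) * g 0 + (f ⊠ tail g) n
  ⊠-sucʳ f g zero    = +-comm _ _
  ⊠-sucʳ f g (suc n) = begin
    f 0 * g (suc (suc n)) + (tail f ⊠ g) (suc n)
      ≈⟨ +-congˡ (⊠-sucʳ (tail f) g n) ⟩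
    f 0 * g (suc (suc n)) + (f (suc (suc n)) * g 0 + (tail f ⊠ tail g) n)
      ≈⟨ x∙yz≈y∙xz _ _ _ ⟩
    f (suc (suc n)) * g 0 + (f 0 * g (suc (suc n)) + (tail f ⊠ tail g) n) ∎

  ⊠-comm : ∀ f g → f ⊠ g ≋ g ⊠ f
  ⊠-comm f g zero    = *-comm _ _
  ⊠-comm f g (suc n) = begin
    f 0 * g (suc n) + (tail f ⊠ g) n ≈⟨ +-cong (*-comm _ _) (⊠-comm (tail f) g n) ⟩
    g (suc n) * f 0 + (g ⊠ tail f) n ≈⟨ sym (⊠-sucʳ g f n) ⟩
    (g ⊠ f) (suc n) ∎

  ⊠-assoc : ∀ f g h → (f ⊠ g) ⊠ h ≋ f ⊠ (g ⊠ h)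
  ⊠-assoc f g h zero    = *-assoc _ _ _
  ⊠-assoc f g h (suc n) = begin
    f 0 * g 0 * h (suc n) + ((f 0 · tail g ⊞ tail f ⊠ g) ⊠ h) n
      ≈⟨ +-cong (*-assoc _ _ _) (⊠-distribʳ h (f 0 · tail g) (tail f ⊠ g) n) ⟩
    f 0 * (g 0 * h (suc n)) + (((f 0 · tail g) ⊠ h) n + ((tail f ⊠ g) ⊠ h) n)
      ≈⟨ +-congˡ (+-cong (·-⊠ (f 0) (tail g) h n) (⊠-assoc (tail f) g h n)) ⟩
    f 0 * (g 0 * h (suc n)) + (f 0 * (tail g ⊠ h) n + (tail f ⊠ (g ⊠ h)) n)
      ≈⟨ sym (+-assoc _ _ _) ⟩
    f 0 * (g 0 * h (suc n)) + f 0 * (tail g ⊠ h) n + (tail f ⊠ (g ⊠ h)) n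
      ≈⟨ +-congʳ (sym (distribˡ _ _ _)) ⟩
    f 0 * (g 0 * h (suc n) + (tail g ⊠ h) n) + (tail f ⊠ (g ⊠ h)) n ∎

  const-⊠ : ∀ c f → const c ⊠ f ≋ c · f
  const-⊠ c f zero    = refl
  const-⊠ c f (suc n) =
    trans (+-congˡ (⊠-zeroˡ (tail (const c)) f n (λ _ → refl))) (+-identityʳ _)

  ⊠-identityˡ : ∀ f → const 1# ⊠ f ≋ f
  ⊠-identityˡ f n = trans (const-⊠ 1# f n) (*-identityˡ _)

  shift-⊠ : ∀ f g → shift f ⊠ g ≋ shift (f ⊠ g)
  shift-⊠ f g zero    = zeroˡ _
  shift-⊠ f g (suc n) = trans (+-congʳ (zeroˡ _)) (+-identityˡ _)

  commutativeRing : CommutativeRing 0ℓ 0ℓ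
  commutativeRing = record
    { Carrier = Series ; _≈_ = _≋_ ; _+_ = _⊞_ ; _*_ = _⊠_
    ; -_ = λ f n → - f n ; 0# = zeroSeries ; 1# = const 1#
    ; isCommutativeRing = record
      { isRing = record
        { +-isAbelianGroup = record
          { isGroup = record
            { isMonoid = record
              { isSemigroup = record
                { isMagma = record
                  { isEquivalence = record
                    { refl = λ _ → refl ; sym = λ p n → sym (p n)
                    ; trans = λ p q n → trans (p n) (q n) }
                  ; ∙-cong = λ p q n → +-cong (p n) (q n) }
                ; assoc = λ f g h n → +-assoc _ _ _ }
              ; identity = (λ f n → +-identityˡ _) , (λ f n → +-identityʳ _) }
            ; inverse = (λ f n → -‿inverseˡ _) , (λ f n → -‿inverseʳ _)
            ; ⁻¹-cong = λ p n → -‿cong (p n) }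
          ; comm = λ f g n → +-comm _ _ }
        ; *-cong = ⊠-cong
        ; *-assoc = ⊠-assoc
        ; *-identity = ⊠-identityˡ
                     , (λ f n → trans (⊠-comm f (const 1#) n) (⊠-identityˡ f n))
        ; distrib = (λ h f g n → trans (⊠-comm h (f ⊞ g) n)
                      (trans (⊠-distribʳ h f g n)
                        (+-cong (⊠-comm f h n) (⊠-comm g h n))))
                  , ⊠-distribʳ
        }
      ; *-comm = ⊠-comm } }

  -- Every other term of the convolution at `a +ℕ b` contains a coefficient below one of the two
  -- orders. With `b` equal to 0 this reads off the lowest coefficient of a product for an arbitrary
  -- second factor.
  ⊠-leading : ∀ f g a b → (∀ i → i <ℕ a → f i ≈ 0#) → (∀ j → j <ℕ b → g j ≈ 0#) →
              (f ⊠ g) (a +ℕ b) ≈ f a * g b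
  ⊠-leading f g (suc a) b p q = trans
    (+-congʳ (trans (*-congʳ (p 0 (s≤ℕs z≤ℕn))) (zeroˡ _)))
    (trans (+-identityˡ _) (⊠-leading (tail f) g a b (λ i l → p (suc i) (s≤ℕs l)) q))
  ⊠-leading f g zero zero    p q = refl
  ⊠-leading f g zero (suc b) p q = trans
    (+-congˡ (trans (⊠-comm (tail f) g b)
      (⊠-zeroˡ-upto g (tail f) b (λ i l → q i (s≤ℕs l)))))
    (+-identityʳ _)

-- Fraction-free linear algebra over a subring of a domain

module LinearDependence (em : ExcludedMiddle 0ℓ) (R : CommutativeRing 0ℓ 0ℓ) where
  open import Data.Fin.Base using (Fin; zero; suc; punchIn)
  open import Data.Nat.Base using (zero; suc)
  open import Data.Product.Base using (∃; _×_; _,_; proj₁; proj₂)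
  open import Data.Vec.Functional using (insertAt)
  open import Data.Vec.Functional.Properties using (insertAt-lookup; insertAt-punchIn)
  open import Function.Base using (_∘_)
  open import Relation.Binary.PropositionalEquality as ≡ using (_≡_)
  open import Relation.Nullary using (¬_; yes; no)
  open import Relation.Nullary.Decidable using (decidable-stable)
  open CommutativeRing R hiding (zero)
  open import Algebra.Properties.Ring ring using (-‿distribˡ-*; -‿distribʳ-*)
  open import Algebra.Properties.Semiring.Sum semiring
  open import Relation.Binary.Reasoning.Setoid setoid

  record Subring (P : Carrier → Set) : Set where
    field
      0-closed : P 0#
      1-closed : P 1#
      +-closed : ∀ {x y} → P x → P y → P (x + y)
      *-closed : ∀ {x y} → P x → P y → P (x * y)
      neg-closed : ∀ {x} → P x → P (- x)

  NoZeroDivisors : Set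
  NoZeroDivisors = ∀ {x y} → ¬ x ≈ 0# → ¬ y ≈ 0# → ¬ x * y ≈ 0#

  module _ (1≉0 : ¬ 1# ≈ 0#) (domain : NoZeroDivisors)
           {P : Carrier → Set} (subring : Subring P) where
    open Subring subring

    sum-closed : ∀ {n} (f : Fin n → Carrier) → (∀ i → P (f i)) → P (sum f)
    sum-closed {zero}  f p = 0-closed
    sum-closed {suc n} f p = +-closed (p zero) (sum-closed (f ∘ suc) (p ∘ suc))

    private
      sum-zero : ∀ {n} (f : Fin n → Carrier) → (∀ i → f i ≈ 0#) → sum f ≈ 0#
      sum-zero {n} f z = trans (sum-cong-≋ {n} {f} {λ _ → 0#} z) (sum-replicate-zero n)

      swap-neg : ∀ a d u w z → - (d * w) * z + a * d * u ≈ d * (a * u + - (w * z))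
      swap-neg a d u w z = begin
        - (d * w) * z + a * d * u
          ≈⟨ +-cong (sym (-‿distribˡ-* _ _)) (*-congʳ (*-comm a d)) ⟩
        - (d * w * z) + d * a * u
          ≈⟨ +-cong (-‿cong (*-assoc d w z)) (*-assoc d a u) ⟩
        - (d * (w * z)) + d * (a * u)
          ≈⟨ +-comm _ _ ⟩
        d * (a * u) + - (d * (w * z))
          ≈⟨ +-congˡ (-‿distribʳ-* _ _) ⟩
        d * (a * u) + d * - (w * z)
          ≈⟨ sym (distribˡ _ _ _) ⟩
        d * (a * u + - (w * z)) ∎

    -- Gaussian elimination by cross-multiplication: nothing is inverted, so the coefficients remain
    -- in the subring. The subring is a predicate because the coefficients are later multiplied with
    -- elements outside it.
    dependent : ∀ k (v : Fin (suc k) → Fin k → Carrier) → (∀ j i → P (v j i)) →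
                ∃ λ (c : Fin (suc k) → Carrier) → (∀ j → P (c j)) ×
                  (∃ λ j → ¬ c j ≈ 0#) × (∀ i → sum (λ j → c j * v j i) ≈ 0#)
    dependent zero    v Pv = (λ _ → 1#) , (λ _ → 1-closed) , (zero , 1≉0) , λ ()
    dependent (suc k) v Pv with em {∃ λ p → ¬ v p zero ≈ 0#}
    -- Without a pivot the first column imposes no condition. Dropping it allows one vector to be
    -- dropped as well, with coefficient 0.
    ... | no none = c , Pc , (suc (proj₁ (proj₁ (proj₂ (proj₂ ih))))
                             , proj₂ (proj₁ (proj₂ (proj₂ ih)))) , rel
      where
      column-zero : ∀ j → v j zero ≈ 0#
      column-zero j = decidable-stable em (λ ne → none (j , ne))
      ih = dependent k (λ j i → v (suc j) (suc i)) (λ j i → Pv (suc j) (suc i))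
      c : Fin (suc (suc k)) → Carrier
      c zero    = 0#
      c (suc j) = proj₁ ih j
      Pc : ∀ j → P (c j)
      Pc zero    = 0-closed
      Pc (suc j) = proj₁ (proj₂ ih) j
      rel : ∀ i → sum (λ j → c j * v j i) ≈ 0#
      rel zero    = sum-zero (λ j → c j * v j zero)
                       (λ j → trans (*-congˡ {c j} (column-zero j)) (zeroʳ (c j)))
      rel (suc i) = trans (+-cong (zeroˡ _) (proj₂ (proj₂ (proj₂ ih)) i)) (+-identityˡ _)
    ... | yes (p , a≉0) = c , Pc , (punchIn p nz , c-nz) , rel
      where
      a : Carrier
      a = v p zero
      v' : Fin (suc k) → Fin (suc k) → Carrier
      v' j = v (punchIn p j)
      -- The remaining rows after clearing their first column with the pivot row; the other columns
      -- fall under the induction hypothesis.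
      w : Fin (suc k) → Fin (suc k) → Carrier
      w j i = a * v' j i + - (v' j zero * v p i)
      ih = dependent k (λ j i → w j (suc i))
             (λ j i → +-closed (*-closed (Pv _ _) (Pv _ _))
                               (neg-closed (*-closed (Pv _ _) (Pv _ _))))
      d : Fin (suc k) → Carrier
      d = proj₁ ih
      Pd = proj₁ (proj₂ ih)
      nz = proj₁ (proj₁ (proj₂ (proj₂ ih)))
      -- The coefficient of the pivot row for which a combination of the rows `v'` with coefficients
      -- `a * d j` becomes the combination of the cleared rows `w` with coefficients `d j`.
      e : Carrier
      e = sum (λ j → - (d j * v' j zero))
      c : Fin (suc (suc k)) → Carrier
      c = insertAt (λ j → a * d j) p e
      c-p : c p ≡ e
      c-p = insertAt-lookup (λ j → a * d j) p e
      c-rest : ∀ j → c (punchIn p j) ≡ a * d j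
      c-rest = insertAt-punchIn (λ j → a * d j) p e
      c-nz : ¬ c (punchIn p nz) ≈ 0#
      c-nz q = domain a≉0 (proj₂ (proj₁ (proj₂ (proj₂ ih))))
                 (trans (reflexive (≡.sym (c-rest nz))) q)
      closed-insert : ∀ {n} (f : Fin n → Carrier) q x → P x → (∀ j → P (f j)) →
                      ∀ j → P (insertAt f q x j)
      closed-insert {n}     f zero x Px Pf zero = Px
      closed-insert {n}     f zero x Px Pf (suc j) = Pf j
      closed-insert {suc n} f (suc q) x Px Pf zero = Pf zero
      closed-insert {suc n} f (suc q) x Px Pf (suc j) =
        closed-insert (f ∘ suc) q x Px (Pf ∘ suc) j
      Pc : ∀ j → P (c j)
      Pc = closed-insert _ p e
        (sum-closed (λ j → - (d j * v' j zero)) (λ j → neg-closed (*-closed (Pd j) (Pv (punchIn p j) zero))))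
        (λ j → *-closed (Pv _ _) (Pd j))
      combine-rows : ∀ i → sum (λ j → c j * v j i) ≈ sum (λ j → d j * w j i)
      combine-rows i = begin
        sum (λ j → c j * v j i)
          ≈⟨ sum-remove {i = p} (λ j → c j * v j i) ⟩
        c p * v p i + sum (λ j → c (punchIn p j) * v' j i)
          ≈⟨ +-cong (*-congʳ (reflexive c-p))
                    (sum-cong-≋ {_} {λ j → c (punchIn p j) * v' j i} {λ j → a * d j * v' j i}
                       (λ j → *-congʳ (reflexive (c-rest j)))) ⟩
        e * v p i + sum (λ j → a * d j * v' j i)
          ≈⟨ +-congʳ (*-distribʳ-sum (v p i) (λ j → - (d j * v' j zero))) ⟩
        sum (λ j → - (d j * v' j zero) * v p i) + sum (λ j → a * d j * v' j i)
          ≈⟨ sym (∑-distrib-+ (λ j → - (d j * v' j zero) * v p i) (λ j → a * d j * v' j i)) ⟩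
        sum (λ j → - (d j * v' j zero) * v p i + a * d j * v' j i)
          ≈⟨ sum-cong-≋ {_} {λ j → - (d j * v' j zero) * v p i + a * d j * v' j i} {λ j → d j * w j i}
               (λ j → swap-neg a (d j) (v' j i) (v' j zero) (v p i)) ⟩
        sum (λ j → d j * w j i) ∎
      w-column : ∀ j → w j zero ≈ 0#
      w-column j = trans (+-congʳ (*-comm _ _)) (-‿inverseʳ _)
      rel : ∀ i → sum (λ j → c j * v j i) ≈ 0#
      rel zero    = trans (combine-rows zero)
        (sum-zero (λ j → d j * w j zero) (λ j → trans (*-congˡ {d j} (w-column j)) (zeroʳ (d j))))
      rel (suc i) = trans (combine-rows (suc i)) (proj₂ (proj₂ (proj₂ ih)) i)

-- Least witnesses, leading coefficients, orders and supports

module LeastNumber (em : ExcludedMiddle 0ℓ) where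
  open import Data.Nat.Base using (ℕ; _<_)
  open import Data.Nat.Induction using (<-rec)
  open import Data.Product.Base using (∃; _×_; _,_)
  open import Relation.Nullary using (¬_; yes; no)

  least : (P : ℕ → Set) → ∀ {n} → P n → ∃ λ m → P m × (∀ k → k < m → ¬ P k)
  least P {n} p = <-rec (λ n → P n → ∃ λ m → P m × (∀ k → k < m → ¬ P k)) step n p
    where
    step : ∀ n → (∀ {k} → k < n → P k → ∃ λ m → P m × (∀ k → k < m → ¬ P k)) →
           P n → ∃ λ m → P m × (∀ k → k < m → ¬ P k)
    step n rec p with em {∃ λ k → k < n × P k}
    ... | yes (k , k<n , pk) = rec k<n pk
    ... | no none = n , p , λ k k<n pk → none (k , k<n , pk)

module SeriesDomain (em : ExcludedMiddle 0ℓ) (A : CommutativeRing 0ℓ 0ℓ) where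
  open import Data.Nat.Base using (_<_) renaming (_+_ to _+ℕ_)
  open import Data.Product.Base using (∃; _×_; _,_)
  open import Relation.Nullary using (¬_; yes; no)
  open import Relation.Nullary.Decidable using (decidable-stable)
  open CommutativeRing A
  open PowerSeriesRing A
  open LeastNumber em

  leading : ∀ {f} → ¬ f ≋ zeroSeries → ∃ λ m → ¬ f m ≈ 0# × (∀ k → k < m → f k ≈ 0#)
  leading {f} f≉0 with em {∃ λ n → ¬ f n ≈ 0#}
  ... | no none with () ← f≉0 (λ n → decidable-stable em (λ ne → none (n , ne)))
  ... | yes (n , ne) with least (λ n → ¬ f n ≈ 0#) ne
  ... | m , nm , below = m , nm , λ k k<m → decidable-stable em (below k k<m)

  ⊠-domain : (∀ {x y} → ¬ x ≈ 0# → ¬ y ≈ 0# → ¬ x * y ≈ 0#) →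
             ∀ {f g} → ¬ f ≋ zeroSeries → ¬ g ≋ zeroSeries → ¬ (f ⊠ g) ≋ zeroSeries
  ⊠-domain domain {f} {g} f≉0 g≉0 fg≈0 with leading f≉0 | leading g≉0
  ... | a , fa , pa | b , gb , pb =
    domain fa gb (trans (sym (⊠-leading f g a b pa pb)) (fg≈0 (a +ℕ b)))

module SeriesSupport (A : CommutativeRing 0ℓ 0ℓ) where
  open import Data.Nat.Base using (ℕ; zero; suc; _<_; _≤_; z≤n; s≤s; _⊔_) renaming (_+_ to _+ℕ_)
  open import Data.Nat.Properties using (m≤n+m; m⊔n≤o⇒m≤o; m⊔n≤o⇒n≤o; ≤-trans; n≤1+n; +-identityʳ)
  open import Data.Product.Base using (∃; _,_)
  open CommutativeRing A hiding (zero; +-identityʳ)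
  open PowerSeriesRing A
  open import Algebra.Properties.Ring ring using (-0#≈0#)

  OrderAtLeast : ℕ → Series → Set
  OrderAtLeast n f = ∀ i → i < n → f i ≈ 0#

  private
    0+0 : ∀ {x y} → x ≈ 0# → y ≈ 0# → x + y ≈ 0#
    0+0 p q = trans (+-cong p q) (+-identityˡ 0#)

  order-⊠ : ∀ a b {f g} → OrderAtLeast a f → OrderAtLeast b g → OrderAtLeast (a +ℕ b) (f ⊠ g)
  order-⊠ (suc a) b p q zero    _ = trans (*-congʳ (p 0 (s≤s z≤n))) (zeroˡ _)
  order-⊠ (suc a) b p q (suc i) (s≤s l) = 0+0
    (trans (*-congʳ (p 0 (s≤s z≤n))) (zeroˡ _))
    (order-⊠ a b (λ j m → p (suc j) (s≤s m)) q i l)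
  order-⊠ zero b p q zero    l = trans (*-congˡ (q 0 l)) (zeroʳ _)
  order-⊠ zero b p q (suc i) l = 0+0
    (trans (*-congˡ (q (suc i) l)) (zeroʳ _))
    (order-⊠ zero b (λ _ ()) q i (≤-trans (n≤1+n _) l))

  FiniteSupport : Series → Set
  FiniteSupport f = ∃ λ B → ∀ i → B ≤ i → f i ≈ 0#

  private
    support-⊠ : ∀ a b {f g} → (∀ i → a ≤ i → f i ≈ 0#) → (∀ i → b ≤ i → g i ≈ 0#) →
                ∀ i → a +ℕ b ≤ i → (f ⊠ g) i ≈ 0#
    support-⊠ zero    b {f} {g} p q i l = ⊠-zeroˡ f g i (λ j → p j z≤n)
    support-⊠ (suc a) b p q (suc i) (s≤s l) = 0+0
      (trans (*-congˡ (q (suc i) (≤-trans (m≤n+m b a) (≤-trans l (n≤1+n i))))) (zeroʳ _))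
      (support-⊠ a b (λ j m → p (suc j) (s≤s m)) q i l)

  support-const : ∀ c → FiniteSupport (const c)
  support-const c = 1 , λ { (suc i) _ → refl }

  support-zero : FiniteSupport zeroSeries
  support-zero = 0 , λ _ _ → refl

  support-shift : ∀ {f} → FiniteSupport f → FiniteSupport (shift f)
  support-shift (B , p) = suc B , λ { (suc i) (s≤s l) → p i l }

  support-+ : ∀ {f g} → FiniteSupport f → FiniteSupport g → FiniteSupport (f ⊞ g)
  support-+ (a , p) (b , q) = a ⊔ b , λ i l →
    0+0 (p i (m⊔n≤o⇒m≤o a b l)) (q i (m⊔n≤o⇒n≤o a b l))

  support-* : ∀ {f g} → FiniteSupport f → FiniteSupport g → FiniteSupport (f ⊠ g)
  support-* (a , p) (b , q) = a +ℕ b , support-⊠ a b p q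

  support-neg : ∀ {f} → FiniteSupport f → FiniteSupport (λ n → - f n)
  support-neg (a , p) = a , λ i l → trans (-‿cong (p i l)) -0#≈0#

module SeriesClosure (A : CommutativeRing 0ℓ 0ℓ) where
  open import Data.Nat.Base using (zero; suc)
  open CommutativeRing A hiding (zero)
  open PowerSeriesRing A

  ⊠-closed : (P Q S : Carrier → Set) → (∀ {x y} → S x → S y → S (x + y)) →
             (∀ {x y} → P x → Q y → S (x * y)) →
             ∀ {f g} → (∀ i → P (f i)) → (∀ i → Q (g i)) → ∀ i → S ((f ⊠ g) i)
  ⊠-closed P Q S s+ s* p q zero    = s* (p 0) (q 0)
  ⊠-closed P Q S s+ s* p q (suc i) =
    s+ (s* (p 0) (q (suc i))) (⊠-closed P Q S s+ s* (λ j → p (suc j)) q i)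

-- Polynomial systems and their x-adic contraction property

module Expressions (A : Set) where
  open import Data.Fin.Base using (Fin)
  open import Data.Nat.Base using (ℕ; zero; suc; _⊔_) renaming (_+_ to _+ℕ_)

  -- Polynomial expressions in K unknowns, the variable X of the power
  -- series and a deformation parameter T.
  data Expr (K : ℕ) : Set where
    con     : A → Expr K
    nil X T : Expr K
    var     : Fin K → Expr K
    _⊹_ _⊗_ : Expr K → Expr K → Expr K

  infixl 6 _⊹_
  infixl 7 _⊗_

  -- Exponents are shifted by one: `power e n` stands for e^(n+1), which keeps powers of positive
  -- expressions positive.
  power : ∀ {K} → Expr K → ℕ → Expr K
  power e zero          = e
  power e (suc n)       = e ⊗ power e n

  -- Only the unknowns count: `X` and `T` belong to the coefficients when monomials are rewritten.
  degree : ∀ {K} → Expr K → ℕ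
  degree (con _) = 0
  degree nil     = 0
  degree X       = 0
  degree T       = 0
  degree (var _) = 1
  degree (e ⊹ f) = degree e ⊔ degree f
  degree (e ⊗ f) = degree e +ℕ degree f

  -- Where the unknowns have no constant term, positive expressions have
  -- none either, and proper ones are contractions for the x-adic topology.
  data Positive {K} : Expr K → Set where
    nil  : Positive nil
    X    : Positive X
    var  : ∀ s → Positive (var s)
    _⊹_  : ∀ {e f} → Positive e → Positive f → Positive (e ⊹ f)
    left  : ∀ {e f} → Positive e → Positive (e ⊗ f)
    right : ∀ {e f} → Positive f → Positive (e ⊗ f)

  data Proper {K} : Expr K → Set where
    nil  : Proper nil
    X    : Proper X
    _⊹_  : ∀ {e f} → Proper e → Proper f → Proper (e ⊹ f)
    _⊗_  : ∀ {e f} → Positive e → Positive f → Proper (e ⊗ f)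
    left  : ∀ {e f} → Proper e → Proper (e ⊗ f)
    right : ∀ {e f} → Proper f → Proper (e ⊗ f)

  proper⇒positive : ∀ {K} {e : Expr K} → Proper e → Positive e
  proper⇒positive nil       = nil
  proper⇒positive X         = X
  proper⇒positive (p ⊹ q)   = proper⇒positive p ⊹ proper⇒positive q
  proper⇒positive (p ⊗ q)   = left p
  proper⇒positive (left p)  = left (proper⇒positive p)
  proper⇒positive (right p) = right (proper⇒positive p)

  positive-power : ∀ {K} {e : Expr K} n → Positive e → Positive (power e n)
  positive-power zero    p = p
  positive-power (suc n) p = left p

  module Evaluation (S : CommutativeRing 0ℓ 0ℓ) where
    open CommutativeRing S hiding (zero)
    open import Algebra.Properties.Semiring.Exp semiring using (_^_)

    eval : (A → Carrier) → Carrier → Carrier → ∀ {K} → Expr K → (Fin K → Carrier) → Carrier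
    eval ι x t (con c) y = ι c
    eval ι x t nil     y = 0#
    eval ι x t X       y = x
    eval ι x t T       y = t
    eval ι x t (var s) y = y s
    eval ι x t (e ⊹ f) y = eval ι x t e y + eval ι x t f y
    eval ι x t (e ⊗ f) y = eval ι x t e y * eval ι x t f y

    eval-power : ∀ ι x t {K} (e : Expr K) n y → eval ι x t (power e n) y ≈ eval ι x t e y ^ suc n
    eval-power ι x t e zero    y = sym (*-identityʳ _)
    eval-power ι x t e (suc n) y = *-congˡ (eval-power ι x t e n y)

-- Abstract because the contraction argument runs twice: over A[[x]] for uniqueness, and over
-- A[[x]][[t]], filtered by the order in x alone, for existence.
record Filtration (S : CommutativeRing 0ℓ 0ℓ) : Set₁ where
  open CommutativeRing S
  field
    Ord     : Data.Nat.Base.ℕ → Carrier → Set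
    ord-0   : ∀ {n} → Ord n 0#
    ord-any : ∀ u → Ord 0 u
    ord-≈   : ∀ {n u v} → u ≈ v → Ord n u → Ord n v
    ord-+   : ∀ {n u v} → Ord n u → Ord n v → Ord n (u + v)
    ord-neg : ∀ {n u} → Ord n u → Ord n (- u)
    ord-*   : ∀ a b {u v} → Ord a u → Ord b v → Ord (a Data.Nat.Base.+ b) (u * v)

module Contraction {A : Set} (S : CommutativeRing 0ℓ 0ℓ) (F : Filtration S)
                   (ι : A → CommutativeRing.Carrier S) (x t : CommutativeRing.Carrier S)
                   (x-ord : Filtration.Ord F 1 x) where
  open import Data.Fin.Base using (Fin)
  open import Data.Nat.Base using (ℕ; zero; suc) renaming (_+_ to _+ℕ_)
  open import Data.Nat.Properties using (+-comm) renaming (+-identityʳ to +ℕ-identityʳ)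
  open import Relation.Binary.PropositionalEquality as ≡ using (_≡_; subst)
  open CommutativeRing S hiding (zero) renaming (+-comm to +-commute)
  open import Algebra.Properties.Ring ring using (-‿distribˡ-*; -‿distribʳ-*)
  open import Algebra.Properties.AbelianGroup +-abelianGroup using (⁻¹-∙-comm)
  open import Algebra.Properties.Group +-group using (⁻¹-involutive)
  open import Algebra.Properties.CommutativeSemigroup +-commutativeSemigroup using (interchange)
  open import Relation.Binary.Reasoning.Setoid setoid
  open Filtration F
  open Expressions A
  open Evaluation S

  Close : ℕ → Carrier → Carrier → Set
  Close n u v = Ord n (u + - v)

  close-refl : ∀ {n} u → Close n u u
  close-refl u = ord-≈ (sym (-‿inverseʳ u)) ord-0

  private
    +-difference : ∀ u u' v v' → (u + - u') + (v + - v') ≈ (u + v) + - (u' + v')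
    +-difference u u' v v' = trans (interchange _ _ _ _) (+-congˡ (⁻¹-∙-comm u' v'))

    *-difference : ∀ u u' v v' → (u + - u') * v + u' * (v + - v') ≈ u * v + - (u' * v')
    *-difference u u' v v' = begin
      (u + - u') * v + u' * (v + - v')
        ≈⟨ +-cong (distribʳ _ _ _) (distribˡ _ _ _) ⟩
      (u * v + - u' * v) + (u' * v + u' * - v')
        ≈⟨ +-assoc _ _ _ ⟩
      u * v + (- u' * v + (u' * v + u' * - v'))
        ≈⟨ +-congˡ (sym (+-assoc _ _ _)) ⟩
      u * v + ((- u' * v + u' * v) + u' * - v')
        ≈⟨ +-congˡ (+-congʳ (+-congʳ (sym (-‿distribˡ-* _ _)))) ⟩
      u * v + ((- (u' * v) + u' * v) + u' * - v')
        ≈⟨ +-congˡ (trans (+-congʳ (-‿inverseˡ _)) (+-identityˡ _)) ⟩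
      u * v + u' * - v'
        ≈⟨ +-congˡ (sym (-‿distribʳ-* _ _)) ⟩
      u * v + - (u' * v') ∎

  close-+ : ∀ {n u u' v v'} → Close n u u' → Close n v v' → Close n (u + v) (u' + v')
  close-+ p q = ord-≈ (+-difference _ _ _ _) (ord-+ p q)

  close-trans : ∀ {n u v w} → Close n u v → Close n v w → Close n u w
  close-trans {n} {u} {v} {w} p q = ord-≈ eq (ord-+ p q)
    where
    eq : (u + - v) + (v + - w) ≈ u + - w
    eq = begin
      (u + - v) + (v + - w) ≈⟨ +-assoc _ _ _ ⟩
      u + (- v + (v + - w)) ≈⟨ +-congˡ (sym (+-assoc _ _ _)) ⟩
      u + ((- v + v) + - w) ≈⟨ +-congˡ (trans (+-congʳ (-‿inverseˡ v)) (+-identityˡ _)) ⟩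
      u + - w ∎

  close-≈ : ∀ {n u u' v v'} → u ≈ u' → v ≈ v' → Close n u v → Close n u' v'
  close-≈ p q = ord-≈ (+-cong p (-‿cong q))

  close-sym : ∀ {n u v} → Close n u v → Close n v u
  close-sym {n} {u} {v} p = ord-≈ eq (ord-neg p)
    where
    eq : - (u + - v) ≈ v + - u
    eq = begin
      - (u + - v)     ≈⟨ sym (⁻¹-∙-comm u (- v)) ⟩
      - u + - (- v)   ≈⟨ +-congˡ (⁻¹-involutive v) ⟩
      - u + v         ≈⟨ +-commute _ _ ⟩
      v + - u         ∎

  -- From uv - u'v' = (u - u')v + u'(v - v'), where in either summand the required order may be
  -- divided between the two factors.
  close-* : ∀ a b c d {n u u' v v'} → a +ℕ b ≡ n → c +ℕ d ≡ n →
            Close a u u' → Ord b v → Ord c u' → Close d v v' → Close n (u * v) (u' * v')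
  close-* a b c d {u = u} {u'} {v} {v'} ≡.refl e p q r s = ord-≈ (*-difference u u' v v')
    (ord-+ (ord-* a b p q) (subst (λ n → Ord n (u' * (v + - v'))) e (ord-* c d r s)))

  module _ {K} (y : Fin K → Carrier) (y-ord : ∀ s → Ord 1 (y s)) where
    ord-positive : ∀ {e : Expr K} → Positive e → Ord 1 (eval ι x t e y)
    ord-positive nil      = ord-0
    ord-positive X        = x-ord
    ord-positive (var s)  = y-ord s
    ord-positive (p ⊹ q)  = ord-+ (ord-positive p) (ord-positive q)
    ord-positive (left p)  = ord-* 1 0 (ord-positive p) (ord-any _)
    ord-positive (right p) = ord-* 0 1 (ord-any _) (ord-positive p)

  module _ {K} (y y' : Fin K → Carrier) (y-ord : ∀ s → Ord 1 (y s)) (y'-ord : ∀ s → Ord 1 (y' s))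
           {n} (yy' : ∀ s → Close n (y s) (y' s)) where
    close-eval : ∀ (e : Expr K) → Close n (eval ι x t e y) (eval ι x t e y')
    close-eval (con c) = close-refl _
    close-eval nil     = close-refl _
    close-eval X       = close-refl _
    close-eval T       = close-refl _
    close-eval (var s) = yy' s
    close-eval (e ⊹ f) = close-+ (close-eval e) (close-eval f)
    close-eval (e ⊗ f) = close-* n 0 0 n (+ℕ-identityʳ n) ≡.refl
      (close-eval e) (ord-any _) (ord-any _) (close-eval f)

    -- In a product of two positive factors each difference is multiplied by something of order at
    -- least one. If one factor is proper, its own difference gains the order, and being positive it
    -- also supplies the order missing from the other difference.
    contraction : ∀ {e : Expr K} → Proper e → Close (suc n) (eval ι x t e y) (eval ι x t e y')
    contraction nil     = close-refl _
    contraction X       = close-refl _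
    contraction (p ⊹ q) = close-+ (contraction p) (contraction q)
    contraction {e ⊗ f} (p ⊗ q) = close-* n 1 1 n (+-comm n 1) ≡.refl
      (close-eval e) (ord-positive y y-ord q) (ord-positive y' y'-ord p) (close-eval f)
    contraction {e ⊗ f} (left p) = close-* (suc n) 0 1 n (+ℕ-identityʳ (suc n)) ≡.refl
      (contraction p) (ord-any _) (ord-positive y' y'-ord (proper⇒positive p)) (close-eval f)
    contraction {e ⊗ f} (right p) = close-* n 1 0 (suc n) (+-comm n 1) ≡.refl
      (close-eval e) (ord-positive y y-ord (proper⇒positive p)) (ord-any _) (contraction p)

-- Reduction of monomials modulo the deformed system

module Monomials (S : CommutativeRing 0ℓ 0ℓ) where
  open import Data.Fin.Base using (Fin; zero; suc)
  open import Data.Nat.Base using (ℕ; zero; suc) renaming (_+_ to _+ℕ_)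
  open import Data.Nat.Properties using (+-assoc; +-commutativeSemigroup)
  open import Algebra.Properties.CommutativeSemigroup +-commutativeSemigroup
    using () renaming (interchange to +-interchange; x∙yz≈y∙xz to +-swap)
  open import Function.Base using (_∘_)
  open import Relation.Binary.PropositionalEquality as ≡ using (_≡_; cong; cong₂)
  open CommutativeRing S hiding (zero; +-assoc; +-commutativeSemigroup)
  open import Algebra.Properties.Semiring.Exp semiring
  open import Algebra.Properties.CommutativeSemigroup *-commutativeSemigroup
    using (interchange; x∙yz≈y∙xz)

  total : ∀ {K} → (Fin K → ℕ) → ℕ
  total {zero}  b = 0
  total {suc K} b = b zero +ℕ total (b ∘ suc)

  mono : ∀ {K} → (Fin K → Carrier) → (Fin K → ℕ) → Carrier
  mono {zero}  y b = 1#
  mono {suc K} y b = y zero ^ b zero * mono (y ∘ suc) (b ∘ suc)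

  raise : ∀ {K} → Fin K → ℕ → (Fin K → ℕ) → Fin K → ℕ
  raise zero    k b zero    = k +ℕ b zero
  raise zero    k b (suc i) = b (suc i)
  raise (suc s) k b zero    = b zero
  raise (suc s) k b (suc i) = raise s k (b ∘ suc) i

  mono-cong : ∀ {K} (y : Fin K → Carrier) {b b'} → (∀ s → b s ≡ b' s) → mono y b ≈ mono y b'
  mono-cong {zero}  y p = refl
  mono-cong {suc K} y p = *-cong (^-congʳ (y zero) (p zero)) (mono-cong (y ∘ suc) (p ∘ suc))

  total-cong : ∀ {K} {b b' : Fin K → ℕ} → (∀ s → b s ≡ b' s) → total b ≡ total b'
  total-cong {zero}  p = ≡.refl
  total-cong {suc K} p = cong₂ _+ℕ_ (p zero) (total-cong (p ∘ suc))

  mono-raise : ∀ {K} (y : Fin K → Carrier) s k b → mono y (raise s k b) ≈ y s ^ k * mono y b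
  mono-raise y zero    k b = trans (*-congʳ (^-homo-* (y zero) k (b zero))) (*-assoc _ _ _)
  mono-raise y (suc s) k b =
    trans (*-congˡ (mono-raise (y ∘ suc) s k (b ∘ suc))) (x∙yz≈y∙xz _ _ _)

  total-raise : ∀ {K} s k (b : Fin K → ℕ) → total (raise s k b) ≡ k +ℕ total b
  total-raise zero    k b = +-assoc k (b zero) _
  total-raise (suc s) k b =
    ≡.trans (cong (b zero +ℕ_) (total-raise s k (b ∘ suc))) (+-swap (b zero) k _)

  mono-zero : ∀ {K} (y : Fin K → Carrier) → mono y (λ _ → 0) ≈ 1#
  mono-zero {zero}  y = refl
  mono-zero {suc K} y = trans (*-identityˡ _) (mono-zero (y ∘ suc))

  total-zero : ∀ K → total {K} (λ _ → 0) ≡ 0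
  total-zero zero    = ≡.refl
  total-zero (suc K) = total-zero K

  mono-+ : ∀ {K} (y : Fin K → Carrier) b b' →
           mono y (λ s → b s +ℕ b' s) ≈ mono y b * mono y b'
  mono-+ {zero}  y b b' = sym (*-identityˡ 1#)
  mono-+ {suc K} y b b' = trans
    (*-cong (^-homo-* (y zero) (b zero) (b' zero)) (mono-+ (y ∘ suc) (b ∘ suc) (b' ∘ suc)))
    (interchange _ _ _ _)

  total-+ : ∀ {K} (b b' : Fin K → ℕ) → total (λ s → b s +ℕ b' s) ≡ total b +ℕ total b'
  total-+ {zero}  b b' = ≡.refl
  total-+ {suc K} b b' = ≡.trans (cong (b zero +ℕ b' zero +ℕ_) (total-+ (b ∘ suc) (b' ∘ suc)))
    (+-interchange (b zero) (b' zero) _ _)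

-- If t y_s^(D+1) is a polynomial of degree at most D in the y's, then up
-- to powers of t every polynomial in the y's is a combination of the
-- finitely many monomials with all exponents at most D.
module Spanning (em : ExcludedMiddle 0ℓ) (S : CommutativeRing 0ℓ 0ℓ)
                {P : CommutativeRing.Carrier S → Set} (subring : LinearDependence.Subring em S P)
                {t : CommutativeRing.Carrier S} (t∈P : P t) where
  open import Data.Fin.Base using (Fin; zero; suc; toℕ; fromℕ<; funToFin; finToFun)
  open import Data.Fin.Properties using (finToFun-funToFin; toℕ-fromℕ<)
  open import Data.Nat.Base using (ℕ; zero; suc; _∸_; _≤_; _<_; s≤s; z≤n; s≤s⁻¹) renaming (_+_ to _+ℕ_; _^_ to _^ℕ_)
  open import Data.Nat.Properties using (≤-refl; ≤-reflexive; ≤-trans; +-mono-≤; m+[n∸m]≡n; ≮⇒≥; _<?_)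
  open import Data.Fin.Properties using (all?; ¬∀⟶∃¬)
  open import Data.Product.Base using (∃; _×_; _,_; proj₁; proj₂)
  open import Function.Base using (_∘_)
  open import Relation.Binary.PropositionalEquality as ≡ using (_≡_; cong; subst)
  open import Relation.Nullary using (¬_; yes; no)
  open CommutativeRing S hiding (zero)
  open import Algebra.Properties.Semiring.Exp semiring
  open import Algebra.Properties.Semiring.Sum semiring
  open import Algebra.Properties.Ring ring using (-‿distribˡ-*; -‿+-comm)
  open import Algebra.Properties.CommutativeSemigroup *-commutativeSemigroup
    using (interchange; x∙yz≈y∙xz)
  open import Relation.Binary.Reasoning.Setoid setoid
  open LinearDependence em S using (module Subring)
  open Subring subring
  open Monomials S

  module _ {K} (y : Fin K → Carrier) where
    -- Generated by terms and sums up to `_≈_`: no normal form of polynomials is needed, and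
    -- rewriting has to treat single terms only.
    data Pol (d : ℕ) : Carrier → Set where
      term : ∀ {c} b → P c → total b ≤ d → Pol d (c * mono y b)
      _⊞_  : ∀ {u v} → Pol d u → Pol d v → Pol d (u + v)
      resp : ∀ {u v} → u ≈ v → Pol d u → Pol d v

    pol-weaken : ∀ {d d' u} → d ≤ d' → Pol d u → Pol d' u
    pol-weaken l (term b p q) = term b p (≤-trans q l)
    pol-weaken l (p ⊞ q)      = pol-weaken l p ⊞ pol-weaken l q
    pol-weaken l (resp e p)   = resp e (pol-weaken l p)

    pol-neg : ∀ {d u} → Pol d u → Pol d (- u)
    pol-neg (term b p q) = resp (sym (-‿distribˡ-* _ _)) (term b (neg-closed p) q)
    pol-neg (p ⊞ q)      = resp (-‿+-comm _ _) (pol-neg p ⊞ pol-neg q)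
    pol-neg (resp e p)   = resp (-‿cong e) (pol-neg p)

    pol-const : ∀ {d c} → P c → Pol d c
    pol-const p = resp (trans (*-congˡ (mono-zero y)) (*-identityʳ _))
                       (term (λ _ → 0) p (≤-trans (≤-reflexive (total-zero K)) z≤n))

    pol-var : ∀ {d} s → Pol (suc d) (y s)
    pol-var s = resp eq (term (raise s 1 (λ _ → 0)) 1-closed
      (≤-trans (≤-reflexive (≡.trans (total-raise s 1 _) (cong suc (total-zero K)))) (s≤s z≤n)))
      where
      eq : 1# * mono y (raise s 1 (λ _ → 0)) ≈ y s
      eq = trans (*-identityˡ _) (trans (mono-raise y s 1 _)
             (trans (*-cong (*-identityʳ _) (mono-zero y)) (*-identityʳ _)))

    pol-* : ∀ {d d' u v} → Pol d u → Pol d' v → Pol (d +ℕ d') (u * v)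
    pol-* (term b p q) (term b' p' q') = resp
      (trans (*-congˡ (mono-+ y b b')) (interchange _ _ _ _))
      (term (λ s → b s +ℕ b' s) (*-closed p p')
            (≤-trans (≤-reflexive (total-+ b b')) (+-mono-≤ q q')))
    pol-* p@(term _ _ _) (q ⊞ q')   = resp (sym (distribˡ _ _ _)) (pol-* p q ⊞ pol-* p q')
    pol-* p@(term _ _ _) (resp e q) = resp (*-congˡ e) (pol-* p q)
    pol-* (p ⊞ p') q   = resp (sym (distribʳ _ _ _)) (pol-* p q ⊞ pol-* p' q)
    pol-* (resp e p) q = resp (*-congʳ e) (pol-* p q)

    pol-^ : ∀ {d u} → Pol d u → ∀ n → ∃ λ d' → Pol d' (u ^ n)
    pol-^ p zero    = 0 , pol-const 1-closed
    pol-^ p (suc n) with pol-^ p n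
    ... | d' , q = _ , pol-* p q

    module _ (D : ℕ) where
      basis : Fin (suc D ^ℕ K) → Carrier
      basis j = mono y (toℕ ∘ finToFun {suc D} {K} j)

      -- The power of `t` on the left is there because rewriting y^(D+1) would require division by
      -- `t`, which is not invertible.
      Reduced : Carrier → Set
      Reduced u = ∃ λ k → ∃ λ (c : Fin (suc D ^ℕ K) → Carrier) → (∀ j → P (c j)) ×
                  t ^ k * u ≈ sum (λ j → c j * basis j)

      t^-closed : ∀ k → P (t ^ k)
      t^-closed zero    = 1-closed
      t^-closed (suc k) = *-closed t∈P (t^-closed k)

      private
        scale-sum : ∀ a (c : Fin (suc D ^ℕ K) → Carrier) →
                    a * sum (λ j → c j * basis j) ≈ sum (λ j → a * c j * basis j)
        scale-sum a c = trans (*-distribˡ-sum a (λ j → c j * basis j))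
          (sum-cong-≋ {_} {λ j → a * (c j * basis j)} {λ j → a * c j * basis j}
                      (λ j → sym (*-assoc a (c j) (basis j))))

      reduced-≈ : ∀ {u v} → u ≈ v → Reduced u → Reduced v
      reduced-≈ e (k , c , p , q) = k , c , p , trans (*-congˡ (sym e)) q

      reduced-scale : ∀ {a u} → P a → Reduced u → Reduced (a * u)
      reduced-scale {a} {u} pa (k , c , p , q) =
        k , (λ j → a * c j) , (λ j → *-closed pa (p j)) , (begin
          t ^ k * (a * u)                  ≈⟨ x∙yz≈y∙xz _ _ _ ⟩
          a * (t ^ k * u)                  ≈⟨ *-congˡ q ⟩
          a * sum (λ j → c j * basis j)    ≈⟨ scale-sum a c ⟩
          sum (λ j → a * c j * basis j)    ∎)

      reduced-+ : ∀ {u v} → Reduced u → Reduced v → Reduced (u + v)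
      reduced-+ {u} {v} (k , c , p , q) (l , d , p' , q') =
        l +ℕ k , (λ j → t ^ l * c j + t ^ k * d j) ,
        (λ j → +-closed (*-closed (t^-closed l) (p j)) (*-closed (t^-closed k) (p' j))) , (begin
          t ^ (l +ℕ k) * (u + v)
            ≈⟨ *-congʳ (^-homo-* t l k) ⟩
          t ^ l * t ^ k * (u + v)
            ≈⟨ distribˡ _ _ _ ⟩
          t ^ l * t ^ k * u + t ^ l * t ^ k * v
            ≈⟨ +-cong (*-assoc _ _ _) (trans (*-congʳ (*-comm _ _)) (*-assoc _ _ _)) ⟩
          t ^ l * (t ^ k * u) + t ^ k * (t ^ l * v)
            ≈⟨ +-cong (trans (*-congˡ q) (scale-sum (t ^ l) c)) (trans (*-congˡ q') (scale-sum (t ^ k) d)) ⟩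
          sum (λ j → t ^ l * c j * basis j) + sum (λ j → t ^ k * d j * basis j)
            ≈⟨ sym (∑-distrib-+ (λ j → t ^ l * c j * basis j) (λ j → t ^ k * d j * basis j)) ⟩
          sum (λ j → t ^ l * c j * basis j + t ^ k * d j * basis j)
            ≈⟨ sum-cong-≋ {_} {λ j → t ^ l * c j * basis j + t ^ k * d j * basis j}
                 {λ j → (t ^ l * c j + t ^ k * d j) * basis j}
                 (λ j → sym (distribʳ (basis j) (t ^ l * c j) (t ^ k * d j))) ⟩
          sum (λ j → (t ^ l * c j + t ^ k * d j) * basis j) ∎)

      reduced-t : ∀ {u} → Reduced (t * u) → Reduced u
      reduced-t {u} (k , c , p , q) = suc k , c , p ,
        trans (trans (*-congʳ (*-comm _ _)) (*-assoc _ _ _)) q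

      private
        δ : ∀ {n} → Fin n → Fin n → Carrier
        δ zero    zero    = 1#
        δ zero    (suc j) = 0#
        δ (suc i) zero    = 0#
        δ (suc i) (suc j) = δ i j

        δ-closed : ∀ {n} (i j : Fin n) → P (δ i j)
        δ-closed zero    zero    = 1-closed
        δ-closed zero    (suc j) = 0-closed
        δ-closed (suc i) zero    = 0-closed
        δ-closed (suc i) (suc j) = δ-closed i j

        zero-sum : ∀ {n} (f : Fin n → Carrier) → sum (λ j → 0# * f j) ≈ 0#
        zero-sum {n} f = trans (sum-cong-≋ {n} {λ j → 0# * f j} {λ _ → 0#} (λ j → zeroˡ (f j)))
                               (sum-replicate-zero n)

        δ-sum : ∀ {n} (i : Fin n) (f : Fin n → Carrier) → sum (λ j → δ i j * f j) ≈ f i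
        δ-sum zero    f = trans (+-cong (*-identityˡ _) (zero-sum (f ∘ suc))) (+-identityʳ _)
        δ-sum (suc i) f = trans (+-cong (zeroˡ _) (δ-sum i (f ∘ suc))) (+-identityˡ _)

      reduced-basis : ∀ j → Reduced (basis j)
      reduced-basis j = 0 , δ j , δ-closed j , trans (*-identityˡ _) (sym (δ-sum j basis))

      module _ (E : Fin K → Carrier) (E-pol : ∀ s → Pol D (E s))
               (1≤D : 1 ≤ D)
               (fixed : ∀ s → E s + t * y s ^ suc D ≈ y s) where

        private
          equation : ∀ s → t * y s ^ suc D ≈ y s + - E s
          equation s = begin
            t * y s ^ suc D                       ≈⟨ sym (+-identityʳ _) ⟩
            t * y s ^ suc D + 0#                  ≈⟨ +-congˡ (sym (-‿inverseʳ (E s))) ⟩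
            t * y s ^ suc D + (E s + - E s)       ≈⟨ sym (+-assoc _ _ _) ⟩
            t * y s ^ suc D + E s + - E s         ≈⟨ +-congʳ (trans (+-comm _ _) (fixed s)) ⟩
            y s + - E s                           ∎

          unraise : ∀ {K'} (b : Fin K' → ℕ) s {N} → N ≤ b s →
                    ∃ λ b' → ∀ i → b i ≡ raise s N b' i
          unraise b zero {N} l = (λ { zero → b zero ∸ N ; (suc i) → b (suc i) }) ,
            λ { zero → ≡.sym (m+[n∸m]≡n l) ; (suc i) → ≡.refl }
          unraise b (suc s) l with unraise (b ∘ suc) s l
          ... | b' , e = (λ { zero → b zero ; (suc i) → b' i }) ,
            λ { zero → ≡.refl ; (suc i) → e i }

        -- Induction on the degree bound, then on the expression. A monomial with an exponent above
        -- `D` contains some y^(D+1); multiplication by `t` replaces this factor by `y s - E s`, of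
        -- degree at most `D`, so the total degree drops.
        reduced-pol : ∀ d {u} → Pol d u → Reduced u
        reduced-pol d (p ⊞ q)    = reduced-+ (reduced-pol d p) (reduced-pol d q)
        reduced-pol d (resp e p) = reduced-≈ e (reduced-pol d p)
        reduced-pol d (term {c} b pc l) with all? (λ s → b s <? suc D)
        ... | yes small = reduced-scale pc (reduced-≈ (mono-cong y exps) (reduced-basis j))
          where
          f : Fin K → Fin (suc D)
          f s = fromℕ< (small s)
          j = funToFin f
          exps : ∀ s → toℕ (finToFun {suc D} {K} j s) ≡ b s
          exps s = ≡.trans (cong toℕ (finToFun-funToFin f s)) (toℕ-fromℕ< (small s))
        ... | no large with ¬∀⟶∃¬ K (λ s → b s < suc D) (λ s → b s <? suc D) large
        ... | s , big with unraise b s (≮⇒≥ big)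
        ... | b' , e = lower d l
          where
          size : total b ≡ suc D +ℕ total b'
          size = ≡.trans (total-cong e) (total-raise s (suc D) b')
          lowered : t * (c * mono y b) ≈ c * ((y s + - E s) * mono y b')
          lowered = begin
            t * (c * mono y b)                      ≈⟨ x∙yz≈y∙xz _ _ _ ⟩
            c * (t * mono y b)                      ≈⟨ *-congˡ (*-congˡ (trans (mono-cong y e) (mono-raise y s (suc D) b'))) ⟩
            c * (t * (y s ^ suc D * mono y b'))     ≈⟨ *-congˡ (sym (*-assoc _ _ _)) ⟩
            c * (t * y s ^ suc D * mono y b')       ≈⟨ *-congˡ (*-congʳ (equation s)) ⟩
            c * ((y s + - E s) * mono y b')         ∎
          -- The reason for `1 ≤ D`: the bare unknown left over by the rewriting must also have
          -- degree at most `D`.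
          y-pol : Pol D (y s)
          y-pol = pol-weaken 1≤D (pol-var {0} s)
          lower : ∀ d → total b ≤ d → Reduced (c * mono y b)
          lower zero    l with () ← subst (_≤ 0) size l
          lower (suc d) l = reduced-t (reduced-≈ (sym lowered) (reduced-pol d
            (pol-weaken (s≤s⁻¹ (subst (_≤ suc d) size l))
              (pol-* {0} (pol-const pc)
                (pol-* (y-pol ⊞ pol-neg (E-pol s))
                  (resp (*-identityˡ _) (term b' 1-closed ≤-refl)))))))

        module _ (1≉0 : ¬ 1# ≈ 0#) (domain : LinearDependence.NoZeroDivisors em S) where

          private
            t^≉0 : ¬ t ≈ 0# → ∀ k → ¬ t ^ k ≈ 0#
            t^≉0 t≉0 zero    = 1≉0
            t^≉0 t≉0 (suc k) = domain t≉0 (t^≉0 t≉0 k)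

          -- With M basis monomials, the M + 1 powers w^0, ..., w^M give M + 1 rows of length M. Row
          -- j expands t^k w^j for an exponent k of its own; the factor t^k goes into the
          -- coefficient of w^j, which stays nonzero in a domain.
          algebraic-relation : ¬ t ≈ 0# → ∀ {d w} → Pol d w →
            ∃ λ n → ∃ λ (c : Fin (suc n) → Carrier) → (∀ j → P (c j)) ×
              (∃ λ j → ¬ c j ≈ 0#) × sum (λ j → c j * w ^ toℕ j) ≈ 0#
          algebraic-relation t≉0 {w = w} w-pol =
            M , (λ j → d j * τ j) ,
            (λ j → *-closed (proj₁ (proj₂ dep) j) (t^-closed (proj₁ (row j)))) ,
            (nz , domain (proj₂ (proj₁ (proj₂ (proj₂ dep)))) (t^≉0 t≉0 (proj₁ (row nz)))) , rel
            where
            M = suc D ^ℕ K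
            row : (j : Fin (suc M)) → Reduced (w ^ toℕ j)
            row j = reduced-pol _ (proj₂ (pol-^ w-pol (toℕ j)))
            v : Fin (suc M) → Fin M → Carrier
            v j = proj₁ (proj₂ (row j))
            τ : Fin (suc M) → Carrier
            τ j = t ^ proj₁ (row j)
            dep = LinearDependence.dependent em S 1≉0 domain subring M v
                    (λ j → proj₁ (proj₂ (proj₂ (row j))))
            d : Fin (suc M) → Carrier
            d = proj₁ dep
            nz = proj₁ (proj₁ (proj₂ (proj₂ dep)))
            expand : ∀ j → d j * τ j * w ^ toℕ j ≈ sum (λ i → d j * v j i * basis i)
            expand j = begin
              d j * τ j * w ^ toℕ j             ≈⟨ *-assoc _ _ _ ⟩
              d j * (τ j * w ^ toℕ j)           ≈⟨ *-congˡ (proj₂ (proj₂ (proj₂ (row j)))) ⟩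
              d j * sum (λ i → v j i * basis i) ≈⟨ scale-sum (d j) (v j) ⟩
              sum (λ i → d j * v j i * basis i) ∎
            column : ∀ i → sum (λ j → d j * v j i * basis i) ≈ 0#
            column i = begin
              sum (λ j → d j * v j i * basis i)
                ≈⟨ sym (*-distribʳ-sum (basis i) (λ j → d j * v j i)) ⟩
              sum (λ j → d j * v j i) * basis i
                ≈⟨ *-congʳ (proj₂ (proj₂ (proj₂ dep)) i) ⟩
              0# * basis i
                ≈⟨ zeroˡ _ ⟩
              0# ∎
            rel : sum (λ j → d j * τ j * w ^ toℕ j) ≈ 0#
            rel = begin
              sum (λ j → d j * τ j * w ^ toℕ j)
                ≈⟨ sum-cong-≋ {_} {λ j → d j * τ j * w ^ toℕ j}
                     {λ j → sum (λ i → d j * v j i * basis i)} expand ⟩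
              sum (λ j → sum (λ i → d j * v j i * basis i))
                ≈⟨ ∑-comm (λ j i → d j * v j i * basis i) ⟩
              sum (λ i → sum (λ j → d j * v j i * basis i))
                ≈⟨ sum-cong-≋ {_} {λ i → sum (λ j → d j * v j i * basis i)} {λ _ → 0#} column ⟩
              sum {M} (λ _ → 0#)
                ≈⟨ sum-replicate-zero M ⟩
              0# ∎

-- Solution of the deformed system and specialisation at t = 0

module AlgebraicRelation (em : ExcludedMiddle 0ℓ) (A : CommutativeRing 0ℓ 0ℓ) where
  open import Data.Fin.Base using (Fin; zero; suc; toℕ)
  open import Data.Nat.Base using (ℕ; zero; suc; _<_; _≤_; s≤s; z≤n; _∸_; _⊔_; _^_) renaming (_+_ to _+ℕ_)
  open import Data.Nat.Properties using (≤-refl; ≤-trans; m∸n+n≡m; m≤m⊔n; m≤n⊔m; m≤n+m; n≤1+n; +-identityʳ)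
  open import Data.Product.Base using (∃; _×_; _,_; proj₁; proj₂)
  open import Function.Base using (_∘_)
  open import Relation.Binary.PropositionalEquality as ≡ using (_≡_; subst)
  open import Relation.Nullary using (¬_)
  open import Relation.Nullary.Decidable using (decidable-stable)
  private
    module A = CommutativeRing A
    module PA = PowerSeriesRing A
    B = PA.commutativeRing
    module B = CommutativeRing B
    module PB = PowerSeriesRing B
    R = PB.commutativeRing
    module R = CommutativeRing R
    module SA = SeriesSupport A
    module RExp = Algebra.Properties.Semiring.Exp R.semiring
    module BExp = Algebra.Properties.Semiring.Exp B.semiring
    module RSum = Algebra.Properties.Semiring.Sum R.semiring
    module BSum = Algebra.Properties.Semiring.Sum B.semiring
    module LR = LinearDependence em R
    module EB = Expressions.Evaluation A.Carrier B
    module ER = Expressions.Evaluation A.Carrier R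
  open import Algebra.Properties.Group A.+-group using (x∙y⁻¹≈ε⇒x≈y; x≈y⇒x∙y⁻¹≈ε)
  open import Algebra.Properties.Ring A.ring using (-0#≈0#)
  open Expressions A.Carrier

  filtrationB : Filtration B
  filtrationB = record
    { Ord     = SA.OrderAtLeast
    ; ord-0   = λ i _ → A.refl
    ; ord-any = λ u i ()
    ; ord-≈   = λ e p i l → A.trans (A.sym (e i)) (p i l)
    ; ord-+   = λ p q i l → A.trans (A.+-cong (p i l) (q i l)) (A.+-identityˡ _)
    ; ord-neg = λ p i l → A.trans (A.-‿cong (p i l)) -0#≈0#
    ; ord-*   = λ a b p q → SA.order-⊠ a b p q
    }

  filtrationR : Filtration R
  filtrationR = record
    { Ord     = λ n u → ∀ j → F.Ord n (u j)
    ; ord-0   = λ j → F.ord-0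
    ; ord-any = λ u j → F.ord-any (u j)
    ; ord-≈   = λ e p j → F.ord-≈ (e j) (p j)
    ; ord-+   = λ p q j → F.ord-+ (p j) (q j)
    ; ord-neg = λ p j → F.ord-neg (p j)
    ; ord-*   = λ a b p q → SeriesClosure.⊠-closed B (F.Ord a) (F.Ord b) (F.Ord (a +ℕ b))
                              F.ord-+ (F.ord-* a b) p q
    }
    where module F = Filtration filtrationB

  private
    x-B : B.Carrier
    x-B = PA.indeterminate

    x-R t-R : R.Carrier
    x-R = PB.const x-B
    t-R = PB.indeterminate

    x-ordB : SA.OrderAtLeast 1 x-B
    x-ordB zero    _        = A.refl
    x-ordB (suc i) (s≤s ())

    x-ordR : ∀ j → SA.OrderAtLeast 1 (x-R j)
    x-ordR zero    = x-ordB
    x-ordR (suc j) _ _ = A.refl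

    evalB : ∀ {K} → Expr K → (Fin K → B.Carrier) → B.Carrier
    evalB = EB.eval PA.const x-B PA.zeroSeries

    evalR : ∀ {K} → Expr K → (Fin K → R.Carrier) → R.Carrier
    evalR = ER.eval (PB.const ∘ PA.const) x-R t-R

    module CB = Contraction B filtrationB PA.const x-B PA.zeroSeries x-ordB
    module CR = Contraction R filtrationR (PB.const ∘ PA.const) x-R t-R x-ordR

    evalR-0 : ∀ {K} (e : Expr K) y → evalR e y 0 B.≈ evalB e (λ s → y s 0)
    evalR-0 (con c) y = B.refl
    evalR-0 nil     y = B.refl
    evalR-0 X       y = B.refl
    evalR-0 T       y = B.refl
    evalR-0 (var s) y = B.refl
    evalR-0 (e ⊹ f) y = B.+-cong (evalR-0 e y) (evalR-0 f y)
    evalR-0 (e ⊗ f) y = B.*-cong (evalR-0 e y) (evalR-0 f y)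

  module _ {K} (e : Fin K → Expr K) (proper : ∀ s → Proper (e s)) where

    module FixedPoint where
      iterate : ℕ → Fin K → R.Carrier
      iterate zero    s = R.0#
      iterate (suc k) s = evalR (e s) (iterate k)

      iterate-ord : ∀ k s j → SA.OrderAtLeast 1 (iterate k s j)
      iterate-ord zero    s _ _ _ = A.refl
      iterate-ord (suc k) s =
        CR.ord-positive (iterate k) (iterate-ord k) (proper⇒positive (proper s))

      iterate-step : ∀ k s → CR.Close k (iterate k s) (iterate (suc k) s)
      iterate-step zero    s j i ()
      iterate-step (suc k) s = CR.contraction (iterate k) (iterate (suc k))
        (iterate-ord k) (iterate-ord (suc k)) (iterate-step k) (proper s)

      close-≤ : ∀ {m n u v} → m ≤ n → CR.Close n u v → CR.Close m u v
      close-≤ m≤n p j i i<m = p j i (≤-trans i<m m≤n)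

      iterate-close : ∀ d m s → CR.Close m (iterate m s) (iterate (d +ℕ m) s)
      iterate-close zero    m s = CR.close-refl (iterate m s)
      iterate-close (suc d) m s = CR.close-trans {m} {iterate m s} {iterate (d +ℕ m) s}
        (iterate-close d m s)
        (close-≤ {m} {d +ℕ m} {iterate (d +ℕ m) s} {iterate (suc d +ℕ m) s} (m≤n+m m d) (iterate-step (d +ℕ m) s))

      -- The iterates from 0 stabilise x-adically: the coefficient of x^i is final from iterate
      -- `suc i` on, for all powers of `t` at once.
      solution : Fin K → R.Carrier
      solution s j i = iterate (suc i) s j i

      solution-ord : ∀ s j → SA.OrderAtLeast 1 (solution s j)
      solution-ord s j i l = iterate-ord (suc i) s j i l

      solution-close : ∀ k s → CR.Close k (iterate k s) (solution s)
      solution-close k s j i i<k = x≈y⇒x∙y⁻¹≈ε (A.sym (x∙y⁻¹≈ε⇒x≈y _ _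
        (subst (λ k → iterate (suc i) s j i A.+ A.- iterate k s j i A.≈ A.0#)
               (m∸n+n≡m i<k) (iterate-close (k ∸ suc i) (suc i) s j i ≤-refl))))

      solution-fixed : ∀ s → evalR (e s) solution R.≈ solution s
      solution-fixed s j i = x∙y⁻¹≈ε⇒x≈y _ _
        (CR.close-trans {suc i} {evalR (e s) solution} {iterate (suc i) s} {solution s}
          (CR.contraction solution (iterate i) solution-ord (iterate-ord i)
            (λ r → CR.close-sym {i} {iterate i r} {solution r} (solution-close i r)) (proper s))
          (solution-close (suc i) s) j i ≤-refl)

    unique : ∀ {f g : Fin K → B.Carrier} →
             (∀ s → f s 0 A.≈ A.0#) → (∀ s → g s 0 A.≈ A.0#) →
             (∀ s → evalB (e s) f B.≈ f s) → (∀ s → evalB (e s) g B.≈ g s) →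
             ∀ s → f s B.≈ g s
    unique {f} {g} f0 g0 ff gf s i = x∙y⁻¹≈ε⇒x≈y _ _ (close (suc i) s i ≤-refl)
      where
      ord : ∀ {h} → h 0 A.≈ A.0# → SA.OrderAtLeast 1 h
      ord p zero    _        = p
      ord p (suc i) (s≤s ())
      close : ∀ n s → CB.Close n (f s) (g s)
      close zero    s i ()
      close (suc n) s = CB.close-≈ {suc n} (ff s) (gf s)
        (CB.contraction f g (ord ∘ f0) (ord ∘ g0) (close n) (proper s))

  private
    -- The subring A[x][[t]]: each coefficient in `t` is a polynomial in x, with no common bound on
    -- the degrees.
    P : R.Carrier → Set
    P u = ∀ j → SA.FiniteSupport (u j)

    subring : LR.Subring P
    subring = record
      { 0-closed   = λ j → SA.support-zero
      ; 1-closed   = λ { zero → SA.support-const A.1# ; (suc j) → SA.support-zero }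
      ; +-closed   = λ p q j → SA.support-+ (p j) (q j)
      ; *-closed   = SeriesClosure.⊠-closed B SA.FiniteSupport SA.FiniteSupport
                       SA.FiniteSupport SA.support-+ SA.support-*
      ; neg-closed = λ p j → SA.support-neg (p j)
      }

    t-closed : P t-R
    t-closed zero          = SA.support-zero
    t-closed (suc zero)    = SA.support-const A.1#
    t-closed (suc (suc j)) = SA.support-zero

    con-closed : ∀ {c} → SA.FiniteSupport c → P (PB.const c)
    con-closed p zero    = p
    con-closed p (suc j) = SA.support-zero

  open Spanning em R subring t-closed
  open LR.Subring subring

  private
    pol-eval : ∀ {K} (y : Fin K → R.Carrier) (e : Expr K) → Pol y (degree e) (evalR e y)
    pol-eval y (con c) = pol-const y (con-closed (SA.support-const c))
    pol-eval y nil     = pol-const y 0-closed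
    pol-eval y X       = pol-const y (con-closed (SA.support-shift (SA.support-const A.1#)))
    pol-eval y T       = pol-const y t-closed
    pol-eval y (var s) = pol-var y s
    pol-eval y (e ⊹ f) = pol-weaken y (m≤m⊔n _ _) (pol-eval y e)
                       ⊞ pol-weaken y (m≤n⊔m (degree e) _) (pol-eval y f)
    pol-eval y (e ⊗ f) = pol-* y (pol-eval y e) (pol-eval y f)

    bound : ∀ {K} (f : Fin K → ℕ) → ∃ λ m → ∀ s → f s ≤ m
    bound {zero}  f = 0 , λ ()
    bound {suc K} f with bound (f ∘ suc)
    ... | m , p = f zero ⊔ m , λ { zero → m≤m⊔n _ _ ; (suc s) → ≤-trans (p s) (m≤n⊔m (f zero) m) }

    ^-at-0 : ∀ (z : R.Carrier) n → (z RExp.^ n) 0 B.≈ z 0 BExp.^ n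
    ^-at-0 z zero    = B.refl
    ^-at-0 z (suc n) = B.*-congˡ (^-at-0 z n)

    sum-at : ∀ {n} (h : Fin n → R.Carrier) k → RSum.sum h k B.≈ BSum.sum (λ j → h j k)
    sum-at {zero}  h k = B.refl
    sum-at {suc n} h k = B.+-congˡ (sum-at (h ∘ suc) k)

  module _ (1≉0 : ¬ A.1# A.≈ A.0#)
           (domain : ∀ {x y} → ¬ x A.≈ A.0# → ¬ y A.≈ A.0# → ¬ x A.* y A.≈ A.0#) where

    private
      domainR : LR.NoZeroDivisors
      domainR = SeriesDomain.⊠-domain em B (SeriesDomain.⊠-domain em A domain)

      1≉0R : ¬ R.1# R.≈ R.0#
      1≉0R p = 1≉0 (p 0 0)

    Relation : B.Carrier → Set
    Relation f = ∃ λ n → ∃ λ (c : Fin (suc n) → B.Carrier) →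
      (∀ j → SA.FiniteSupport (c j)) × (∃ λ j → ¬ c j B.≈ B.0#) ×
      BSum.sum (λ j → c j B.* (f BExp.^ toℕ j)) B.≈ B.0#

    private
      -- All coefficients of the relation may vanish at t = 0, so `k` is taken as the lowest power
      -- of `t` occurring in any of them. Nothing lies below `k`, hence the coefficient of t^k in
      -- the relation sees the powers of `z` only at t = 0.
      specialise : ∀ z {f} → z 0 B.≈ f →
                   (∃ λ n → ∃ λ (c : Fin (suc n) → R.Carrier) → (∀ j → P (c j)) ×
                     (∃ λ j → ¬ c j R.≈ R.0#) ×
                     RSum.sum (λ j → c j R.* (z RExp.^ toℕ j)) R.≈ R.0#) → Relation f
      specialise z {f} z≈f (n , c , Pc , (j , cj≉0) , rel)
        with LeastNumber.least em (λ k → ∃ λ j → ¬ c j k B.≈ B.0#)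
               (j , proj₁ (proj₂ (SeriesDomain.leading em B cj≉0)))
      ... | k , nonzero , below = n , (λ j → c j k) , (λ j → Pc j k) , nonzero ,
        B.trans (BSum.sum-cong-≋ {_} {λ j → c j k B.* (f BExp.^ toℕ j)}
                  {λ j → (c j R.* (z RExp.^ toℕ j)) k} (λ j → B.sym (term-at-k j)))
          (B.trans (B.sym (sum-at (λ j → c j R.* (z RExp.^ toℕ j)) k)) (rel k))
        where
        vanish : ∀ j i → i < k → c j i B.≈ B.0#
        vanish j i i<k = decidable-stable em (λ ne → below i i<k (j , ne))
        term-at-k : ∀ j → (c j R.* (z RExp.^ toℕ j)) k B.≈ c j k B.* (f BExp.^ toℕ j)
        term-at-k j = B.trans
          (B.reflexive (≡.cong (c j R.* (z RExp.^ toℕ j)) (≡.sym (+-identityʳ k))))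
          (B.trans (PB.⊠-leading (c j) (z RExp.^ toℕ j) k 0 (vanish j) (λ _ ()))
                   (B.*-congˡ (B.trans (^-at-0 z (toℕ j)) (BExp.^-congˡ (toℕ j) z≈f))))

    private
      evalB-cong : ∀ {K} (e : Expr K) {g h} → (∀ s → g s B.≈ h s) → evalB e g B.≈ evalB e h
      evalB-cong (con c) p = B.refl
      evalB-cong nil     p = B.refl
      evalB-cong X       p = B.refl
      evalB-cong T       p = B.refl
      evalB-cong (var s) p = p s
      evalB-cong (e ⊹ f) p = B.+-cong (evalB-cong e p) (evalB-cong f p)
      evalB-cong (e ⊗ f) p = B.*-cong (evalB-cong e p) (evalB-cong f p)

      RelationR : R.Carrier → Set
      RelationR w = ∃ λ n → ∃ λ (c : Fin (suc n) → R.Carrier) → (∀ j → P (c j)) ×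
        (∃ λ j → ¬ c j R.≈ R.0#) × RSum.sum (λ j → c j R.* (w RExp.^ toℕ j)) R.≈ R.0#

      module _ {K} (e : Fin K → Expr K) (D : ℕ) (degrees : ∀ s → degree (e s) ≤ D) (1≤D : 1 ≤ D)
               (y : Fin K → R.Carrier)
               (fixed : ∀ s → evalR (e s ⊹ T ⊗ power (var s) D) y R.≈ y s) where

        relationR : ∀ z → RelationR (evalR z y)
        relationR z = algebraic-relation y D (λ s → evalR (e s) y)
          (λ s → pol-weaken y (degrees s) (pol-eval y (e s)))
          1≤D fixed' 1≉0R domainR (λ p → 1≉0 (p 1 0)) (pol-eval y z)
          where
          fixed' : ∀ s → evalR (e s) y R.+ t-R R.* (y s RExp.^ suc D) R.≈ y s
          fixed' s = R.trans
            (R.+-congˡ {evalR (e s) y} (R.*-congˡ {t-R}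
              (R.sym (ER.eval-power (PB.const ∘ PA.const) x-R t-R (var s) D y))))
            (fixed s)

        fixed-at-0 : ∀ s → evalB (e s) (λ s → y s 0) B.≈ y s 0
        fixed-at-0 s = B.trans (B.sym (evalR-0 (e s) y)) (B.trans
          (B.sym (B.trans (B.+-congˡ {evalR (e s) y 0} (B.zeroˡ (evalR (power (var s) D) y 0)))
                          (B.+-identityʳ (evalR (e s) y 0))))
          (fixed s 0))

    algebraic : ∀ {K} (e : Fin K → Expr K) → (∀ s → Proper (e s)) →
                (f : Fin K → B.Carrier) → (∀ s → f s 0 A.≈ A.0#) →
                (∀ s → evalB (e s) f B.≈ f s) → (z : Expr K) → Relation (evalB z f)
    algebraic {K} e proper f f0 f-fixed z = result
      where
      -- The successor gives `1 ≤ D` even if all degrees are 0.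
      D = suc (proj₁ (bound (degree ∘ e)))
      degrees : ∀ s → degree (e s) ≤ D
      degrees s = ≤-trans (proj₂ (bound (degree ∘ e)) s) (n≤1+n _)
      deformed : Fin K → Expr K
      deformed s = e s ⊹ T ⊗ power (var s) D
      deformed-proper : ∀ s → Proper (deformed s)
      -- `T` has x-adic order 0; the contraction comes from y^(D+1), which has at least two positive
      -- factors because `D` is positive.
      deformed-proper s = proper s ⊹ right (var s ⊗ positive-power _ (var s))
      open FixedPoint deformed deformed-proper
      -- At t = 0 the deformed equations become the given ones, whose solution without constant term
      -- is unique.
      y≈f : ∀ s → solution s 0 B.≈ f s
      y≈f = unique e proper (λ s → solution-ord s 0 0 (s≤s z≤n)) f0
        (fixed-at-0 e D degrees (s≤s z≤n) solution solution-fixed) f-fixed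
      relation : RelationR (evalR z solution)
      relation = relationR e D degrees (s≤s z≤n) solution solution-fixed z
      result : Relation (evalB z f)
      result = specialise (evalR z solution)
        (B.trans (evalR-0 z solution) (evalB-cong z y≈f)) relation

-- Translation to the polynomials and series of the statement

open import Defs

module Horner (S : CommutativeRing 0ℓ 0ℓ) where
  open import Data.Fin.Base using (Fin; zero; suc; toℕ)
  open import Data.Nat.Base using (suc)
  open CommutativeRing S hiding (zero)
  open import Algebra.Properties.Semiring.Exp semiring
  open import Algebra.Properties.Semiring.Sum semiring
  open import Algebra.Properties.CommutativeSemigroup *-commutativeSemigroup using (x∙yz≈y∙xz)

  horner-step : ∀ {n} (c : Fin (suc n) → Carrier) f →
                sum (λ j → c j * f ^ toℕ j) ≈ c zero + f * sum (λ j → c (suc j) * f ^ toℕ j)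
  horner-step c f = +-cong (*-identityʳ _) (trans
    (sum-cong-≋ {_} {λ j → c (suc j) * (f * f ^ toℕ j)} {λ j → f * (c (suc j) * f ^ toℕ j)}
      (λ j → x∙yz≈y∙xz (c (suc j)) f (f ^ toℕ j)))
    (sym (*-distribˡ-sum f (λ j → c (suc j) * f ^ toℕ j))))

module RationalSeries where
  open import Data.Fin.Base using (Fin; zero; suc; toℕ)
  open import Data.List.Base using ([]; _∷_)
  open import Data.List.Relation.Unary.Any using (Any; here; there)
  open import Data.Nat.Base using (ℕ; zero; suc; _<_; _≤_; z≤n; s≤s)
  open import Data.Nat.Properties using (<-≤-connex)
  open import Data.Product.Base using (∃; _×_; _,_; proj₁; proj₂)
  open import Data.Rational.Base as ℚ using (ℚ; 0ℚ; 1ℚ; ≢-nonZero; 1/_)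
  open import Data.Rational.Properties as ℚ using (+-*-commutativeRing; +-0-commutativeMonoid)
  open import Data.Sum.Base using (inj₁; inj₂)
  open import Function.Base using (_∘_)
  open import Relation.Binary.PropositionalEquality
  open import Relation.Nullary using (¬_; contradiction)
  open import Algebra.Properties.CommutativeMonoid.Sum +-0-commutativeMonoid using (sum)

  open PowerSeriesRing +-*-commutativeRing public
  open Expressions ℚ public

  ℚ-domain : ∀ {x y : ℚ} → x ≢ 0ℚ → y ≢ 0ℚ → x ℚ.* y ≢ 0ℚ
  ℚ-domain {x} {y} x≢0 y≢0 xy≡0 = y≢0 (begin
    y                        ≡⟨ sym (ℚ.*-identityˡ y) ⟩
    1ℚ ℚ.* y                 ≡⟨ cong (ℚ._* y) (sym (ℚ.*-inverseˡ x)) ⟩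
    (1/ x) ℚ.* x ℚ.* y       ≡⟨ ℚ.*-assoc (1/ x) x y ⟩
    (1/ x) ℚ.* (x ℚ.* y)     ≡⟨ cong ((1/ x) ℚ.*_) xy≡0 ⟩
    (1/ x) ℚ.* 0ℚ            ≡⟨ ℚ.*-zeroʳ (1/ x) ⟩
    0ℚ ∎)
    where
    open ≡-Reasoning
    instance _ = ≢-nonZero x≢0

  series : ∀ {K} → Expr K → (Fin K → Series) → Series
  series = Expressions.Evaluation.eval ℚ commutativeRing const indeterminate zeroSeries

  ⊛≋⊠ : ∀ f g n → (f ⊛ g) n ≡ (f ⊠ g) n
  ⊛≋⊠ f g zero    = ℚ.+-identityʳ _
  ⊛≋⊠ f g (suc n) = cong (f 0 ℚ.* g (suc n) ℚ.+_) (⊛≋⊠ (f ∘ suc) g n)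

  private
    module S = CommutativeRing commutativeRing
    open SeriesSupport +-*-commutativeRing using (FiniteSupport)
    open import Algebra.Properties.Semiring.Exp S.semiring using (_^_)
    open import Algebra.Properties.Semiring.Sum S.semiring using () renaming (sum to ∑)

    truncate : ℕ → Series → Poly
    truncate zero    f = []
    truncate (suc B) f = f 0 ∷ truncate B (tail f)

    coeff-truncate : ∀ B {f} → (∀ i → B ≤ i → f i ≡ 0ℚ) → ∀ i → coeff (truncate B f) i ≡ f i
    coeff-truncate zero    p i       = sym (p i z≤n)
    coeff-truncate (suc B) p zero    = refl
    coeff-truncate (suc B) p (suc i) = coeff-truncate B (λ j l → p (suc j) (s≤s l)) i

    truncate-nonzero : ∀ B {f} n → n < B → f n ≢ 0ℚ → Any (_≢ 0ℚ) (truncate B f)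
    truncate-nonzero (suc B) zero    _       ne = here ne
    truncate-nonzero (suc B) (suc n) (s≤s l) ne = there (truncate-nonzero B n l ne)

    polynomial : ∀ {n} (c : Fin n → Series) → (∀ j → FiniteSupport (c j)) → Poly₂
    polynomial {zero}  c fs = []
    polynomial {suc n} c fs = truncate (proj₁ (fs zero)) (c zero) ∷ polynomial (c ∘ suc) (fs ∘ suc)

    polynomial-nonzero : ∀ {n} (c : Fin n → Series) fs j i → c j i ≢ 0ℚ →
                         NonZeroPoly₂ (polynomial c fs)
    polynomial-nonzero c fs (suc j) i ne = there (polynomial-nonzero (c ∘ suc) (fs ∘ suc) j i ne)
    polynomial-nonzero c fs zero    i ne with <-≤-connex i (proj₁ (fs zero))
    ... | inj₁ i<B = here (truncate-nonzero _ i i<B ne)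
    ... | inj₂ B≤i = contradiction (proj₂ (fs zero) i B≤i) ne

    eval-polynomial : ∀ {n} (c : Fin n → Series) fs f →
                      eval (polynomial c fs) f ≋ ∑ (λ j → c j ⊠ (f ^ toℕ j))
    eval-polynomial {zero}  c fs f n = refl
    eval-polynomial {suc _} c fs f n = trans
      (cong₂ ℚ._+_ (coeff-truncate (proj₁ (fs zero)) (proj₂ (fs zero)) n)
        (trans (⊛≋⊠ f (eval (polynomial (c ∘ suc) (fs ∘ suc)) f) n)
               (⊠-cong {f} (λ _ → refl) (eval-polynomial (c ∘ suc) (fs ∘ suc) f) n)))
      (sym (Horner.horner-step commutativeRing c f n))

  module _ (em : ExcludedMiddle 0ℓ) where
    open AlgebraicRelation em +-*-commutativeRing using (algebraic; Relation)

    -- The coefficients of the relation have finite support and are truncated to lists; the sum of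
    -- powers becomes a Horner scheme.
    algebraic-solution : ∀ {K} (e : Fin K → Expr K) → (∀ s → Proper (e s)) →
                         (f : Fin K → Series) → (∀ s → f s 0 ≡ 0ℚ) →
                         (∀ s → f s ≋ series (e s) f) → (z : Expr K) → Algebraic (series z f)
    algebraic-solution e proper f f0 f-fixed z = finish
      (algebraic (λ ()) ℚ-domain e proper f f0 (λ s n → sym (f-fixed s n)) z)
      where
      finish : ∀ {g} → Relation (λ ()) ℚ-domain g → Algebraic g
      finish {g} (n , c , fs , (j , c≉0) , zero-sum)
        with SeriesDomain.leading em +-*-commutativeRing c≉0
      ... | i , ne , _ = polynomial c fs , polynomial-nonzero c fs j i ne ,
        λ n → trans (eval-polynomial c fs g n) (zero-sum n)

  algebraic-resp : ∀ {f g} → f ≋ g → Algebraic f → Algebraic g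
  algebraic-resp {f} {g} p (P , nz , z) = P , nz , λ n → trans (sym (eval-cong P n)) (z n)
    where
    eval-cong : ∀ P → eval P f ≋ eval P g
    eval-cong []      n = refl
    eval-cong (q ∷ P) n = cong (coeff q n ℚ.+_)
      (trans (⊛≋⊠ f (eval P f) n) (trans (⊠-cong p (eval-cong P) n) (sym (⊛≋⊠ g (eval P g) n))))

open import Data.Product.Base using (∃; ∃₂; _×_; _,_; proj₁; proj₂)
open import Data.Sum.Base using (_⊎_; inj₁; inj₂; [_,_]; [_,_]′)
open import Function.Base using (_∘_; id)
open import Relation.Binary.Definitions using (tri<; tri≈; tri>)
open import Relation.Binary.PropositionalEquality
  using (_≡_; _≢_; refl; sym; trans; cong; cong₂; subst; subst₂; module ≡-Reasoning)
open import Relation.Binary.Structures using (IsEquivalence)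
open import Relation.Nullary using (¬_; Dec; yes; no; contradiction)
open import Relation.Nullary.Decidable using (decidable-stable)
open import Data.List.Base using (List)

-- Inflations and simple quotients

module FiniteOrders (em : ExcludedMiddle 0ℓ) where
  open import Data.Fin.Base using (Fin; zero; suc; toℕ; _<_; _≤_; fromℕ<)
  open import Data.Fin.Permutation using (Permutation′; _⟨$⟩ʳ_; permutation)
  open import Data.Fin.Properties using (toℕ<n; <-cmp; injective⇒≤; toℕ-fromℕ<; fromℕ<-toℕ)
  open import Data.Nat.Base as ℕ using (ℕ; zero; suc; z≤n; s≤s)
  open import Data.Nat.Properties as ℕ using ()
  open import Function.Definitions using (Injective)

  StrictlyMonotone : ∀ {m n} → (Fin m → Fin n) → Set
  StrictlyMonotone f = ∀ {i j} → i < j → f i < f j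

  Onto : ∀ {A B : Set} → (A → B) → Set
  Onto f = ∀ y → ∃ λ x → f x ≡ y

  monotone⇒injective : ∀ {m n} {f : Fin m → Fin n} → StrictlyMonotone f → Injective _≡_ _≡_ f
  monotone⇒injective {f = f} mono {i} {j} e with <-cmp i j
  ... | tri< l _ _ = contradiction (mono l) (λ l' → ℕ.<-irrefl (cong toℕ e) l')
  ... | tri≈ _ p _ = p
  ... | tri> _ _ l = contradiction (mono l) (λ l' → ℕ.<-irrefl (cong toℕ (sym e)) l')

  monotone⇒reflects : ∀ {m n} {f : Fin m → Fin n} → StrictlyMonotone f → ∀ {i j} → f i < f j → i < j
  monotone⇒reflects {f = f} mono {i} {j} fi<fj with <-cmp i j
  ... | tri< l _ _    = l
  ... | tri≈ _ refl _ = contradiction fi<fj (ℕ.<-irrefl refl)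
  ... | tri> _ _ l    = contradiction (mono l) (ℕ.<-asym fi<fj)

  monotone⇒expanding : ∀ {m n} {f : Fin m → Fin n} → StrictlyMonotone f → ∀ i → i ≤ f i
  monotone⇒expanding {m} {n} {f} mono i =
    subst (λ k → toℕ i ℕ.≤ toℕ (f k)) (fromℕ<-toℕ i (toℕ<n i)) (go (toℕ i) (toℕ<n i))
    where
    go : ∀ k (k<m : k ℕ.< m) → k ℕ.≤ toℕ (f (fromℕ< k<m))
    go zero    _ = z≤n
    go (suc k) l = ℕ.≤-trans (s≤s (go k (ℕ.<⇒≤ l)))
      (mono (subst₂ ℕ._<_ (sym (toℕ-fromℕ< (ℕ.<⇒≤ l))) (sym (toℕ-fromℕ< l)) ℕ.≤-refl))

  bijection-size : ∀ {m n} {f : Fin m → Fin n} → Injective _≡_ _≡_ f → Onto f → m ≡ n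
  bijection-size {f = f} inj onto = ℕ.≤-antisym (injective⇒≤ inj)
    (injective⇒≤ {f = proj₁ ∘ onto} λ {x} {y} e →
      trans (sym (proj₂ (onto x))) (trans (cong f e) (proj₂ (onto y))))

  -- Both `f` and its section are strictly monotone, hence expanding, so neither can move an index
  -- upwards. Comparison through `toℕ` avoids transport along `m ≡ n`.
  rigid : ∀ {m n} {f : Fin m → Fin n} → StrictlyMonotone f → Onto f → ∀ i → toℕ (f i) ≡ toℕ i
  rigid {f = f} mono onto i = ℕ.≤-antisym
    (subst (λ k → f i ≤ k) (monotone⇒injective mono (proj₂ (onto (f i))))
      (monotone⇒expanding {f = proj₁ ∘ onto} g-mono (f i)))
    (monotone⇒expanding mono i)
    where
    g-mono : StrictlyMonotone (proj₁ ∘ onto)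
    g-mono {x} {y} x<y = monotone⇒reflects mono
      (subst₂ _<_ (sym (proj₂ (onto x))) (sym (proj₂ (onto y))) x<y)

  record Enumeration {n} (P : Fin n → Set) : Set where
    field
      size     : ℕ
      at       : Fin size → Fin n
      monotone : StrictlyMonotone at
      sound    : ∀ a → P (at a)
      complete : ∀ i → P i → ∃ λ a → at a ≡ i

  -- Excluded middle decides membership, so any set of positions can be cut out in increasing order;
  -- this is how blocks and patterns become permutations.
  enumerate : ∀ {n} (P : Fin n → Set) → Enumeration P
  enumerate {zero}  P = record { size = 0 ; at = λ () ; monotone = λ {} ; sound = λ () ; complete = λ () }
  enumerate {suc n} P with enumerate (P ∘ suc) | em {P zero}
  ... | E | no ¬p = record
    { size = size ; at = suc ∘ at ; monotone = s≤s ∘ monotone ; sound = sound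
    ; complete = λ { zero p → contradiction p ¬p
                   ; (suc i) p → proj₁ (complete i p) , cong suc (proj₂ (complete i p)) } }
    where open Enumeration E
  ... | E | yes p₀ = record
    { size = suc size ; at = at' ; monotone = mono ; sound = λ { zero → p₀ ; (suc a) → sound a }
    ; complete = λ { zero p → zero , refl
                   ; (suc i) p → suc (proj₁ (complete i p)) , cong suc (proj₂ (complete i p)) } }
    where
    open Enumeration E
    at' : Fin (suc size) → Fin (suc n)
    at' zero    = zero
    at' (suc a) = suc (at a)
    mono : StrictlyMonotone at'
    mono {zero}  {suc b} _       = s≤s z≤n
    mono {suc a} {suc b} (s≤s l) = s≤s (monotone l)

  mk-permutation : ∀ {m n} {f : Fin m → Fin n} → Injective _≡_ _≡_ f → (onto : Onto f) →
                   m ≡ n → ∃ λ (π : Permutation′ m) → ∀ i → toℕ (π ⟨$⟩ʳ i) ≡ toℕ (f i)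
  mk-permutation {f = f} inj onto refl =
    permutation f (proj₁ ∘ onto) (proj₂ ∘ onto) (λ x → inj (proj₂ (onto (f x)))) , λ _ → refl

  -- Each value is replaced by its rank in the increasing list of the values taken.
  standardise : ∀ {k n} (v : Fin k → Fin n) → Injective _≡_ _≡_ v →
                ∃ λ (τ : Permutation′ k) → ∀ a b → v a < v b → τ ⟨$⟩ʳ a < τ ⟨$⟩ʳ b
  standardise {k} v v-inj = proj₁ τ , λ a b l →
    subst₂ ℕ._<_ (sym (proj₂ τ a)) (sym (proj₂ τ b))
      (monotone⇒reflects monotone (subst₂ _<_ (sym (at-h a)) (sym (at-h b)) l))
    where
    E = enumerate (λ y → ∃ λ a → v a ≡ y)
    open Enumeration E
    h : Fin k → Fin size
    h a = proj₁ (complete (v a) (a , refl))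
    at-h : ∀ a → at (h a) ≡ v a
    at-h a = proj₂ (complete (v a) (a , refl))
    h-inj : Injective _≡_ _≡_ h
    h-inj {a} {b} e = v-inj (trans (sym (at-h a)) (trans (cong at e) (at-h b)))
    h-onto : Onto h
    h-onto c = proj₁ (sound c) ,
      monotone⇒injective monotone (trans (at-h (proj₁ (sound c))) (proj₂ (sound c)))
    τ = mk-permutation h-inj h-onto (bijection-size h-inj h-onto)

-- Embeddings, isomorphisms and inflations

module Inflations (em : ExcludedMiddle 0ℓ) where
  open import Data.Fin.Base using (Fin; zero; suc; toℕ; _<_; combine; inject≤)
  open import Data.Fin.Permutation using (Permutation′; _⟨$⟩ʳ_; _⟨$⟩ˡ_; inverseˡ; inverseʳ; flip)
  open import Data.Fin.Properties using (toℕ-injective; <-cmp; combine-monoˡ-<; toℕ-combine; toℕ-inject≤; combine-injective; inject≤-injective)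
  open import Data.Nat.Base as ℕ using (ℕ; zero; suc)
  open import Data.Nat.Properties as ℕ using ()
  open import Function.Bundles using (mk⇔; Equivalence)
  open import Function.Definitions using (Injective)
  open FiniteOrders em public

  Perm : Set
  Perm = ∃ Permutation′

  size : Perm → ℕ
  size = proj₁

  Pos : Perm → Set
  Pos p = Fin (size p)

  val : (p : Perm) → Pos p → Pos p
  val (_ , π) = π ⟨$⟩ʳ_

  val⁻¹ : (p : Perm) → Pos p → Pos p
  val⁻¹ (_ , π) = π ⟨$⟩ˡ_

  val-injective : ∀ p → Injective _≡_ _≡_ (val p)
  val-injective (_ , π) e = trans (sym (inverseˡ π)) (trans (cong (π ⟨$⟩ˡ_) e) (inverseˡ π))

  inverse : Perm → Perm
  inverse (n , π) = n , flip π

  ≅-refl : ∀ {p} → p ≅ p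
  ≅-refl = same (λ _ → refl)

  ≅-sym : ∀ {p q} → p ≅ q → q ≅ p
  ≅-sym (same e) = same (sym ∘ e)

  ≅-trans : ∀ {p q r} → p ≅ q → q ≅ r → p ≅ r
  ≅-trans (same e) (same f) = same (λ i → trans (e i) (f i))

  ≅-size : ∀ {p q} → p ≅ q → size p ≡ size q
  ≅-size (same _) = refl

  ≅-inverse : ∀ {p q} → p ≅ q → inverse p ≅ inverse q
  ≅-inverse {_ , π} {_ , ρ} (same e) = same λ i →
    trans (cong (π ⟨$⟩ˡ_) (sym (trans (e (ρ ⟨$⟩ˡ i)) (inverseʳ ρ)))) (inverseˡ π)

  record Embedding (p q : Perm) : Set where
    field
      map    : Pos p → Pos q
      pos    : StrictlyMonotone map
      values : ∀ {i j} → val p i < val p j → val q (map i) < val q (map j)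

  record Iso (p q : Perm) : Set where
    field
      embedding : Embedding p q
    open Embedding embedding public
    field
      onto : Onto map

  <⇒≢ : ∀ {n} {i j : Fin n} → i < j → i ≢ j
  <⇒≢ l refl = ℕ.<-irrefl refl l

  embedding-reflects : ∀ {p q} (f : Embedding p q) → let open Embedding f in
                       ∀ {i j} → val q (map i) < val q (map j) → val p i < val p j
  embedding-reflects {p} {q} f {i} {j} l with <-cmp (val p i) (val p j)
  ... | tri< l' _ _ = l'
  ... | tri≈ _ e _  = contradiction (cong (val q ∘ Embedding.map f) (val-injective p e)) (<⇒≢ l)
  ... | tri> _ _ l' = contradiction (Embedding.values f l') (ℕ.<-asym l)

  embedding⇒contains : ∀ {p q} → Embedding p q → proj₂ q Contains proj₂ p
  embedding⇒contains {p} {q} f = map , record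
    { positions = λ _ _ → pos
    ; values    = λ _ _ → mk⇔ values (embedding-reflects f) }
    where open Embedding f

  contains⇒embedding : ∀ {p q} → proj₂ q Contains proj₂ p → Embedding p q
  contains⇒embedding (f , o) = record
    { map = f ; pos = OrderIso.positions o _ _ ; values = Equivalence.to (OrderIso.values o _ _) }

  embedding-∘ : ∀ {p q r} → Embedding q r → Embedding p q → Embedding p r
  embedding-∘ f g = record
    { map = F.map ∘ G.map ; pos = F.pos ∘ G.pos ; values = F.values ∘ G.values }
    where module F = Embedding f
          module G = Embedding g

  ≅⇒iso : ∀ {p q} → p ≅ q → Iso p q
  ≅⇒iso (same e) = record
    { embedding = record { map = id ; pos = id ; values = λ {i} {j} → subst₂ _<_ (e i) (e j) }
    ; onto = λ y → y , refl }

  -- Rigidity is applied twice: to the map on positions, which is therefore the identity, and to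
  -- `val q ∘ map ∘ val⁻¹ p`, the induced map on values.
  iso⇒≅ : ∀ {p q} → Iso p q → p ≅ q
  iso⇒≅ {p@(m , π)} {q@(n , ρ)} f = go (bijection-size (monotone⇒injective pos) onto)
    where
    open Iso f
    go : m ≡ n → p ≅ q
    go refl = same λ i → toℕ-injective (trans
      (cong (toℕ ∘ val p) (sym (map-id i)))
      (sym (trans (cong (toℕ ∘ val q) (trans (sym (map-id i)) (cong map (sym (inverseˡ π {i})))))
        (trans (rigid {f = val q ∘ map ∘ val⁻¹ p} mono surj (val p i)) (cong (toℕ ∘ val p) (sym (map-id i)))))))
      where
      map-id : ∀ i → map i ≡ i
      map-id i = toℕ-injective (rigid pos onto i)
      mono : StrictlyMonotone (val q ∘ map ∘ val⁻¹ p)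
      mono l = values (subst₂ _<_ (sym (inverseʳ π)) (sym (inverseʳ π)) l)
      surj : Onto (val q ∘ map ∘ val⁻¹ p)
      surj y = val p (proj₁ (onto (val⁻¹ q y))) ,
        trans (cong (val q ∘ map) (inverseˡ π))
          (trans (cong (val q) (proj₂ (onto (val⁻¹ q y)))) (inverseʳ ρ))

  ≅⇒embedding : ∀ {p q} → p ≅ q → Embedding p q
  ≅⇒embedding = Iso.embedding ∘ ≅⇒iso

  -- p is the inflation s[b] of s by the permutations b.
  record Inflation (s : Perm) (b : Pos s → Perm) (p : Perm) : Set where
    field
      emb     : ∀ i → Pos (b i) → Pos p
      onto    : ∀ x → ∃₂ λ i a → emb i a ≡ x
      pos-in  : ∀ {i a c} → a < c → emb i a < emb i c
      pos-out : ∀ {i j a c} → i < j → emb i a < emb j c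
      val-in  : ∀ {i a c} → val (b i) a < val (b i) c → val p (emb i a) < val p (emb i c)
      val-out : ∀ {i j a c} → val s i < val s j → val p (emb i a) < val p (emb j c)

    block : Pos p → Pos s
    block x = proj₁ (onto x)

    coord : ∀ x → Pos (b (block x))
    coord x = proj₁ (proj₂ (onto x))

    emb-coord : ∀ x → emb (block x) (coord x) ≡ x
    emb-coord x = proj₂ (proj₂ (onto x))

    component : ∀ i → Embedding (b i) p
    component i = record { map = emb i ; pos = pos-in ; values = val-in }

    -- The fields only lead from the orders of `s` and of the blocks to that of `p`; trichotomy
    -- supplies the way back.
    pos-cases : ∀ {i j a c} → emb i a < emb j c → i < j ⊎ ∃ λ (e : i ≡ j) → subst (Pos ∘ b) e a < c
    pos-cases {i} {j} {a} {c} l with <-cmp i j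
    ... | tri< i<j _ _    = inj₁ i<j
    ... | tri≈ _ refl _   = inj₂ (refl , monotone⇒reflects pos-in l)
    ... | tri> _ _ j<i    = contradiction (pos-out j<i) (ℕ.<-asym l)

    val-cases : ∀ {i j a c} → val p (emb i a) < val p (emb j c) →
                val s i < val s j ⊎ ∃ λ (e : i ≡ j) → val (b j) (subst (Pos ∘ b) e a) < val (b j) c
    val-cases {i} {j} {a} {c} l with <-cmp (val s i) (val s j)
    ... | tri< i<j _ _ = inj₁ i<j
    ... | tri> _ _ j<i = contradiction (val-out j<i) (ℕ.<-asym l)
    ... | tri≈ _ e _ with refl ← val-injective s e = inj₂ (refl , embedding-reflects (component i) l)

    block-emb : ∀ i a → block (emb i a) ≡ i
    block-emb i a with <-cmp (block (emb i a)) i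
    ... | tri< l _ _ = contradiction (emb-coord (emb i a)) (<⇒≢ (pos-out l))
    ... | tri≈ _ e _ = e
    ... | tri> _ _ l = contradiction (sym (emb-coord (emb i a))) (<⇒≢ (pos-out l))

    emb-injective : ∀ {i j a c} → emb i a ≡ emb j c → ∃ λ (e : i ≡ j) → subst (Pos ∘ b) e a ≡ c
    emb-injective {i} {j} {a} {c} e
      with refl ← trans (sym (block-emb i a)) (trans (cong block e) (block-emb j c)) =
      refl , monotone⇒injective pos-in e

  open Inflation

  inflation-embedding : ∀ {s b c p q} → Inflation s b p → Inflation s c q →
                        (∀ i → Embedding (b i) (c i)) → Embedding p q
  inflation-embedding {s} {b} {c} {p} {q} I J f = record { map = g ; pos = g-pos ; values = g-val }
    where
    module F i = Embedding (f i)
    g : Pos p → Pos q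
    g x = J .emb (block I x) (F.map _ (coord I x))
    g-pos : StrictlyMonotone g
    g-pos {x} {y} l with pos-cases I (subst₂ _<_ (sym (emb-coord I x)) (sym (emb-coord I y)) l)
    ... | inj₁ l' = J .pos-out l'
    ... | inj₂ (e , l') = same-block e (coord I x) (coord I y) l'
      where
      same-block : ∀ {i j} (e : i ≡ j) a c → subst (Pos ∘ b) e a < c →
                   J .emb i (F.map i a) < J .emb j (F.map j c)
      same-block refl a c l = J .pos-in (F.pos _ l)
    g-val : ∀ {x y} → val p x < val p y → val q (g x) < val q (g y)
    g-val {x} {y} l with val-cases I (subst₂ (λ x y → val p x < val p y) (sym (emb-coord I x)) (sym (emb-coord I y)) l)
    ... | inj₁ l' = J .val-out l'
    ... | inj₂ (e , l') = same-block e (coord I x) (coord I y) l'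
      where
      same-block : ∀ {i j} (e : i ≡ j) a c → val (b j) (subst (Pos ∘ b) e a) < val (b j) c →
                   val q (J .emb i (F.map i a)) < val q (J .emb j (F.map j c))
      same-block refl a c l = J .val-in (F.values _ l)

  inflation-≅ : ∀ {s b b' p p'} → Inflation s b p → Inflation s b' p' → (∀ i → b i ≅ b' i) → p ≅ p'
  inflation-≅ {s} {b} {b'} {p} {p'} I J b≅b' = iso⇒≅ (record { embedding = F ; onto = f-onto })
    where
    module B i = Iso (≅⇒iso (b≅b' i))
    F = inflation-embedding I J (≅⇒embedding ∘ b≅b')
    f = Embedding.map F
    f-emb : ∀ i a → f (I .emb i a) ≡ J .emb i (B.map i a)
    f-emb i a with emb-injective I (emb-coord I (I .emb i a))
    ... | e , e' = go e e'
      where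
      go : ∀ {j c} (e : j ≡ i) → subst (Pos ∘ b) e c ≡ a → J .emb j (B.map j c) ≡ J .emb i (B.map i a)
      go refl refl = refl
    f-onto : Onto f
    f-onto y with J .onto y
    ... | i , c , refl with B.onto i c
    ... | a , refl = I .emb i a , f-emb i a

  inflation-resp : ∀ {s b p p'} → p ≅ p' → Inflation s b p → Inflation s b p'
  inflation-resp (same e) I = record
    { emb = I .emb ; onto = I .onto ; pos-in = I .pos-in ; pos-out = I .pos-out
    ; val-in = λ l → subst₂ _<_ (e _) (e _) (I .val-in l)
    ; val-out = λ l → subst₂ _<_ (e _) (e _) (I .val-out l) }

  inflation-blocks : ∀ {s b b' p} → (∀ i → b i ≅ b' i) → Inflation s b p → Inflation s b' p
  inflation-blocks {s} {b} {b'} {p} b≅b' I = record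
    { emb = λ i a → I .emb i (B.map i a)
    ; onto = λ x → block I x , proj₁ (B.onto _ (coord I x)) ,
        trans (cong (I .emb _) (proj₂ (B.onto _ (coord I x)))) (emb-coord I x)
    ; pos-in = λ l → I .pos-in (B.pos _ l)
    ; pos-out = I .pos-out
    ; val-in = λ l → I .val-in (B.values _ l)
    ; val-out = I .val-out }
    where module B i = Iso (≅⇒iso (≅-sym (b≅b' i)))

  inflation-skeleton : ∀ {s s' b p} (s≅s' : s ≅ s') → Inflation s b p →
                       Inflation s' (b ∘ Iso.map (≅⇒iso (≅-sym s≅s'))) p
  inflation-skeleton {n , σ} {_ , σ'} (same e) I = record
    { emb = I .emb ; onto = I .onto ; pos-in = I .pos-in ; pos-out = I .pos-out
    ; val-in = I .val-in
    ; val-out = λ {i} {j} l → I .val-out (subst₂ _<_ (sym (e i)) (sym (e j)) l) }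

  inflation-inverse : ∀ {s b p} → Inflation s b p →
                      Inflation (inverse s) (λ j → inverse (b (val⁻¹ s j))) (inverse p)
  inflation-inverse {s@(_ , σ)} {b} {p@(_ , π)} I = record
    { emb = λ j a → val p (I .emb (val⁻¹ s j) (val⁻¹ (b (val⁻¹ s j)) a))
    ; onto = λ x → val s (block I (val⁻¹ p x)) , surj (inverseˡ σ) x (coord I (val⁻¹ p x)) (emb-coord I (val⁻¹ p x))
    ; pos-in = λ {j} l → I .val-in (subst₂ _<_ (sym (inverseʳ (proj₂ (b (val⁻¹ s j))))) (sym (inverseʳ (proj₂ (b (val⁻¹ s j))))) l)
    ; pos-out = λ l → I .val-out (subst₂ _<_ (sym (inverseʳ σ)) (sym (inverseʳ σ)) l)
    ; val-in = λ l → subst₂ _<_ (sym (inverseˡ π)) (sym (inverseˡ π)) (I .pos-in l)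
    ; val-out = λ l → subst₂ _<_ (sym (inverseˡ π)) (sym (inverseˡ π)) (I .pos-out l) }
    where
    surj : ∀ {i k} → k ≡ i → ∀ x (a : Pos (b i)) → I .emb i a ≡ val⁻¹ p x →
           ∃ λ c → val p (I .emb k (val⁻¹ (b k) c)) ≡ x
    surj {i} refl x a e = val (b i) a ,
      trans (cong (val p) (trans (cong (I .emb i) (inverseˡ (proj₂ (b i)))) e)) (inverseʳ π)

  module _ (s : Perm) (b : Pos s → Perm) where
    private
      bound : ∀ {m} (f : Fin m → ℕ) → ∃ λ M → ∀ i → f i ℕ.≤ M
      bound {zero}  f = 0 , λ ()
      bound {suc m} f with bound (f ∘ suc)
      ... | M , p = f zero ℕ.⊔ M , λ { zero → ℕ.m≤m⊔n _ _ ; (suc i) → ℕ.≤-trans (p i) (ℕ.m≤n⊔m (f zero) M) }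

      M = proj₁ (bound (size ∘ b))

      into : ∀ i → Pos (b i) → Fin M
      into i a = inject≤ a (proj₂ (bound (size ∘ b)) i)

      key : ∀ i → Pos (b i) → Fin (size s ℕ.* M)
      key i a = combine i (into i a)

      combine-monoʳ-< : ∀ {m n} (i : Fin m) {k l : Fin n} → k < l → combine i k < combine i l
      combine-monoʳ-< {n = n} i {k} {l} k<l = subst₂ ℕ._<_ (sym (toℕ-combine i k)) (sym (toℕ-combine i l))
        (ℕ.+-monoʳ-< (n ℕ.* toℕ i) k<l)

      into-mono : ∀ i {a c} → a < c → into i a < into i c
      into-mono i {a} {c} = subst₂ ℕ._<_ (sym (toℕ-inject≤ a _)) (sym (toℕ-inject≤ c _))

      E = enumerate (λ y → ∃₂ λ i a → key i a ≡ y)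
      open Enumeration E using (at; monotone; sound; complete) renaming (size to n)

      block' : Fin n → Pos s
      block' x = proj₁ (sound x)

      coord' : ∀ x → Pos (b (block' x))
      coord' x = proj₁ (proj₂ (sound x))

      key-injective : ∀ {i j a c} → key i a ≡ key j c → ∃ λ (e : i ≡ j) → subst (Pos ∘ b) e a ≡ c
      key-injective {i} {j} {a} {c} e with combine-injective i (into i a) j (into j c) e
      ... | refl , e' = refl , inject≤-injective _ _ a c e'

      valueKey : Fin n → Fin (size s ℕ.* M)
      valueKey x = combine (val s (block' x)) (into _ (val (b (block' x)) (coord' x)))

      valueKey-injective : Injective _≡_ _≡_ valueKey
      valueKey-injective {x} {y} e = monotone⇒injective monotone
        (trans (sym (proj₂ (proj₂ (sound x)))) (trans keys (proj₂ (proj₂ (sound y)))))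
        where
        go : ∀ {i j} a c → combine (val s i) (into i (val (b i) a)) ≡ combine (val s j) (into j (val (b j) c)) →
             key i a ≡ key j c
        go {i} {j} a c e with combine-injective (val s i) _ (val s j) _ e
        ... | e₁ , e₂ with refl ← val-injective s e₁ =
          cong (key i) (val-injective (b i) (inject≤-injective _ _ _ _ e₂))
        keys = go (coord' x) (coord' y) e

      τ = standardise valueKey valueKey-injective

      place : ∀ i → Pos (b i) → Fin n
      place i a = proj₁ (complete (key i a) (i , a , refl))

      at-place : ∀ i a → at (place i a) ≡ key i a
      at-place i a = proj₂ (complete (key i a) (i , a , refl))

      valueKey-place : ∀ i a → valueKey (place i a) ≡ combine (val s i) (into i (val (b i) a))
      valueKey-place i a with sound (place i a)
      ... | j , c , e with key-injective {j} {i} {c} {a} (trans e (at-place i a))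
      ... | refl , refl = refl

      place-pos : ∀ {i j a c} → key i a < key j c → place i a < place j c
      place-pos l = monotone⇒reflects monotone (subst₂ _<_ (sym (at-place _ _)) (sym (at-place _ _)) l)

      place-val : ∀ {i j a c} → combine (val s i) (into i (val (b i) a)) < combine (val s j) (into j (val (b j) c)) →
                  proj₁ τ ⟨$⟩ʳ place i a < proj₁ τ ⟨$⟩ʳ place j c
      place-val l = proj₂ τ _ _ (subst₂ _<_ (sym (valueKey-place _ _)) (sym (valueKey-place _ _)) l)

    -- Pairs (i, a) are coded lexicographically in `size s` times M, where M bounds all block sizes,
    -- and the codes in use are squeezed together by `enumerate`. The values come from the codes of
    -- (value of i, value of a), which are standardised.
    inflate : ∃ (Inflation s b)
    inflate = (n , proj₁ τ) , record
      { emb = place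
      ; onto = λ x → block' x , coord' x , monotone⇒injective monotone
                       (trans (at-place _ _) (proj₂ (proj₂ (sound x))))
      ; pos-in = λ {i} l → place-pos (combine-monoʳ-< i (into-mono i l))
      ; pos-out = λ l → place-pos (combine-monoˡ-< _ _ l)
      ; val-in = λ {i} l → place-val (combine-monoʳ-< (val s i) (into-mono i l))
      ; val-out = λ l → place-val (combine-monoˡ-< _ _ l) }

-- Quotients by intervals and simple quotients

module Quotients (em : ExcludedMiddle 0ℓ) where
  open import Data.Bool.Base using (Bool; true; false)
  open import Data.Fin.Base using (Fin; zero; suc; toℕ; _<_; fromℕ<)
  open import Data.Fin.Permutation using (_⟨$⟩ʳ_; inverseˡ; inverseʳ)
  open import Data.Fin.Properties using (<-cmp; injective⇒≤; toℕ-fromℕ<)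
  open import Data.Nat.Base as ℕ using (ℕ; zero; suc; s≤s; z≤n)
  open import Data.Nat.Properties as ℕ using ()
  open import Data.Nat.Induction using (<-rec)
  open import Function.Base using (case_of_)
  open import Function.Bundles using (Equivalence)
  open import Function.Definitions using (Injective)
  open Inflations em public

  -- p is an inflation of s by nonempty permutations: map sends each
  -- position of p to the block containing it.
  record Quotient (p s : Perm) : Set where
    field
      map  : Pos p → Pos s
      onto : Onto map
      pos  : ∀ {x y} → map x < map y → x < y
      values : ∀ {x y} → val s (map x) < val s (map y) → val p x < val p y

    pos≤ : ∀ {x y} → x < y → map x < map y ⊎ map x ≡ map y
    pos≤ {x} {y} l with <-cmp (map x) (map y)
    ... | tri< l' _ _ = inj₁ l'
    ... | tri≈ _ e _  = inj₂ e
    ... | tri> _ _ l' = contradiction (pos l') (ℕ.<-asym l)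

    values≤ : ∀ {x y} → val p x < val p y → val s (map x) < val s (map y) ⊎ map x ≡ map y
    values≤ {x} {y} l with <-cmp (val s (map x)) (val s (map y))
    ... | tri< l' _ _ = inj₁ l'
    ... | tri≈ _ e _  = inj₂ (val-injective s e)
    ... | tri> _ _ l' = contradiction (values l') (ℕ.<-asym l)

  quotient-refl : ∀ p → Quotient p p
  quotient-refl p = record { map = id ; onto = λ y → y , refl ; pos = id ; values = id }

  quotient-∘ : ∀ {p s t} → Quotient s t → Quotient p s → Quotient p t
  quotient-∘ G F = record
    { map = G.map ∘ F.map
    ; onto = λ y → proj₁ (F.onto (proj₁ (G.onto y))) ,
        trans (cong G.map (proj₂ (F.onto (proj₁ (G.onto y))))) (proj₂ (G.onto y))
    ; pos = F.pos ∘ G.pos ; values = F.values ∘ G.values }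
    where module F = Quotient F
          module G = Quotient G

  -- Any choice of one element from each block is a copy of the skeleton.
  quotient-embedding : ∀ {p s} → Quotient p s → Embedding s p
  quotient-embedding {p} {s} F = record
    { map = proj₁ ∘ onto
    ; pos = λ l → pos (subst₂ _<_ (sym (proj₂ (onto _))) (sym (proj₂ (onto _))) l)
    ; values = λ l → values (subst₂ (λ i j → val s i < val s j) (sym (proj₂ (onto _))) (sym (proj₂ (onto _))) l) }
    where open Quotient F

  quotient-inverse : ∀ {p s} → Quotient p s → Quotient (inverse p) (inverse s)
  quotient-inverse {p@(_ , π)} {s@(_ , σ)} F = record
    { map = λ x → val s (map (val⁻¹ p x))
    ; onto = λ y → val p (proj₁ (onto (val⁻¹ s y))) ,
        trans (cong (val s ∘ map) (inverseˡ π)) (trans (cong (val s) (proj₂ (onto (val⁻¹ s y)))) (inverseʳ σ))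
    ; pos = λ l → subst₂ _<_ (inverseʳ π) (inverseʳ π) (values l)
    ; values = λ l → pos (subst₂ _<_ (inverseˡ σ) (inverseˡ σ) l) }
    where open Quotient F

  iso⇒quotient : ∀ {p q} → Iso p q → Quotient p q
  iso⇒quotient f = record
    { map = map ; onto = onto ; pos = monotone⇒reflects pos ; values = embedding-reflects embedding }
    where open Iso f

  quotient-resp : ∀ {p p' s s'} → p ≅ p' → s ≅ s' → Quotient p s → Quotient p' s'
  quotient-resp p≅p' s≅s' F =
    quotient-∘ (iso⇒quotient (≅⇒iso s≅s')) (quotient-∘ F (iso⇒quotient (≅⇒iso (≅-sym p≅p'))))

  Nonempty : Perm → Set
  Nonempty p = 1 ℕ.≤ size p

  inhabited⇒nonempty : ∀ {p} → Pos p → Nonempty p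
  inhabited⇒nonempty {suc _ , _} _ = s≤s z≤n

  first : ∀ p → Nonempty p → Pos p
  first (suc _ , _) _ = zero

  inflation⇒quotient : ∀ {s b p} (I : Inflation s b p) → (∀ i → Nonempty (b i)) →
                       ∃ λ (F : Quotient p s) → ∀ x → Quotient.map F x ≡ Inflation.block I x
  inflation⇒quotient {s} {b} {p} I ne = record
    { map = block
    ; onto = λ i → emb i (first (b i) (ne i)) , block-emb i _
    ; pos = λ {x} {y} l → subst₂ _<_ (emb-coord x) (emb-coord y) (pos-out l)
    ; values = λ {x} {y} l → subst₂ (λ x y → val p x < val p y) (emb-coord x) (emb-coord y) (val-out l) } ,
    λ _ → refl
    where open Inflation I

  subpattern : ∀ {n} (p : Perm) (e : Fin n → Pos p) → StrictlyMonotone e →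
               ∃ λ τ → ∀ {i j} → val (n , τ) i < val (n , τ) j → val p (e i) < val p (e j)
  subpattern {n} p e mono = proj₁ st , reflect
    where
    st = standardise (val p ∘ e) (monotone⇒injective mono ∘ val-injective p)
    reflect : ∀ {i j} → proj₁ st ⟨$⟩ʳ i < proj₁ st ⟨$⟩ʳ j → val p (e i) < val p (e j)
    reflect {i} {j} l with <-cmp (val p (e i)) (val p (e j))
    ... | tri< l' _ _ = l'
    ... | tri≈ _ q _  = contradiction (cong (val (n , proj₁ st)) (monotone⇒injective mono (val-injective p q))) (<⇒≢ l)
    ... | tri> _ _ l' = contradiction (proj₂ st _ _ l') (ℕ.<-asym l)

  quotient⇒inflation : ∀ {p s} (F : Quotient p s) → ∃ λ b → ∃ λ (I : Inflation s b p) →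
                       (∀ i → Nonempty (b i)) × (∀ i a → Quotient.map F (Inflation.emb I i a) ≡ i)
  quotient⇒inflation {p} {s} F = b , I , ne , λ i → E.sound i
    where
    open Quotient F
    module E i = Enumeration (enumerate (λ x → map x ≡ i))
    P : ∀ i → ∃ λ τ → ∀ {a c} → val (E.size i , τ) a < val (E.size i , τ) c → val p (E.at i a) < val p (E.at i c)
    P i = subpattern p (E.at i) (E.monotone i)
    b : Pos s → Perm
    b i = E.size i , proj₁ (P i)
    ne : ∀ i → Nonempty (b i)
    ne i = inhabited⇒nonempty {b i} (proj₁ (E.complete i (proj₁ (onto i)) (proj₂ (onto i))))
    I : Inflation s b p
    I = record
      { emb = E.at
      ; onto = λ x → map x , proj₁ (E.complete (map x) x refl) , proj₂ (E.complete (map x) x refl)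
      ; pos-in = λ {i} → E.monotone i
      ; pos-out = λ {i} {j} l → pos (subst₂ _<_ (sym (E.sound i _)) (sym (E.sound j _)) l)
      ; val-in = λ {i} → proj₂ (P i)
      ; val-out = λ {i} {j} l → values (subst₂ (λ i j → val s i < val s j) (sym (E.sound i _)) (sym (E.sound j _)) l) }

  -- Intervals without endpoints: closure under betweenness, both in position and in value.
  record Convex (s : Perm) (P : Pos s → Set) : Set where
    field
      pos    : ∀ {i j k} → P i → P k → i < j → j < k → P j
      values : ∀ {i j k} → P i → P k → val s i < val s j → val s j < val s k → P j

  -- Intervals are given by Boolean predicates, so that simplicity is
  -- small and can be decided.
  NontrivialInterval : Perm → Set
  NontrivialInterval s = ∃ λ (P : Pos s → Bool) → Convex s (λ i → P i ≡ true) ×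
    ∃₂ λ i j → i ≢ j × P i ≡ true × P j ≡ true × ∃ λ k → P k ≢ true

  Indecomposable : Perm → Set
  Indecomposable s = ¬ NontrivialInterval s

  private
    decide : ∀ {n} → (Fin n → Set) → Fin n → Bool
    decide P i = Dec.does (em {P i})

    decide-sound : ∀ {n} (P : Fin n → Set) i → decide P i ≡ true → P i
    decide-sound P i e with em {P i}
    ... | yes p = p

    decide-complete : ∀ {n} (P : Fin n → Set) i → P i → decide P i ≡ true
    decide-complete P i p with em {P i}
    ... | yes _ = refl
    ... | no ¬p = contradiction p ¬p

  indecomposable : ∀ {s} → Indecomposable s → (P : Pos s → Set) → Convex s P →
                   ∀ {i j} → i ≢ j → P i → P j → ∀ k → P k
  indecomposable ind P convex {i} {j} i≢j pi pj k = decidable-stable em λ ¬pk → ind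
    (decide P , record
      { pos = λ {a} {c} {d} pa pd l m → decide-complete P c (pos (decide-sound P a pa) (decide-sound P d pd) l m)
      ; values = λ {a} {c} {d} pa pd l m → decide-complete P c (values (decide-sound P a pa) (decide-sound P d pd) l m) } ,
     i , j , i≢j , decide-complete P i pi , decide-complete P j pj , k , ¬pk ∘ decide-sound P k)
    where open Convex convex

  -- An interval with at least two positions contains `a` and its successor, hence by
  -- indecomposability every position; so `a` is 0 and `c` is at least `n`.
  indecomposable⇒simple : ∀ {s} → Indecomposable s → Simple (proj₂ s)
  indecomposable⇒simple {n , σ} ind a c interval with c ℕ.∸ a in e
  ... | zero        = inj₁ refl
  ... | suc zero    = inj₂ (inj₁ refl)
  ... | suc (suc k) = inj₂ (inj₂ (ℕ.≤-antisym size≤ ≤size))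
    where
    open IsInterval interval
    a<c : suc (suc a) ℕ.≤ c
    a<c = subst (λ m → suc (suc a) ℕ.≤ m) (ℕ.m∸n+n≡m {c} {a} ordered)
            (subst (λ d → suc (suc a) ℕ.≤ d ℕ.+ a) (sym e) (s≤s (s≤s (ℕ.m≤n+m a k))))
    P : Fin n → Set
    P i = i ∈[ a , c ⟩
    convex : Convex (n , σ) P
    convex = record
      { pos = λ (a≤i , _) (_ , k<c) i<j j<k →
          ℕ.≤-trans a≤i (ℕ.<⇒≤ i<j) , ℕ.<-trans j<k k<c
      ; values = λ {i} {j} {k} pi pk l m →
          let (d , d' , f) = consecutive
              vi = Equivalence.to (f (σ ⟨$⟩ʳ i)) (i , pi , refl)
              vk = Equivalence.to (f (σ ⟨$⟩ʳ k)) (k , pk , refl)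
              (j' , pj' , e') = Equivalence.from (f (σ ⟨$⟩ʳ j))
                (ℕ.≤-trans (proj₁ vi) (ℕ.<⇒≤ l) , ℕ.<-trans m (proj₂ vk))
          in subst P (val-injective (n , σ) e') pj' }
    i₀ i₁ : Fin n
    i₀ = fromℕ< (ℕ.≤-trans (ℕ.≤-trans (ℕ.n≤1+n _) a<c) bounded)
    i₁ = fromℕ< (ℕ.≤-trans a<c bounded)
    all : ∀ i → P i
    all = indecomposable ind P convex {i₀} {i₁}
      (λ q → ℕ.<-irrefl (trans (sym (toℕ-fromℕ< _)) (trans (cong toℕ q) (toℕ-fromℕ< _))) (ℕ.n<1+n a))
      (subst (λ m → a ℕ.≤ m × m ℕ.< c) (sym (toℕ-fromℕ< _)) (ℕ.≤-refl , ℕ.≤-trans (ℕ.n≤1+n _) a<c))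
      (subst (λ m → a ℕ.≤ m × m ℕ.< c) (sym (toℕ-fromℕ< _)) (ℕ.n≤1+n a , a<c))
    size≤ : suc (suc k) ℕ.≤ n
    size≤ = subst (ℕ._≤ n) e (ℕ.≤-trans (ℕ.m∸n≤m c a) bounded)
    0<n : 0 ℕ.< n
    0<n = ℕ.≤-trans (s≤s z≤n) size≤
    a≡0 : a ≡ 0
    a≡0 = ℕ.n≤0⇒n≡0 (subst (a ℕ.≤_) (toℕ-fromℕ< 0<n) (proj₁ (all (fromℕ< 0<n))))
    bound : ∀ m → (∀ (i : Fin m) → toℕ i ℕ.< c) → m ℕ.≤ c
    bound zero    f = z≤n
    bound (suc m) f = subst (ℕ._< c) (toℕ-fromℕ< ℕ.≤-refl) (f (fromℕ< {m} ℕ.≤-refl))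
    n≤c : n ℕ.≤ c
    n≤c = bound n (proj₂ ∘ all)
    ≤size : n ℕ.≤ suc (suc k)
    ≤size = subst (n ℕ.≤_) e (subst (λ a → n ℕ.≤ c ℕ.∸ a) (sym a≡0) n≤c)

  -- The interval is collapsed onto its member `i₀`, and all other positions are kept. The size
  -- drops because `i₁` disappears, and remains at least two because `i₀` and the outside point `o`
  -- survive.
  contract : ∀ {s} → NontrivialInterval s → ∃ λ t → Quotient s t × size t ℕ.< size s × 2 ℕ.≤ size t
  contract {s} (P , convex , i₀ , i₁ , i₀≢i₁ , p₀ , p₁ , o , ¬po) =
    (E.size , τ) , quotient , smaller , two
    where
    open Convex convex
    rep : Pos s → Pos s
    rep i with P i
    ... | true  = i₀
    ... | false = i
    rep-in : ∀ {i} → P i ≡ true → rep i ≡ i₀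
    rep-in {i} e with P i
    rep-in refl | true = refl
    rep-out : ∀ {i} → P i ≢ true → rep i ≡ i
    rep-out {i} ne with P i
    ... | true  = contradiction refl ne
    ... | false = refl
    module E = Enumeration (enumerate (λ i → rep i ≡ i))
    τ = proj₁ (subpattern s E.at E.monotone)
    τ-values : ∀ {i j} → val (E.size , τ) i < val (E.size , τ) j → val s (E.at i) < val s (E.at j)
    τ-values = proj₂ (subpattern s E.at E.monotone)
    rep-rep : ∀ i → rep (rep i) ≡ rep i
    rep-rep i with P i in e
    ... | true  = rep-in p₀
    ... | false = rep-out (λ e' → case trans (sym e) e' of λ ())
    index : Pos s → Fin E.size
    index i = proj₁ (E.complete (rep i) (rep-rep i))
    at-index : ∀ i → E.at (index i) ≡ rep i
    at-index i = proj₂ (E.complete (rep i) (rep-rep i))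
    rep-pos : ∀ {i j} → rep i < rep j → i < j
    rep-pos {i} {j} l with em {P i ≡ true} | em {P j ≡ true}
    ... | yes pi | yes pj = contradiction (trans (rep-in pi) (sym (rep-in pj))) (<⇒≢ l)
    ... | no ¬pi | no ¬pj = subst₂ _<_ (rep-out ¬pi) (rep-out ¬pj) l
    ... | yes pi | no ¬pj with <-cmp i j
    ...   | tri< l' _ _ = l'
    ...   | tri≈ _ refl _ = contradiction pi ¬pj
    ...   | tri> _ _ j<i = contradiction (pos p₀ pi (subst₂ _<_ (rep-in pi) (rep-out ¬pj) l) j<i) ¬pj
    rep-pos {i} {j} l | no ¬pi | yes pj with <-cmp i j
    ...   | tri< l' _ _ = l'
    ...   | tri≈ _ refl _ = contradiction pj ¬pi
    ...   | tri> _ _ j<i = contradiction (pos pj p₀ j<i (subst₂ _<_ (rep-out ¬pi) (rep-in pj) l)) ¬pi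
    rep-val : ∀ {i j} → val s (rep i) < val s (rep j) → val s i < val s j
    rep-val {i} {j} l with em {P i ≡ true} | em {P j ≡ true}
    ... | yes pi | yes pj = contradiction (cong (val s) (trans (rep-in pi) (sym (rep-in pj)))) (<⇒≢ l)
    ... | no ¬pi | no ¬pj = subst₂ (λ i j → val s i < val s j) (rep-out ¬pi) (rep-out ¬pj) l
    ... | yes pi | no ¬pj with <-cmp (val s i) (val s j)
    ...   | tri< l' _ _ = l'
    ...   | tri≈ _ e _ = contradiction (subst (λ k → P k ≡ true) (val-injective s e) pi) ¬pj
    ...   | tri> _ _ j<i = contradiction (values p₀ pi (subst₂ (λ i j → val s i < val s j) (rep-in pi) (rep-out ¬pj) l) j<i) ¬pj
    rep-val {i} {j} l | no ¬pi | yes pj with <-cmp (val s i) (val s j)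
    ...   | tri< l' _ _ = l'
    ...   | tri≈ _ e _ = contradiction (subst (λ k → P k ≡ true) (sym (val-injective s e)) pj) ¬pi
    ...   | tri> _ _ j<i = contradiction (values pj p₀ j<i (subst₂ (λ i j → val s i < val s j) (rep-out ¬pi) (rep-in pj) l)) ¬pi
    quotient : Quotient s (E.size , τ)
    quotient = record
      { map = index
      ; onto = λ y → E.at y , monotone⇒injective E.monotone (trans (at-index (E.at y)) (E.sound y))
      ; pos = λ l → rep-pos (subst₂ _<_ (at-index _) (at-index _) (E.monotone l))
      ; values = λ l → rep-val (subst₂ (λ i j → val s i < val s j) (at-index _) (at-index _) (τ-values l)) }
    not-onto : ¬ (∃ λ y → E.at y ≡ i₁)
    not-onto (y , e) = i₀≢i₁ (trans (sym (rep-in p₁)) (trans (cong rep (sym e)) (trans (E.sound y) e)))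
    smaller : E.size ℕ.< size s
    smaller = injective⇒≤ {f = f} f-injective
      where
      f : Fin (suc E.size) → Pos s
      f zero    = i₁
      f (suc y) = E.at y
      f-injective : Injective _≡_ _≡_ f
      f-injective {zero}  {zero}  e = refl
      f-injective {zero}  {suc y} e = contradiction (y , sym e) not-onto
      f-injective {suc x} {zero}  e = contradiction (x , e) not-onto
      f-injective {suc x} {suc y} e = cong suc (monotone⇒injective E.monotone e)
    two : 2 ℕ.≤ E.size
    two = injective⇒≤ {f = f} f-injective
      where
      o≢i₀ : index o ≢ index i₀
      o≢i₀ e = ¬po (subst (λ k → P k ≡ true) (sym (trans (sym (rep-out ¬po))
        (trans (sym (at-index o)) (trans (cong E.at e) (trans (at-index i₀) (rep-in p₀)))))) p₀)
      f : Fin 2 → Fin E.size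
      f zero    = index o
      f (suc _) = index i₀
      f-injective : Injective _≡_ _≡_ f
      f-injective {zero}     {zero}     e = refl
      f-injective {zero}     {suc _}    e = contradiction e o≢i₀
      f-injective {suc _}    {zero}     e = contradiction (sym e) o≢i₀
      f-injective {suc zero} {suc zero} e = refl

  indecomposable-quotient : ∀ p → 2 ℕ.≤ size p →
                            ∃ λ s → Indecomposable s × 2 ℕ.≤ size s × Quotient p s
  indecomposable-quotient p two = <-rec Goal step (size p) p refl (quotient-refl p) two
    where
    Goal : ℕ → Set
    Goal m = ∀ s → size s ≡ m → Quotient p s → 2 ℕ.≤ size s →
             ∃ λ s → Indecomposable s × 2 ℕ.≤ size s × Quotient p s
    step : ∀ m → (∀ {k} → k ℕ.< m → Goal k) → Goal m
    step _ rec s refl F two with em {NontrivialInterval s}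
    ... | no ind = s , ind , two , F
    ... | yes interval with contract interval
    ... | t , G , smaller , two' = rec smaller t refl (quotient-∘ G F) two'

-- Uniqueness of the skeleton and of the blocks

module Decomposition (em : ExcludedMiddle 0ℓ) where
  open import Data.Fin.Base using (Fin; zero; suc; toℕ; _<_; punchIn)
  open import Data.Fin.Properties using (toℕ-injective; <-cmp; punchInᵢ≢i; punchIn-injective)
  open import Data.Nat.Base as ℕ using (ℕ; zero; suc; s≤s; z≤n)
  open import Data.Nat.Properties as ℕ using ()
  open Quotients em public

  module _ {p t} (G : Quotient p t) where
    open Quotient G

    fibre-pos : ∀ {x y z} → map x ≡ map z → x < y → y < z → map y ≡ map z
    fibre-pos e x<y y<z with pos≤ x<y | pos≤ y<z
    ... | _       | inj₂ e' = e'
    ... | inj₂ e' | inj₁ _  = trans (sym e') e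
    ... | inj₁ l  | inj₁ l' = contradiction (subst (_< map _) e l) (ℕ.<-asym l')

    fibre-val : ∀ {x y z} → map x ≡ map z → val p x < val p y → val p y < val p z → map y ≡ map z
    fibre-val e x<y y<z with values≤ x<y | values≤ y<z
    ... | _       | inj₂ e' = e'
    ... | inj₂ e' | inj₁ _  = trans (sym e') e
    ... | inj₁ l  | inj₁ l' = contradiction (subst (λ i → val t i < val t (map _)) e l) (ℕ.<-asym l')

  module _ {p s t} (F : Quotient p s) (G : Quotient p t) where
    private
      module F = Quotient F
      module G = Quotient G

    Image : Pos t → Pos s → Set
    Image u i = ∃ λ x → F.map x ≡ i × G.map x ≡ u

    -- A block of `F` between two blocks that meet a fibre of `G` consists of elements between two
    -- members of that fibre, and fibres of quotients are intervals.
    image-convex : ∀ u → Convex s (Image u)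
    image-convex u = record
      { pos = λ { {_} {j} (x , refl , gx) (z , refl , gz) l m →
          let (y , e) = F.onto j in y , e , trans (fibre-pos G (trans gx (sym gz))
            (F.pos (subst (F.map x <_) (sym e) l)) (F.pos (subst (_< F.map z) (sym e) m))) gz }
      ; values = λ { {_} {j} (x , refl , gx) (z , refl , gz) l m →
          let (y , e) = F.onto j in y , e , trans (fibre-val G (trans gx (sym gz))
            (F.values (subst (λ j → val s (F.map x) < val s j) (sym e) l))
            (F.values (subst (λ j → val s j < val s (F.map z)) (sym e) m))) gz } }

    module _ (s-ind : Indecomposable s) where

      -- A fibre of G meeting all blocks of F leaves out only elements of
      -- blocks that are extreme both in position and in value.
      full-image : 2 ℕ.≤ size t → ∀ u → (∀ i → Image u i) → ¬ 3 ℕ.≤ size s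
      full-image two u full three = indecomposable s-ind (_≢ i) convex (proj₁ (proj₂ (proj₂ others)))
        (proj₁ (proj₂ (proj₂ (proj₂ others)))) (proj₂ (proj₂ (proj₂ (proj₂ others)))) i refl
        where
        another : ∀ {n} → 2 ℕ.≤ n → (u : Fin n) → ∃ λ u' → u' ≢ u
        another (s≤s (s≤s _)) u = punchIn u zero , punchInᵢ≢i u zero ∘ id
        u' = another two u
        x = proj₁ (G.onto (proj₁ u'))
        gx≢u : G.map x ≢ u
        gx≢u e = proj₂ u' (trans (sym (proj₂ (G.onto (proj₁ u')))) e)
        i = F.map x
        two-others : ∀ {n} → 3 ℕ.≤ n → (i : Fin n) → ∃₂ λ j k → j ≢ k × j ≢ i × k ≢ i
        two-others (s≤s (s≤s (s≤s _))) i = punchIn i zero , punchIn i (suc zero) ,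
          (λ e → contradiction (punchIn-injective i zero (suc zero) e) λ ()) ,
          punchInᵢ≢i i zero , punchInᵢ≢i i (suc zero)
        others = two-others three i
        convex : Convex s (_≢ i)
        convex = record
          { pos = λ { {j} {k} {l} _ _ j<k k<l refl →
              let (y , fy , gy) = full j ; (z , fz , gz) = full l in
              gx≢u (trans (fibre-pos G (trans gy (sym gz)) (F.pos (subst (_< i) (sym fy) j<k))
                                       (F.pos (subst (i <_) (sym fz) k<l))) gz) }
          ; values = λ { {j} {k} {l} _ _ j<k k<l refl →
              let (y , fy , gy) = full j ; (z , fz , gz) = full l in
              gx≢u (trans (fibre-val G (trans gy (sym gz))
                (F.values (subst (λ j → val s j < val s i) (sym fy) j<k))
                (F.values (subst (λ j → val s i < val s j) (sym fz) k<l))) gz) } }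

      -- Otherwise a fibre of `G` meets two blocks of `F`; its image is an interval of the simple
      -- `s`, hence all of `s`, which `full-image` excludes.
      refines : 3 ℕ.≤ size s → 2 ℕ.≤ size t → ∀ {x y} → G.map x ≡ G.map y → F.map x ≡ F.map y
      refines three two {x} {y} e = decidable-stable em λ ne →
        full-image two (G.map y)
          (indecomposable s-ind (Image (G.map y)) (image-convex (G.map y)) ne (x , refl , e) (y , refl , refl))
          three

  -- If one block of `F` met two blocks of `G`, it would meet all of them, `t` being simple. Since
  -- every block of `G` lies inside a block of `F`, there would be a single block of `F`.
  coarsens : ∀ {p s t} (F : Quotient p s) (G : Quotient p t) → Indecomposable s → Indecomposable t →
             3 ℕ.≤ size s → 2 ℕ.≤ size t →
             ∀ {x y} → Quotient.map F x ≡ Quotient.map F y → Quotient.map G x ≡ Quotient.map G y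
  coarsens {p} {s} {t} F G s-ind t-ind three two {x} {y} e = decidable-stable em λ ne →
    let full = indecomposable t-ind (Image G F (F.map y)) (image-convex G F (F.map y)) ne
                 (x , refl , e) (y , refl , refl)
        constant : ∀ z → F.map z ≡ F.map y
        constant z = let (w , gw , fw) = full (G.map z)
                     in trans (refines F G s-ind three two (sym gw)) fw
    in not-constant three (F.map y) λ i → trans (sym (proj₂ (F.onto i))) (constant (proj₁ (F.onto i)))
    where
    module F = Quotient F
    module G = Quotient G
    not-constant : ∀ {n} → 3 ℕ.≤ n → (i : Fin n) → ¬ (∀ j → j ≡ i)
    not-constant (s≤s (s≤s _)) i f with () ← trans (f zero) (sym (f (suc zero)))

  unique-large : ∀ {p s t} (F : Quotient p s) (G : Quotient p t) → Indecomposable s → Indecomposable t →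
                 3 ℕ.≤ size s → 2 ℕ.≤ size t →
                 s ≅ t × ∀ x → toℕ (Quotient.map F x) ≡ toℕ (Quotient.map G x)
  unique-large {p} {s} {t} F G s-ind t-ind three two = iso⇒≅ iso , λ x →
    trans (sym (rigid (Iso.pos iso) (Iso.onto iso) (F.map x))) (cong toℕ (h-map x))
    where
    module F = Quotient F
    module G = Quotient G
    h : Pos s → Pos t
    h i = G.map (proj₁ (F.onto i))
    h-map : ∀ x → h (F.map x) ≡ G.map x
    h-map x = coarsens F G s-ind t-ind three two (proj₂ (F.onto (F.map x)))
    distinct : ∀ {x y} → F.map x ≢ F.map y → G.map x ≢ G.map y
    distinct ne e = ne (refines F G s-ind three two e)
    ordered : ∀ {x y} → F.map x < F.map y → G.map x < G.map y
    ordered l with G.pos≤ (F.pos l)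
    ... | inj₁ l' = l'
    ... | inj₂ e  = contradiction e (distinct (<⇒≢ l))
    valued : ∀ {x y} → val s (F.map x) < val s (F.map y) → val t (G.map x) < val t (G.map y)
    valued l with G.values≤ (F.values l)
    ... | inj₁ l' = l'
    ... | inj₂ e  = contradiction e (distinct (λ e' → <⇒≢ l (cong (val s) e')))
    back : ∀ i → F.map (proj₁ (F.onto i)) ≡ i
    back i = proj₂ (F.onto i)
    iso : Iso s t
    iso = record
      { embedding = record
        { map = h
        ; pos = λ l → ordered (subst₂ _<_ (sym (back _)) (sym (back _)) l)
        ; values = λ l → valued (subst₂ (λ i j → val s i < val s j) (sym (back _)) (sym (back _)) l) }
      ; onto = λ u → F.map (proj₁ (G.onto u)) , trans (h-map _) (proj₂ (G.onto u)) }

  -- Of two elements taken from the two first blocks, the left one lies in both of them; dually for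
  -- the second blocks. The order of the values of such common elements determines either skeleton.
  unique-skeleton₂ : ∀ {p σ τ} → Quotient p (2 , σ) → Quotient p (2 , τ) → (2 , σ) ≅ (2 , τ)
  unique-skeleton₂ {p} {σ} {τ} F G = iso⇒≅ (record
    { embedding = record { map = id ; pos = id ; values = λ {i} {j} → agree i j } ; onto = λ y → y , refl })
    where
    module F = Quotient F
    module G = Quotient G
    min : ∃ λ a → F.map a ≡ zero × G.map a ≡ zero
    min with F.onto zero | G.onto zero
    ... | x , fx | y , gy with <-cmp x y
    ... | tri≈ _ refl _ = x , fx , gy
    ... | tri< x<y _ _ = x , fx , below (G.pos≤ x<y)
      where below : G.map x < G.map y ⊎ G.map x ≡ G.map y → G.map x ≡ zero
            below (inj₂ e) = trans e gy
            below (inj₁ l) with () ← subst (G.map x <_) gy l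
    ... | tri> _ _ y<x = y , below (F.pos≤ y<x) , gy
      where below : F.map y < F.map x ⊎ F.map y ≡ F.map x → F.map y ≡ zero
            below (inj₂ e) = trans e fx
            below (inj₁ l) with () ← subst (F.map y <_) fx l
    top : ∀ {i j : Fin 2} → i ≡ suc zero → i < j ⊎ i ≡ j → j ≡ suc zero
    top e (inj₂ refl) = e
    top {j = suc zero} refl (inj₁ l) = refl
    max : ∃ λ a → F.map a ≡ suc zero × G.map a ≡ suc zero
    max with F.onto (suc zero) | G.onto (suc zero)
    ... | x , fx | y , gy with <-cmp x y
    ... | tri≈ _ refl _ = x , fx , gy
    ... | tri< x<y _ _ = y , top fx (F.pos≤ x<y) , gy
    ... | tri> _ _ y<x = x , fx , top gy (G.pos≤ y<x)
    common : ∀ i → ∃ λ a → F.map a ≡ i × G.map a ≡ i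
    common zero       = min
    common (suc zero) = max
    agree : ∀ i j → val (2 , σ) i < val (2 , σ) j → val (2 , τ) i < val (2 , τ) j
    agree i j l with common i | common j
    ... | a , refl , ga | c , refl , gc with G.values≤ (F.values l)
    ... | inj₁ l' = subst₂ (λ i j → val (2 , τ) i < val (2 , τ) j) ga gc l'
    ... | inj₂ e  = contradiction (cong (val (2 , σ)) (trans (sym ga) (trans e gc))) (<⇒≢ l)

  private
    two-or-more : ∀ {n} → 2 ℕ.≤ n → n ≡ 2 ⊎ 3 ℕ.≤ n
    two-or-more {suc (suc zero)}    _ = inj₁ refl
    two-or-more {suc (suc (suc _))} _ = inj₂ (s≤s (s≤s (s≤s z≤n)))
    two-or-more {suc zero} (s≤s ())

  unique-skeleton : ∀ {p s t} → Quotient p s → Quotient p t → Indecomposable s → Indecomposable t →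
                    2 ℕ.≤ size s → 2 ℕ.≤ size t → s ≅ t
  unique-skeleton {p} {s} {t} F G s-ind t-ind s≥2 t≥2 with two-or-more s≥2 | two-or-more t≥2
  ... | inj₂ s≥3  | _          = proj₁ (unique-large F G s-ind t-ind s≥3 t≥2)
  ... | _         | inj₂ t≥3   = ≅-sym (proj₁ (unique-large G F t-ind s-ind t≥3 s≥2))
  ... | inj₁ refl | inj₁ refl  = unique-skeleton₂ F G

  -- For a skeleton of size 2 the decomposition is made unique by
  -- requiring the first block to be as small as possible.
  Normal : (s : Perm) → (Pos s → Perm) → Set
  Normal s b = size s ≡ 2 → ∀ i → toℕ i ≡ 0 → ¬ Quotient (b i) s

  -- `G` cuts the first block of `I` into two nonempty parts: `x` belongs to the second, and
  -- whatever `G` puts into its first block precedes `x` and so lies in the first block of `I`.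
  first-block-quotient : ∀ {p σ b} (I : Inflation (2 , σ) b p) (ne : ∀ i → Nonempty (b i)) (G : Quotient p (2 , σ)) →
                         ∀ x → Inflation.block I x ≡ zero → Quotient.map G x ≡ suc zero →
                         Quotient (b zero) (2 , σ)
  first-block-quotient {p} {σ} {b} I ne G x bx gx = record
    { map = λ a → G.map (I.emb zero a) ; onto = onto
    ; pos = λ l → monotone⇒reflects I.pos-in (G.pos l)
    ; values = λ l → embedding-reflects (I.component zero) (G.values l) }
    where
    module I = Inflation I
    module G = Quotient G
    F = proj₁ (inflation⇒quotient I ne)
    in-first : ∀ {y} → I.block y ≡ zero → ∃ λ a → I.emb zero a ≡ y
    in-first {y} e = subst (λ i → ∃ λ a → I.emb i a ≡ y) e (I.coord y , I.emb-coord y)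
    onto : ∀ i → ∃ λ a → G.map (I.emb zero a) ≡ i
    onto (suc zero) with in-first bx
    ... | a , refl = a , gx
    onto zero with G.onto zero
    ... | y , gy with Quotient.pos≤ F {y} {x} (G.pos (subst₂ _<_ (sym gy) (sym gx) (s≤s z≤n)))
    ... | inj₁ l with () ← subst (I.block y <_) bx l
    ... | inj₂ e with in-first (trans e bx)
    ... | a , refl = a , gy

  blocks-≅ : ∀ {n σ τ b c p} (I : Inflation (n , σ) b p) (J : Inflation (n , τ) c p) →
             (∀ x → Inflation.block I x ≡ Inflation.block J x) → ∀ i → b i ≅ c i
  blocks-≅ {b = b} {c} {p} I J agree i = iso⇒≅ (record
    { embedding = record { map = f
      ; pos = λ l → monotone⇒reflects J.pos-in (subst₂ _<_ (sym (f-emb _)) (sym (f-emb _)) (I.pos-in l))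
      ; values = λ l → embedding-reflects (J.component i)
          (subst₂ (λ x y → val p x < val p y) (sym (f-emb _)) (sym (f-emb _)) (I.val-in l)) }
    ; onto = onto })
    where
    module I = Inflation I
    module J = Inflation J
    within : ∀ {m} (d : Fin m → Perm) {e : ∀ i → Pos (d i) → Pos p} {x} i → (∃₂ λ j a → e j a ≡ x × j ≡ i) →
             ∃ λ a → e i a ≡ x
    within d i (_ , a , e , refl) = a , e
    f∃ : ∀ a → ∃ λ c' → J.emb i c' ≡ I.emb i a
    f∃ a = within c {e = J.emb} i (J.block (I.emb i a) , J.coord (I.emb i a) , J.emb-coord _ ,
             trans (sym (agree (I.emb i a))) (I.block-emb i a))
    f : Pos (b i) → Pos (c i)
    f = proj₁ ∘ f∃
    f-emb : ∀ a → J.emb i (f a) ≡ I.emb i a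
    f-emb a = proj₂ (f∃ a)
    onto : Onto f
    onto y with within b {e = I.emb} i (I.block (J.emb i y) , I.coord (J.emb i y) , I.emb-coord _ ,
                  trans (agree (J.emb i y)) (J.block-emb i y))
    ... | a , e = a , monotone⇒injective J.pos-in (trans (f-emb a) e)

  -- For length two, an element placed differently by the two decompositions would make the first
  -- block of one of them divisible by the skeleton, against normality.
  unique-blocks : ∀ {n σ τ b c p} (I : Inflation (n , σ) b p) (J : Inflation (n , τ) c p) →
                  (n , σ) ≅ (n , τ) → Indecomposable (n , σ) → Indecomposable (n , τ) → 2 ℕ.≤ n →
                  (∀ i → Nonempty (b i)) → (∀ i → Nonempty (c i)) →
                  Normal (n , σ) b → Normal (n , τ) c → ∀ i → b i ≅ c i
  unique-blocks {σ = σ} {τ} {b} {c} {p} I J s≅t s-ind t-ind n≥2 b-ne c-ne b-nf c-nf with two-or-more n≥2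
  ... | inj₂ n≥3 = blocks-≅ I J λ x → toℕ-injective
    (proj₂ (unique-large (proj₁ (inflation⇒quotient I b-ne)) (proj₁ (inflation⇒quotient J c-ne)) s-ind t-ind n≥3 n≥2) x)
  ... | inj₁ refl = blocks-≅ I J agree
    where
    F = proj₁ (inflation⇒quotient I b-ne)
    G = proj₁ (inflation⇒quotient J c-ne)
    agree : ∀ x → Inflation.block I x ≡ Inflation.block J x
    agree x with Inflation.block I x in fx | Inflation.block J x in gx
    ... | zero     | zero     = refl
    ... | suc zero | suc zero = refl
    ... | zero | suc zero = contradiction
      (first-block-quotient I b-ne (quotient-resp ≅-refl (≅-sym s≅t) G) x fx
        (trans (Iso-id s≅t (Inflation.block J x)) gx)) (b-nf refl zero refl)
      where
      Iso-id : ∀ {σ τ} (e : (2 , σ) ≅ (2 , τ)) i → Iso.map (≅⇒iso (≅-sym e)) i ≡ i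
      Iso-id (same _) i = refl
    ... | suc zero | zero = contradiction
      (first-block-quotient J c-ne (quotient-resp ≅-refl s≅t F) x gx
        (trans (Iso-id s≅t (Inflation.block I x)) fx)) (c-nf refl zero refl)
      where
      Iso-id : ∀ {σ τ} (e : (2 , σ) ≅ (2 , τ)) i → Iso.map (≅⇒iso e) i ≡ i
      Iso-id (same _) i = refl

  -- Associativity σ[σ[x, y], z] = σ[x, σ[y, z]] for σ of length two: the second part of the first
  -- block can be handed over to the second block, which moves the cut to the left.
  split-first : ∀ {p σ b} (I : Inflation (2 , σ) b p) (ne : ∀ i → Nonempty (b i)) →
                Quotient (b zero) (2 , σ) →
                ∃₂ λ (F' : Quotient p (2 , σ)) x → Inflation.block I x ≡ zero × Quotient.map F' x ≡ suc zero
  split-first {p} {σ} {b} I ne G = F' , x₁ , I.block-emb zero _ , trans (f-emb _) (proj₂ (G.onto (suc zero)))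
    where
    module I = Inflation I
    module G = Quotient G
    g : ∀ i → Pos (b i) → Fin 2
    g zero    a = G.map a
    g (suc _) _ = suc zero
    f : Pos p → Fin 2
    f x = g (I.block x) (I.coord x)
    f-emb' : ∀ {i} a → f (I.emb i a) ≡ g i a
    f-emb' {i} a with I.emb-injective (I.emb-coord (I.emb i a))
    ... | e , e' = go e e'
      where go : ∀ {j c} (e : j ≡ i) → subst (Pos ∘ b) e c ≡ a → g j c ≡ g i a
            go refl refl = refl
    f-emb : ∀ a → f (I.emb zero a) ≡ G.map a
    f-emb = f-emb'
    x₁ = I.emb zero (proj₁ (G.onto (suc zero)))
    later : ∀ {i j a c} → g i a < g j c → I.emb i a < I.emb j c
    later {zero}     {zero}     l = I.pos-in (G.pos l)
    later {zero}     {suc zero} l = I.pos-out (s≤s z≤n)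
    later {suc zero} {zero} {c = c} l with G.map c
    later {suc zero} {zero} (s≤s ()) | suc zero
    later {suc zero} {suc zero} (s≤s ())
    higher : ∀ {i j a c} → val (2 , σ) (g i a) < val (2 , σ) (g j c) → val p (I.emb i a) < val p (I.emb j c)
    higher {zero}     {zero}     l = I.val-in (G.values l)
    higher {zero} {suc zero} {a} l with G.map a
    ... | zero     = I.val-out l
    ... | suc zero = contradiction l (ℕ.<-irrefl refl)
    higher {suc zero} {zero} {c = c} l with G.map c
    ... | zero     = I.val-out l
    ... | suc zero = contradiction l (ℕ.<-irrefl refl)
    higher {suc zero} {suc zero} l = contradiction l (ℕ.<-irrefl refl)
    F' : Quotient p (2 , σ)
    F' = record
      { map = f
      ; onto = λ { zero → I.emb zero (proj₁ (G.onto zero)) , trans (f-emb _) (proj₂ (G.onto zero))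
                 ; (suc zero) → x₁ , trans (f-emb _) (proj₂ (G.onto (suc zero))) }
      ; pos = λ {x} {y} l → subst₂ _<_ (I.emb-coord x) (I.emb-coord y) (later l)
      ; values = λ {x} {y} l → subst₂ (λ x y → val p x < val p y) (I.emb-coord x) (I.emb-coord y) (higher l) }

  record Decomposed (p : Perm) : Set where
    field
      skeleton       : Perm
      blocks         : Pos skeleton → Perm
      inflation      : Inflation skeleton blocks p
      nonempty       : ∀ i → Nonempty (blocks i)
      normal         : Normal skeleton blocks
      simple         : Indecomposable skeleton
      size≥2         : 2 ℕ.≤ size skeleton

  -- For a skeleton of length two the quotient is chosen so that its second block reaches as far
  -- left as possible; by `split-first` its first block cannot be divisible by the same skeleton.
  decompose : ∀ p → 2 ℕ.≤ size p → Decomposed p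
  decompose p p≥2 with indecomposable-quotient p p≥2
  ... | s , s-ind , s≥2 , F with two-or-more s≥2
  ... | inj₂ s≥3 with quotient⇒inflation F
  ...   | b , I , ne , _ = record
    { skeleton = s ; blocks = b ; inflation = I ; nonempty = ne ; simple = s-ind ; size≥2 = s≥2
    ; normal = λ e → contradiction s≥3 (ℕ.<⇒≱ (subst (ℕ._< 3) (sym e) (s≤s (s≤s (s≤s z≤n))))) }
  decompose p p≥2 | (_ , σ) , s-ind , s≥2 , F | inj₁ refl = result
    where
    Cut : ℕ → Set
    Cut k = ∃₂ λ (G : Quotient p (2 , σ)) x → Quotient.map G x ≡ suc zero × toℕ x ≡ k
    result : Decomposed p
    result with LeastNumber.least em Cut (F , proj₁ (Quotient.onto F (suc zero)) , proj₂ (Quotient.onto F (suc zero)) , refl)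
    ... | k , (G , x , gx , refl) , minimal with quotient⇒inflation G
    ... | b , I , ne , in-block = record
      { skeleton = 2 , σ ; blocks = b ; inflation = I ; nonempty = ne ; simple = s-ind ; size≥2 = s≥2
      ; normal = λ { _ zero _ H → normal H ; _ (suc _) () } }
      where
      normal : ¬ Quotient (b zero) (2 , σ)
      normal H with split-first I ne H
      ... | F' , y , by , fy = minimal (toℕ y) y<x (F' , y , fy , refl)
        where
        y<x : toℕ y ℕ.< toℕ x
        y<x = Quotient.pos G (subst₂ _<_ (sym gy) (sym gx) (s≤s z≤n))
          where
          gy : Quotient.map G y ≡ zero
          gy = trans (cong (Quotient.map G) (sym (Inflation.emb-coord I y)))
                     (trans (in-block (Inflation.block I y) (Inflation.coord I y)) by)

-- Well-quasi-ordering

module InfiniteSequences (em : ExcludedMiddle 0ℓ) where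
  open import Data.Fin.Base using (Fin; zero; suc)
  open import Data.Nat.Base using (ℕ; zero; suc; _<_; _≤_; s≤s)
  open import Data.Nat.Properties using (≤-trans; ≤-refl; <-trans; m≤n⇒m<n∨m≡n; n≤1+n)

  Increasing : (ℕ → ℕ) → Set
  Increasing θ = ∀ {i j} → i < j → θ i < θ j

  increasing : ∀ θ → (∀ n → θ n < θ (suc n)) → Increasing θ
  increasing θ step {i} {suc j} (s≤s i≤j) with m≤n⇒m<n∨m≡n i≤j
  ... | inj₁ i<j  = <-trans (increasing θ step i<j) (step j)
  ... | inj₂ refl = step i

  module _ {X : Set} (_≼_ : X → X → Set) where

    Ascent : (ℕ → X) → Set
    Ascent s = ∃₂ λ i j → i < j × s i ≼ s j

    Ascending : (ℕ → X) → Set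
    Ascending s = ∀ {i j} → i < j → s i ≼ s j

    module _ (transitive : ∀ {x y z} → x ≼ y → y ≼ z → x ≼ z) where

      -- An index is terminal if no later term lies above its term. Infinitely many terminal indices
      -- would form a subsequence without an ascent, so from some index on a larger later term can
      -- always be chosen.
      ascending-subsequence : ∀ s → (∀ θ → Increasing θ → Ascent (s ∘ θ)) →
                              ∃ λ θ → Increasing θ × Ascending (s ∘ θ)
      ascending-subsequence s ascents = θ , increasing θ (λ n → proj₁ (proj₂ (next (seq n)))) , asc
        where
        Terminal : ℕ → Set
        Terminal i = ¬ ∃ λ j → i < j × s i ≼ s j

        few-terminals : ¬ (∀ N → ∃ λ i → N ≤ i × Terminal i)
        few-terminals later = terminal i (τ j , increasing τ step i<j , a)
          where
          τ : ℕ → ℕ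
          τ zero    = proj₁ (later 0)
          τ (suc n) = proj₁ (later (suc (τ n)))
          step : ∀ n → τ n < τ (suc n)
          step n = proj₁ (proj₂ (later (suc (τ n))))
          terminal : ∀ n → Terminal (τ n)
          terminal zero    = proj₂ (proj₂ (later 0))
          terminal (suc n) = proj₂ (proj₂ (later (suc (τ n))))
          ascent = ascents τ (increasing τ step)
          i = proj₁ ascent
          j = proj₁ (proj₂ ascent)
          i<j = proj₁ (proj₂ (proj₂ ascent))
          a = proj₂ (proj₂ (proj₂ ascent))

        eventually : ∃ λ N → ∀ i → N ≤ i → ¬ Terminal i
        eventually = decidable-stable em λ none → few-terminals λ N →
          decidable-stable em λ no-later → none (N , λ i N≤i t → no-later (i , N≤i , t))

        N = proj₁ eventually

        next : ∀ (i : ∃ (N ≤_)) → ∃ λ j → proj₁ i < j × s (proj₁ i) ≼ s j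
        next (i , N≤i) = decidable-stable em (proj₂ eventually i N≤i)

        seq : ℕ → ∃ (N ≤_)
        seq zero    = N , ≤-refl
        seq (suc n) = proj₁ (next (seq n)) ,
          ≤-trans (proj₂ (seq n)) (≤-trans (n≤1+n _) (proj₁ (proj₂ (next (seq n)))))

        θ : ℕ → ℕ
        θ = proj₁ ∘ seq

        asc : Ascending (s ∘ θ)
        asc {i} {suc j} (s≤s i≤j) with m≤n⇒m<n∨m≡n i≤j
        ... | inj₁ i<j  = transitive (asc i<j) (proj₂ (proj₂ (next (seq j))))
        ... | inj₂ refl = proj₂ (proj₂ (next (seq i)))

      simultaneous-subsequence : ∀ m (s : Fin m → ℕ → X) →
        (∀ i θ → Increasing θ → Ascent (s i ∘ θ)) →
        ∃ λ θ → Increasing θ × ∀ i → Ascending (s i ∘ θ)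
      simultaneous-subsequence zero    s ascents = id , id , λ ()
      simultaneous-subsequence (suc m) s ascents
        with ascending-subsequence (s zero) (ascents zero)
      ... | θ , θ-inc , asc₀ with simultaneous-subsequence m (λ i → s (suc i) ∘ θ)
                                    (λ i ν ν-inc → ascents (suc i) (θ ∘ ν) (θ-inc ∘ ν-inc))
      ... | ν , ν-inc , asc = θ ∘ ν , θ-inc ∘ ν-inc , λ { zero → asc₀ ∘ ν-inc ; (suc i) → asc i }

-- Minimal bad sequences and finite bases

module FiniteBasis (em : ExcludedMiddle 0ℓ) where
  open import Data.Empty using (⊥)
  open import Data.Fin.Base as Fin using (Fin; zero; suc; toℕ)
  open import Data.Fin.Properties using (pigeonhole)
  open import Data.List.Base using (List; []; _∷_)
  open import Data.List.Relation.Unary.All using (All; []; _∷_)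
  open import Data.List.Relation.Unary.Any using (Any; here; there)
  open import Data.Nat.Base using (ℕ; zero; suc; _+_; _<_; _≤_; s≤s; z≤n)
  open import Data.Nat.Properties using (≤-trans; ≤-refl; <-trans; m≤n⇒m<n∨m≡n; n≤1+n; n<1+n; <⇒≱; ≮⇒≥; m≤m+n; +-cancelˡ-<; <-≤-trans; <-irrefl)
  open import Data.Nat.Induction using (<-rec)
  open import Function.Definitions using (Injective)
  open InfiniteSequences em
  open Decomposition em

  -- Some other block exists and is nonempty, which leaves an element outside block `i`.
  inflation-smaller : ∀ {s b p} → Inflation s b p → (∀ i → Nonempty (b i)) → 2 ≤ size s →
                      ∀ i → size (b i) < size p
  inflation-smaller {s} {b} {p} I ne s≥2 i = injective⇒≤ {f = f} f-injective
    where
    open import Data.Fin.Properties using (injective⇒≤; punchInᵢ≢i)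
    open Inflation I
    another : ∀ {n} → 2 ≤ n → (i : Fin n) → ∃ λ j → j ≢ i
    another (s≤s (s≤s _)) i = Fin.punchIn i zero , punchInᵢ≢i i zero ∘ id
    j = another s≥2 i
    f : Fin (suc (size (b i))) → Pos p
    f zero    = emb (proj₁ j) (first (b (proj₁ j)) (ne (proj₁ j)))
    f (suc a) = emb i a
    f-injective : Injective _≡_ _≡_ f
    f-injective {zero}  {zero}  e = refl
    f-injective {zero}  {suc _} e = contradiction (proj₁ (emb-injective e)) (proj₂ j)
    f-injective {suc _} {zero}  e = contradiction (sym (proj₁ (emb-injective e))) (proj₂ j)
    f-injective {suc a} {suc c} e = cong suc (monotone⇒injective pos-in e)

  -- Closure under patterns makes the generated permutations closed under inflation, closure under
  -- inverses serves the involutions, and with all skeletons of length two present, inflations of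
  -- `21` by generated permutations are generated.
  record Skeletons : Set₁ where
    field
      Allowed : Perm → Set
      closed  : ∀ {s t} → Embedding s t → 2 ≤ size s → Allowed t → Allowed s
      inverse-closed : ∀ {s} → Allowed s → Allowed (inverse s)
      two     : ∀ {s} → size s ≡ 2 → Allowed s
      count   : ℕ
      list    : Fin count → Perm
      listed  : ∀ {s} → Allowed s → Indecomposable s → 2 ≤ size s → ∃ λ l → s ≅ list l

  module _ (S : Skeletons) where
    open Skeletons S

    -- Stated through simple patterns rather than recursively through decompositions, so that
    -- closure under patterns is immediate.
    record Generated (p : Perm) : Set where
      field
        nonempty  : Nonempty p
        skeletons : ∀ s → 2 ≤ size s → Indecomposable s → Embedding s p → Allowed s

    open Generated

    generated-pattern : ∀ {p q} → Embedding p q → Nonempty p → Generated q → Generated p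
    generated-pattern f ne G = record
      { nonempty = ne ; skeletons = λ s s≥2 ind g → G .skeletons s s≥2 ind (embedding-∘ f g) }

    embeds-trans : ∀ {p q r} → Embedding p q → Embedding q r → Embedding p r
    embeds-trans f g = embedding-∘ g f

    private
      record Bad (f : ℕ → Perm) : Set where
        field
          generated : ∀ n → Generated (f n)
          bad       : ∀ {i j} → i < j → ¬ Embedding (f i) (f j)
      open Bad

      Agree : ℕ → (f g : ℕ → Perm) → Set
      Agree n f g = ∀ k → k < n → f k ≡ g k

      MinimalAt : ℕ → (ℕ → Perm) → Set
      MinimalAt n f = ∀ f' → Bad f' → Agree n f' f → size (f n) ≤ size (f' n)

      minimise : ∀ n f → Bad f → ∃ λ f' → Bad f' × Agree n f' f × MinimalAt n f'
      minimise n f f-bad = <-rec Goal step (size (f n)) f f-bad refl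
        where
        Goal : ℕ → Set
        Goal m = ∀ f → Bad f → size (f n) ≡ m → ∃ λ f' → Bad f' × Agree n f' f × MinimalAt n f'
        step : ∀ m → (∀ {k} → k < m → Goal k) → Goal m
        step _ rec f f-bad refl with em {∃ λ f' → Bad f' × Agree n f' f × size (f' n) < size (f n)}
        ... | no none = f , f-bad , (λ _ _ → refl) , λ f' f'-bad agree →
          ≮⇒≥ λ smaller → none (f' , f'-bad , agree , smaller)
        ... | yes (f' , f'-bad , agree , smaller) with rec smaller f' f'-bad refl
        ... | f″ , f″-bad , agree' , minimal =
          f″ , f″-bad , (λ k k<n → trans (agree' k k<n) (agree k k<n)) , minimal

      -- Stage n keeps the terms before n and makes the size of the n-th term least possible. Later
      -- stages do not touch earlier terms, so the diagonal `g` is bad and minimal everywhere.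
      module MinimalBad (f : ℕ → Perm) (f-bad : Bad f) where
        F : ℕ → ∃ Bad
        F zero    = let (g , g-bad , _) = minimise 0 f f-bad in g , g-bad
        F (suc n) = let (g , g-bad , _) = minimise (suc n) (proj₁ (F n)) (proj₂ (F n)) in g , g-bad

        F-minimal : ∀ n → MinimalAt n (proj₁ (F n))
        F-minimal zero    = proj₂ (proj₂ (proj₂ (minimise 0 f f-bad)))
        F-minimal (suc n) = proj₂ (proj₂ (proj₂ (minimise (suc n) (proj₁ (F n)) (proj₂ (F n)))))

        g : ℕ → Perm
        g n = proj₁ (F n) n

        F-g : ∀ n k → k ≤ n → proj₁ (F n) k ≡ g k
        F-g zero    zero z≤n = refl
        F-g (suc n) k k≤1+n with m≤n⇒m<n∨m≡n k≤1+n
        ... | inj₂ refl = refl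
        ... | inj₁ k<1+n@(s≤s k≤n) = trans
          (proj₁ (proj₂ (proj₂ (minimise (suc n) (proj₁ (F n)) (proj₂ (F n))))) k k<1+n) (F-g n k k≤n)

        g-bad : Bad g
        g-bad = record
          { generated = λ n → proj₂ (F n) .generated n
          ; bad = λ {i} {j} i<j e → proj₂ (F j) .bad i<j
              (subst (λ p → Embedding p (g j)) (sym (F-g j i (≤-trans (n≤1+n i) i<j))) e) }

        g-minimal : ∀ n → MinimalAt n g
        g-minimal n f' f'-bad agree = F-minimal n f' f'-bad
          (λ k k<n → trans (agree k k<n) (sym (F-g n k (≤-trans (n≤1+n k) k<n))))

      splice : ℕ → (ℕ → Perm) → (ℕ → Perm) → ℕ → Perm
      splice zero    g d n       = d n
      splice (suc N) g d zero    = g 0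
      splice (suc N) g d (suc n) = splice N (g ∘ suc) d n

      data Spliced (N : ℕ) (g d : ℕ → Perm) (p : Perm) : ℕ → Set where
        before : ∀ {n} → n < N → p ≡ g n → Spliced N g d p n
        after  : ∀ k → p ≡ d k → Spliced N g d p (N + k)

      spliced : ∀ N g d n → Spliced N g d (splice N g d n) n
      spliced zero    g d n       = after n refl
      spliced (suc N) g d zero    = before (s≤s z≤n) refl
      spliced (suc N) g d (suc n) with splice N (g ∘ suc) d n | spliced N (g ∘ suc) d n
      ... | _ | before l e = before (s≤s l) e
      ... | _ | after k e  = after k e

      splice-at : ∀ N g d → splice N g d N ≡ d 0
      splice-at zero    g d = refl
      splice-at (suc N) g d = splice-at N (g ∘ suc) d

      splice-agree : ∀ N g d → Agree N (splice N g d) g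
      splice-agree (suc N) g d zero    _       = refl
      splice-agree (suc N) g d (suc k) (s≤s l) = splice-agree N (g ∘ suc) d k l

      splice-bad : ∀ N g d → Bad g → (∀ k → Generated (d k)) →
                   (∀ n k → n < N → ¬ Embedding (g n) (d k)) → ¬ Ascent Embedding d → Bad (splice N g d)
      splice-bad N g d g-bad d-gen apart none = record { generated = gen ; bad = bad' _ _ }
        where
        gen : ∀ n → Generated (splice N g d n)
        gen n with splice N g d n | spliced N g d n
        ... | _ | before _ refl = g-bad .generated n
        ... | _ | after k refl  = d-gen k
        bad' : ∀ m n → m < n → ¬ Embedding (splice N g d m) (splice N g d n)
        bad' m n m<n f with splice N g d m | spliced N g d m | splice N g d n | spliced N g d n
        ... | _ | before _ refl | _ | before _ refl = g-bad .bad m<n f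
        ... | _ | before l refl | _ | after k refl  = apart m k l f
        ... | _ | after k refl  | _ | before l refl = contradiction (<-trans m<n l) (<⇒≱ (s≤s (m≤m+n N k)))
        ... | _ | after k refl  | _ | after k' refl = none (k , k' , +-cancelˡ-< N k k' m<n , f)

      Decomposable : Perm → Perm → Set
      Decomposable p s = ∃ λ (b : Pos s → Perm) → Inflation s b p ×
        (∀ i → Generated (b i)) × (∀ i → size (b i) < size p)

      labelled : ∀ p → Generated p → 2 ≤ size p → ∃ λ l → Decomposable p (list l)
      labelled p p-gen p≥2 = l , _ , inflation-skeleton e inflation , (λ i → gen (Iso.map (≅⇒iso (≅-sym e)) i)) ,
        (λ i → inflation-smaller inflation ne size≥2 (Iso.map (≅⇒iso (≅-sym e)) i))
        where
        open Decomposed (decompose p p≥2) renaming (nonempty to ne)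
        found = listed (p-gen .skeletons skeleton size≥2 simple
                  (quotient-embedding (proj₁ (inflation⇒quotient inflation ne)))) simple size≥2
        l = proj₁ found
        e = proj₂ found
        gen : ∀ i → Generated (blocks i)
        gen i = generated-pattern (Inflation.component inflation i) (ne i) p-gen

      module _ (g : ℕ → Perm) (g-bad : Bad g) (g-minimal : ∀ n → MinimalAt n g) where

        -- Without an ascent, the terms of `g` before `ν 0` followed by `e` would form a bad
        -- sequence, since a term of `g` embedded in `e k` also embeds in `g (ν k)`. At `ν 0` it is
        -- smaller than `g`, against minimality.
        block-ascent : (e : ℕ → Perm) (ν : ℕ → ℕ) → Increasing ν → (∀ k → Embedding (e k) (g (ν k))) →
                       (∀ k → Generated (e k)) → size (e 0) < size (g (ν 0)) → Ascent Embedding e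
        block-ascent e ν ν-inc sub e-gen smaller = decidable-stable em λ none → <⇒≱ smaller
          (subst (λ p → size (g (ν 0)) ≤ size p) (splice-at (ν 0) g e)
            (g-minimal (ν 0) (splice (ν 0) g e)
              (splice-bad (ν 0) g e g-bad e-gen
                (λ n k n<ν0 f → g-bad .bad (<-≤-trans n<ν0 (ν0≤ k)) (embedding-∘ (sub k) f)) none)
              (splice-agree (ν 0) g e)))
          where
          ν0≤ : ∀ k → ν 0 ≤ ν k
          ν0≤ zero    = ≤-refl
          ν0≤ (suc k) = ≤-trans (n≤1+n _) (ν-inc (s≤s z≤n))

        -- The blocks at all positions ascend simultaneously along some subsequence, and embeddings
        -- of blocks assemble to an embedding of the inflations.
        same-skeleton : ∀ s θ → Increasing θ → ¬ (∀ k → Decomposable (g (θ k)) s)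
        same-skeleton s θ θ-inc dec
          with simultaneous-subsequence Embedding embeds-trans _ (λ i k → proj₁ (dec k) i)
                 (λ i ν ν-inc → block-ascent (λ k → proj₁ (dec (ν k)) i) (θ ∘ ν) (θ-inc ∘ ν-inc)
                   (λ k → Inflation.component (proj₁ (proj₂ (dec (ν k)))) i)
                   (λ k → proj₁ (proj₂ (proj₂ (dec (ν k)))) i) (proj₂ (proj₂ (proj₂ (dec (ν 0)))) i))
        ... | ν , ν-inc , asc = g-bad .bad (θ-inc (ν-inc {0} {1} (s≤s z≤n)))
          (inflation-embedding (proj₁ (proj₂ (dec (ν 0)))) (proj₁ (proj₂ (dec (ν 1)))) (λ i → asc i (s≤s z≤n)))

        big : ∀ n → 2 ≤ size (g n)
        big n = ≮⇒≥ λ small → g-bad .bad (n<1+n n)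
          (point small (g-bad .generated (suc n) .nonempty))
          where
          point : ∀ {p q} → size p < 2 → Nonempty q → Embedding p q
          point {zero , _} _ _ = record { map = λ () ; pos = λ {} ; values = λ {} }
          point {suc zero , _} {q} _ ne = record
            { map = λ _ → first q ne ; pos = λ { {zero} {zero} () }
            ; values = λ { {zero} {zero} l → contradiction l (<-irrefl refl) } }
          point {suc (suc _) , _} (s≤s (s≤s ())) _

        no-minimal-bad : ∃ (λ (label : ℕ → Fin count) → ∀ n → Decomposable (g n) (list (label n))) → ⊥
        no-minimal-bad (label , dec) with ascending-subsequence _≡_ trans label repeat
          where
          repeat : ∀ θ → Increasing θ → Ascent _≡_ (label ∘ θ)
          repeat θ _ with pigeonhole (n<1+n count) (label ∘ θ ∘ toℕ)
          ... | i , j , i<j , e = toℕ i , toℕ j , i<j , e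
        ... | θ , θ-inc , constant = same-skeleton (list (label (θ 0))) θ θ-inc
          (λ k → subst (Decomposable (g (θ k)) ∘ list) (same-label k) (dec (θ k)))
          where
          same-label : ∀ k → label (θ k) ≡ label (θ 0)
          same-label zero    = refl
          same-label (suc k) = sym (constant (s≤s z≤n))

    -- Nash-Williams: in a minimal bad sequence the blocks of the terms
    -- are well-quasi-ordered.
    generated-wqo : ∀ f → (∀ n → Generated (f n)) → Ascent Embedding f
    generated-wqo f f-gen = decidable-stable em λ none →
      let open MinimalBad f (record { generated = f-gen ; bad = λ {i} {j} i<j e → none (i , j , i<j , e) })
          decomposed : ∀ n → ∃ λ l → Decomposable (g n) (list l)
          decomposed n = labelled (g n) (g-bad .generated n) (big g g-bad g-minimal n)
      in no-minimal-bad g g-bad g-minimal (proj₁ ∘ decomposed , proj₂ ∘ decomposed)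

    -- If no finite list suffices, every list can be extended by a generated permutation outside `P`
    -- that contains none of its members. The permutations added one after the other then form a
    -- sequence without an ascent.
    finite-basis : (P : Perm → Set) → ∃ λ (B : List Perm) → All (¬_ ∘ P) B ×
                   (∀ p → Generated p → ¬ P p → Any (λ β → Embedding β p) B)
    finite-basis P = decidable-stable em λ none →
      let extend : ∀ B → All (¬_ ∘ P) B → ∃ λ p → Generated p × ¬ P p × ¬ Any (λ β → Embedding β p) B
          extend B nB = decidable-stable em λ stuck → none (B , nB , λ p p-gen ¬p →
            decidable-stable em λ avoid → stuck (p , p-gen , ¬p , avoid))
      in no-extension extend
      where
      no-extension : ¬ (∀ B → All (¬_ ∘ P) B → ∃ λ p → Generated p × ¬ P p × ¬ Any (λ β → Embedding β p) B)
      no-extension extend = proj₂ (proj₂ (proj₂ (ext j))) (earlier (proj₁ (proj₂ (proj₂ found))) (proj₂ (proj₂ (proj₂ found))))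
        where
        bases : ℕ → ∃ (All (¬_ ∘ P))
        bases zero    = [] , []
        bases (suc n) = let (B , nB) = bases n ; (p , _ , ¬p , _) = extend B nB in p ∷ B , ¬p ∷ nB
        ext : ∀ n → ∃ λ p → Generated p × ¬ P p × ¬ Any (λ β → Embedding β p) (proj₁ (bases n))
        ext n = extend (proj₁ (bases n)) (proj₂ (bases n))
        f : ℕ → Perm
        f = proj₁ ∘ ext
        found = generated-wqo f (λ n → proj₁ (proj₂ (ext n)))
        j = proj₁ (proj₂ found)
        earlier : ∀ {i j p} → i < j → Embedding (f i) p → Any (λ β → Embedding β p) (proj₁ (bases j))
        earlier {i} {suc j} (s≤s i≤j) e with m≤n⇒m<n∨m≡n i≤j
        ... | inj₁ i<j  = there (earlier i<j e)
        ... | inj₂ refl = here e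

-- Generating functions of weighted sets

module Enumerations where
  open import Data.Fin.Base using (Fin; zero; suc; splitAt; join; _↑ˡ_; _↑ʳ_; combine; remQuot)
  open import Data.Fin.Properties using (splitAt-↑ˡ; splitAt-↑ʳ; join-splitAt; combine-remQuot; remQuot-combine; injective⇒≤)
  open import Data.Integer.Base using (+_)
  open import Data.Integer.Properties as ℤ using (pos-+; pos-*)
  open import Data.Nat.Base using (ℕ; zero; suc; _≤_; z≤n) renaming (_+_ to _+ℕ_; _*_ to _*ℕ_)
  open import Data.Nat.Properties as ℕ using (≤-antisym)
  open import Data.Product.Relation.Binary.Pointwise.NonDependent using () renaming (Pointwise to ×-Pointwise)
  open import Data.Rational.Base as ℚ using (ℚ; toℚᵘ)
  open import Data.Rational.Properties as ℚ using ()
  open import Data.Rational.Unnormalised.Base as ℚᵘ using (mkℚᵘ; *≡*)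
  open import Data.Rational.Unnormalised.Properties as ℚᵘ using ()
  open RationalSeries

  record Enumerates {A : Set} (_∼_ : A → A → Set) (P : A → Set) (k : ℕ) : Set where
    field
      at       : Fin k → A
      sound    : ∀ a → P (at a)
      distinct : ∀ {a b} → at a ∼ at b → a ≡ b
      complete : ∀ {x} → P x → ∃ λ a → at a ∼ x
  open Enumerates

  module _ {A : Set} {_∼_ : A → A → Set} where

    enumerates-resp : ∀ {P Q k} → (∀ {x} → P x → Q x) → (∀ {x} → Q x → P x) →
                      Enumerates _∼_ P k → Enumerates _∼_ Q k
    enumerates-resp f g E = record
      { at = E .at ; sound = f ∘ E .sound ; distinct = E .distinct ; complete = E .complete ∘ g }

    enumerates-∅ : ∀ {P} → (∀ x → ¬ P x) → Enumerates _∼_ P 0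
    enumerates-∅ empty = record
      { at = λ () ; sound = λ () ; distinct = λ { {()} } ; complete = λ p → contradiction p (empty _) }

    enumerates-⊎ : ∀ {P Q k l} → (∀ {x y} → P x → Q y → ¬ x ∼ y) → (∀ {x y} → Q x → P y → ¬ x ∼ y) →
                   Enumerates _∼_ P k → Enumerates _∼_ Q l → Enumerates _∼_ (λ x → P x ⊎ Q x) (k +ℕ l)
    enumerates-⊎ {P} {Q} {k} {l} apart apart' E F = record
      { at = both ∘ splitAt k ; sound = λ a → both-sound (splitAt k a)
      ; distinct = λ {a} {b} e → trans (sym (join-splitAt k l a))
          (trans (cong (join k l) (both-distinct (splitAt k a) (splitAt k b) e)) (join-splitAt k l b))
      ; complete = λ { (inj₁ p) → let (a , e) = E .complete p in
                         a ↑ˡ l , subst (λ c → both c ∼ _) (sym (splitAt-↑ˡ k a l)) e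
                     ; (inj₂ q) → let (a , e) = F .complete q in
                         k ↑ʳ a , subst (λ c → both c ∼ _) (sym (splitAt-↑ʳ k l a)) e } }
      where
      both : Fin k ⊎ Fin l → A
      both = [ E .at , F .at ]
      both-sound : ∀ c → P (both c) ⊎ Q (both c)
      both-sound (inj₁ a) = inj₁ (E .sound a)
      both-sound (inj₂ a) = inj₂ (F .sound a)
      both-distinct : ∀ c d → both c ∼ both d → c ≡ d
      both-distinct (inj₁ a) (inj₁ b) e = cong inj₁ (E .distinct e)
      both-distinct (inj₂ a) (inj₂ b) e = cong inj₂ (F .distinct e)
      both-distinct (inj₁ a) (inj₂ b) e = contradiction e (apart (E .sound a) (F .sound b))
      both-distinct (inj₂ a) (inj₁ b) e = contradiction e (apart' (F .sound a) (E .sound b))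

    enumerates-singleton : ∀ {P} → IsEquivalence _∼_ → ∀ x → P x → (∀ {y} → P y → x ∼ y) → Enumerates _∼_ P 1
    enumerates-singleton equiv x p unique = record
      { at = λ _ → x ; sound = λ _ → p ; distinct = λ { {zero} {zero} _ → refl } ; complete = λ q → zero , unique q }

  enumerates-× : ∀ {A B : Set} {_∼_ : A → A → Set} {_≈_ : B → B → Set} {P Q k l} →
                 Enumerates _∼_ P k → Enumerates _≈_ Q l →
                 Enumerates (×-Pointwise _∼_ _≈_) (λ (x , y) → P x × Q y) (k *ℕ l)
  enumerates-× {_∼_ = _∼_} {_≈_} {k = k} {l} E F = record
    { at = λ c → E .at (proj₁ (remQuot l c)) , F .at (proj₂ (remQuot {k} l c))
    ; sound = λ c → E .sound _ , F .sound _
    ; distinct = λ {c} {d} (e , f) → trans (sym (combine-remQuot {k} l c))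
        (trans (cong₂ combine (E .distinct e) (F .distinct f)) (combine-remQuot {k} l d))
    ; complete = λ { {x , y} (p , q) →
        let (a , e) = E .complete p ; (b , f) = F .complete q in combine a b ,
        subst (λ c → E .at (proj₁ c) ∼ x × F .at (proj₂ c) ≈ y) (sym (remQuot-combine a b)) (e , f) } }

  -- A bijection of equivalence classes given by a relation: blocks and their inflation determine
  -- each other only up to `_≅_`.
  record Correspondence {A B : Set} (_∼_ : A → A → Set) (_≈_ : B → B → Set)
                        (P : A → Set) (Q : B → Set) (R : A → B → Set) : Set where
    field
      to       : ∀ {x} → P x → ∃ λ y → Q y × R x y
      from     : ∀ {y} → Q y → ∃ λ x → P x × R x y
      to-cong  : ∀ {x x' y y'} → P x → P x' → Q y → Q y' → R x y → R x' y' → x ∼ x' → y ≈ y'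
      to-inj   : ∀ {x x' y y'} → P x → P x' → Q y → Q y' → R x y → R x' y' → y ≈ y' → x ∼ x'

  module _ {A B : Set} {_∼_ : A → A → Set} {_≈_ : B → B → Set}
           (A-equiv : IsEquivalence _∼_) (B-equiv : IsEquivalence _≈_)
           {P : A → Set} {Q : B → Set} {R : A → B → Set}
           (C : Correspondence _∼_ _≈_ P Q R) where
    private
      module A = IsEquivalence A-equiv
      module B = IsEquivalence B-equiv
      module C = Correspondence C

    enumerates-transfer : (∀ {x y} → x ∼ y → P x → P y) → ∀ {k} → Enumerates _∼_ P k → Enumerates _≈_ Q k
    enumerates-transfer P-resp E = record
      { at = λ a → proj₁ (C.to (E .sound a))
      ; sound = λ a → proj₁ (proj₂ (C.to (E .sound a)))
      ; distinct = λ {a} {b} e → E .distinct (C.to-inj (E .sound a) (E .sound b)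
          (proj₁ (proj₂ (C.to (E .sound a)))) (proj₁ (proj₂ (C.to (E .sound b))))
          (proj₂ (proj₂ (C.to (E .sound a)))) (proj₂ (proj₂ (C.to (E .sound b)))) e)
      ; complete = λ q → let (x , p , r) = C.from q ; (a , e) = E .complete p in a ,
          C.to-cong (E .sound a) p (proj₁ (proj₂ (C.to (E .sound a)))) q (proj₂ (proj₂ (C.to (E .sound a)))) r e }

  enumerates-unique : ∀ {A : Set} {_∼_ : A → A → Set} {P k l} → IsEquivalence _∼_ →
                      Enumerates _∼_ P k → Enumerates _∼_ P l → k ≡ l
  enumerates-unique {_∼_ = _∼_} {P} equiv E F = ≤-antisym (below E F) (below F E)
    where
    open IsEquivalence equiv renaming (trans to ∼-trans; sym to ∼-sym)
    below : ∀ {k l} → Enumerates _∼_ P k → Enumerates _∼_ P l → k ≤ l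
    below E F = injective⇒≤ {f = λ a → proj₁ (F .complete (E .sound a))} λ {a} {b} e →
      E .distinct (∼-trans (∼-sym (proj₂ (F .complete (E .sound a))))
        (subst (λ c → F .at c ∼ _) (sym e) (proj₂ (F .complete (E .sound b)))))

  fromℕ : ℕ → ℚ
  fromℕ k = + k ℚ./ 1

  private
    toℚᵘ-fromℕ : ∀ k → toℚᵘ (fromℕ k) ℚᵘ.≃ mkℚᵘ (+ k) 0
    toℚᵘ-fromℕ k = ℚ.toℚᵘ-fromℚᵘ (mkℚᵘ (+ k) 0)

  fromℕ-+ : ∀ k l → fromℕ (k +ℕ l) ≡ fromℕ k ℚ.+ fromℕ l
  fromℕ-+ k l = ℚ.toℚᵘ-injective (ℚᵘ.≃-trans (toℚᵘ-fromℕ (k +ℕ l)) (ℚᵘ.≃-trans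
    (*≡* (cong (Data.Integer.Base._* + 1) (trans (pos-+ k l)
      (sym (cong₂ Data.Integer.Base._+_ (ℤ.*-identityʳ (+ k)) (ℤ.*-identityʳ (+ l)))))))
    (ℚᵘ.≃-sym (ℚᵘ.≃-trans (ℚ.toℚᵘ-homo-+ (fromℕ k) (fromℕ l)) (ℚᵘ.+-cong (toℚᵘ-fromℕ k) (toℚᵘ-fromℕ l))))))
    where import Data.Integer.Base

  fromℕ-* : ∀ k l → fromℕ (k *ℕ l) ≡ fromℕ k ℚ.* fromℕ l
  fromℕ-* k l = ℚ.toℚᵘ-injective (ℚᵘ.≃-trans (toℚᵘ-fromℕ (k *ℕ l)) (ℚᵘ.≃-trans
    (*≡* (cong (Data.Integer.Base._* + 1) (pos-* k l)))
    (ℚᵘ.≃-sym (ℚᵘ.≃-trans (ℚ.toℚᵘ-homo-* (fromℕ k) (fromℕ l)) (ℚᵘ.*-cong (toℚᵘ-fromℕ k) (toℚᵘ-fromℕ l))))))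
    where import Data.Integer.Base

  HasGF : {A : Set} (_∼_ : A → A → Set) (P : A → Set) (w : A → ℕ) → Series → Set
  HasGF _∼_ P w F = ∀ n → ∃ λ k → Enumerates _∼_ (λ x → P x × w x ≡ n) k × F n ≡ fromℕ k

  module _ {A : Set} {_∼_ : A → A → Set} where

    gf-resp : ∀ {P Q : A → Set} {w F} → (∀ {x} → P x → Q x) → (∀ {x} → Q x → P x) →
              HasGF _∼_ P w F → HasGF _∼_ Q w F
    gf-resp f g H n with H n
    ... | k , E , e = k , enumerates-resp (λ (p , q) → f p , q) (λ (p , q) → g p , q) E , e

    gf-≋ : ∀ {P w F G} → F ≋ G → HasGF _∼_ P w F → HasGF _∼_ P w G
    gf-≋ F≋G H n with H n
    ... | k , E , e = k , E , trans (sym (F≋G n)) e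

    gf-∅ : ∀ {P w} → (∀ x → ¬ P x) → HasGF _∼_ P w zeroSeries
    gf-∅ empty n = 0 , enumerates-∅ (λ x (p , _) → empty x p) , refl

    gf-⊎ : ∀ {P Q : A → Set} {w F G} → (∀ {x y} → P x → Q y → ¬ x ∼ y) → (∀ {x y} → Q x → P y → ¬ x ∼ y) →
           HasGF _∼_ P w F → HasGF _∼_ Q w G → HasGF _∼_ (λ x → P x ⊎ Q x) w (F ⊞ G)
    gf-⊎ apart apart' H J n with H n | J n
    ... | k , E , e | l , F , f = k +ℕ l ,
      enumerates-resp (λ { (inj₁ (p , q)) → inj₁ p , q ; (inj₂ (p , q)) → inj₂ p , q })
                      (λ { (inj₁ p , q) → inj₁ (p , q) ; (inj₂ p , q) → inj₂ (p , q) })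
        (enumerates-⊎ (λ (p , _) (q , _) → apart p q) (λ (p , _) (q , _) → apart' p q) E F) ,
      trans (cong₂ ℚ._+_ e f) (sym (fromℕ-+ k l))

    -- The source of all equations between series: the same weighted set is counted directly and
    -- through its decomposition.
    gf-unique : IsEquivalence _∼_ → ∀ {P w F G} → HasGF _∼_ P w F → HasGF _∼_ P w G → F ≋ G
    gf-unique equiv H J n with H n | J n
    ... | k , E , e | l , F , f = trans e (trans (cong fromℕ (enumerates-unique equiv E F)) (sym f))

  gf-transfer : ∀ {A B : Set} {_∼_ : A → A → Set} {_≈_ : B → B → Set} → IsEquivalence _∼_ → IsEquivalence _≈_ →
                ∀ {P Q R w v F} → Correspondence _∼_ _≈_ P Q R → (∀ {x y} → x ∼ y → P x → P y) →
                (∀ {x y} → x ∼ y → w x ≡ w y) → (∀ {x y} → P x → Q y → R x y → w x ≡ v y) →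
                HasGF _∼_ P w F → HasGF _≈_ Q v F
  gf-transfer A-equiv B-equiv C P-resp w-resp weights H n with H n
  ... | k , E , e = k , enumerates-transfer A-equiv B-equiv (record
    { to = λ (p , w≡n) → let (y , q , r) = C.to p in y , (q , trans (sym (weights p q r)) w≡n) , r
    ; from = λ (q , v≡n) → let (x , p , r) = C.from q in x , (p , trans (weights p q r) v≡n) , r
    ; to-cong = λ (p , _) (p' , _) (q , _) (q' , _) → C.to-cong p p' q q'
    ; to-inj = λ (p , _) (p' , _) (q , _) (q' , _) → C.to-inj p p' q q' })
    (λ s (p , w≡n) → P-resp s p , trans (sym (w-resp s)) w≡n) E , e
    where module C = Correspondence C

  module _ {A B : Set} {_∼_ : A → A → Set} {_≈_ : B → B → Set}
           {P : A → Set} {Q : B → Set} {w : A → ℕ} {v : B → ℕ}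
           (w-resp : ∀ {x y} → x ∼ y → w x ≡ w y) where

    -- Splitting off the pairs whose first component has the least weight d
    -- is the recursion defining ⊠.
    private
      Tail : ℕ → ℕ → A × B → Set
      Tail d n (x , y) = (P x × Q y) × (w x +ℕ v y ≡ d +ℕ n × d ≤ w x)

      enumerates-tail : ∀ d n F G → HasGF _≈_ Q v G →
        (∀ i → ∃ λ k → Enumerates _∼_ (λ x → P x × w x ≡ d +ℕ i) k × F i ≡ fromℕ k) →
        ∃ λ k → Enumerates (×-Pointwise _∼_ _≈_) (Tail d n) k × (F ⊠ G) n ≡ fromℕ k
      enumerates-tail d zero F G HG HF with HF 0 | HG 0
      ... | k , E , e | l , E' , e' = k *ℕ l , enumerates-resp to from (enumerates-× E E') ,
        trans (cong₂ ℚ._*_ e e') (sym (fromℕ-* k l))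
        where
        to : ∀ {z} → (P (proj₁ z) × w (proj₁ z) ≡ d +ℕ 0) × (Q (proj₂ z) × v (proj₂ z) ≡ 0) → Tail d 0 z
        to ((p , wx) , (q , vy)) = (p , q) ,
          trans (cong₂ _+ℕ_ wx vy) (ℕ.+-identityʳ _) , ℕ.≤-reflexive (sym (trans wx (ℕ.+-identityʳ d)))
        from : ∀ {z} → Tail d 0 z → (P (proj₁ z) × w (proj₁ z) ≡ d +ℕ 0) × (Q (proj₂ z) × v (proj₂ z) ≡ 0)
        from {x , y} ((p , q) , wv , d≤w) = (p , ≤-antisym (subst (w x ≤_) wv (ℕ.m≤m+n _ _))
                                                (subst (_≤ w x) (sym (ℕ.+-identityʳ d)) d≤w)) ,
          (q , ℕ.n≤0⇒n≡0 (ℕ.+-cancelˡ-≤ d _ 0 (subst (d +ℕ v y ≤_) wv (ℕ.+-monoˡ-≤ (v y) d≤w))))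
      enumerates-tail d (suc n) F G HG HF with HF 0 | HG (suc n) | enumerates-tail (suc d) n (F ∘ suc) G HG
                                                 (λ i → let (k , E , e) = HF (suc i) in k ,
                                                   subst (λ j → Enumerates _∼_ (λ x → P x × w x ≡ j) k) (ℕ.+-suc d i) E , e)
      ... | k , E , e | l , E' , e' | m , U , t = k *ℕ l +ℕ m ,
        enumerates-resp to from (enumerates-⊎ apart apart' (enumerates-× E E') U) ,
        trans (cong₂ ℚ._+_ (trans (cong₂ ℚ._*_ e e') (sym (fromℕ-* k l))) t) (sym (fromℕ-+ (k *ℕ l) m))
        where
        Head : A × B → Set
        Head z = (P (proj₁ z) × w (proj₁ z) ≡ d +ℕ 0) × (Q (proj₂ z) × v (proj₂ z) ≡ suc n)
        to : ∀ {z} → Head z ⊎ Tail (suc d) n z → Tail d (suc n) z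
        to (inj₁ ((p , wx) , (q , vy))) = (p , q) , cong₂ _+ℕ_ (trans wx (ℕ.+-identityʳ d)) vy ,
          ℕ.≤-reflexive (sym (trans wx (ℕ.+-identityʳ d)))
        to (inj₂ (pq , wv , d<w)) = pq , trans wv (sym (ℕ.+-suc d n)) , ℕ.<⇒≤ d<w
        from : ∀ {z} → Tail d (suc n) z → Head z ⊎ Tail (suc d) n z
        from {x , y} ((p , q) , wv , d≤w) with ℕ.m≤n⇒m<n∨m≡n d≤w
        ... | inj₁ d<w = inj₂ ((p , q) , trans wv (ℕ.+-suc d n) , d<w)
        ... | inj₂ d≡w = inj₁ ((p , trans (sym d≡w) (sym (ℕ.+-identityʳ d))) ,
          (q , ℕ.+-cancelˡ-≡ d _ _ (trans (cong (_+ℕ v y) d≡w) wv)))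
        apart : ∀ {z z'} → Head z → Tail (suc d) n z' → ¬ ×-Pointwise _∼_ _≈_ z z'
        apart ((_ , wx) , _) (_ , _ , d<w) (e , _) =
          contradiction d<w (ℕ.≤⇒≯ (ℕ.≤-reflexive (trans (sym (w-resp e)) (trans wx (ℕ.+-identityʳ d)))))
        apart' : ∀ {z z'} → Tail (suc d) n z → Head z' → ¬ ×-Pointwise _∼_ _≈_ z z'
        apart' (_ , _ , d<w) ((_ , wx) , _) (e , _) =
          contradiction d<w (ℕ.≤⇒≯ (ℕ.≤-reflexive (trans (w-resp e) (trans wx (ℕ.+-identityʳ d)))))

    gf-× : ∀ {F G} → HasGF _∼_ P w F → HasGF _≈_ Q v G →
           HasGF (×-Pointwise _∼_ _≈_) (λ (x , y) → P x × Q y) (λ (x , y) → w x +ℕ v y) (F ⊠ G)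
    gf-× {F} {G} HF HG n with enumerates-tail 0 n F G HG HF
    ... | k , E , e = k , enumerates-resp (λ (pq , wv , _) → pq , wv) (λ (pq , wv) → pq , wv , z≤n) E , e

-- Congruences of finite index

module BlockSums (em : ExcludedMiddle 0ℓ) where
  open import Data.Fin.Base using (Fin; zero; suc; toℕ; _<_; punchIn)
  open import Data.Fin.Permutation using (_⟨$⟩ʳ_)
  open import Data.Fin.Properties using (_≟_; punchInᵢ≢i)
  open import Data.List.Base as List using (List; []; _∷_; length; filter; cartesianProduct; map; allFin; tabulate)
  open import Data.List.Properties using (length-++; filter-++)
  open import Data.Nat.Base as ℕ using (ℕ; zero; suc; _+_; _*_; parity; s≤s; z≤n)
  open import Data.Nat.Divisibility using (_∣_; divides; ∣-refl; ∣m+n∣m⇒∣n; ∣m∣n⇒∣m+n)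
  open import Data.Nat.Properties as ℕ using (+-*-semiring; +-identityʳ; *-identityˡ; *-identityʳ)
  open import Data.Parity.Base as ℙ using (Parity; 0ℙ)
  open import Data.Parity.Properties using (+-homo-+; *-homo-*)
  open import Function.Bundles using (_⇔_; mk⇔)
  open import Relation.Unary using (Decidable)
  open import Algebra.Properties.Semiring.Sum +-*-semiring
    using (sum; sum-cong-≗; sum-remove; ∑-distrib-+; ∑-comm; sum-permute; *-distribˡ-sum; *-distribʳ-sum; sum-replicate-zero) public
  open Decomposition em

  χ : Set → ℕ
  χ P with em {P}
  ... | yes _ = 1
  ... | no _  = 0

  χ-yes : ∀ {P} → P → χ P ≡ 1
  χ-yes {P} p with em {P}
  ... | yes _ = refl
  ... | no ¬p = contradiction p ¬p

  χ-no : ∀ {P} → ¬ P → χ P ≡ 0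
  χ-no {P} ¬p with em {P}
  ... | yes p = contradiction p ¬p
  ... | no _  = refl

  χ-cong : ∀ {P Q} → (P → Q) → (Q → P) → χ P ≡ χ Q
  χ-cong {P} {Q} f g with em {P}
  ... | yes p = sym (χ-yes (f p))
  ... | no ¬p = sym (χ-no (¬p ∘ g))

  sum-zero : ∀ {n} (f : Fin n → ℕ) → (∀ i → f i ≡ 0) → sum f ≡ 0
  sum-zero {n} f z = trans (sum-cong-≗ z) (sum-replicate-zero n)

  sum-const : ∀ n k → sum {n} (λ _ → k) ≡ n * k
  sum-const zero    k = refl
  sum-const (suc n) k = cong (k +_) (sum-const n k)

  sum-single : ∀ {n} (f : Fin n → ℕ) i → (∀ j → j ≢ i → f j ≡ 0) → sum f ≡ f i
  sum-single {suc n} f i z = trans (sum-remove {i = i} f)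
    (trans (cong (f i +_) (sum-zero _ (λ j → z (punchIn i j) (punchInᵢ≢i i j)))) (+-identityʳ _))

  sum-δ : ∀ {n} (f : Fin n → ℕ) i → sum (λ j → χ (i ≡ j) * f j) ≡ f i
  sum-δ f i = trans (sum-single (λ j → χ (i ≡ j) * f j) i λ j j≢i → cong (_* f j) (χ-no (j≢i ∘ sym)))
                    (trans (cong (_* f i) (χ-yes refl)) (*-identityˡ _))

  sum-below : ∀ {n} (v : Fin n) → sum {n} (λ z → χ (z < v)) ≡ toℕ v
  sum-below {suc n} zero    = sum-zero {suc n} _ (λ z → χ-no {z < zero {n}} λ ())
  sum-below {suc n} (suc v) = cong₂ _+_ (χ-yes {zero {n} < suc v} (s≤s z≤n))
    (trans (sum-cong-≗ {n} (λ z → χ-cong {suc z < suc v} {z < v} (λ { (s≤s l) → l }) s≤s)) (sum-below v))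

  -- Turns parities of values into parities of sums over positions, which split along the blocks.
  value-sum : ∀ p x → toℕ (val p x) ≡ sum (λ z → χ (val p z < val p x))
  value-sum p x = trans (sym (sum-below (val p x))) (sum-permute {size p} (λ w → χ (w < val p x)) (proj₂ p))

  inversions-sum : ∀ p → inversions (proj₂ p) ≡ sum (λ x → sum (λ y → χ (x < y × val p y < val p x)))
  inversions-sum (n , π) = trans (length-product _ (allFin n) (allFin n))
    (trans (listSum-tabulate id (λ x → listSum (λ y → χ (P (x , y))) (allFin n)))
      (sum-cong-≗ (λ x → listSum-tabulate id (λ y → χ (P (x , y))))))
    where
    P : Fin n × Fin n → Set
    P (x , y) = x < y × π ⟨$⟩ʳ y < π ⟨$⟩ʳ x
    listSum : ∀ {A : Set} → (A → ℕ) → List A → ℕ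
    listSum f []       = 0
    listSum f (x ∷ xs) = f x + listSum f xs
    listSum-tabulate : ∀ {A : Set} {n} (g : Fin n → A) f → listSum f (tabulate g) ≡ sum (f ∘ g)
    listSum-tabulate {n = zero}  g f = refl
    listSum-tabulate {n = suc n} g f = cong (f (g zero) +_) (listSum-tabulate (g ∘ suc) f)
    length-map : ∀ {A B : Set} {P : B → Set} (P? : Decidable P) (g : A → B) ys →
                 length (filter P? (map g ys)) ≡ listSum (λ y → χ (P (g y))) ys
    length-map P? g []       = refl
    length-map P? g (y ∷ ys) with P? (g y)
    ... | yes p = trans (cong suc (length-map P? g ys)) (cong (_+ _) (sym (χ-yes p)))
    ... | no ¬p = trans (length-map P? g ys) (cong (_+ _) (sym (χ-no ¬p)))
    length-product : ∀ {A B : Set} {P : A × B → Set} (P? : Decidable P) xs ys →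
                     length (filter P? (cartesianProduct xs ys)) ≡
                     listSum (λ x → listSum (λ y → χ (P (x , y))) ys) xs
    length-product P? []       ys = refl
    length-product P? (x ∷ xs) ys = trans (cong length (filter-++ P? (map (x ,_) ys) _))
      (trans (length-++ (filter P? (map (x ,_) ys)))
        (cong₂ _+_ (length-map P? (x ,_) ys) (length-product P? xs ys)))

  module _ {s b p} (I : Inflation s b p) where
    open Inflation I

    private
      hits : ∀ z → sum (λ i → sum (λ a → χ (emb i a ≡ z))) ≡ 1
      hits z = trans (sum-single (λ i → sum (λ a → χ (emb i a ≡ z))) (block z)
                 (λ i i≢ → sum-zero (λ a → χ (emb i a ≡ z)) (λ a → χ-no λ e → i≢ (trans (sym (block-emb i a)) (cong block e)))))
        (trans (sum-single (λ a → χ (emb (block z) a ≡ z)) (coord z)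
                 (λ a a≢ → χ-no λ e → a≢ (monotone⇒injective pos-in (trans e (sym (emb-coord z))))))
          (χ-yes (emb-coord z)))

    -- Each `f z` is multiplied by the number of pairs (i, a) with image `z`, which is one by
    -- `hits`, and the sums are interchanged.
    sum-blocks : ∀ f → sum f ≡ sum (λ i → sum (λ a → f (emb i a)))
    sum-blocks f = sym (begin
      sum (λ i → sum (λ a → f (emb i a)))
        ≡⟨ sum-cong-≗ (λ i → sum-cong-≗ (λ a → sym (sum-δ f (emb i a)))) ⟩
      sum (λ i → sum (λ a → sum (λ z → χ (emb i a ≡ z) * f z)))
        ≡⟨ sum-cong-≗ (λ i → ∑-comm (λ a z → χ (emb i a ≡ z) * f z)) ⟩
      sum (λ i → sum (λ z → sum (λ a → χ (emb i a ≡ z) * f z)))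
        ≡⟨ ∑-comm (λ i z → sum (λ a → χ (emb i a ≡ z) * f z)) ⟩
      sum (λ z → sum (λ i → sum (λ a → χ (emb i a ≡ z) * f z)))
        ≡⟨ sum-cong-≗ (λ z → sum-cong-≗ (λ i → sym (*-distribʳ-sum (f z) (λ a → χ (emb i a ≡ z))))) ⟩
      sum (λ z → sum (λ i → sum (λ a → χ (emb i a ≡ z)) * f z))
        ≡⟨ sum-cong-≗ (λ z → sym (*-distribʳ-sum (f z) (λ i → sum (λ a → χ (emb i a ≡ z))))) ⟩
      sum (λ z → sum (λ i → sum (λ a → χ (emb i a ≡ z))) * f z)
        ≡⟨ sum-cong-≗ (λ z → trans (cong (_* f z) (hits z)) (*-identityˡ (f z))) ⟩
      sum f ∎)
      where open ≡-Reasoning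

    size-sum : size p ≡ sum (λ i → size (b i))
    size-sum = trans (sym (trans (sum-const (size p) 1) (*-identityʳ _)))
      (trans (sum-blocks (λ _ → 1)) (sum-cong-≗ (λ i → trans (sum-const (size (b i)) 1) (*-identityʳ _))))

    below-block : ∀ i a j → Dec (j ≡ i) → ℕ
    below-block i a j (yes _) = toℕ (val (b i) a)
    below-block i a j (no _)  = size (b j) * χ (val s j < val s i)

    value-blocks : ∀ i a → toℕ (val p (emb i a)) ≡ sum (λ j → below-block i a j (j ≟ i))
    value-blocks i a = trans (value-sum p (emb i a))
      (trans (sum-blocks (λ z → χ (val p z < val p (emb i a)))) (sum-cong-≗ (λ j → term j (j ≟ i))))
      where
      term : ∀ j (d : Dec (j ≡ i)) → sum (λ c → χ (val p (emb j c) < val p (emb i a))) ≡ below-block i a j d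
      term j (yes refl) = trans
        (sum-cong-≗ {size (b i)} (λ c → χ-cong (embedding-reflects (component i)) (val-in {i} {c} {a})))
        (sym (value-sum (b i) a))
      term j (no j≢i) = trans
        (sum-cong-≗ {size (b j)} (λ c → χ-cong (λ l → outer (val-cases l)) (val-out {j} {i} {c} {a})))
        (sum-const (size (b j)) _)
        where
        outer : ∀ {A : j ≡ i → Set} → val s j < val s i Data.Sum.Base.⊎ ∃ A → val s j < val s i
        outer (inj₁ l)       = l
        outer (inj₂ (e , _)) = contradiction e j≢i

    inverted : ∀ i j → Dec (i ≡ j) → ℕ
    inverted i j (yes _) = inversions (proj₂ (b i))
    inverted i j (no _)  = size (b i) * (size (b j) * χ (i < j × val s j < val s i))

    -- Between two different blocks all pairs are inversions or none are, as decided by `s`; within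
    -- a block its own inversions are counted.
    inversions-blocks : inversions (proj₂ p) ≡ sum (λ i → sum (λ j → inverted i j (i ≟ j)))
    inversions-blocks = begin
      inversions (proj₂ p)
        ≡⟨ inversions-sum p ⟩
      sum (λ x → sum (λ y → χ (x < y × val p y < val p x)))
        ≡⟨ sum-blocks (λ x → sum (λ y → χ (x < y × val p y < val p x))) ⟩
      sum (λ i → sum (λ a → sum (λ y → χ (emb i a < y × val p y < val p (emb i a)))))
        ≡⟨ sum-cong-≗ (λ i → sum-cong-≗ (λ a → sum-blocks (λ y → χ (emb i a < y × val p y < val p (emb i a))))) ⟩
      sum (λ i → sum (λ a → sum (λ j → sum (λ c → X i a j c))))
        ≡⟨ sum-cong-≗ (λ i → ∑-comm (λ a j → sum (λ c → X i a j c))) ⟩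
      sum (λ i → sum (λ j → sum (λ a → sum (λ c → X i a j c))))
        ≡⟨ sum-cong-≗ (λ i → sum-cong-≗ (λ j → term i j (i ≟ j))) ⟩
      sum (λ i → sum (λ j → inverted i j (i ≟ j))) ∎
      where
      open ≡-Reasoning
      X : ∀ i → Pos (b i) → ∀ j → Pos (b j) → ℕ
      X i a j c = χ (emb i a < emb j c × val p (emb j c) < val p (emb i a))
      term : ∀ i j (d : Dec (i ≡ j)) → sum (λ a → sum (λ c → X i a j c)) ≡ inverted i j d
      term i j (yes refl) = trans
        (sum-cong-≗ {size (b i)} (λ a → sum-cong-≗ {size (b i)} (λ c → χ-cong
          (λ (l , m) → monotone⇒reflects pos-in l , embedding-reflects (component i) m)
          (λ (l , m) → pos-in {i} {a} {c} l , val-in {i} {c} {a} m))))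
        (sym (inversions-sum (b i)))
      term i j (no i≢j) = trans
        (sum-cong-≗ {size (b i)} (λ a → trans
          (sum-cong-≗ {size (b j)} (λ c → χ-cong
            (λ (l , m) → outer i≢j (pos-cases l) , outer (i≢j ∘ sym) (val-cases m))
            (λ (l , m) → pos-out {i} {j} {a} {c} l , val-out {j} {i} {c} {a} m)))
          (sum-const (size (b j)) _)))
        (sum-const (size (b i)) _)
        where
        outer : ∀ {k l : Pos s} {P : Set} {A : k ≡ l → Set} → k ≢ l → P Data.Sum.Base.⊎ ∃ A → P
        outer ne (inj₁ l)       = l
        outer ne (inj₂ (e , _)) = contradiction e ne

  sum-parity : ∀ {n} (f g : Fin n → ℕ) → (∀ i → parity (f i) ≡ parity (g i)) → parity (sum f) ≡ parity (sum g)
  sum-parity {zero}  f g e = refl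
  sum-parity {suc n} f g e = trans (+-homo-+ (f zero) _)
    (trans (cong₂ ℙ._+_ (e zero) (sum-parity (f ∘ suc) (g ∘ suc) (e ∘ suc))) (sym (+-homo-+ (g zero) _)))

  *-parity : ∀ m m' n n' → parity m ≡ parity m' → parity n ≡ parity n' → parity (m * n) ≡ parity (m' * n')
  *-parity m m' n n' e f = trans (*-homo-* m n) (trans (cong₂ ℙ._*_ e f) (sym (*-homo-* m' n')))

  module _ {s b b' p p'} (I : Inflation s b p) (I' : Inflation s b' p')
           (sizes : ∀ i → parity (size (b i)) ≡ parity (size (b' i))) where
    private
      module I = Inflation I
      module I' = Inflation I'

    size-parity : parity (size p) ≡ parity (size p')
    size-parity = trans (cong parity (size-sum I))
      (trans (sum-parity (size ∘ b) (size ∘ b') sizes) (cong parity (sym (size-sum I'))))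

    value-parity : ∀ i a a' → parity (toℕ (val (b i) a)) ≡ parity (toℕ (val (b' i) a')) →
                   parity (toℕ (val p (I.emb i a))) ≡ parity (toℕ (val p' (I'.emb i a')))
    value-parity i a a' e = trans (cong parity (value-blocks I i a))
      (trans (sum-parity _ _ (λ j → term j (j ≟ i))) (cong parity (sym (value-blocks I' i a'))))
      where
      term : ∀ j (d : Dec (j ≡ i)) → parity (below-block I i a j d) ≡ parity (below-block I' i a' j d)
      term j (yes _) = e
      term j (no _)  = *-parity (size (b j)) (size (b' j)) (χ (val s j < val s i)) (χ (val s j < val s i)) (sizes j) refl

    inversions-parity : (∀ i → parity (inversions (proj₂ (b i))) ≡ parity (inversions (proj₂ (b' i)))) →
                        parity (inversions (proj₂ p)) ≡ parity (inversions (proj₂ p'))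
    inversions-parity e = trans (cong parity (inversions-blocks I))
      (trans (sum-parity _ _ (λ i → sum-parity (λ j → inverted I i j (i ≟ j)) (λ j → inverted I' i j (i ≟ j))
                                (λ j → term i j (i ≟ j))))
             (cong parity (sym (inversions-blocks I'))))
      where
      term : ∀ i j (d : Dec (i ≡ j)) → parity (inverted I i j d) ≡ parity (inverted I' i j d)
      term i j (yes _) = e i
      term i j (no _)  = *-parity (size (b i)) (size (b' i)) _ _ (sizes i)
        (*-parity (size (b j)) (size (b' j)) (χ (i < j × val s j < val s i)) (χ (i < j × val s j < val s i)) (sizes j) refl)

  even⇔parity : ∀ n → 2 ∣ n ⇔ parity n ≡ 0ℙ
  even⇔parity n = mk⇔ (to n) (from n)
    where
    from : ∀ n → parity n ≡ 0ℙ → 2 ∣ n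
    from zero          _ = divides 0 refl
    from (suc (suc n)) e = ∣m∣n⇒∣m+n ∣-refl (from n e)
    to : ∀ n → 2 ∣ n → parity n ≡ 0ℙ
    to zero          _ = refl
    to (suc zero)    (divides (suc q) ())
    to (suc (suc n)) d = to n (∣m+n∣m⇒∣n d ∣-refl)

-- Equivalence relations of finite index

module FiniteIndexRelations (em : ExcludedMiddle 0ℓ) where
  open import Data.Fin.Base using (Fin; zero; suc; toℕ; combine; remQuot; splitAt; _↑ˡ_; _↑ʳ_; funToFin; finToFun)
  open import Data.Fin.Properties using (combine-injective; finToFun-funToFin; toℕ-injective; remQuot-combine; splitAt-↑ˡ; splitAt-↑ʳ)
  open import Data.Nat.Base as ℕ using (ℕ)
  open import Data.Product.Base as Product using (∃; _×_; _,_; proj₁; proj₂)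
  open import Data.Sum.Base as Sum using (_⊎_; inj₁; inj₂)
  open import Data.Unit.Base using (⊤)
  open import Function.Bundles using (_⇔_; mk⇔)

  Finite : Set → Set
  Finite J = ∃ λ N → ∃ λ (f : Fin N → J) → ∀ j → ∃ λ i → f i ≡ j

  finite-Fin : ∀ n → Finite (Fin n)
  finite-Fin n = n , id , λ j → j , refl

  finite-⊤ : Finite ⊤
  finite-⊤ = 1 , _ , λ _ → zero , refl

  finite-⊎ : ∀ {I J} → Finite I → Finite J → Finite (I ⊎ J)
  finite-⊎ (m , f , p) (n , g , q) = m ℕ.+ n , Sum.map f g ∘ splitAt m , λ
    { (inj₁ i) → proj₁ (p i) ↑ˡ n , trans (cong (Sum.map f g) (splitAt-↑ˡ m _ n)) (cong inj₁ (proj₂ (p i)))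
    ; (inj₂ j) → m ↑ʳ proj₁ (q j) , trans (cong (Sum.map f g) (splitAt-↑ʳ m n _)) (cong inj₂ (proj₂ (q j))) }

  finite-× : ∀ {I J} → Finite I → Finite J → Finite (I × J)
  finite-× (m , f , p) (n , g , q) = m ℕ.* n , Product.map f g ∘ remQuot n , λ (i , j) →
    combine (proj₁ (p i)) (proj₁ (q j)) ,
    trans (cong (Product.map f g) (remQuot-combine (proj₁ (p i)) (proj₁ (q j)))) (cong₂ _,_ (proj₂ (p i)) (proj₂ (q j)))

  -- The code separates classes but may split them. This makes finite index obvious for
  -- intersections and coarser relations; `classify` makes the code constant on classes.
  FiniteIndex : {A : Set} → (A → A → Set) → Set
  FiniteIndex {A} _~_ = ∃ λ K → ∃ λ (τ : A → Fin K) → ∀ {x y} → τ x ≡ τ y → x ~ y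

  module _ {A : Set} where

    finiteIndex-⊆ : {_~_ _≈_ : A → A → Set} → (∀ {x y} → x ~ y → x ≈ y) → FiniteIndex _~_ → FiniteIndex _≈_
    finiteIndex-⊆ f (K , τ , s) = K , τ , f ∘ s

    finiteIndex-∩ : {_~_ _≈_ : A → A → Set} → FiniteIndex _~_ → FiniteIndex _≈_ →
                    FiniteIndex (λ x y → (x ~ y) × (x ≈ y))
    finiteIndex-∩ (K , τ , s) (L , υ , t) = K ℕ.* L , (λ x → combine (τ x) (υ x)) ,
      λ {x} {y} e → let (e₁ , e₂) = combine-injective (τ x) (υ x) (τ y) (υ y) e in s e₁ , t e₂

    -- The truth values, decided by excluded middle, form a bit vector, which serves as the code.
    finiteIndex-predicates : ∀ {J} → Finite J → (P : J → A → Set) →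
                             FiniteIndex (λ x y → ∀ j → P j x ⇔ P j y)
    finiteIndex-predicates {J} (N , f , onto) P = 2 ℕ.^ N , τ , agree
      where
      bit : Set → Fin 2
      bit Q with em {Q}
      ... | yes _ = suc zero
      ... | no _  = zero
      bit-⇔ : ∀ {Q R} → bit Q ≡ bit R → Q → R
      bit-⇔ {Q} {R} e q with em {Q} | em {R}
      ... | _     | yes r = r
      ... | no ¬q | no _  = contradiction q ¬q
      bit-⇔ () q | yes _ | no _
      bits : A → Fin N → Fin 2
      bits x i = bit (P (f i) x)
      τ : A → Fin (2 ℕ.^ N)
      τ x = funToFin (bits x)
      agree : ∀ {x y} → τ x ≡ τ y → ∀ j → P j x ⇔ P j y
      agree {x} {y} e j with onto j
      ... | i , refl = mk⇔ (bit-⇔ eq) (bit-⇔ (sym eq))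
        where
        eq : bits x i ≡ bits y i
        eq = trans (sym (finToFun-funToFin (bits x) i))
               (trans (cong (λ c → finToFun c i) e) (finToFun-funToFin (bits y) i))

  -- The class of x is the least index occurring among the elements
  -- related to x.
  classify : ∀ {A : Set} {_~_ : A → A → Set} → IsEquivalence _~_ → FiniteIndex _~_ →
             ∃ λ K → ∃ λ (ty : A → Fin K) → (∀ {x y} → ty x ≡ ty y → x ~ y) × (∀ {x y} → x ~ y → ty x ≡ ty y)
  classify {A} {_~_} equiv (K , τ , s) = K , ty , sound , complete
    where
    open IsEquivalence equiv renaming (refl to ~-refl; sym to ~-sym; trans to ~-trans)
    open LeastNumber em
    Index : A → ℕ → Set
    Index x k = ∃ λ y → x ~ y × toℕ (τ y) ≡ k
    L : ∀ x → _
    L x = least (Index x) {toℕ (τ x)} (x , ~-refl , refl)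
    rep : A → A
    rep x = proj₁ (proj₁ (proj₂ (L x)))
    x~rep : ∀ x → x ~ rep x
    x~rep x = proj₁ (proj₂ (proj₁ (proj₂ (L x))))
    rep-index : ∀ x → toℕ (τ (rep x)) ≡ proj₁ (L x)
    rep-index x = proj₂ (proj₂ (proj₁ (proj₂ (L x))))
    ty : A → Fin K
    ty x = τ (rep x)
    sound : ∀ {x y} → ty x ≡ ty y → x ~ y
    sound {x} {y} e = ~-trans (x~rep x) (~-trans (s e) (~-sym (x~rep y)))
    below : ∀ {x y} → x ~ y → proj₁ (L x) ℕ.≤ proj₁ (L y)
    below {x} {y} x~y = ℕ.≮⇒≥ λ l → proj₂ (proj₂ (L x)) _ l
      (rep y , ~-trans x~y (x~rep y) , rep-index y)
      where open import Data.Nat.Properties as ℕ using ()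
    complete : ∀ {x y} → x ~ y → ty x ≡ ty y
    complete {x} {y} x~y = toℕ-injective (trans (rep-index x)
      (trans (ℕ.≤-antisym (below x~y) (below (~-sym x~y))) (sym (rep-index y))))
      where open import Data.Nat.Properties as ℕ using ()

-- Congruences for inflation

module Congruences (em : ExcludedMiddle 0ℓ) where
  open import Data.Fin.Base using (Fin; zero; suc; _<_)
  open import Data.Fin.Permutation as Perm using (inverseˡ; inverseʳ)
  open import Data.Nat.Base as ℕ using (ℕ; parity; s≤s; z≤n)
  open import Data.Parity.Base using (Parity; 0ℙ; 1ℙ)
  open import Function.Bundles using (_⇔_; mk⇔; Equivalence)
  open Decomposition em public
  open BlockSums em public
  open FiniteIndexRelations em public

  -- Compatibility is asked for simple skeletons of length at least two and nonempty blocks, where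
  -- the skeleton is determined by the inflation; on this the congruence `decomposability` relies.
  record Congruence : Set₁ where
    field
      _~_           : Perm → Perm → Set
      isEquivalence : IsEquivalence _~_
      resp          : ∀ {p q} → p ≅ q → p ~ q
      cong-inflate  : ∀ {s b b' p p'} → Indecomposable s → 2 ℕ.≤ size s →
                      Inflation s b p → Inflation s b' p' →
                      (∀ i → Nonempty (b i)) → (∀ i → Nonempty (b' i)) →
                      (∀ i → b i ~ b' i) → p ~ p'
      finiteIndex   : FiniteIndex _~_

  open Congruence

  congruence-∩ : Congruence → Congruence → Congruence
  congruence-∩ C D = record
    { _~_ = λ p q → C.p~ p q × D.p~ p q
    ; isEquivalence = record
      { refl = C.E.refl , D.E.refl
      ; sym = λ (e , f) → C.E.sym e , D.E.sym f
      ; trans = λ (e , f) (e' , f') → C.E.trans e e' , D.E.trans f f' }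
    ; resp = λ e → C .resp e , D .resp e
    ; cong-inflate = λ ind two I J ne ne' e →
        C .cong-inflate ind two I J ne ne' (proj₁ ∘ e) , D .cong-inflate ind two I J ne ne' (proj₂ ∘ e)
    ; finiteIndex = finiteIndex-∩ (C .finiteIndex) (D .finiteIndex) }
    where
    module C where
      p~ = _~_ C
      module E = IsEquivalence (C .isEquivalence)
    module D where
      p~ = _~_ D
      module E = IsEquivalence (D .isEquivalence)

  indecomposable-inverse : ∀ {s} → Indecomposable s → Indecomposable (inverse s)
  indecomposable-inverse {s@(_ , σ)} ind (P , convex , i , j , i≢j , pi , pj , k , ¬pk) = ind
    (P ∘ val s , record
      { pos = λ p q l m → Convex.values convex p q
          (subst₂ _<_ (sym (inverseˡ σ)) (sym (inverseˡ σ)) l) (subst₂ _<_ (sym (inverseˡ σ)) (sym (inverseˡ σ)) m)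
      ; values = λ p q l m → Convex.pos convex p q l m } ,
     val⁻¹ s i , val⁻¹ s j , (λ e → i≢j (trans (sym (inverseʳ σ)) (trans (cong (val s) e) (inverseʳ σ)))) ,
     trans (cong P (inverseʳ σ)) pi , trans (cong P (inverseʳ σ)) pj ,
     val⁻¹ s k , λ e → ¬pk (trans (cong P (sym (inverseʳ σ))) e))

  congruence-inverse : Congruence → Congruence
  congruence-inverse C = record
    { _~_ = λ p q → C.p~ (inverse p) (inverse q)
    ; isEquivalence = record { refl = C.E.refl ; sym = C.E.sym ; trans = C.E.trans }
    ; resp = λ e → C .resp (≅-inverse e)
    ; cong-inflate = λ {s} ind two I J ne ne' e → C .cong-inflate (indecomposable-inverse {s} ind) two
        (inflation-inverse I) (inflation-inverse J) (λ j → ne (val⁻¹ s j)) (λ j → ne' (val⁻¹ s j)) (λ j → e (val⁻¹ s j))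
    ; finiteIndex = let (K , τ , sound) = C .finiteIndex in K , τ ∘ inverse , sound }
    where
    module C where
      p~ = _~_ C
      module E = IsEquivalence (C .isEquivalence)

  indecomposable₂ : ∀ {s} → size s ≡ 2 → Indecomposable s
  indecomposable₂ {_ , σ} refl (P , _ , i , j , i≢j , pi , pj , k , ¬pk) = go i j k i≢j pi pj ¬pk
    where
    open import Data.Bool.Base using (true)
    go : ∀ (i j k : Fin 2) → i ≢ j → P i ≡ true → P j ≡ true → ¬ P k ≢ true
    go zero       zero       _ ne = contradiction refl ne
    go (suc zero) (suc zero) _ ne = contradiction refl ne
    go zero       (suc zero) zero       _ pi pj ne = ne pi
    go zero       (suc zero) (suc zero) _ pi pj ne = ne pj
    go (suc zero) zero       zero       _ pi pj ne = ne pj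
    go (suc zero) zero       (suc zero) _ pi pj ne = ne pi

  perm12 perm21 : Perm
  perm12 = 2 , Perm.id
  perm21 = 2 , Perm.reverse

  -- Makes `Normal` depend only on the classes of the blocks. It is a congruence since the simple
  -- quotient of an inflation is its skeleton, whatever the blocks are.
  decomposability : Congruence
  decomposability = record
    { _~_ = λ p q → ∀ (i : Fin 2) → Quotient p (skel i) ⇔ Quotient q (skel i)
    ; isEquivalence = record
      { refl = λ i → mk⇔ id id
      ; sym = λ e i → mk⇔ (Equivalence.from (e i)) (Equivalence.to (e i))
      ; trans = λ e f i → mk⇔ (Equivalence.to (f i) ∘ Equivalence.to (e i))
                              (Equivalence.from (e i) ∘ Equivalence.from (f i)) }
    ; resp = λ e i → mk⇔ (quotient-resp e ≅-refl) (quotient-resp (≅-sym e) ≅-refl)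
    ; cong-inflate = λ ind two I J ne ne' _ i →
        mk⇔ (transfer i ind two I J ne ne') (transfer i ind two J I ne' ne)
    ; finiteIndex = finiteIndex-predicates (finite-Fin 2) (λ i p → Quotient p (skel i)) }
    where
    skel : Fin 2 → Perm
    skel zero    = perm12
    skel (suc _) = perm21
    skel-size : ∀ i → size (skel i) ≡ 2
    skel-size zero    = refl
    skel-size (suc _) = refl
    transfer : ∀ i {s b b' p p'} → Indecomposable s → 2 ℕ.≤ size s → Inflation s b p → Inflation s b' p' →
               (∀ i → Nonempty (b i)) → (∀ i → Nonempty (b' i)) → Quotient p (skel i) → Quotient p' (skel i)
    transfer i ind two I J ne ne' Q = quotient-resp ≅-refl
      (unique-skeleton (proj₁ (inflation⇒quotient I ne)) Q ind (indecomposable₂ {skel i} (skel-size i)) two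
        (subst (2 ℕ.≤_) (sym (skel-size i)) (s≤s (s≤s z≤n))))
      (proj₁ (inflation⇒quotient J ne'))

  parities : Congruence
  parities = record
    { _~_ = λ p q → parity (size p) ≡ parity (size q) ×
                    parity (inversions (proj₂ p)) ≡ parity (inversions (proj₂ q))
    ; isEquivalence = record
      { refl = refl , refl ; sym = λ (e , f) → sym e , sym f ; trans = λ (e , f) (e' , f') → trans e e' , trans f f' }
    ; resp = λ e → cong parity (≅-size e) , cong parity (inversions-≅ e)
    ; cong-inflate = λ _ _ I J _ _ e → size-parity I J (proj₁ ∘ e) ,
        inversions-parity I J (proj₁ ∘ e) (proj₂ ∘ e)
    ; finiteIndex = finiteIndex-∩ (parityIndex (parity ∘ size)) (parityIndex (parity ∘ λ p → inversions (proj₂ p))) }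
    where
    code : Parity → Fin 2
    code 0ℙ = zero
    code 1ℙ = suc zero
    code-injective : ∀ {x y} → code x ≡ code y → x ≡ y
    code-injective {0ℙ} {0ℙ} _ = refl
    code-injective {1ℙ} {1ℙ} _ = refl
    parityIndex : (f : Perm → Parity) → FiniteIndex (λ p q → f p ≡ f q)
    parityIndex f = 2 , code ∘ f , code-injective
    inversions-≅ : ∀ {p q} → p ≅ q → inversions (proj₂ p) ≡ inversions (proj₂ q)
    inversions-≅ {p} {q} (same e) = trans (inversions-sum p) (trans
      (sum-cong-≗ {size p} (λ x → sum-cong-≗ {size p} (λ y → χ-cong
        (λ (l , m) → l , subst₂ _<_ (e y) (e x) m)
        (λ (l , m) → l , subst₂ _<_ (sym (e y)) (sym (e x)) m))))
      (sym (inversions-sum q)))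

-- Ehrenfeucht-Fraïssé games on permutations

module Games (em : ExcludedMiddle 0ℓ) where
  open import Data.Empty using (⊥)
  open import Data.Fin.Base using (Fin; zero; suc; toℕ; _<_)
  open import Data.Maybe.Base using (Maybe; just; nothing)
  open import Data.Maybe.Properties using (just-injective)
  open import Data.Nat.Base as ℕ using (ℕ; zero; suc; parity)
  open import Data.Nat.Properties as ℕ using ()
  open import Data.Parity.Base using (0ℙ; 1ℙ)
  open import Data.Unit.Base using (⊤; tt)
  open import Function.Bundles using (_⇔_; mk⇔; Equivalence)
  open Congruences em

  -- `first′` and `last′` decide adjacency across the border of two blocks, `even` serves the Dumont
  -- condition, and `defined` says that a mark is in use.
  data Unary : Set where
    defined first′ last′ even : Unary

  data Binary : Set where
    lt vlt adj : Binary

  Sat₁ : Unary → (p : Perm) → Pos p → Set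
  Sat₁ defined p x = ⊤
  Sat₁ first′  p x = ∀ (z : Pos p) → ¬ z < x
  Sat₁ last′   p x = ∀ (z : Pos p) → ¬ x < z
  Sat₁ even    p x = parity (toℕ (val p x)) ≡ 0ℙ

  Sat₂ : Binary → (p : Perm) → Pos p → Pos p → Set
  Sat₂ lt  p x y = x < y
  Sat₂ vlt p x y = val p x < val p y
  Sat₂ adj p x y = x < y × (∀ (z : Pos p) → ¬ (x < z × z < y))

  -- Unused marks are allowed, as they arise when a marked inflation is
  -- restricted to its blocks.
  Marked : Set → Set
  Marked I = ∃ λ p → I → Maybe (Pos p)

  -- The last summand stands for the parity of the size. A value in an inflation is shifted by the
  -- sizes of the lower blocks, so `even` could not be transferred without it.
  Atom : Set → Set
  Atom I = (Unary × I) ⊎ (Binary × I × I) ⊎ ⊤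

  Holds : ∀ {I} → Atom I → Marked I → Set
  Holds (inj₁ (a , i))            (p , u) = ∃ λ x → u i ≡ just x × Sat₁ a p x
  Holds (inj₂ (inj₁ (a , i , j))) (p , u) = ∃₂ λ x y → u i ≡ just x × u j ≡ just y × Sat₂ a p x y
  Holds (inj₂ (inj₂ _))           (p , u) = parity (size p) ≡ 0ℙ

  Alike : ∀ {I} → Marked I → Marked I → Set
  Alike x y = ∀ a → Holds a x ⇔ Holds a y

  extend : ∀ {I k} ((p , _) : Marked I) → (Fin k → Maybe (Pos p)) → Marked (I ⊎ Fin k)
  extend (p , u) m = p , [ u , m ]

  -- d rounds of the Ehrenfeucht–Fraïssé game, in each of which k points
  -- are marked.
  Sim : (k d : ℕ) {I : Set} → Marked I → Marked I → Set
  Sim k zero    x y = Alike x y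
  Sim k (suc d) x y = Alike x y
    × (∀ m → ∃ λ m' → Sim k d (extend {k = k} x m) (extend y m'))
    × (∀ m' → ∃ λ m → Sim k d (extend {k = k} x m) (extend y m'))

  sim⇒alike : ∀ {k} d {I} {x y : Marked I} → Sim k d x y → Alike x y
  sim⇒alike zero    s = s
  sim⇒alike (suc d) s = proj₁ s

  ⇔-sym : ∀ {A B : Set} → A ⇔ B → B ⇔ A
  ⇔-sym e = mk⇔ (Equivalence.from e) (Equivalence.to e)

  ⇔-trans : ∀ {A B C : Set} → A ⇔ B → B ⇔ C → A ⇔ C
  ⇔-trans e f = mk⇔ (Equivalence.to f ∘ Equivalence.to e) (Equivalence.from e ∘ Equivalence.from f)

  sim-refl : ∀ {k} d {I} (x : Marked I) → Sim k d x x
  sim-refl zero    x a = mk⇔ id id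
  sim-refl (suc d) x = (λ a → mk⇔ id id) , (λ m → m , sim-refl d _) , (λ m → m , sim-refl d _)

  sim-sym : ∀ {k} d {I} {x y : Marked I} → Sim k d x y → Sim k d y x
  sim-sym zero    s a = ⇔-sym (s a)
  sim-sym (suc d) (s , forth , back) = (λ a → ⇔-sym (s a)) ,
    (λ m → proj₁ (back m) , sim-sym d (proj₂ (back m))) ,
    (λ m → proj₁ (forth m) , sim-sym d (proj₂ (forth m)))

  sim-trans : ∀ {k} d {I} {x y z : Marked I} → Sim k d x y → Sim k d y z → Sim k d x z
  sim-trans zero    s t a = ⇔-trans (s a) (t a)
  sim-trans (suc d) (s , sf , sb) (t , tf , tb) = (λ a → ⇔-trans (s a) (t a)) ,
    (λ m → proj₁ (tf (proj₁ (sf m))) , sim-trans d (proj₂ (sf m)) (proj₂ (tf (proj₁ (sf m))))) ,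
    (λ m → proj₁ (sb (proj₁ (tb m))) , sim-trans d (proj₂ (sb (proj₁ (tb m)))) (proj₂ (tb m)))

  private
    finite-Unary : Finite Unary
    finite-Unary = 4 , f , λ { defined → zero , refl ; first′ → suc zero , refl
                             ; last′ → suc (suc zero) , refl ; even → suc (suc (suc zero)) , refl }
      where f : Fin 4 → Unary
            f zero = defined
            f (suc zero) = first′
            f (suc (suc zero)) = last′
            f (suc (suc (suc _))) = even

    finite-Binary : Finite Binary
    finite-Binary = 3 , f , λ { lt → zero , refl ; vlt → suc zero , refl ; adj → suc (suc zero) , refl }
      where f : Fin 3 → Binary
            f zero = lt
            f (suc zero) = vlt
            f (suc (suc _)) = adj

    alike-finite : ∀ {I} → Finite I → FiniteIndex (Alike {I})
    alike-finite I-fin = finiteIndex-predicates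
      (finite-⊎ (finite-× finite-Unary I-fin)
        (finite-⊎ (finite-× finite-Binary (finite-× I-fin I-fin)) finite-⊤)) Holds

  -- Induction on the rounds: a position is described by its atoms together with the set of codes
  -- reachable by one more move, out of finitely many.
  sim-finite : ∀ k d {I} → Finite I → FiniteIndex (Sim k d {I})
  sim-finite k zero    I-fin = alike-finite I-fin
  sim-finite k (suc d) {I} I-fin with sim-finite k d (finite-⊎ I-fin (finite-Fin k))
  ... | K , τ , sound = finiteIndex-⊆ (λ {x} {y} (s , e) → s ,
      (λ m → let (m' , e') = Equivalence.to (e (τ (extend x m))) (m , refl) in m' , sound (sym e')) ,
      (λ m' → let (m , e') = Equivalence.from (e (τ (extend y m'))) (m' , refl) in m , sound e'))
    (finiteIndex-∩ (alike-finite I-fin)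
      (finiteIndex-predicates (finite-Fin K) (λ c x → ∃ λ m → τ (extend x m) ≡ c)))

  record Restricts {s b p I} (In : Inflation s b p) (u : I → Maybe (Pos p))
                   (us : ∀ i → I → Maybe (Pos (b i))) : Set where
    open Inflation In
    field
      to   : ∀ {i x a} → us i x ≡ just a → u x ≡ just (emb i a)
      from : ∀ {i x a} → u x ≡ just (emb i a) → us i x ≡ just a

    at : ∀ {x y} → u x ≡ just y → us (block y) x ≡ just (coord y)
    at {x} {y} e = from (trans e (cong just (sym (emb-coord y))))

  parity-⇔ : ∀ {x y} → (x ≡ 0ℙ → y ≡ 0ℙ) → (y ≡ 0ℙ → x ≡ 0ℙ) → x ≡ y
  parity-⇔ {0ℙ} {y}  f g = sym (f refl)
  parity-⇔ {1ℙ} {0ℙ} f g = g refl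
  parity-⇔ {1ℙ} {1ℙ} f g = refl

  alike-parity : ∀ {I} {x y : Marked I} → Alike x y → parity (size (proj₁ x)) ≡ parity (size (proj₁ y))
  alike-parity al = parity-⇔ (Equivalence.to (al (inj₂ (inj₂ tt)))) (Equivalence.from (al (inj₂ (inj₂ tt))))

  module _ {s b b' p p'} (In : Inflation s b p) (In' : Inflation s b' p')
           (ne : ∀ i → Nonempty (b i)) (ne' : ∀ i → Nonempty (b' i)) where
    private
      module A = Inflation In
      module B = Inflation In'

    module _ {I : Set} {u : I → Maybe (Pos p)} {us : ∀ i → I → Maybe (Pos (b i))}
             {v : I → Maybe (Pos p')} {vs : ∀ i → I → Maybe (Pos (b' i))}
             (R : Restricts In u us) (R' : Restricts In' v vs)
             (alike : ∀ i → Alike (b i , us i) (b' i , vs i)) where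
      private
        module R = Restricts R
        module R' = Restricts R'

        unary : ∀ a {i x c} → us i x ≡ just c → Sat₁ a (b i) c →
                ∃ λ c' → vs i x ≡ just c' × Sat₁ a (b' i) c'
        unary a {i} {x} {c} e h = Equivalence.to (alike i (inj₁ (a , x))) (c , e , h)

        binary : ∀ a {i x y c d} → us i x ≡ just c → us i y ≡ just d → Sat₂ a (b i) c d →
                 ∃₂ λ c' d' → vs i x ≡ just c' × vs i y ≡ just d' × Sat₂ a (b' i) c' d'
        binary a {i} {x} {y} {c} {d} e f h = Equivalence.to (alike i (inj₂ (inj₁ (a , x , y)))) (c , d , e , f , h)

        transfer₁ : ∀ a {i x c} → us i x ≡ just c → Sat₁ a p (A.emb i c) →
                    ∃ λ y → v x ≡ just y × Sat₁ a p' y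
        transfer₁ defined e _ = let (c' , e' , _) = unary defined e tt in _ , R'.to e' , tt
        transfer₁ first′ {i} e h =
          let (c' , e' , h') = unary first′ e (λ z l → h _ (A.pos-in l)) in _ , R'.to e' , λ z l → below h' z l
          where
          below : ∀ {c' : Pos (b' i)} → (∀ (z : Pos (b' i)) → ¬ z < c') → ∀ (z : Pos p') → ¬ z < B.emb i c'
          below h' z l with B.pos-cases (subst (_< _) (sym (B.emb-coord z)) l)
          -- An element of an earlier block of `p'` yields one of `p`, as the corresponding block of
          -- `p` is nonempty.
          ... | inj₁ k<i = h (A.emb (B.block z) (first (b (B.block z)) (ne (B.block z)))) (A.pos-out k<i)
          ... | inj₂ (e , l') = h' _ l'
        transfer₁ last′ {i} e h =
          let (c' , e' , h') = unary last′ e (λ z l → h _ (A.pos-in l)) in _ , R'.to e' , λ z l → above h' z l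
          where
          above : ∀ {c' : Pos (b' i)} → (∀ (z : Pos (b' i)) → ¬ c' < z) → ∀ (z : Pos p') → ¬ B.emb i c' < z
          above {c'} h' z l with B.block z | B.coord z | B.emb-coord z
          ... | k | d | refl with B.pos-cases l
          ... | inj₁ i<k = h (A.emb k (first (b k) (ne k))) (A.pos-out i<k)
          ... | inj₂ (refl , l') = h' _ l'
        transfer₁ even {i} {x} {c} e h =
          let (c' , e' , _) = unary defined e tt in _ , R'.to e' ,
            trans (sym (value-parity In In' (λ i → alike-parity (alike i)) i c c' (parity-⇔ (fwd e') (bwd e')))) h
          where
          fwd : ∀ {c'} → vs i x ≡ just c' → parity (toℕ (val (b i) c)) ≡ 0ℙ → parity (toℕ (val (b' i) c')) ≡ 0ℙ
          fwd e' h = let (d , f , h') = unary even e h in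
            subst (λ d → parity (toℕ (val (b' i) d)) ≡ 0ℙ) (just-injective (trans (sym f) e')) h'
          bwd : ∀ {c'} → vs i x ≡ just c' → parity (toℕ (val (b' i) c')) ≡ 0ℙ → parity (toℕ (val (b i) c)) ≡ 0ℙ
          bwd {c'} e' h = let (d , f , h') = Equivalence.from (alike i (inj₁ (even , x))) (c' , e' , h) in
            subst (λ d → parity (toℕ (val (b i) d)) ≡ 0ℙ) (just-injective (trans (sym f) e)) h'

        transfer₂ : ∀ a {i j x y c d} → us i x ≡ just c → us j y ≡ just d → Sat₂ a p (A.emb i c) (A.emb j d) →
                    ∃₂ λ z w → v x ≡ just z × v y ≡ just w × Sat₂ a p' z w
        transfer₂ lt e f h with A.pos-cases h
        ... | inj₁ i<j = let (c' , e' , _) = unary defined e tt ; (d' , f' , _) = unary defined f tt in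
                         _ , _ , R'.to e' , R'.to f' , B.pos-out i<j
        ... | inj₂ (refl , l) = let (c' , d' , e' , f' , l') = binary lt e f l in
                         _ , _ , R'.to e' , R'.to f' , B.pos-in l'
        transfer₂ vlt e f h with A.val-cases h
        ... | inj₁ i<j = let (c' , e' , _) = unary defined e tt ; (d' , f' , _) = unary defined f tt in
                         _ , _ , R'.to e' , R'.to f' , B.val-out i<j
        ... | inj₂ (refl , l) = let (c' , d' , e' , f' , l') = binary vlt e f l in
                         _ , _ , R'.to e' , R'.to f' , B.val-in l'
        transfer₂ adj {i} {j} {c = c} {d} e f (h , gap) with A.pos-cases h
        ... | inj₂ (refl , l) =
          let (c' , d' , e' , f' , l' , gap') = binary adj e f (l , λ z (l₁ , l₂) → gap _ (A.pos-in l₁ , A.pos-in l₂)) in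
          _ , _ , R'.to e' , R'.to f' , B.pos-in l' , λ z → between gap' z
          where
          between : ∀ {c' d' : Pos (b' i)} → (∀ (z : Pos (b' i)) → ¬ (c' < z × z < d')) →
                    ∀ (z : Pos p') → ¬ (B.emb i c' < z × z < B.emb i d')
          between gap' z (l₁ , l₂) with B.block z | B.coord z | B.emb-coord z
          ... | k | g | refl with B.pos-cases l₁ | B.pos-cases l₂
          ... | inj₁ i<k      | inj₁ k<i       = ℕ.<-asym i<k k<i
          ... | inj₁ i<k      | inj₂ (refl , _) = ℕ.<-irrefl refl i<k
          ... | inj₂ (refl , _) | inj₁ k<i     = ℕ.<-irrefl refl k<i
          ... | inj₂ (refl , m₁) | inj₂ (refl , m₂) = gap' _ (m₁ , m₂)
        -- Adjacency across blocks: the left element is last in its block, the right one is first in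
        -- its block, and no block lies between.
        ... | inj₁ i<j =
          let (c' , e' , h₁) = unary last′ e (λ z l → gap _ (A.pos-in l , A.pos-out i<j))
              (d' , f' , h₂) = unary first′ f (λ z l → gap _ (A.pos-out i<j , A.pos-in l)) in
          _ , _ , R'.to e' , R'.to f' , B.pos-out i<j , λ z → between h₁ h₂ z
          where
          between : ∀ {c' : Pos (b' i)} {d' : Pos (b' j)} → (∀ (z : Pos (b' i)) → ¬ c' < z) →
                    (∀ (z : Pos (b' j)) → ¬ z < d') → ∀ (z : Pos p') → ¬ (B.emb i c' < z × z < B.emb j d')
          between h₁ h₂ z (l₁ , l₂) with B.block z | B.coord z | B.emb-coord z
          ... | k | g | refl with B.pos-cases l₁ | B.pos-cases l₂
          ... | inj₂ (refl , m) | _              = h₁ _ m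
          ... | inj₁ _          | inj₂ (refl , m) = h₂ _ m
          ... | inj₁ i<k        | inj₁ k<j       =
            gap (A.emb k (first (b k) (ne k))) (A.pos-out i<k , A.pos-out k<j)

      alike-inflate→ : ∀ a → Holds a (p , u) → Holds a (p' , v)
      alike-inflate→ (inj₁ (a , x)) (y , e , h) =
        transfer₁ a (R.at e) (subst (Sat₁ a p) (sym (A.emb-coord y)) h)
      alike-inflate→ (inj₂ (inj₁ (a , x , y))) (z , w , e , f , h) =
        transfer₂ a (R.at e) (R.at f) (subst₂ (Sat₂ a p) (sym (A.emb-coord z)) (sym (A.emb-coord w)) h)
      alike-inflate→ (inj₂ (inj₂ tt)) h =
        trans (sym (size-parity In In' (λ i → alike-parity (alike i)))) h

  module _ {s b p} (In : Inflation s b p) {I : Set} where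
    open Inflation In
    restrict : (u : I → Maybe (Pos p)) → ∃ (Restricts In u)
    restrict u = us , record { to = to ; from = from }
      where
      us : ∀ i → I → Maybe (Pos (b i))
      us i x with em {∃ λ a → u x ≡ just (emb i a)}
      ... | yes (a , _) = just a
      ... | no _        = nothing
      to : ∀ {i x a} → us i x ≡ just a → u x ≡ just (emb i a)
      to {i} {x} e with em {∃ λ a → u x ≡ just (emb i a)}
      to refl | yes (a , e) = e
      from : ∀ {i x a} → u x ≡ just (emb i a) → us i x ≡ just a
      from {i} {x} {a} e with em {∃ λ a → u x ≡ just (emb i a)}
      ... | yes (c , f) = cong just (monotone⇒injective pos-in (just-injective (trans (sym f) e)))
      ... | no none     = contradiction (a , e) none

    glue : (us : ∀ i → I → Maybe (Pos (b i))) →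
           (∀ {i j x a c} → us i x ≡ just a → us j x ≡ just c → i ≡ j) → ∃ λ u → Restricts In u us
    glue us disjoint = u , record { to = to ; from = from }
      where
      u : I → Maybe (Pos p)
      u x with em {∃₂ λ i a → us i x ≡ just a}
      ... | yes (i , a , _) = just (emb i a)
      ... | no _            = nothing
      to : ∀ {i x a} → us i x ≡ just a → u x ≡ just (emb i a)
      to {i} {x} {a} e with em {∃₂ λ i a → us i x ≡ just a}
      ... | no none = contradiction (i , a , e) none
      ... | yes (j , c , f) with refl ← disjoint f e = cong (just ∘ emb j) (just-injective (trans (sym f) e))
      from : ∀ {i x a} → u x ≡ just (emb i a) → us i x ≡ just a
      from {i} {x} {a} e with em {∃₂ λ i a → us i x ≡ just a}
      from {i} {x} {a} e | yes (j , c , f) with emb-injective (just-injective e)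
      ... | refl , refl = f

    restricts-disjoint : ∀ {u : I → Maybe (Pos p)} {us} → Restricts In u us →
                         ∀ {i j x a c} → us i x ≡ just a → us j x ≡ just c → i ≡ j
    restricts-disjoint R e f = proj₁ (emb-injective (just-injective (trans (sym (R.to e)) (R.to f))))
      where module R = Restricts R

  restricts-extend : ∀ {s b p} (In : Inflation s b p) {I J : Set} {u : I → Maybe (Pos p)} {us} {m : J → Maybe (Pos p)} {ms : ∀ i → J → Maybe (Pos (b i))} →
                     Restricts In u us → Restricts In m ms → Restricts In [ u , m ] (λ i → [ us i , ms i ])
  restricts-extend In R M = record
    { to = λ { {x = inj₁ x} → R.to ; {x = inj₂ x} → M.to }
    ; from = λ { {x = inj₁ x} → R.from ; {x = inj₂ x} → M.from } }
    where module R = Restricts R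
          module M = Restricts M

  module _ {s b b' p p'} (In : Inflation s b p) (In' : Inflation s b' p')
           (ne : ∀ i → Nonempty (b i)) (ne' : ∀ i → Nonempty (b' i)) {k : ℕ} where

    -- A move is restricted to the blocks, answered in each block separately, and the replies are
    -- glued. Gluing requires that no mark is used in two blocks; this holds for the restricted move
    -- and passes to the replies through the atom `defined`.
    sim-inflate : ∀ d {I : Set} {u : I → Maybe (Pos p)} {us v vs} → Restricts In u us → Restricts In' v vs →
                  (∀ i → Sim k d (b i , us i) (b' i , vs i)) → Sim k d (p , u) (p' , v)
    sim-inflate d {I} {u} {us} {v} {vs} R R' sims = go d sims
      where
      alike : ∀ d → (∀ i → Sim k d (b i , us i) (b' i , vs i)) → Alike (p , u) (p' , v)
      alike d sims a = mk⇔ (alike-inflate→ In In' ne ne' R R' (λ i → sim⇒alike d (sims i)) a)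
        (alike-inflate→ In' In ne' ne R' R (λ i a → ⇔-sym (sim⇒alike d (sims i) a)) a)
      moved : ∀ d {J : Set} {i} {w : J → Maybe (Pos (b i))} {w' : J → Maybe (Pos (b' i))} {m m'} →
              Sim k d (extend {k = k} (b i , w) m) (extend (b' i , w') m') →
              ∀ {x a} → m' x ≡ just a → ∃ λ c → m x ≡ just c
      moved d s {x} e = let (c , f , _) = Equivalence.from (sim⇒alike d s (inj₁ (defined , inj₂ x))) (_ , e , tt) in c , f
      moved' : ∀ d {J : Set} {i} {w : J → Maybe (Pos (b i))} {w' : J → Maybe (Pos (b' i))} {m m'} →
              Sim k d (extend {k = k} (b i , w) m) (extend (b' i , w') m') →
              ∀ {x a} → m x ≡ just a → ∃ λ c → m' x ≡ just c
      moved' d s {x} e = let (c , f , _) = Equivalence.to (sim⇒alike d s (inj₁ (defined , inj₂ x))) (_ , e , tt) in c , f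
      go : ∀ d → (∀ i → Sim k d (b i , us i) (b' i , vs i)) → Sim k d (p , u) (p' , v)
      go zero    sims = alike zero sims
      go (suc d) sims = alike (suc d) sims ,
        (λ m → let (ms , M) = restrict In m
                   reply : ∀ i → ∃ λ m' → Sim k d (extend {k = k} (b i , us i) (ms i)) (extend (b' i , vs i) m')
                   reply i = proj₁ (proj₂ (sims i)) (ms i)
                   (m' , M') = glue In' (proj₁ ∘ reply) (λ e f → restricts-disjoint In M
                     (proj₂ (moved d (proj₂ (reply _)) e)) (proj₂ (moved d (proj₂ (reply _)) f)))
               in m' , sim-inflate d (restricts-extend In R M) (restricts-extend In' R' M') (proj₂ ∘ reply)) ,
        (λ m' → let (ms' , M') = restrict In' m'
                    reply : ∀ i → ∃ λ m → Sim k d (extend {k = k} (b i , us i) m) (extend (b' i , vs i) (ms' i))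
                    reply i = proj₂ (proj₂ (sims i)) (ms' i)
                    (m , M) = glue In (proj₁ ∘ reply) (λ e f → restricts-disjoint In' M'
                      (proj₂ (moved' d (proj₂ (reply _)) e)) (proj₂ (moved' d (proj₂ (reply _)) f)))
                in m , sim-inflate d (restricts-extend In R M) (restricts-extend In' R' M') (proj₂ ∘ reply))

  sim-≅ : ∀ {k} d {I} {n π ρ} → (∀ i → val (n , π) i ≡ val (n , ρ) i) →
          (u : I → Maybe (Fin n)) → Sim k d ((n , π) , u) ((n , ρ) , u)
  sim-≅ {k} d {I} {n} {π} {ρ} e u = go d
    where
    holds : ∀ {π ρ} → (∀ i → val (n , π) i ≡ val (n , ρ) i) → ∀ (a : Atom I) → Holds a ((n , π) , u) → Holds a ((n , ρ) , u)
    holds e (inj₁ (defined , _)) h = h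
    holds e (inj₁ (first′ , _))  h = h
    holds e (inj₁ (last′ , _))   h = h
    holds e (inj₁ (even , _)) (x , f , h) = x , f , trans (cong (parity ∘ toℕ) (sym (e x))) h
    holds e (inj₂ (inj₁ (lt , _)))  h = h
    holds e (inj₂ (inj₁ (adj , _))) h = h
    holds e (inj₂ (inj₁ (vlt , _))) (x , y , f , g , h) = x , y , f , g , subst₂ _<_ (e x) (e y) h
    holds e (inj₂ (inj₂ _)) h = h
    alike : Alike ((n , π) , u) ((n , ρ) , u)
    alike a = mk⇔ (holds e a) (holds (sym ∘ e) a)
    go : ∀ d → Sim k d ((n , π) , u) ((n , ρ) , u)
    go zero    = alike
    go (suc d) = alike , (λ m → m , sim-≅ d e _) , (λ m → m , sim-≅ d e _)

  unmarked : Perm → Marked ⊥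
  unmarked p = p , λ ()

  game : ℕ → ℕ → Congruence
  game k d = record
    { _~_ = λ p q → Sim k d (unmarked p) (unmarked q)
    ; isEquivalence = record
      { refl = sim-refl d _ ; sym = sim-sym d ; trans = sim-trans d }
    ; resp = λ { (same e) → sim-≅' e }
    ; cong-inflate = λ _ _ I J ne ne' sims → sim-inflate I J ne ne' d
        (record { to = λ { {x = ()} } ; from = λ { {x = ()} } })
        (record { to = λ { {x = ()} } ; from = λ { {x = ()} } }) sims
    ; finiteIndex = let (K , τ , sound) = sim-finite k d (0 , (λ ()) , λ ()) in K , τ ∘ unmarked , sound }
    where
    sim-≅' : ∀ {n π ρ} → (∀ i → val (n , π) i ≡ val (n , ρ) i) → Sim k d (unmarked (n , π)) (unmarked (n , ρ))
    sim-≅' e = sim-≅ d e (λ ())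

-- Conditions as unions of congruence classes

module ConditionCongruences (em : ExcludedMiddle 0ℓ) where
  open import Data.Fin.Base using (Fin; zero; suc; toℕ; _<_; fromℕ<)
  open import Data.Fin.Patterns using (0F; 1F; 2F)
  open import Data.Fin.Properties using (<-cmp; toℕ<n; toℕ-fromℕ<)
  open import Data.Fin.Subset using (∁)
  open import Data.Fin.Subset.Properties using (_∈?_)
  open import Data.List.Base using (List; []; _∷_)
  open import Data.List.Relation.Unary.All using (All; []; _∷_)
  open import Data.Maybe.Base using (Maybe; just; nothing)
  open import Data.Maybe.Properties using (just-injective)
  open import Data.Nat.Base as ℕ using (ℕ; zero; suc; parity; s≤s)
  open import Data.Nat.Divisibility using (_∣_)
  open import Data.Nat.Properties as ℕ using ()
  open import Data.Parity.Base using (Parity; 0ℙ; 1ℙ; _⁻¹)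
  open import Data.Parity.Properties using (suc-homo-⁻¹)
  open import Data.Unit.Base using (⊤; tt)
  open import Data.Vec.Properties.WithK using ([]=-irrelevant)
  open import Function.Bundles using (mk⇔; Equivalence)
  open Congruences em public
  open Games em
  open Congruence

  Saturates : Congruence → (Perm → Set) → Set
  Saturates C P = ∀ {p q} → C ._~_ p q → P p → P q

  module _ {I : Set} {x y : Marked I} (alike : Alike x y) where
    private
      p = proj₁ x
      q = proj₁ y
      u = proj₂ x
      v = proj₂ y

    image : ∀ {i a} → u i ≡ just a → ∃ λ c → v i ≡ just c
    image {i} e = let (c , f , _) = Equivalence.to (alike (inj₁ (defined , i))) (_ , e , tt) in c , f

    move₁ : ∀ b {i a a'} → u i ≡ just a → v i ≡ just a' → Sat₁ b p a → Sat₁ b q a'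
    move₁ b {i} e e' h = let (c , f , h') = Equivalence.to (alike (inj₁ (b , i))) (_ , e , h) in
      subst (Sat₁ b q) (just-injective (trans (sym f) e')) h'

    move₂ : ∀ b {i j a c a' c'} → u i ≡ just a → u j ≡ just c → v i ≡ just a' → v j ≡ just c' →
            Sat₂ b p a c → Sat₂ b q a' c'
    move₂ b {i} {j} e f e' f' h =
      let (d , d' , g , g' , h') = Equivalence.to (alike (inj₂ (inj₁ (b , i , j)))) (_ , _ , e , f , h) in
      subst₂ (Sat₂ b q) (just-injective (trans (sym g) e')) (just-injective (trans (sym g') f')) h'

  alike-sym : ∀ {I} {x y : Marked I} → Alike x y → Alike y x
  alike-sym al a = ⇔-sym (al a)

  next⇒adj : ∀ p {i j : Pos p} → j NextTo i → Sat₂ adj p i j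
  next⇒adj p {i} {j} e = subst (toℕ i ℕ.<_) (sym e) ℕ.≤-refl ,
    λ z (l , m) → ℕ.<⇒≱ m (subst (ℕ._≤ toℕ z) (sym e) l)

  adj⇒next : ∀ p {i j : Pos p} → Sat₂ adj p i j → j NextTo i
  adj⇒next p {i} {j} (l , gap) with ℕ.m≤n⇒m<n∨m≡n l
  ... | inj₂ e = sym e
  ... | inj₁ m = contradiction (subst (toℕ i ℕ.<_) (sym z≡) ℕ.≤-refl , subst (ℕ._< toℕ j) (sym z≡) m) (gap z)
    where
    z : Pos p
    z = fromℕ< (ℕ.<-trans m (toℕ<n j))
    z≡ : toℕ z ≡ suc (toℕ i)
    z≡ = toℕ-fromℕ< _

  last⇒end : ∀ p {i : Pos p} → Sat₁ last′ p i → suc (toℕ i) ≡ size p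
  last⇒end p {i} h with ℕ.m≤n⇒m<n∨m≡n (toℕ<n i)
  ... | inj₂ e = e
  ... | inj₁ l = contradiction (subst (toℕ i ℕ.<_) (sym (toℕ-fromℕ< l)) ℕ.≤-refl) (h (fromℕ< l))

  end⇒last : ∀ p {i : Pos p} → suc (toℕ i) ≡ size p → Sat₁ last′ p i
  end⇒last p e z l = ℕ.<⇒≱ (toℕ<n z) (subst (ℕ._≤ toℕ z) e l)

  even-saturated : Saturates parities (λ p → EvenPerm (proj₂ p))
  even-saturated (_ , e) ev = Equivalence.from (even⇔parity _) (trans (sym e) (Equivalence.to (even⇔parity _) ev))

  -- A violation in `q` consists of three consecutive entries; marking them is one move, and the
  -- reply is a violation in `p`.
  alternating-saturated : Saturates (game 3 1) (λ p → Alternating (proj₂ p))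
  alternating-saturated {p} {q} (_ , _ , back) alt i j k ij jk between =
    alt (f 0F) (f 1F) (f 2F) (next 0F 1F ij) (next 1F 2F jk) (betw between)
    where
    points : Fin 3 → Pos q
    points 0F = i
    points 1F = j
    points 2F = k
    alike = proj₂ (back (just ∘ points))
    f∃ : ∀ a → ∃ λ x → proj₁ (back (just ∘ points)) a ≡ just x
    f∃ a = image (alike-sym alike) {inj₂ a} refl
    f : Fin 3 → Pos p
    f = proj₁ ∘ f∃
    next : ∀ a c → points c NextTo points a → f c NextTo f a
    next a c e = adj⇒next p (move₂ (alike-sym alike) adj {inj₂ a} {inj₂ c} refl refl (proj₂ (f∃ a)) (proj₂ (f∃ c)) (next⇒adj q e))
    value : ∀ a c → val q (points a) < val q (points c) → val p (f a) < val p (f c)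
    value a c = move₂ (alike-sym alike) vlt {inj₂ a} {inj₂ c} refl refl (proj₂ (f∃ a)) (proj₂ (f∃ c))
    betw : Between (val q i) (val q j) (val q k) → Between (val p (f 0F)) (val p (f 1F)) (val p (f 2F))
    betw (inj₁ (l , m)) = inj₁ (value 0F 1F l , value 1F 2F m)
    betw (inj₂ (l , m)) = inj₂ (value 2F 1F l , value 1F 0F m)

  -- An occurrence is a single move marking all its entries; gaps without a dash are preserved
  -- because `adj` is an atom.
  blocked-saturated : ∀ β → Saturates (game (Blocked.size β) 1) (λ p → AvoidsBlocked (proj₂ p) β)
  blocked-saturated β {p} {q} (_ , _ , back) avoids (g , occ , blocks) = avoids (f , record
    { positions = λ a c l → move₂ al lt {inj₂ a} {inj₂ c} refl refl (f-eq a) (f-eq c) (occ.positions a c l)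
    ; values = λ a c → ⇔-trans (occ.values a c) (mk⇔
        (move₂ al vlt {inj₂ a} {inj₂ c} refl refl (f-eq a) (f-eq c))
        (move₂ alike vlt {inj₂ a} {inj₂ c} (f-eq a) (f-eq c) refl refl)) } ,
    λ d i j d∉ e ij → adj⇒next p (move₂ al adj {inj₂ i} {inj₂ j} refl refl (f-eq i) (f-eq j)
      (next⇒adj q (blocks d i j d∉ e ij))))
    where
    module occ = OrderIso occ
    alike = proj₂ (back (just ∘ g))
    al = alike-sym alike
    f : Fin (Blocked.size β) → Pos p
    f a = proj₁ (image al {inj₂ a} refl)
    f-eq : ∀ a → proj₁ (back (just ∘ g)) a ≡ just (f a)
    f-eq a = proj₂ (image al {inj₂ a} refl)

  -- Two rounds mirror the two quantifiers: an occurrence of the unbarred entries in `q` is answered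
  -- in `p`, and its extension, which exists in `p`, is answered in `q`.
  barred-saturated : ∀ β → Saturates (game (Barred.size β) 2) (λ p → AvoidsBarred (proj₂ p) β)
  barred-saturated β {p} {q} (_ , _ , back) avoids f occ = g' , record
    { positions = λ a c l → move₂ alike₂ lt {inj₂ a} {inj₂ c} refl refl (g'-eq a) (g'-eq c) (Occ.positions a c l)
    ; values = λ a c → ⇔-trans (Occ.values a c) (mk⇔
        (move₂ alike₂ vlt {inj₂ a} {inj₂ c} refl refl (g'-eq a) (g'-eq c))
        (move₂ al₂ vlt {inj₂ a} {inj₂ c} (g'-eq a) (g'-eq c) refl refl)) } ,
    agree
    where
    open Barred β renaming (size to k; barred to bars)
    module F = OrderIso occ
    -- Barred entries remain unmarked in the first round.
    mark : Fin k → Maybe (Pos q)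
    mark a with a ∈? ∁ bars
    ... | yes h = just (f (a , h))
    ... | no _  = nothing
    mark-eq : ∀ u → mark (proj₁ u) ≡ just (f u)
    mark-eq (a , h) with a ∈? ∁ bars
    ... | yes h' = cong (λ h → just (f (a , h))) ([]=-irrelevant h' h)
    ... | no ¬h  = contradiction h ¬h
    round₁ = proj₂ (back mark)
    al₁ = alike-sym (sim⇒alike 1 round₁)
    fp : Unbarred → Pos p
    fp u = proj₁ (image al₁ {inj₂ (proj₁ u)} (mark-eq u))
    fp-eq : ∀ u → proj₁ (back mark) (proj₁ u) ≡ just (fp u)
    fp-eq u = proj₂ (image al₁ {inj₂ (proj₁ u)} (mark-eq u))
    occp : OrderIso proj₁ perm (proj₂ p) fp
    occp = record
      { positions = λ a c l → move₂ al₁ lt {inj₂ (proj₁ a)} {inj₂ (proj₁ c)} (mark-eq a) (mark-eq c) (fp-eq a) (fp-eq c) (F.positions a c l)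
      ; values = λ a c → ⇔-trans (F.values a c) (mk⇔
          (move₂ al₁ vlt {inj₂ (proj₁ a)} {inj₂ (proj₁ c)} (mark-eq a) (mark-eq c) (fp-eq a) (fp-eq c))
          (move₂ (alike-sym al₁) vlt {inj₂ (proj₁ a)} {inj₂ (proj₁ c)} (fp-eq a) (fp-eq c) (mark-eq a) (mark-eq c))) }
    extension = avoids fp occp
    g : Fin k → Pos p
    g = proj₁ extension
    module Occ = OrderIso (proj₁ (proj₂ extension))
    round₂ = proj₁ (proj₂ round₁) (just ∘ g)
    alike₂ = proj₂ round₂
    al₂ = alike-sym alike₂
    g' : Fin k → Pos q
    g' a = proj₁ (image alike₂ {inj₂ a} refl)
    g'-eq : ∀ a → proj₁ round₂ a ≡ just (g' a)
    g'-eq a = proj₂ (image alike₂ {inj₂ a} refl)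
    -- Equality is not an atom. It follows because `lt` in either direction would carry over to `p`,
    -- where the two marks coincide.
    agree : ∀ u → g' (proj₁ u) ≡ f u
    agree u with <-cmp (g' (proj₁ u)) (f u)
    ... | tri≈ _ e _ = e
    ... | tri< l _ _ = contradiction (proj₂ (proj₂ extension) u)
      (<⇒≢ (move₂ al₂ lt {inj₂ (proj₁ u)} {inj₁ (inj₂ (proj₁ u))} (g'-eq _) (mark-eq u) refl (fp-eq u) l))
    ... | tri> _ _ l = contradiction (sym (proj₂ (proj₂ extension) u))
      (<⇒≢ (move₂ al₂ lt {inj₁ (inj₂ (proj₁ u))} {inj₂ (proj₁ u)} (mark-eq u) (g'-eq _) (fp-eq u) refl l))

  -- Entries are numbered from 1, so that their parity is opposite to that
  -- of the corresponding element of Fin.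
  entry-even⇒odd : ∀ p {i} → 2 ∣ entry (proj₂ p) i → ¬ Sat₁ even p i
  entry-even⇒odd p {i} d e with Equivalence.to (even⇔parity _) d
  ... | e' with () ← trans (sym e) (trans (sym (suc-homo-⁻¹ (toℕ (val p i)))) (cong _⁻¹ e'))

  odd⇒entry-even : ∀ p {i} → ¬ Sat₁ even p i → 2 ∣ entry (proj₂ p) i
  odd⇒entry-even p {i} h = Equivalence.from (even⇔parity _) (flip (parity (suc (toℕ (val p i)))) refl)
    where
    flip : ∀ x → parity (suc (toℕ (val p i))) ≡ x → parity (suc (toℕ (val p i))) ≡ 0ℙ
    flip 0ℙ e = e
    flip 1ℙ e = contradiction (trans (sym (suc-homo-⁻¹ (toℕ (val p i)))) (cong _⁻¹ e)) h

  -- The first round marks an entry of `q`; the second carries the right neighbour of the reply back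
  -- from `p` to `q`. Being the last entry is an atom.
  dumont-saturated : Saturates (game 1 2) (λ p → Dumont₁ (proj₂ p))
  dumont-saturated {p} {q} (_ , _ , back) D = record { even = even-case ; odd = odd-case }
    where
    module D = Dumont₁ D
    module Round (i : Pos q) where
      round₁ = proj₂ (back (λ _ → just i))
      al₁ = alike-sym (sim⇒alike 1 round₁)
      x : Pos p
      x = proj₁ (image al₁ {inj₂ 0F} refl)
      x-eq : proj₁ (back (λ _ → just i)) 0F ≡ just x
      x-eq = proj₂ (image al₁ {inj₂ 0F} refl)
      parity→ : Sat₁ even q i → Sat₁ even p x
      parity→ = move₁ al₁ even {inj₂ 0F} refl x-eq
      parity← : Sat₁ even p x → Sat₁ even q i
      parity← = move₁ (alike-sym al₁) even {inj₂ 0F} x-eq refl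
      end : suc (toℕ x) ≡ size p → suc (toℕ i) ≡ size q
      end e = last⇒end q (move₁ (alike-sym al₁) last′ {inj₂ 0F} x-eq refl (end⇒last p e))
      follow : ∀ y → y NextTo x → ∃ λ j → j NextTo i ×
               (val p x < val p y → val q i < val q j) × (val p y < val p x → val q j < val q i)
      follow y e = j , adj⇒next q (move₂ alike₂ adj {inj₁ (inj₂ 0F)} {inj₂ 0F} x-eq refl refl j-eq (next⇒adj p e)) ,
        move₂ alike₂ vlt {inj₁ (inj₂ 0F)} {inj₂ 0F} x-eq refl refl j-eq ,
        move₂ alike₂ vlt {inj₂ 0F} {inj₁ (inj₂ 0F)} refl x-eq j-eq refl
        where
        round₂ = proj₁ (proj₂ round₁) (λ _ → just y)
        alike₂ = proj₂ round₂
        j : Pos q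
        j = proj₁ (image alike₂ {inj₂ 0F} refl)
        j-eq : proj₁ round₂ 0F ≡ just j
        j-eq = proj₂ (image alike₂ {inj₂ 0F} refl)
    even-case : ∀ i → 2 ∣ entry (proj₂ q) i → ∃ λ j → j NextTo i × entry (proj₂ q) j ℕ.< entry (proj₂ q) i
    even-case i d = let (y , e , l) = D.even x (odd⇒entry-even p (entry-even⇒odd q d ∘ parity←))
                        (j , e' , _ , down) = follow y e in j , e' , s≤s (down (ℕ.s≤s⁻¹ l))
      where open Round i
    odd-case : ∀ i → ¬ (2 ∣ entry (proj₂ q) i) →
               (∃ λ j → j NextTo i × entry (proj₂ q) i ℕ.< entry (proj₂ q) j) ⊎ suc (toℕ i) ≡ size q
    odd-case i ¬d with D.odd (Round.x i) (λ d → ¬d (odd⇒entry-even q (entry-even⇒odd p d ∘ Round.parity→ i)))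
    ... | inj₂ e = inj₂ (Round.end i e)
    ... | inj₁ (y , e , s≤s l) = let (j , e' , up , _) = Round.follow i y e in inj₁ (j , e' , s≤s (up l))

  pattern-congruence : ∀ β → ∃ λ C → Saturates C (λ p → Avoids (proj₂ p) β)
  pattern-congruence (blocked β) = game (Blocked.size β) 1 , λ {p} {q} → blocked-saturated β {p} {q}
  pattern-congruence (barred β)  = game (Barred.size β) 2 , λ {p} {q} → barred-saturated β {p} {q}

  patterns-congruence : ∀ B → ∃ λ C → Saturates C (λ p → AvoidsAll B (proj₂ p))
  patterns-congruence []      = parities , λ _ _ → []
  patterns-congruence (β ∷ B) with pattern-congruence β | patterns-congruence B
  ... | C , c | D , d = congruence-∩ C D , λ { (e , f) (h ∷ hs) → c e h ∷ d f hs }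

  -- The conditions that are determined by congruences: all but (5).
  NonInvolutive : Condition → Perm → Set
  NonInvolutive involution p = ⊤
  NonInvolutive c          p = Satisfies (proj₂ p) c

  condition-congruence : ∀ c → ∃ λ C → Saturates C (NonInvolutive c)
  condition-congruence alternating  = game 3 1 , λ {p} {q} → alternating-saturated {p} {q}
  condition-congruence evenPerm     = parities , λ {p} {q} → even-saturated {p} {q}
  condition-congruence dumont₁      = game 1 2 , λ {p} {q} → dumont-saturated {p} {q}
  condition-congruence involution   = parities , λ _ _ → tt
  condition-congruence (avoiding B) = patterns-congruence B

  conditions-congruence : ∀ cs → ∃ λ C → Saturates C (λ p → All (λ c → NonInvolutive c p) cs)
  conditions-congruence []       = parities , λ _ _ → []
  conditions-congruence (c ∷ cs) with condition-congruence c | conditions-congruence cs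
  ... | C , f | D , g = congruence-∩ C D , λ { (e , e') (h ∷ hs) → f e h ∷ g e' hs }

-- The system of equations

module PermutationSeries (em : ExcludedMiddle 0ℓ) where
  open import Data.Fin.Base using (Fin; zero; suc; funToFin; finToFun)
  open import Data.Fin.Permutation using (Permutation′; _⟨$⟩ʳ_)
  open import Data.Fin.Properties using (finToFun-funToFin)
  open import Data.Nat.Base as ℕ using (ℕ; zero; suc; NonZero; _+_; _*_; _^_)
  open import Data.Nat.Properties as ℕ using ()
  open import Data.Product.Relation.Binary.Pointwise.NonDependent using (×-isEquivalence) renaming (Pointwise to ×-Pointwise)
  open import Data.Rational.Base as ℚ using (ℚ; 0ℚ; 1ℚ)
  open import Data.Rational.Properties as ℚ using ()
  open import Data.Vec.Functional using (_∷_)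
  open Congruences em
  open Enumerations
  open RationalSeries

  ≅-isEquivalence : IsEquivalence _≅_
  ≅-isEquivalence = record { refl = ≅-refl ; sym = ≅-sym ; trans = ≅-trans }

  module _ (P : Perm → Set) where

    -- Permutations are coded by their value vectors among n^n codes, and the codes of those
    -- satisfying `P` are enumerated.
    enumerates-size : ∀ n → ∃ λ k → Enumerates _≅_ (λ p → P p × size p ≡ n) k
    enumerates-size n = E.size , record
      { at = λ a → n , proj₁ (E.sound a)
      ; sound = λ a → proj₁ (proj₂ (E.sound a)) , refl
      ; distinct = λ {a} {b} e → monotone⇒injective E.monotone
          (trans (sym (proj₂ (proj₂ (E.sound a)))) (trans (code-cong e) (proj₂ (proj₂ (E.sound b)))))
      ; complete = λ { {_ , π} (p , refl) →
          let (a , e) = E.complete (code π) (π , p , refl)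
          in a , same (code-injective {proj₁ (E.sound a)} {π} (trans (proj₂ (proj₂ (E.sound a))) e)) } }
      where
      code : Permutation′ n → Fin (n ^ n)
      code π = funToFin (π ⟨$⟩ʳ_)
      code-injective : ∀ {π ρ} → code π ≡ code ρ → ∀ i → π ⟨$⟩ʳ i ≡ ρ ⟨$⟩ʳ i
      code-injective {π} {ρ} e i = trans (sym (finToFun-funToFin (π ⟨$⟩ʳ_) i))
        (trans (cong (λ c → finToFun c i) e) (finToFun-funToFin (ρ ⟨$⟩ʳ_) i))
      funToFin-cong : ∀ {m} {f g : Fin m → Fin n} → (∀ i → f i ≡ g i) → funToFin f ≡ funToFin g
      funToFin-cong {zero}  e = refl
      funToFin-cong {suc m} e = cong₂ Data.Fin.Base.combine (e zero) (funToFin-cong (e ∘ suc))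
      code-cong : ∀ {π ρ} → (n , π) ≅ (n , ρ) → code π ≡ code ρ
      code-cong (same e) = funToFin-cong e
      module E = Enumeration (enumerate (λ c → ∃ λ π → P (n , π) × code π ≡ c))

    -- The factor 2 gives F(x²), in which a block of an involution also accounts for its inverse at
    -- the partner position.
    series-exists : ∀ d .{{_ : NonZero d}} → ∃ λ F → HasGF _≅_ P (λ p → d * size p) F
    series-exists d = (λ n → fromℕ (proj₁ (count n))) , λ n → proj₁ (count n) , proj₂ (count n) , refl
      where
      count : ∀ n → ∃ λ k → Enumerates _≅_ (λ p → P p × d * size p ≡ n) k
      count n with em {∃ λ m → d * m ≡ n}
      ... | no none = 0 , enumerates-∅ (λ p (_ , e) → none (size p , e))
      ... | yes (m , refl) with enumerates-size m
      ... | k , E = k , enumerates-resp (λ (p , e) → p , cong (d *_) e)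
                          (λ (p , e) → p , ℕ.*-cancelˡ-≡ _ _ d e) E

  ΣE : ∀ {K n} → (Fin n → Expr K) → Expr K
  ΣE {n = zero}  e = nil
  ΣE {n = suc n} e = e zero ⊹ ΣE (e ∘ suc)

  ΣE-positive : ∀ {K n} {e : Fin n → Expr K} → (∀ i → Positive (e i)) → Positive (ΣE e)
  ΣE-positive {n = zero}  p = nil
  ΣE-positive {n = suc n} p = p zero ⊹ ΣE-positive (p ∘ suc)

  ΣE-proper : ∀ {K n} {e : Fin n → Expr K} → (∀ i → Proper (e i)) → Proper (ΣE e)
  ΣE-proper {n = zero}  p = nil
  ΣE-proper {n = suc n} p = p zero ⊹ ΣE-proper (p ∘ suc)

  -- A coefficient 0 or 1 decided by excluded middle; properties of `e` are then needed only where
  -- `Q` holds.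
  when : ∀ {K} → Set → Expr K → Expr K
  when Q e with em {Q}
  ... | yes _ = e
  ... | no _  = nil

  when-proper : ∀ {K} Q {e : Expr K} → (Q → Proper e) → Proper (when Q e)
  when-proper Q p with em {Q}
  ... | yes q = p q
  ... | no _  = nil

  module _ {A : Set} {_∼_ : A → A → Set} {w : A → ℕ} {K} (y : Fin K → Series) where

    gf-when : ∀ {Q : Set} {P : A → Set} {e} → (Q → HasGF _∼_ P w (series e y)) →
              HasGF _∼_ (λ x → Q × P x) w (series (when Q e) y)
    gf-when {Q} H with em {Q}
    ... | yes q = gf-resp (q ,_) proj₂ (H q)
    ... | no ¬q = gf-∅ (λ x (q , _) → ¬q q)

    gf-Σ : ∀ {n} (P : Fin n → A → Set) {e : Fin n → Expr K} →
           (∀ {i j x x'} → P i x → P j x' → x ∼ x' → i ≡ j) →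
           (∀ i → HasGF _∼_ (P i) w (series (e i) y)) →
           HasGF _∼_ (λ x → ∃ λ i → P i x) w (series (ΣE e) y)
    gf-Σ {zero}  P disjoint H = gf-∅ (λ { x (() , _) })
    gf-Σ {suc n} P disjoint H = gf-resp
      (λ { (inj₁ p) → zero , p ; (inj₂ (i , p)) → suc i , p })
      (λ { (zero , p) → inj₁ p ; (suc i , p) → inj₂ (i , p) })
      (gf-⊎ (λ p (j , q) e → contradiction (disjoint p q e) λ ())
            (λ (i , p) q e → contradiction (disjoint p q e) λ ())
            (H zero)
            (gf-Σ (P ∘ suc) (λ p q e → suc-inj (disjoint p q e)) (H ∘ suc)))
      where
      suc-inj : ∀ {i j : Fin n} → Fin.suc i ≡ suc j → i ≡ j
      suc-inj refl = refl

    gf-one : IsEquivalence _∼_ → ∀ {P : A → Set} → ∃ P → (∀ {x x'} → P x → P x' → x ∼ x') → (∀ {x} → P x → w x ≡ 0) →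
             HasGF _∼_ P w (series (con 1ℚ) y)
    gf-one equiv (x , p) unique weight zero =
      1 , enumerates-singleton equiv x (p , weight p) (λ (q , _) → unique p q) , refl
    gf-one equiv (x , p) unique weight (suc n) =
      0 , enumerates-∅ (λ x (q , e) → contradiction (trans (sym (weight q)) e) λ ()) , refl

    gf-power : IsEquivalence _∼_ → ∀ m {P : A → Set} → ∃ P → (∀ {x x'} → P x → P x' → x ∼ x') → (∀ {x} → P x → w x ≡ suc m) →
               HasGF _∼_ P w (series (power X m) y)
    gf-power equiv m {P} (x , p) unique weight = gf-≋ (λ n → sym (power-series m n)) H
      where
      monomial : ℕ → Series
      monomial zero    = indeterminate
      monomial (suc m) = shift (monomial m)
      power-series : ∀ m n → series (power X m) y n ≡ monomial m n
      power-series zero    n = refl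
      power-series (suc m) n = trans (shift-⊠ (const 1ℚ) (series (power X m) y) n) (shifted n)
        where
        shifted : ∀ n → shift (const 1ℚ ⊠ series (power X m) y) n ≡ shift (monomial m) n
        shifted zero    = refl
        shifted (suc n) = trans (⊠-identityˡ _ n) (power-series m n)
      monomial-at : ∀ m → monomial m (suc m) ≡ 1ℚ
      monomial-at zero    = refl
      monomial-at (suc m) = monomial-at m
      monomial-off : ∀ m n → n ≢ suc m → monomial m n ≡ 0ℚ
      monomial-off zero    zero          _  = refl
      monomial-off zero    (suc zero)    ne = contradiction refl ne
      monomial-off zero    (suc (suc n)) _  = refl
      monomial-off (suc m) zero          _  = refl
      monomial-off (suc m) (suc n)       ne = monomial-off m n (ne ∘ cong suc)
      H : HasGF _∼_ P w (monomial m)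
      H n with n ℕ.≟ suc m
      ... | yes refl = 1 , enumerates-singleton equiv x (p , weight p) (λ (q , _) → unique p q) , monomial-at m
      ... | no ne    = 0 , enumerates-∅ (λ x (q , e) → ne (trans (sym e) (weight q))) , monomial-off m n ne

  Tuple≅ : ∀ {m} → (Fin m → Perm) → (Fin m → Perm) → Set
  Tuple≅ b b' = ∀ i → b i ≅ b' i

  tuple-isEquivalence : ∀ {m} → IsEquivalence (Tuple≅ {m})
  tuple-isEquivalence = record
    { refl = λ i → ≅-refl ; sym = λ e i → ≅-sym (e i) ; trans = λ e f i → ≅-trans (e i) (f i) }

  module _ {K K'} (ty : Perm → Fin K) (ty-≅ : ∀ {p q} → p ≅ q → ty p ≡ ty q) (y : Fin K' → Series) where

    tupleExpr : ∀ m → (Fin m → Fin K → Expr K') → ((Fin m → Fin K) → Set) → Expr K'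
    tupleExpr zero    e cond = when (cond λ ()) (con 1ℚ)
    tupleExpr (suc m) e cond = ΣE λ s → e zero s ⊗ tupleExpr m (e ∘ suc) (λ t → cond (s ∷ t))

    gf-tuple : ∀ m (P : Fin m → Perm → Set) (w : Fin m → Perm → ℕ) (e : Fin m → Fin K → Expr K')
               (cond : (Fin m → Fin K) → Set) →
               (∀ {i p q} → p ≅ q → P i p → P i q) → (∀ {i p q} → p ≅ q → w i p ≡ w i q) →
               (∀ {t t'} → (∀ i → t i ≡ t' i) → cond t → cond t') →
               (∀ i s → HasGF _≅_ (λ p → P i p × ty p ≡ s) (w i) (series (e i s) y)) →
               HasGF Tuple≅ (λ b → (∀ i → P i (b i)) × cond (ty ∘ b)) (λ b → sum (λ i → w i (b i)))
                     (series (tupleExpr m e cond) y)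
    gf-tuple zero P w e cond P-≅ w-≅ cond-≗ H = gf-resp
      (λ (c , _) → (λ ()) , cond-≗ (λ ()) c) (λ (_ , c) → cond-≗ (λ ()) c , _)
      (gf-when y {P = λ _ → ⊤} (λ c → gf-one y tuple-isEquivalence ((λ ()) , _) (λ _ _ ()) (λ _ → refl)))
      where open import Data.Unit.Base using (⊤)
    gf-tuple (suc m) P w e cond P-≅ w-≅ cond-≗ H = gf-resp
      (λ { (s , (ps , c) , refl) → ps , c }) (λ (ps , c) → _ , (ps , c) , refl)
      (gf-Σ y (λ s b → ((∀ i → P i (b i)) × cond (ty ∘ b)) × ty (b zero) ≡ s)
        (λ { (_ , refl) (_ , refl) e → ty-≅ (e zero) })
        λ s → gf-transfer (×-isEquivalence ≅-isEquivalence tuple-isEquivalence) tuple-isEquivalence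
          {w = λ (p , b) → w zero p + sum (λ i → w (suc i) (b i))} {v = λ b → sum (λ i → w i (b i))}
          (correspondence s)
          (λ { (p≅ , b≅) ((p , refl) , (ps , c)) → (P-≅ p≅ p , sym (ty-≅ p≅)) ,
               (λ i → P-≅ (b≅ i) (ps i)) , cond-≗ (λ { zero → refl ; (suc i) → ty-≅ (b≅ i) }) c })
          (λ (p≅ , b≅) → cong₂ _+_ (w-≅ p≅) (sum-cong-≗ (λ i → w-≅ (b≅ i))))
          (λ _ _ (p≅ , b≅) → cong₂ _+_ (w-≅ p≅) (sum-cong-≗ (λ i → w-≅ (b≅ i))))
          (gf-× w-≅ (H zero s) (gf-tuple m (P ∘ suc) (w ∘ suc) (e ∘ suc) (λ t → cond (s ∷ t)) P-≅ w-≅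
            (λ t≗ → cond-≗ (λ { zero → refl ; (suc i) → t≗ i })) (H ∘ suc))))
      where
      R : Perm × (Fin m → Perm) → (Fin (suc m) → Perm) → Set
      R (p , b) b' = p ≅ b' zero × ∀ i → b i ≅ b' (suc i)
      correspondence : ∀ s → Correspondence (×-Pointwise _≅_ Tuple≅) Tuple≅
        (λ (p , b) → (P zero p × ty p ≡ s) × (∀ i → P (suc i) (b i)) × cond (s ∷ (ty ∘ b)))
        (λ b → ((∀ i → P i (b i)) × cond (ty ∘ b)) × ty (b zero) ≡ s) R
      correspondence s = record
        { to = λ { {p , b} ((Pp , refl) , Pb , c) → p ∷ b ,
            (((λ { zero → Pp ; (suc i) → Pb i }) , cond-≗ (λ { zero → refl ; (suc i) → refl }) c) , refl) ,
            ≅-refl , λ i → ≅-refl }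
        ; from = λ { {b} ((Pb , c) , refl) → (b zero , b ∘ suc) ,
            ((Pb zero , refl) , (Pb ∘ suc) , cond-≗ (λ { zero → refl ; (suc i) → refl }) c) ,
            ≅-refl , λ i → ≅-refl }
        ; to-cong = λ { _ _ _ _ (r , rs) (r' , rs') (e , es) →
            λ { zero → ≅-trans (≅-sym r) (≅-trans e r') ; (suc i) → ≅-trans (≅-sym (rs i)) (≅-trans (es i) (rs' i)) } }
        ; to-inj = λ { _ _ _ _ (r , rs) (r' , rs') es →
            ≅-trans r (≅-trans (es zero) (≅-sym r')) , λ i → ≅-trans (rs i) (≅-trans (es (suc i)) (≅-sym (rs' i))) } }

    tuple-positive : ∀ m e cond i → (∀ s → Positive (e i s)) → Positive (tupleExpr m e cond)
    tuple-positive (suc m) e cond zero    p = ΣE-positive (λ s → left (p s))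
    tuple-positive (suc m) e cond (suc i) p = ΣE-positive (λ s → right (tuple-positive m (e ∘ suc) _ i p))

    tuple-proper₁ : ∀ m e cond i → (∀ s → Proper (e i s)) → Proper (tupleExpr m e cond)
    tuple-proper₁ (suc m) e cond zero    p = ΣE-proper (λ s → left (p s))
    tuple-proper₁ (suc m) e cond (suc i) p = ΣE-proper (λ s → right (tuple-proper₁ m (e ∘ suc) _ i p))

    tuple-proper₂ : ∀ m e cond i j → i ≢ j → (∀ s → Positive (e i s)) → (∀ s → Positive (e j s)) →
                    Proper (tupleExpr m e cond)
    tuple-proper₂ (suc m) e cond zero    zero    ne _ _ = contradiction refl ne
    tuple-proper₂ (suc m) e cond zero    (suc j) ne p q =
      ΣE-proper (λ s → p s ⊗ tuple-positive m (e ∘ suc) _ j q)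
    tuple-proper₂ (suc m) e cond (suc i) zero    ne p q =
      ΣE-proper (λ s → q s ⊗ tuple-positive m (e ∘ suc) _ i p)
    tuple-proper₂ (suc m) e cond (suc i) (suc j) ne p q =
      ΣE-proper (λ s → right (tuple-proper₂ m (e ∘ suc) _ i j (ne ∘ cong suc) p q))

-- Generated permutations and their types

module GeneratedPermutations (em : ExcludedMiddle 0ℓ) where
  open import Data.Empty using (⊥)
  open import Data.Fin.Base using (Fin; zero; suc; _<_)
  open import Data.Fin.Permutation using (inverseˡ; inverseʳ)
  open import Data.Fin.Properties using (<-cmp; injective⇒≤)
  open import Data.Nat.Base as ℕ using (ℕ; zero; suc; s≤s; z≤n)
  open import Data.Nat.Properties as ℕ using ()
  open import Function.Bundles using (Equivalence)
  open Congruences em public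
  open FiniteBasis em using (Skeletons; module Skeletons; Generated; module Generated; generated-pattern; inflation-smaller) public

  embedding-inverse : ∀ {p q} → Embedding p q → Embedding (inverse p) (inverse q)
  embedding-inverse {p@(_ , π)} {q@(_ , ρ)} f = record
    { map = λ v → val q (map (val⁻¹ p v))
    ; pos = λ l → values (subst₂ _<_ (sym (inverseʳ π)) (sym (inverseʳ π)) l)
    ; values = λ l → subst₂ _<_ (sym (inverseˡ ρ)) (sym (inverseˡ ρ)) (pos l) }
    where open Embedding f

  embedding-size : ∀ {p q} → Embedding p q → size p ℕ.≤ size q
  embedding-size f = injective⇒≤ (monotone⇒injective (Embedding.pos f))

  inverse-inverse : ∀ p → inverse (inverse p) ≅ p
  inverse-inverse p = same (λ _ → refl)

  indecomposable-≅ : ∀ {s t} → s ≅ t → Indecomposable s → Indecomposable t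
  indecomposable-≅ {n , σ} {_ , τ} (same e) ind (P , convex , rest) = ind
    (P , record { pos = Convex.pos convex
                ; values = λ p q l m → Convex.values convex p q (subst₂ _<_ (e _) (e _) l) (subst₂ _<_ (e _) (e _) m) } , rest)

  -- If two elements of the copy of `t` share a block, the elements in that block form an interval
  -- of `t`, hence all of `t`. Otherwise the blocks that are met form a copy of `t` in `s`.
  indecomposable-in-inflation : ∀ {s b p t} → Inflation s b p → Indecomposable t → Embedding t p →
                                Embedding t s ⊎ ∃ λ i → Embedding t (b i)
  indecomposable-in-inflation {s} {b} {p} {t} I ind f with em {∃₂ λ i j → i ≢ j × Inflation.block I (Embedding.map f i) ≡ Inflation.block I (Embedding.map f j)}
  ... | no distinct = inj₁ (record
    { map = h
    ; pos = λ {i} {j} l → strict (<⇒≢ l) (I.pos-cases (subst₂ _<_ (sym (I.emb-coord _)) (sym (I.emb-coord _)) (F.pos l)))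
    ; values = λ {i} {j} l → strict (λ e → <⇒≢ l (cong (val t) e))
        (I.val-cases (subst₂ (λ x y → val p x < val p y) (sym (I.emb-coord _)) (sym (I.emb-coord _)) (F.values l))) })
    where
    module I = Inflation I
    module F = Embedding f
    h : Pos t → Pos s
    h i = I.block (F.map i)
    strict : ∀ {i j} {P : Set} {Q : h i ≡ h j → Set} → i ≢ j → P ⊎ ∃ Q → P
    strict ne (inj₁ l) = l
    strict {i} {j} ne (inj₂ (e , _)) = contradiction (i , j , ne , e) distinct
  ... | yes (i , j , i≢j , e) = inj₂ (h i , record
    { map = c ; pos = λ l → monotone⇒reflects I.pos-in (subst₂ _<_ (sym (c-emb _)) (sym (c-emb _)) (F.pos l))
    ; values = λ l → embedding-reflects (I.component (h i))
        (subst₂ (λ x y → val p x < val p y) (sym (c-emb _)) (sym (c-emb _)) (F.values l)) })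
    where
    module I = Inflation I
    module F = Embedding f
    h : Pos t → Pos s
    h i = I.block (F.map i)
    between : ∀ {a c d : Pos s} {P Q : Set} → a ≡ d → a < c ⊎ a ≡ c → c < d ⊎ c ≡ d → c ≡ a
    between refl (inj₂ e) _        = sym e
    between refl (inj₁ l) (inj₂ e) = e
    between refl (inj₁ l) (inj₁ m) = contradiction m (ℕ.<-asym l)
    betweenᵛ : ∀ {a c d : Pos s} → a ≡ d → val s a < val s c ⊎ a ≡ c → val s c < val s d ⊎ c ≡ d → c ≡ a
    betweenᵛ refl (inj₂ e) _        = sym e
    betweenᵛ refl (inj₁ l) (inj₂ e) = e
    betweenᵛ refl (inj₁ l) (inj₁ m) = contradiction m (ℕ.<-asym l)
    pos≤ : ∀ {a c} → a < c → h a < h c ⊎ h a ≡ h c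
    pos≤ l with I.pos-cases (subst₂ _<_ (sym (I.emb-coord _)) (sym (I.emb-coord _)) (F.pos l))
    ... | inj₁ m       = inj₁ m
    ... | inj₂ (e , _) = inj₂ e
    val≤ : ∀ {a c} → val t a < val t c → val s (h a) < val s (h c) ⊎ h a ≡ h c
    val≤ l with I.val-cases (subst₂ (λ x y → val p x < val p y) (sym (I.emb-coord _)) (sym (I.emb-coord _)) (F.values l))
    ... | inj₁ m       = inj₁ m
    ... | inj₂ (e , _) = inj₂ e
    constant : ∀ k → h k ≡ h i
    constant = indecomposable ind (λ k → h k ≡ h i) (record
      { pos = λ pa pd l m → trans (between {P = ⊥} {Q = ⊥} (trans pa (sym pd)) (pos≤ l) (pos≤ m)) pa
      ; values = λ pa pd l m → trans (betweenᵛ (trans pa (sym pd)) (val≤ l) (val≤ m)) pa }) i≢j refl (sym e)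
    c∃ : ∀ k → ∃ λ a → I.emb (h i) a ≡ F.map k
    c∃ k = subst (λ j → ∃ λ a → I.emb j a ≡ F.map k) (constant k) (I.coord (F.map k) , I.emb-coord (F.map k))
    c : Pos t → Pos (b (h i))
    c = proj₁ ∘ c∃
    c-emb : ∀ k → I.emb (h i) (c k) ≡ F.map k
    c-emb = proj₂ ∘ c∃

  module _ (Sk : Skeletons) where
    open Skeletons Sk
    open Generated

    generated-single : ∀ {p} → size p ≡ 1 → Generated Sk p
    generated-single {p} refl = record
      { nonempty = s≤s z≤n
      ; skeletons = λ s s≥2 _ f → contradiction (ℕ.≤-trans s≥2 (embedding-size f)) λ { (s≤s ()) } }

    generated-≅ : ∀ {p q} → p ≅ q → Generated Sk p → Generated Sk q
    generated-≅ e G = generated-pattern Sk (≅⇒embedding (≅-sym e)) (subst (1 ℕ.≤_) (≅-size e) (G .nonempty)) G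

    generated-inflate : ∀ {s b p} → Allowed s → Inflation s b p → (∀ i → Generated Sk (b i)) → Nonempty p → Generated Sk p
    generated-inflate allowed I G ne = record
      { nonempty = ne
      ; skeletons = λ t t≥2 ind f → [ (λ g → closed g t≥2 allowed) , (λ (i , g) → G i .skeletons t t≥2 ind g) ]
          (indecomposable-in-inflation I ind f) }

    generated-inverse : ∀ {p} → Generated Sk p → Generated Sk (inverse p)
    generated-inverse {p} G = record
      { nonempty = G .nonempty
      ; skeletons = λ s s≥2 ind f → closed (≅⇒embedding (≅-sym (inverse-inverse s))) s≥2
          (inverse-closed (G .skeletons (inverse s) s≥2 (indecomposable-inverse {s} ind)
            (embedding-∘ (≅⇒embedding (inverse-inverse p)) (embedding-inverse f)))) }

  size-2 : ∀ {s} → size s ≡ 2 → perm12 ≅ s ⊎ perm21 ≅ s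
  size-2 {s@(_ , σ)} refl with <-cmp (val s zero) (val s (suc zero))
  ... | tri≈ _ e _ with () ← val-injective s e
  ... | tri< l _ _ = inj₁ (iso⇒≅ (record
    { embedding = record { map = id ; pos = id ; values = values } ; onto = λ y → y , refl }))
    where
    values : ∀ {i j : Fin 2} → val perm12 i < val perm12 j → val s i < val s j
    values {zero}     {zero}     ()
    values {zero}     {suc zero} _ = l
    values {suc zero} {zero}     ()
    values {suc zero} {suc zero} (s≤s ())
  ... | tri> _ _ l = inj₂ (iso⇒≅ (record
    { embedding = record { map = id ; pos = id ; values = values } ; onto = λ y → y , refl }))
    where
    values : ∀ {i j : Fin 2} → val perm21 i < val perm21 j → val s i < val s j
    values {zero}     {zero}     (s≤s ())
    values {zero}     {suc zero} ()
    values {suc zero} {zero}     _ = l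
    values {suc zero} {suc zero} ()

  -- Classes of a refinement of `C` that also records divisibility by `12` and `21` and is invariant
  -- under inversion: the former makes normality of a decomposition depend on types, the latter
  -- gives inverse blocks a type determined by the block's.
  record Typing (C : Congruence) : Set₁ where
    field
      K          : ℕ
      ty         : Perm → Fin K
      ty-≅       : ∀ {p q} → p ≅ q → ty p ≡ ty q
      ty-inflate : ∀ {s b b' p p'} → Indecomposable s → 2 ℕ.≤ size s → Inflation s b p → Inflation s b' p' →
                   (∀ i → Nonempty (b i)) → (∀ i → Nonempty (b' i)) → (∀ i → ty (b i) ≡ ty (b' i)) → ty p ≡ ty p'
      ty-quotient : ∀ {p q s} → size s ≡ 2 → ty p ≡ ty q → Quotient p s → Quotient q s
      ty-inverse : ∀ {p q} → ty p ≡ ty q → ty (inverse p) ≡ ty (inverse q)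
      ty-refines : ∀ {p q} → ty p ≡ ty q → Congruence._~_ C p q

  typing : ∀ C → Typing C
  typing C = record
    { K = proj₁ classes ; ty = ty ; ty-≅ = complete ∘ resp
    ; ty-inflate = λ ind two I J ne ne' e → complete (cong-inflate ind two I J ne ne' (sound ∘ e))
    ; ty-quotient = λ {p} {q} {s} two e Q → quotient two (proj₁ (proj₁ (sound e))) Q
    ; ty-inverse = λ e → complete (let ((d , c) , (d' , c')) = sound e in (d' , c') ,
        E.trans (E.resp′ (inverse-inverse _)) (E.trans (d , c) (E.resp′ (≅-sym (inverse-inverse _)))))
    ; ty-refines = λ e → proj₂ (proj₁ (sound e)) }
    where
    D = congruence-∩ decomposability C
    -- Invariant under inversion, because inverting twice changes nothing up to `_≅_`.
    D' = congruence-∩ D (congruence-inverse D)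
    open Congruence D'
    module E where
      open IsEquivalence (Congruence.isEquivalence D) public
      resp′ : ∀ {p q} → p ≅ q → Congruence._~_ D p q
      resp′ = Congruence.resp D
    classes = classify isEquivalence finiteIndex
    ty = proj₁ (proj₂ classes)
    sound : ∀ {p q} → ty p ≡ ty q → p ~ q
    sound = proj₁ (proj₂ (proj₂ classes))
    complete : ∀ {p q} → p ~ q → ty p ≡ ty q
    complete = proj₂ (proj₂ (proj₂ classes))
    quotient : ∀ {p q s} → size s ≡ 2 → Congruence._~_ decomposability p q → Quotient p s → Quotient q s
    quotient two e Q with size-2 two
    ... | inj₁ s≅ = quotient-resp ≅-refl s≅ (Equivalence.to (e zero) (quotient-resp ≅-refl (≅-sym s≅) Q))
    ... | inj₂ s≅ = quotient-resp ≅-refl s≅ (Equivalence.to (e (suc zero)) (quotient-resp ≅-refl (≅-sym s≅) Q))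

  pair : Perm → Perm → Fin 2 → Perm
  pair x y zero    = x
  pair x y (suc _) = y

-- Equations for the generating functions of the types

module ClassEquations (em : ExcludedMiddle 0ℓ) where
  open import Data.Fin.Base using (Fin; zero; suc; toℕ; _<_; fromℕ<)
  open import Data.Fin.Properties using (<-cmp; toℕ-fromℕ<)
  open import Data.Nat.Base as ℕ using (ℕ; zero; suc; s≤s; z≤n; _*_)
  open import Data.Nat.Properties as ℕ using ()
  open GeneratedPermutations em public
  open PermutationSeries em public
  open Enumerations public
  open RationalSeries hiding (T) public

  normal-≅ : ∀ {s s' b} (e : s ≅ s') → Normal s b → Normal s' (b ∘ Iso.map (≅⇒iso (≅-sym e)))
  normal-≅ e@(same f) nf two i i≡0 Q = nf two i i≡0 (quotient-resp ≅-refl (same (sym ∘ f)) Q)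

  module _ (Sk : Skeletons) {C : Congruence} (Ty : Typing C) where
    open Skeletons Sk
    open Typing Ty
    open Generated

    private
      Good = Generated Sk

    Class : Fin K → Perm → Set
    Class s p = Good p × ty p ≡ s

    Single : Fin K → Perm → Set
    Single s p = size p ≡ 1 × ty p ≡ s

    single-≅ : ∀ {p q} → size p ≡ 1 → size q ≡ 1 → p ≅ q
    single-≅ {_ , π} {_ , ρ} refl refl = same λ { zero → only (val (_ , π) zero) (val (_ , ρ) zero) }
      where
      only : ∀ (x y : Fin 1) → x ≡ y
      only zero zero = refl

    -- Repeated entries of the list are skipped, lest permutations be counted
    -- twice.
    record Skeleton (l : Fin count) : Set where
      field
        allowed : Allowed (list l)
        simple  : Indecomposable (list l)
        size≥2  : 2 ℕ.≤ size (list l)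
        first-occurrence : ∀ l' → l' < l → ¬ list l' ≅ list l

    skeleton-unique : ∀ {l l'} → Skeleton l → Skeleton l' → list l ≅ list l' → l ≡ l'
    skeleton-unique {l} {l'} S S' e with <-cmp l l'
    ... | tri≈ _ l≡l' _ = l≡l'
    ... | tri< m _ _ = contradiction e (Skeleton.first-occurrence S' l m)
    ... | tri> _ _ m = contradiction (≅-sym e) (Skeleton.first-occurrence S l' m)

    skeleton-of : ∀ {s} → Allowed s → Indecomposable s → 2 ℕ.≤ size s → ∃ λ l → Skeleton l × s ≅ list l
    skeleton-of {s} allowed ind s≥2 with LeastNumber.least em (λ k → ∃ λ l → s ≅ list l × toℕ l ≡ k)
                                           (_ , proj₂ (listed allowed ind s≥2) , refl)
    ... | _ , (l , e , refl) , minimal = l , record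
      { allowed = closed (≅⇒embedding (≅-sym e)) (subst (2 ℕ.≤_) (≅-size e) s≥2) allowed
      ; simple = indecomposable-≅ e ind
      ; size≥2 = subst (2 ℕ.≤_) (≅-size e) s≥2
      ; first-occurrence = λ l' m e' → minimal (toℕ l') m (l' , ≅-trans e (≅-sym e') , refl) } , e

    record Decomposition′ (l : Fin count) (b : Pos (list l) → Perm) (p : Perm) : Set where
      field
        skeleton  : Skeleton l
        good      : ∀ i → Good (b i)
        normal    : Normal (list l) b
        inflation : Inflation (list l) b p
      open Skeleton skeleton public

      quotient : Quotient p (list l)
      quotient = proj₁ (inflation⇒quotient inflation (λ i → good i .nonempty))

      size-p : 2 ℕ.≤ size p
      size-p = ℕ.≤-trans size≥2 (embedding-size (quotient-embedding quotient))

      good-p : Good p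
      good-p = generated-inflate Sk allowed inflation good (ℕ.≤-trans (s≤s z≤n) size-p)

    decomposition : ∀ {p} → Good p → 2 ℕ.≤ size p → ∃₂ λ l b → Decomposition′ l b p
    decomposition {p} G p≥2 = l , blocks ∘ ρ , record
      { skeleton = proj₁ (proj₂ found)
      ; good = λ i → generated-pattern Sk (Inflation.component inflation (ρ i)) (nonempty' (ρ i)) G
      ; normal = normal-≅ e normal
      ; inflation = inflation-skeleton e inflation }
      where
      open Decomposed (decompose p p≥2) renaming (nonempty to nonempty')
      found = skeleton-of (G .skeletons skeleton size≥2 simple
                (quotient-embedding (proj₁ (inflation⇒quotient inflation nonempty')))) simple size≥2
      l = proj₁ found
      e = proj₂ (proj₂ found)
      ρ = Iso.map (≅⇒iso (≅-sym e))

    decomposition-skeleton : ∀ {l l' b b' p p'} → Decomposition′ l b p → Decomposition′ l' b' p' → p ≅ p' → l ≡ l'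
    decomposition-skeleton D D' e = skeleton-unique D.skeleton D'.skeleton
      (unique-skeleton (quotient-resp e ≅-refl D.quotient) D'.quotient D.simple D'.simple D.size≥2 D'.size≥2)
      where module D = Decomposition′ D
            module D' = Decomposition′ D'

    decomposition-blocks : ∀ {l b b' p p'} → Decomposition′ l b p → Decomposition′ l b' p' → p ≅ p' → ∀ i → b i ≅ b' i
    decomposition-blocks D D' e = unique-blocks (inflation-resp e D.inflation) D'.inflation ≅-refl D.simple D'.simple D.size≥2
      (λ i → D.good i .nonempty) (λ i → D'.good i .nonempty) D.normal D'.normal
      where module D = Decomposition′ D
            module D' = Decomposition′ D'

    normal-ty : ∀ {l b b'} → (∀ i → ty (b i) ≡ ty (b' i)) → Normal (list l) b → Normal (list l) b'
    normal-ty e nf two i i≡0 Q = nf two i i≡0 (ty-quotient two (sym (e i)) Q)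

    Node : Fin K → (l : Fin count) → (Pos (list l) → Perm) → Perm → Set
    Node s l b p = Decomposition′ l b p × ty p ≡ s

    node-ty : ∀ {s l b b' p p'} → Node s l b p → (∀ i → Good (b' i)) → (∀ i → ty (b i) ≡ ty (b' i)) →
              Inflation (list l) b' p' → Node s l b' p'
    node-ty (D , refl) good e I = record
      { skeleton = D.skeleton ; good = good ; normal = normal-ty e D.normal ; inflation = I } ,
      ty-inflate D.simple D.size≥2 I D.inflation (λ i → good i .nonempty) (λ i → D.good i .nonempty) (sym ∘ e)
      where module D = Decomposition′ D

    -- One witness with the types `t` suffices: by `node-ty`, any other good blocks of these types
    -- are again in normal form and inflate to type `s`.
    NodeTypes : Fin K → (l : Fin count) → (Pos (list l) → Fin K) → Set
    NodeTypes s l t = ∃₂ λ b p → Node s l b p × ∀ i → ty (b i) ≡ t i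

    class-cases : ∀ {s p} → Class s p → Single s p ⊎ ∃ λ l → ∃ λ b → Node s l b p
    class-cases {s} {p} (G , t) with ℕ.m≤n⇒m<n∨m≡n (G .nonempty)
    ... | inj₂ e = inj₁ (sym e , t)
    ... | inj₁ p≥2 = let (l , b , D) = decomposition G p≥2 in inj₂ (l , b , D , t)

    single-or-node : ∀ {s l b p q} → Single s p → Node s l b q → ¬ p ≅ q
    single-or-node (e , _) (D , _) p≅q = ℕ.<⇒≢ (Decomposition′.size-p D) (trans (sym e) (≅-size p≅q))

    singleExpr : ℕ → ∀ {K'} → Fin K → Expr K'
    singleExpr d' s = when (∃ (Single s)) (power X d')

    gf-single : ∀ d' {K'} (y : Fin K' → Series) s → HasGF _≅_ (Single s) (λ p → suc d' * size p) (series (singleExpr d' s) y)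
    gf-single d' y s = gf-resp proj₂ (λ {p} h → (p , h) , h)
      (gf-when y (λ exists → gf-power y ≅-isEquivalence d' exists (λ (e , _) (f , _) → single-≅ e f)
        (λ (e , _) → trans (cong (suc d' *_) e) (ℕ.*-identityʳ _))))

    single-proper : ∀ d' {K'} s → Proper (singleExpr d' {K'} s)
    single-proper d' s = when-proper _ (λ _ → power-proper d')
      where
      power-proper : ∀ {K'} n → Proper {K'} (power X n)
      power-proper zero    = X
      power-proper (suc n) = left X

    -- The series of the types are given by arbitrary expressions `v`, so that the same equations
    -- serve alone and inside the larger system for involutions. The weight factor is `suc d'`.
    module _ (d' : ℕ) {K' : ℕ} (y : Fin K' → Series) (v : Fin K → Expr K')
             (v-gf : ∀ s → HasGF _≅_ (Class s) (λ p → suc d' * size p) (series (v s) y)) where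
      private
        w : Perm → ℕ
        w p = suc d' * size p

        w-≅ : ∀ {p q} → p ≅ q → w p ≡ w q
        w-≅ e = cong (suc d' *_) (≅-size e)

      weight-blocks : ∀ {s b p} → Inflation s b p → sum (λ i → w (b i)) ≡ w p
      weight-blocks {b = b} I = trans (sym (*-distribˡ-sum (suc d') (size ∘ b))) (cong (suc d' *_) (sym (size-sum I)))

      nodeExpr : Fin K → Fin count → Expr K'
      nodeExpr s l = tupleExpr ty ty-≅ y (size (list l)) (λ _ → v) (NodeTypes s l)

      classExpr : Fin K → Expr K'
      classExpr s = singleExpr d' s ⊹ ΣE λ l → when (Skeleton l) (nodeExpr s l)

      private
        gf-node : ∀ s l → HasGF _≅_ (λ p → ∃ λ b → Node s l b p) w (series (nodeExpr s l) y)
        gf-node s l = gf-transfer tuple-isEquivalence ≅-isEquivalence correspondence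
          (λ e (g , t) → (λ i → generated-≅ Sk (e i) (g i)) , types-≗ (λ i → ty-≅ (e i)) t)
          (λ e → sum-cong-≗ (λ i → w-≅ (e i))) (λ _ _ → weight-blocks)
          (gf-tuple ty ty-≅ y (size (list l)) (λ _ → Good) (λ _ → w) (λ _ → v) (NodeTypes s l)
            (generated-≅ Sk) w-≅ types-≗ (λ _ → v-gf))
          where
          types-≗ : ∀ {t t'} → (∀ i → t i ≡ t' i) → NodeTypes s l t → NodeTypes s l t'
          types-≗ e (b , p , n , f) = b , p , n , λ i → trans (f i) (e i)
          node : ∀ {b p} → (∀ i → Good (b i)) × NodeTypes s l (ty ∘ b) → Inflation (list l) b p → Node s l b p
          node (g , (b' , p' , n , f)) I = node-ty n g f I
          correspondence : Correspondence Tuple≅ _≅_ (λ b → (∀ i → Good (b i)) × NodeTypes s l (ty ∘ b))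
                             (λ p → ∃ λ b → Node s l b p) (λ b p → Inflation (list l) b p)
          correspondence = record
            { to = λ {b} h → let (p , I) = inflate (list l) b in p , (b , node h I) , I
            ; from = λ {p} (b , n) → let D = proj₁ n in b ,
                (Decomposition′.good D , (b , p , n , λ _ → refl)) , Decomposition′.inflation D
            ; to-cong = λ _ _ _ _ I J e → inflation-≅ I J e
            ; to-inj = λ h h' _ _ I J e → decomposition-blocks (proj₁ (node h I)) (proj₁ (node h' J)) e }

      gf-class : ∀ s → HasGF _≅_ (Class s) w (series (classExpr s) y)
      gf-class s = gf-resp from class-cases (gf-⊎
        (λ p (l , b , n) → single-or-node p n) (λ (l , b , n) p e → single-or-node p n (≅-sym e))
        (gf-single d' y s)
        (gf-Σ y (λ l p → ∃ λ b → Node s l b p)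
          (λ (_ , n) (_ , n') e → decomposition-skeleton (proj₁ n) (proj₁ n') e)
          (λ l → gf-resp proj₂ (λ (b , n) → Decomposition′.skeleton (proj₁ n) , (b , n))
            (gf-when y (λ _ → gf-node s l)))))
        where
        from : ∀ {p} → Single s p ⊎ (∃ λ l → ∃ λ b → Node s l b p) → Class s p
        from (inj₁ (e , t))         = generated-single Sk e , t
        from (inj₂ (l , b , D , t)) = Decomposition′.good-p D , t

      -- A skeleton has two distinct positions, each contributing a positive factor, and a product
      -- of two positive factors is proper.
      class-proper : (∀ s → Positive (v s)) → ∀ s → Proper (classExpr s)
      class-proper v-pos s = single-proper d' s ⊹
        ΣE-proper λ l → when-proper (Skeleton l) λ S →
          tuple-proper₂ ty ty-≅ y (size (list l)) (λ _ → v) (NodeTypes s l)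
            (fromℕ< (ℕ.≤-trans (s≤s z≤n) (Skeleton.size≥2 S))) (fromℕ< (Skeleton.size≥2 S))
            (λ e → contradiction (trans (sym (toℕ-fromℕ< _)) (trans (cong toℕ e) (toℕ-fromℕ< _))) λ ())
            v-pos v-pos

-- Structure of involutions

module InvolutionEquations (em : ExcludedMiddle 0ℓ) where
  open import Data.Fin.Base using (Fin; zero; suc; toℕ; _<_)
  open import Data.Fin.Patterns using (0F; 1F; 2F)
  open import Data.Fin.Permutation as Perm using (inverseˡ; inverseʳ)
  open import Data.Nat.Base as ℕ using (ℕ; zero; suc; s≤s; z≤n)
  open import Data.Nat.Properties as ℕ using ()
  open ClassEquations em public

  SelfInverse : Perm → Set
  SelfInverse p = inverse p ≅ p

  selfInverse-≅ : ∀ {p q} → p ≅ q → SelfInverse p → SelfInverse q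
  selfInverse-≅ e f = ≅-trans (≅-inverse (≅-sym e)) (≅-trans f e)

  inverse-injective : ∀ {p q} → inverse p ≅ inverse q → p ≅ q
  inverse-injective {p} {q} e = ≅-trans (≅-sym (inverse-inverse p)) (≅-trans (≅-inverse e) (inverse-inverse q))

  inverse21 : inverse perm21 ≅ perm21
  inverse21 = same (λ _ → refl)

  inflation21-inverse : ∀ {x y p} → Inflation perm21 (pair x y) p →
                        Inflation perm21 (pair (inverse y) (inverse x)) (inverse p)
  inflation21-inverse {x} {y} I = inflation-blocks (λ { zero → ≅-refl ; (suc zero) → ≅-refl })
    (inflation-skeleton inverse21 (inflation-inverse I))

  quotient21-inverse : ∀ {x} → Quotient (inverse x) perm21 → Quotient x perm21
  quotient21-inverse {x} Q = quotient-resp (inverse-inverse x) inverse21 (quotient-inverse Q)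

  normal21 : ∀ {x y} → ¬ Quotient x perm21 → Normal perm21 (pair x y)
  normal21 nq _ zero    _ = nq
  normal21 nq _ (suc _) ()

  private
    nonempty-pair : ∀ {x y} → Nonempty x → Nonempty y → ∀ i → Nonempty (pair x y i)
    nonempty-pair nx ny zero    = nx
    nonempty-pair nx ny (suc _) = ny

  unique21 : ∀ {x y x' y' p p'} → Inflation perm21 (pair x y) p → Inflation perm21 (pair x' y') p' → p ≅ p' →
             Nonempty x → Nonempty y → Nonempty x' → Nonempty y' →
             ¬ Quotient x perm21 → ¬ Quotient x' perm21 → x ≅ x' × y ≅ y'
  unique21 I J e nx ny nx' ny' nq nq' = f zero , f (suc zero)
    where f = unique-blocks (inflation-resp e I) J ≅-refl (indecomposable₂ {perm21} refl) (indecomposable₂ {perm21} refl)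
                (s≤s (s≤s z≤n)) (nonempty-pair nx ny) (nonempty-pair nx' ny') (normal21 nq) (normal21 nq')

  -- Normality is known for `x` and not for `y`, so uniqueness is applied to the inverse,
  -- 21[x, y⁻¹].
  unique21ʳ : ∀ {x y x' y' p p'} → Inflation perm21 (pair y (inverse x)) p → Inflation perm21 (pair y' (inverse x')) p' → p ≅ p' →
              Nonempty x → Nonempty y → Nonempty x' → Nonempty y' →
              ¬ Quotient x perm21 → ¬ Quotient x' perm21 → y ≅ y'
  unique21ʳ I J e nx ny nx' ny' nq nq' = inverse-injective (proj₂ (unique21 (inflation21-inverse I) (inflation21-inverse J)
    (≅-inverse e) nx ny nx' ny' (nq ∘ quotient21-inverse ∘ quotient21-inverse) (nq' ∘ quotient21-inverse ∘ quotient21-inverse)))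

  perm321 : Perm
  perm321 = 3 , Perm.reverse

  triple : Perm → Perm → Perm → Fin 3 → Perm
  triple x y z 0F = x
  triple x y z 1F = y
  triple x y z 2F = z

  module _ {x y z u v} (I : Inflation perm21 (pair x y) u) (J : Inflation perm21 (pair u z) v) where
    private
      module I = Inflation I
      module J = Inflation J

    flattenˡ : Inflation perm321 (triple x y z) v
    flattenˡ = record
      { emb = emb ; onto = onto ; pos-in = λ {i} → pos-in i
      ; pos-out = λ {i} {j} → pos-out i j ; val-in = λ {i} → val-in i ; val-out = λ {i} {j} → val-out i j }
      where
      emb : ∀ i → Pos (triple x y z i) → Pos v
      emb 0F a = J.emb 0F (I.emb 0F a)
      emb 1F a = J.emb 0F (I.emb 1F a)
      emb 2F a = J.emb 1F a
      onto : ∀ t → ∃₂ λ i a → emb i a ≡ t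
      onto t with J.onto t
      ... | 1F , c , refl = 2F , c , refl
      ... | 0F , c , refl with I.onto c
      ... | 0F , a , refl = 0F , a , refl
      ... | 1F , a , refl = 1F , a , refl
      pos-in : ∀ i {a c} → a < c → emb i a < emb i c
      pos-in 0F l = J.pos-in (I.pos-in l)
      pos-in 1F l = J.pos-in (I.pos-in l)
      pos-in 2F l = J.pos-in l
      pos-out : ∀ i j {a c} → i < j → emb i a < emb j c
      pos-out 0F 1F l = J.pos-in (I.pos-out (s≤s z≤n))
      pos-out 0F 2F l = J.pos-out (s≤s z≤n)
      pos-out 1F 2F l = J.pos-out (s≤s z≤n)
      pos-out 0F 0F ()
      pos-out 1F 0F ()
      pos-out 1F 1F (s≤s ())
      pos-out 2F 0F ()
      pos-out 2F 1F (s≤s ())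
      pos-out 2F 2F (s≤s (s≤s ()))
      val-in : ∀ i {a c} → val (triple x y z i) a < val (triple x y z i) c → val v (emb i a) < val v (emb i c)
      val-in 0F l = J.val-in (I.val-in l)
      val-in 1F l = J.val-in (I.val-in l)
      val-in 2F l = J.val-in l
      val-out : ∀ i j {a c} → val perm321 i < val perm321 j → val v (emb i a) < val v (emb j c)
      val-out 1F 0F l = J.val-in (I.val-out (s≤s z≤n))
      val-out 2F 0F l = J.val-out (s≤s z≤n)
      val-out 2F 1F l = J.val-out (s≤s z≤n)
      val-out 0F 0F (s≤s (s≤s ()))
      val-out 0F 1F (s≤s ())
      val-out 0F 2F ()
      val-out 1F 1F (s≤s ())
      val-out 1F 2F ()
      val-out 2F 2F ()

  module _ {x y z w v} (I : Inflation perm21 (pair y z) w) (J : Inflation perm21 (pair x w) v) where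
    private
      module I = Inflation I
      module J = Inflation J

    flattenʳ : Inflation perm321 (triple x y z) v
    flattenʳ = record
      { emb = emb ; onto = onto ; pos-in = λ {i} → pos-in i
      ; pos-out = λ {i} {j} → pos-out i j ; val-in = λ {i} → val-in i ; val-out = λ {i} {j} → val-out i j }
      where
      emb : ∀ i → Pos (triple x y z i) → Pos v
      emb 0F a = J.emb 0F a
      emb 1F a = J.emb 1F (I.emb 0F a)
      emb 2F a = J.emb 1F (I.emb 1F a)
      onto : ∀ t → ∃₂ λ i a → emb i a ≡ t
      onto t with J.onto t
      ... | 0F , c , refl = 0F , c , refl
      ... | 1F , c , refl with I.onto c
      ... | 0F , a , refl = 1F , a , refl
      ... | 1F , a , refl = 2F , a , refl
      pos-in : ∀ i {a c} → a < c → emb i a < emb i c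
      pos-in 0F l = J.pos-in l
      pos-in 1F l = J.pos-in (I.pos-in l)
      pos-in 2F l = J.pos-in (I.pos-in l)
      pos-out : ∀ i j {a c} → i < j → emb i a < emb j c
      pos-out 0F 1F l = J.pos-out (s≤s z≤n)
      pos-out 0F 2F l = J.pos-out (s≤s z≤n)
      pos-out 1F 2F l = J.pos-in (I.pos-out (s≤s z≤n))
      pos-out 0F 0F ()
      pos-out 1F 0F ()
      pos-out 1F 1F (s≤s ())
      pos-out 2F 0F ()
      pos-out 2F 1F (s≤s ())
      pos-out 2F 2F (s≤s (s≤s ()))
      val-in : ∀ i {a c} → val (triple x y z i) a < val (triple x y z i) c → val v (emb i a) < val v (emb i c)
      val-in 0F l = J.val-in l
      val-in 1F l = J.val-in (I.val-in l)
      val-in 2F l = J.val-in (I.val-in l)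
      val-out : ∀ i j {a c} → val perm321 i < val perm321 j → val v (emb i a) < val v (emb j c)
      val-out 1F 0F l = J.val-out (s≤s z≤n)
      val-out 2F 0F l = J.val-out (s≤s z≤n)
      val-out 2F 1F l = J.val-in (I.val-out (s≤s z≤n))
      val-out 0F 0F (s≤s (s≤s ()))
      val-out 0F 1F (s≤s ())
      val-out 0F 2F ()
      val-out 1F 1F (s≤s ())
      val-out 1F 2F ()
      val-out 2F 2F ()

  -- Both sides are inflations of `321` by the same three blocks.
  associative21 : ∀ {x y z u w v v'} → Inflation perm21 (pair x y) u → Inflation perm21 (pair u z) v →
                  Inflation perm21 (pair y z) w → Inflation perm21 (pair x w) v' → v ≅ v'
  associative21 I J I' J' = inflation-≅ (flattenˡ I J) (flattenʳ I' J') (λ _ → ≅-refl)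

  blocks21 : ∀ {x y x' y' p} → x ≅ x' → y ≅ y' → Inflation perm21 (pair x y) p → Inflation perm21 (pair x' y') p
  blocks21 e f = inflation-blocks λ { zero → e ; (suc _) → f }

  -- The involutions 21[α , 21[γ , α⁻¹]] with γ an involution: those for
  -- which inversion does not preserve the normal form.
  record Twist (Good : Perm → Set) (c : Fin 2 → Perm) (p : Perm) : Set where
    field
      α-good    : Good (c 0F)
      γ-good    : Good (c 1F)
      γ-self    : SelfInverse (c 1F)
      α-normal  : ¬ Quotient (c 0F) perm21
      inner     : Perm
      inner-inf : Inflation perm21 (pair (c 1F) (inverse (c 0F))) inner
      outer-inf : Inflation perm21 (pair (c 0F) inner) p

  -- The inverse of 21[α, 21[γ, α⁻¹]] is 21[21[α, γ⁻¹], α⁻¹], and with γ⁻¹ = γ associativity leads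
  -- back.
  twist-self : ∀ {Good c p} → Twist Good c p → SelfInverse p
  twist-self {c = c} {p} t = associative21 inverse-inner
    (inflation21-inverse outer-inf) inner-inf outer-inf
    where
    open Twist t
    inverse-inner : Inflation perm21 (pair (c 0F) (c 1F)) (inverse inner)
    inverse-inner = blocks21 (inverse-inverse (c 0F)) γ-self (inflation21-inverse inner-inf)

  Symmetric : (s : Perm) → (Pos s → Perm) → Set
  Symmetric s b = (∀ i → val s (val s i) ≡ i) × (∀ i → b (val s i) ≅ inverse (b i))

  symmetric-self : ∀ {n σ b p} → Inflation (n , σ) b p → Symmetric (n , σ) b → SelfInverse p
  symmetric-self {n} {σ} {b} I (invol , sym-b) = inflation-≅
    (inflation-skeleton (same from≡to) (inflation-inverse I)) I blocks
    where
    from≡to : ∀ i → val (inverse (n , σ)) i ≡ val (n , σ) i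
    from≡to i = trans (cong (val⁻¹ (n , σ)) (sym (invol i))) (inverseˡ σ)
    blocks : ∀ i → inverse (b (val⁻¹ (n , σ) i)) ≅ b i
    blocks i = subst (λ j → inverse (b (val⁻¹ (n , σ) i)) ≅ b j) (inverseʳ σ) (≅-sym (sym-b (val⁻¹ (n , σ) i)))

  ≅-val : ∀ {n σ τ} → (n , σ) ≅ (n , τ) → ∀ i → val (n , σ) i ≡ val (n , τ) i
  ≅-val (same e) = e

  module _ {Good : Perm → Set} (nonempty : ∀ {p} → Good p → Nonempty p)
           (good-inverse : ∀ {p} → Good p → Good (inverse p))
           (good-pattern : ∀ {p q} → Embedding p q → Nonempty p → Good q → Good p) where

    -- Comparing p = 21[α , 21[γ , δ]] with its inverse gives δ = α⁻¹ and
    -- γ = γ⁻¹.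
    twisted21 : ∀ {α β p} → Inflation perm21 (pair α β) p → SelfInverse p → Good α → Good β →
                ¬ Quotient α perm21 → Quotient (inverse β) perm21 → ∃ λ c → Twist Good c p
    twisted21 {α} {β} {p} I self α-good β-good α-normal Q = pair α γ , record
      { α-good = α-good ; γ-good = good-inverse ζ-good ; γ-self = ≅-sym γ≅γ⁻¹ ; α-normal = α-normal
      ; inner = β ; inner-inf = Jβα ; outer-inf = I }
      where
      -- β⁻¹ = 21[ε, ζ] in normal form gives β = 21[γ, ε⁻¹] with γ = ζ⁻¹, and p = 21[u, ε⁻¹] with u
      -- = 21[α, γ]. Inversion yields a second normal decomposition p = 21[ε, u⁻¹], to be compared
      -- with 21[α, β].
      D = decompose (inverse β) (embedding-size (quotient-embedding Q))
      module D = Decomposed D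
      e : D.skeleton ≅ perm21
      e = unique-skeleton (proj₁ (inflation⇒quotient D.inflation D.nonempty)) Q D.simple
            (indecomposable₂ {perm21} refl) D.size≥2 (s≤s (s≤s z≤n))
      ρ = Iso.map (≅⇒iso (≅-sym e))
      ε = D.blocks (ρ zero)
      ζ = D.blocks (ρ (suc zero))
      J : Inflation perm21 (pair ε ζ) (inverse β)
      J = inflation-blocks {b = D.blocks ∘ ρ} (λ { zero → ≅-refl ; (suc zero) → ≅-refl }) (inflation-skeleton e D.inflation)
      ε-normal : ¬ Quotient ε perm21
      ε-normal = normal-≅ e D.normal refl zero refl
      ζ-good : Good ζ
      ζ-good = good-pattern (Inflation.component J 1F) (D.nonempty _) (good-inverse β-good)
      γ = inverse ζ
      Jβ : Inflation perm21 (pair γ (inverse ε)) β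
      Jβ = inflation-resp (inverse-inverse β) (inflation21-inverse J)
      U = inflate perm21 (pair α γ)
      u = proj₁ U
      V = inflate perm21 (pair u (inverse ε))
      p-left : Inflation perm21 (pair u (inverse ε)) p
      p-left = inflation-resp (associative21 (proj₂ U) (proj₂ V) Jβ I) (proj₂ V)
      p-flipped : Inflation perm21 (pair ε (inverse u)) p
      p-flipped = blocks21 (inverse-inverse ε) ≅-refl (inflation-resp self (inflation21-inverse p-left))
      u-nonempty : Nonempty u
      u-nonempty = ℕ.≤-trans (nonempty α-good) (embedding-size (Inflation.component (proj₂ U) 0F))
      compared : α ≅ ε × β ≅ inverse u
      compared = unique21 I p-flipped ≅-refl (nonempty α-good) (nonempty β-good) (D.nonempty _) u-nonempty α-normal ε-normal
      Jβα : Inflation perm21 (pair γ (inverse α)) β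
      Jβα = blocks21 ≅-refl (≅-inverse (≅-sym (proj₁ compared))) Jβ
      γ≅γ⁻¹ : γ ≅ inverse γ
      γ≅γ⁻¹ = unique21ʳ {α} {γ} {α} {inverse γ} Jβα (inflation21-inverse (proj₂ U)) (proj₂ compared) (nonempty α-good) (D.nonempty _)
                (nonempty α-good) (D.nonempty _) α-normal α-normal

    -- Inverting the decomposition yields another one of `p` with the same skeleton. If it is
    -- normal, uniqueness identifies the blocks. Normality can fail only in length two, and not for
    -- `12`, where inversion leaves the blocks in their places.
    self-inverse-cases :
      ∀ {n σ b p} → Indecomposable (n , σ) → 2 ℕ.≤ n → (∀ i → Good (b i)) → Normal (n , σ) b →
      Inflation (n , σ) b p → SelfInverse p → Symmetric (n , σ) b ⊎ ∃ λ c → Twist Good c p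
    self-inverse-cases {n} {σ} {b} {p} ind n≥2 good normal I self = cases em
      where
      s : Perm
      s = n , σ
      ne : ∀ i → Nonempty (b i)
      ne i = nonempty (good i)
      I⁻¹ : Inflation (inverse s) (λ j → inverse (b (val⁻¹ s j))) p
      I⁻¹ = inflation-resp self (inflation-inverse I)
      s⁻¹≅s : inverse s ≅ s
      s⁻¹≅s = unique-skeleton (proj₁ (inflation⇒quotient I⁻¹ (λ j → ne (val⁻¹ s j)))) (proj₁ (inflation⇒quotient I ne))
        (indecomposable-inverse {s} ind) ind n≥2 n≥2
      from≡to : ∀ i → val⁻¹ s i ≡ val s i
      from≡to = ≅-val s⁻¹≅s
      b' : Pos s → Perm
      b' j = inverse (b (val⁻¹ s j))
      I' : Inflation s b' p
      I' = inflation-skeleton (same from≡to) I⁻¹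
      cases : Relation.Nullary.Dec (Normal s b') → Symmetric s b ⊎ ∃ λ c → Twist Good c p
      cases (yes normal') = inj₁ ((λ i → trans (sym (from≡to (val s i))) (inverseˡ σ)) , λ i →
        subst (λ j → b (val s i) ≅ inverse (b j)) (inverseˡ σ) (unique-blocks I I' ≅-refl ind ind n≥2 ne (λ j → ne (val⁻¹ s j)) normal normal' (val s i)))
      cases (no abnormal) = inj₂ (twisted (decidable-stable em λ none → abnormal λ two i i≡0 Q → none (two , i , i≡0 , Q)))
        where
        twisted : (∃ λ (two : n ≡ 2) → ∃ λ i → toℕ i ≡ 0 × Quotient (b' i) s) → ∃ λ c → Twist Good c p
        twisted (refl , suc _ , () , _)
        twisted (refl , zero , refl , Q) with size-2 {s} refl
        ... | inj₁ (same e) = contradiction (quotient-resp (inverse-inverse (b zero)) s⁻¹≅s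
            (quotient-inverse (subst (λ i → Quotient (inverse (b i)) s) (trans (from≡to zero) (sym (e zero))) Q)))
            (normal refl zero refl)
        ... | inj₂ s≅@(same e) = twisted21
          (inflation-blocks (λ { zero → ≅-refl ; (suc zero) → ≅-refl }) (inflation-skeleton (≅-sym s≅) I))
          self (good zero) (good (suc zero)) (λ H → normal refl zero refl (quotient-resp ≅-refl s≅ H))
          (quotient-resp ≅-refl (≅-sym s≅)
            (subst (λ i → Quotient (inverse (b i)) s) (trans (from≡to zero) (sym (e zero))) Q))

-- Equations for the generating functions of involutions

module InvolutionSeries (em : ExcludedMiddle 0ℓ) where
  open import Data.Fin.Base using (Fin; zero; suc; toℕ; _<_; fromℕ<)
  open import Data.Fin.Patterns using (0F; 1F)
  import Data.Fin.Permutation as Perm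
  open import Data.Fin.Properties using (<-cmp; toℕ-fromℕ<)
  open import Data.Nat.Base as ℕ using (ℕ; zero; suc; s≤s; z≤n; _+_; _*_)
  open import Data.Nat.Properties as ℕ using ()
  open import Data.Rational.Base using (1ℚ)
  open InvolutionEquations em public

  -- A symmetric tuple of blocks of an involution s is determined by its
  -- entries at the fixed points and at the lower points of the 2-cycles.
  module Orbits (s : Perm) where
    data Kind (i : Pos s) : Set where
      fixed : val s i ≡ i → Kind i
      low   : i < val s i → Kind i
      high  : val s i < i → Kind i

    kind : ∀ i → Kind i
    kind i with <-cmp i (val s i)
    ... | tri< l _ _ = low l
    ... | tri≈ _ e _ = fixed (sym e)
    ... | tri> _ _ l = high l

    completion : ∀ {i} → Kind i → Perm → Perm → Perm
    completion (fixed _) x y = x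
    completion (low _)   x y = x
    completion (high _)  x y = inverse y

    complete : (Pos s → Perm) → Pos s → Perm
    complete b i = completion (kind i) (b i) (b (val s i))

    complete-cong : ∀ {b b'} → (∀ i → b i ≅ b' i) → ∀ i → complete b i ≅ complete b' i
    complete-cong e i with kind i
    ... | fixed _ = e i
    ... | low _   = e i
    ... | high _  = ≅-inverse (e (val s i))

    module _ (invol : ∀ i → val s (val s i) ≡ i) where

      complete-pair : ∀ b → (∀ i → val s i ≡ i → SelfInverse (b i)) → ∀ i → complete b (val s i) ≅ inverse (complete b i)
      complete-pair b self i with kind i | kind (val s i)
      ... | fixed e | fixed _ = subst (λ j → b j ≅ inverse (b i)) (sym e) (≅-sym (self i e))
      ... | fixed e | low l   = contradiction (sym (cong (val s) e)) (<⇒≢ l)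
      ... | fixed e | high l  = contradiction (cong (val s) e) (<⇒≢ l)
      ... | low l   | high _  = ≅-inverse (subst (λ j → b j ≅ b i) (sym (invol i)) ≅-refl)
      ... | low l   | fixed e = contradiction (trans (sym e) (invol i)) (<⇒≢ l ∘ sym)
      ... | low l   | low m   = contradiction l (ℕ.<-asym (subst (val s i <_) (invol i) m))
      ... | high l  | low _   = ≅-sym (inverse-inverse (b (val s i)))
      ... | high l  | fixed e = contradiction (trans (sym e) (invol i)) (<⇒≢ l)
      ... | high l  | high m  = contradiction l (ℕ.<-asym (subst (_< val s i) (invol i) m))

    -- The block at the lower point of a 2-cycle also counts for its partner; the entry at the upper
    -- point will be required to be empty.
    weight : ∀ {i} → Kind i → Perm → ℕ
    weight (fixed _) p = 1 * size p
    weight (low _)   p = 2 * size p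
    weight (high _)  p = 1 * size p

    module _ (invol : ∀ i → val s (val s i) ≡ i) (b : Pos s → Perm)
             (self : ∀ i → val s i ≡ i → SelfInverse (b i)) (empty : ∀ i → val s i < i → size (b i) ≡ 0) where
      private
        f : Pos s → ℕ
        f i = size (complete b i)

        f-pair : ∀ i → f (val s i) ≡ f i
        f-pair i = ≅-size (complete-pair invol b self i)

        fixedPart lowPart highPart : ∀ {i} → Kind i → ℕ → ℕ
        fixedPart (fixed _) x = x
        fixedPart (low _)   x = 0
        fixedPart (high _)  x = 0
        lowPart (fixed _) x = 0
        lowPart (low _)   x = x
        lowPart (high _)  x = 0
        highPart (fixed _) x = 0
        highPart (low _)   x = 0
        highPart (high _)  x = x

        f-parts : ∀ i → f i ≡ fixedPart (kind i) (f i) + (lowPart (kind i) (f i) + highPart (kind i) (f i))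
        f-parts i with kind i
        ... | fixed _ = sym (ℕ.+-identityʳ _)
        ... | low _   = sym (ℕ.+-identityʳ _)
        ... | high _  = refl

        w-parts : ∀ i → weight (kind i) (b i) ≡ fixedPart (kind i) (f i) + (lowPart (kind i) (f i) + lowPart (kind i) (f i))
        w-parts i with kind i
        ... | fixed _ = refl
        ... | low _   = cong (size (b i) +_) (ℕ.+-identityʳ _)
        ... | high l  = trans (ℕ.+-identityʳ _) (empty i l)

        low≡high : ∀ i → lowPart (kind (val s i)) (f (val s i)) ≡ highPart (kind i) (f i)
        low≡high i = trans (cong (lowPart (kind (val s i))) (f-pair i)) (swap (kind i) (kind (val s i)))
          where
          swap : (k : Kind i) (k' : Kind (val s i)) → lowPart k' (f i) ≡ highPart k (f i)
          swap (fixed e) (fixed _) = refl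
          swap (fixed e) (low l)   = contradiction (sym (cong (val s) e)) (<⇒≢ l)
          swap (fixed e) (high _)  = refl
          swap (low l)   (low m)   = contradiction l (ℕ.<-asym (subst (val s i <_) (invol i) m))
          swap (low _)   (fixed _) = refl
          swap (low _)   (high _)  = refl
          swap (high _)  (low _)   = refl
          swap (high l)  (fixed e) = contradiction (trans (sym e) (invol i)) (<⇒≢ l)
          swap (high l)  (high m)  = contradiction l (ℕ.<-asym (subst (_< val s i) (invol i) m))

      -- Permuting the summation index by the skeleton exchanges lower and upper points, so twice
      -- the lower sizes equals the lower plus the upper sizes.
      weight-sum : sum (λ i → weight (kind i) (b i)) ≡ sum f
      weight-sum = begin
        sum (λ i → weight (kind i) (b i))
          ≡⟨ sum-cong-≗ w-parts ⟩
        sum (λ i → fp i + (lp i + lp i))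
          ≡⟨ trans (∑-distrib-+ fp (λ i → lp i + lp i)) (cong (sum fp +_) (∑-distrib-+ lp lp)) ⟩
        sum fp + (sum lp + sum lp)
          ≡⟨ cong (λ x → sum fp + (sum lp + x)) (trans (sum-permute lp (proj₂ s)) (sum-cong-≗ low≡high)) ⟩
        sum fp + (sum lp + sum hp)
          ≡⟨ sym (trans (∑-distrib-+ fp (λ i → lp i + hp i)) (cong (sum fp +_) (∑-distrib-+ lp hp))) ⟩
        sum (λ i → fp i + (lp i + hp i))
          ≡⟨ sym (sum-cong-≗ f-parts) ⟩
        sum f ∎
        where
        open ≡-Reasoning
        fp lp hp : Pos s → ℕ
        fp i = fixedPart (kind i) (f i)
        lp i = lowPart (kind i) (f i)
        hp i = highPart (kind i) (f i)

  module _ (Sk : Skeletons) {C : Congruence} (Ty : Typing C) where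
    open Skeletons Sk
    open Typing Ty
    open Generated

    private
      Good = Generated Sk

      nonempty-good : ∀ {p} → Good p → Nonempty p
      nonempty-good g = g .nonempty

    SelfClass : Fin K → Perm → Set
    SelfClass s p = Class Sk Ty s p × SelfInverse p

    module _ {K' : ℕ} (y : Fin K' → Series) (v : Fin K → Expr K') (g : Fin K → Expr K')
             (v-gf : ∀ s → HasGF _≅_ (SelfClass s) (λ p → 1 * size p) (series (v s) y))
             (g-gf : ∀ s → HasGF _≅_ (Class Sk Ty s) (λ p → 2 * size p) (series (g s) y)) where

      private
        w : Perm → ℕ
        w p = 1 * size p

        w-≅ : ∀ {p q} → p ≅ q → w p ≡ w q
        w-≅ e = cong (1 *_) (≅-size e)

      module SymmetricNodes (s : Fin K) (l : Fin count) where
        open Orbits (list l)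

        P : ∀ {i} → Kind i → Perm → Set
        P (fixed _) p = Good p × SelfInverse p
        P (low _)   p = Good p
        P (high _)  p = size p ≡ 0

        -- Upper points hold the empty permutation as a placeholder, which contributes the constant
        -- 1 for its own type and nothing for the others.
        e : ∀ {i} → Kind i → Fin K → Expr K'
        e (fixed _) t = v t
        e (low _)   t = g t
        e (high _)  t = when (∃ λ p → size p ≡ 0 × ty p ≡ t) (con 1ℚ)

        P-≅ : ∀ {i} (k : Kind i) {p q} → p ≅ q → P k p → P k q
        P-≅ (fixed _) p≅q (h , f) = generated-≅ Sk p≅q h , selfInverse-≅ p≅q f
        P-≅ (low _)   p≅q h       = generated-≅ Sk p≅q h
        P-≅ (high _)  p≅q h       = trans (sym (≅-size p≅q)) h

        weight-≅ : ∀ {i} (k : Kind i) {p q} → p ≅ q → weight k p ≡ weight k q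
        weight-≅ (fixed _) e = cong (1 *_) (≅-size e)
        weight-≅ (low _)   e = cong (2 *_) (≅-size e)
        weight-≅ (high _)  e = cong (1 *_) (≅-size e)

        empty-≅ : ∀ {p q} → size p ≡ 0 → size q ≡ 0 → p ≅ q
        empty-≅ {_ , _} {_ , _} refl refl = same λ ()

        e-gf : ∀ {i} (k : Kind i) t → HasGF _≅_ (λ p → P k p × ty p ≡ t) (weight k) (series (e k t) y)
        e-gf (fixed _) t = gf-resp (λ ((h , f) , i) → (h , i) , f) (λ ((h , i) , f) → (h , f) , i) (v-gf t)
        e-gf (low _)   t = g-gf t
        e-gf (high _)  t = gf-resp proj₂ (λ {p} h → (p , h) , h)
          (gf-when y (λ exists → gf-one y ≅-isEquivalence exists (λ (h , _) (h' , _) → empty-≅ h h')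
            (λ (h , _) → trans (ℕ.+-identityʳ _) h)))

        SymmetricNode : (Pos (list l) → Perm) → Perm → Set
        SymmetricNode b p = Node Sk Ty s l b p × Symmetric (list l) b

        Types : (Pos (list l) → Fin K) → Set
        Types t = ∃₂ λ b p → (∀ i → P (kind i) (b i)) × SymmetricNode (complete b) p × ∀ i → ty (b i) ≡ t i

        types-≗ : ∀ {t t'} → (∀ i → t i ≡ t' i) → Types t → Types t'
        types-≗ t≗ (b , p , Pb , n , f) = b , p , Pb , n , λ i → trans (f i) (t≗ i)

        fixed-self : ∀ (b : Pos (list l) → Perm) → (∀ i → P (kind i) (b i)) → ∀ i → val (list l) i ≡ i → SelfInverse (b i)
        fixed-self b Pb i e with kind i | Pb i
        ... | fixed _ | _ , f = f
        ... | low l   | _     = contradiction (sym e) (<⇒≢ l)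
        ... | high l  | _     = contradiction e (<⇒≢ l)

        high-empty : ∀ (b : Pos (list l) → Perm) → (∀ i → P (kind i) (b i)) → ∀ i → val (list l) i < i → size (b i) ≡ 0
        high-empty b Pb i l with kind i | Pb i
        ... | fixed e | _ = contradiction e (<⇒≢ l)
        ... | low m   | _ = contradiction l (ℕ.<-asym m)
        ... | high _  | h = h

        complete-good : (∀ i → val (list l) (val (list l) i) ≡ i) → ∀ (b : Pos (list l) → Perm) → (∀ i → P (kind i) (b i)) → ∀ i → Good (complete b i)
        complete-good invol b Pb i with kind i | Pb i
        ... | fixed _ | h , _ = h
        ... | low _   | h     = h
        ... | high m  | _     with kind (val (list l) i) | Pb (val (list l) i)
        ...   | fixed _ | h , _ = generated-inverse Sk h
        ...   | low _   | h     = generated-inverse Sk h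
        ...   | high m' | _     = contradiction m (ℕ.<-asym (subst (_< val (list l) i) (invol i) m'))

        complete-ty : ∀ (b b' : Pos (list l) → Perm) → (∀ i → ty (b i) ≡ ty (b' i)) → ∀ i → ty (complete b i) ≡ ty (complete b' i)
        complete-ty b b' f i with kind i
        ... | fixed _ = f i
        ... | low _   = f i
        ... | high _  = ty-inverse (f (val (list l) i))

        node : ∀ {b : Pos (list l) → Perm} {p} → (∀ i → P (kind i) (b i)) × Types (ty ∘ b) → Inflation (list l) (complete b) p → SymmetricNode (complete b) p
        node {b} (Pb , (b' , p' , Pb' , (n , (invol , _)) , f)) I =
          node-ty Sk Ty n (complete-good invol b Pb) (complete-ty b' b f) I ,
          invol , complete-pair invol b (fixed-self b Pb)

        half : ∀ {i} → Kind i → Perm → Perm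
        half (fixed _) p = p
        half (low _)   p = p
        half (high _)  p = 0 , Perm.id

        half-P : ∀ {b : Pos (list l) → Perm} {p} → SymmetricNode b p → ∀ i → P (kind i) (half (kind i) (b i))
        half-P {b} ((D , _) , (invol , pairs)) i with kind i
        ... | fixed e = Decomposition′.good D i , ≅-sym (subst (λ j → b j ≅ inverse (b i)) e (pairs i))
        ... | low _   = Decomposition′.good D i
        ... | high _  = refl

        half-complete : ∀ {b : Pos (list l) → Perm} → Symmetric (list l) b → ∀ i → complete (λ i → half (kind i) (b i)) i ≅ b i
        half-complete {b} (invol , pairs) i with kind i
        ... | fixed _ = ≅-refl
        ... | low _   = ≅-refl
        ... | high m  with kind (val (list l) i)
        ...   | fixed _ = ≅-sym (subst (λ j → b j ≅ inverse (b (val (list l) i))) (invol i) (pairs (val (list l) i)))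
        ...   | low _   = ≅-sym (subst (λ j → b j ≅ inverse (b (val (list l) i))) (invol i) (pairs (val (list l) i)))
        ...   | high m' = contradiction m (ℕ.<-asym (subst (_< val (list l) i) (invol i) m'))

        complete-injective : ∀ {b b' : Pos (list l) → Perm} → (∀ i → P (kind i) (b i)) → (∀ i → P (kind i) (b' i)) →
                             (∀ i → complete b i ≅ complete b' i) → ∀ i → b i ≅ b' i
        complete-injective Pb Pb' f i with kind i | Pb i | Pb' i | f i
        ... | fixed _ | _ | _  | h = h
        ... | low _   | _ | _  | h = h
        ... | high _  | h | h' | _ = empty-≅ h h'

        expr : Expr K'
        expr = tupleExpr ty ty-≅ y (size (list l)) (λ i → e (kind i)) Types

        gf : HasGF _≅_ (λ p → ∃ λ b → SymmetricNode b p) w (series expr y)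
        gf = gf-transfer tuple-isEquivalence ≅-isEquivalence correspondence
          (λ b≅ (Pb , t) → (λ i → P-≅ (kind i) (b≅ i) (Pb i)) , types-≗ (λ i → ty-≅ (b≅ i)) t)
          (λ b≅ → sum-cong-≗ (λ i → weight-≅ (kind i) (b≅ i))) weights
          (gf-tuple ty ty-≅ y (size (list l)) (λ i → P (kind i)) (λ i → weight (kind i)) (λ i → e (kind i)) Types
            (λ {i} → P-≅ (kind i)) (λ {i} → weight-≅ (kind i)) types-≗ (λ i → e-gf (kind i)))
          where
          R : (Pos (list l) → Perm) → Perm → Set
          R b p = Inflation (list l) (complete b) p
          weights : ∀ {b p} → (∀ i → P (kind i) (b i)) × Types (ty ∘ b) → (∃ λ b → SymmetricNode b p) → R b p →
                    sum (λ i → weight (kind i) (b i)) ≡ w p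
          weights {b} h@(Pb , _) _ I = trans
            (weight-sum (proj₁ (proj₂ (node h I))) b (fixed-self b Pb) (high-empty b Pb))
            (trans (sym (size-sum I)) (sym (ℕ.+-identityʳ _)))
          correspondence : Correspondence Tuple≅ _≅_ (λ b → (∀ i → P (kind i) (b i)) × Types (ty ∘ b))
                             (λ p → ∃ λ b → SymmetricNode b p) R
          correspondence = record
            { to = λ {b} h → let (p , I) = inflate (list l) (complete b) in p , (complete b , node h I) , I
            ; from = λ {p} (b , n) →
                let c = λ i → half (kind i) (b i)
                    Pc = half-P n
                    c≅b = half-complete (proj₂ n)
                    I = inflation-blocks (λ i → ≅-sym (c≅b i)) (Decomposition′.inflation (proj₁ (proj₁ n)))
                    invol = proj₁ (proj₂ n)
                in c , (Pc , (c , p , Pc ,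
                     (node-ty Sk Ty (proj₁ n) (complete-good invol c Pc) (λ i → ty-≅ (≅-sym (c≅b i))) I ,
                      invol , complete-pair invol c (fixed-self c Pc)) , λ _ → refl)) , I
            ; to-cong = λ _ _ _ _ I J b≅ → inflation-≅ I J (complete-cong b≅)
            ; to-inj = λ h h' _ _ I J p≅ → complete-injective (proj₁ h) (proj₁ h')
                (decomposition-blocks Sk Ty (proj₁ (proj₁ (node h I))) (proj₁ (proj₁ (node h' J))) p≅) }

        -- A 2-cycle may supply the only nonconstant factor, as in `21`; hence `g` has to be proper
        -- and not merely positive. Without 2-cycles there are at least two fixed points, each with
        -- a positive factor.
        expr-proper : (∀ i → val (list l) (val (list l) i) ≡ i) → (∀ t → Positive (v t)) → (∀ t → Proper (g t)) →
                      2 ℕ.≤ size (list l) → Proper expr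
        expr-proper invol v-pos g-proper l≥2 with em {∃ λ i → i < val (list l) i}
        ... | yes (j , m) = tuple-proper₁ ty ty-≅ y (size (list l)) (λ i → e (kind i)) Types j proper
          where
          proper : ∀ t → Proper (e (kind j) t)
          proper t with kind j
          ... | low _   = g-proper t
          ... | fixed q = contradiction (sym q) (<⇒≢ m)
          ... | high m' = contradiction m (ℕ.<-asym m')
        ... | no none = tuple-proper₂ ty ty-≅ y (size (list l)) (λ i → e (kind i)) Types i₀ i₁
            (λ q → contradiction (trans (sym (toℕ-fromℕ< _)) (trans (cong toℕ q) (toℕ-fromℕ< _))) λ ())
            (pos i₀) (pos i₁)
          where
          i₀ = fromℕ< (ℕ.≤-trans (s≤s z≤n) l≥2)
          i₁ = fromℕ< l≥2
          pos : ∀ i t → Positive (e (kind i) t)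
          pos i t with kind i
          ... | fixed _ = v-pos t
          ... | low m   = contradiction (i , m) none
          ... | high m  = contradiction (val (list l) i , subst (val (list l) i <_) (sym (invol i)) m) none

        Involutive : Set
        Involutive = ∀ i → val (list l) (val (list l) i) ≡ i

        nodeExpr′ : Expr K'
        nodeExpr′ = when (Skeleton Sk Ty l × Involutive) expr

        gf-symmetric : HasGF _≅_ (λ p → ∃ λ b → SymmetricNode b p) w (series nodeExpr′ y)
        gf-symmetric = gf-resp proj₂ (λ (b , n) → (Decomposition′.skeleton (proj₁ (proj₁ n)) , proj₁ (proj₂ n)) , (b , n))
          (gf-when y (λ _ → gf))

      module Twists (s : Fin K) where
        P : Fin 2 → Perm → Set
        P zero    p = Good p
        P (suc _) p = Good p × SelfInverse p

        weight′ : Fin 2 → Perm → ℕ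
        weight′ zero    p = 2 * size p
        weight′ (suc _) p = 1 * size p

        e : Fin 2 → Fin K → Expr K'
        e zero    = g
        e (suc _) = v

        P-≅ : ∀ i {p q} → p ≅ q → P i p → P i q
        P-≅ zero    p≅q h       = generated-≅ Sk p≅q h
        P-≅ (suc _) p≅q (h , f) = generated-≅ Sk p≅q h , selfInverse-≅ p≅q f

        weight-≅ : ∀ i {p q} → p ≅ q → weight′ i p ≡ weight′ i q
        weight-≅ zero    e = cong (2 *_) (≅-size e)
        weight-≅ (suc _) e = cong (1 *_) (≅-size e)

        e-gf : ∀ i t → HasGF _≅_ (λ p → P i p × ty p ≡ t) (weight′ i) (series (e i t) y)
        e-gf zero    t = g-gf t
        e-gf (suc _) t = gf-resp (λ ((h , f) , i) → (h , i) , f) (λ ((h , i) , f) → (h , f) , i) (v-gf t)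

        module _ {c p} (t : Twist Good c p) where
          open Twist t

          inner-nonempty : Nonempty inner
          inner-nonempty = ℕ.≤-trans (γ-good .nonempty) (embedding-size (Inflation.component inner-inf 0F))

          outer-nonempty : ∀ i → Nonempty (pair (c 0F) inner i)
          outer-nonempty zero    = α-good .nonempty
          outer-nonempty (suc _) = inner-nonempty

          inner-blocks-nonempty : ∀ i → Nonempty (pair (c 1F) (inverse (c 0F)) i)
          inner-blocks-nonempty zero    = γ-good .nonempty
          inner-blocks-nonempty (suc _) = α-good .nonempty

          twist-quotient : Quotient p perm21
          twist-quotient = proj₁ (inflation⇒quotient outer-inf outer-nonempty)

          inner-quotient : Quotient inner perm21
          inner-quotient = proj₁ (inflation⇒quotient inner-inf inner-blocks-nonempty)

          twist-size≥2 : 2 ℕ.≤ size p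
          twist-size≥2 = embedding-size (quotient-embedding twist-quotient)

          twist-good : Good p
          twist-good = generated-inflate Sk (two refl) outer-inf
            (λ { zero → α-good ; (suc _) → generated-inflate Sk (two refl) inner-inf
                 (λ { zero → γ-good ; (suc _) → generated-inverse Sk α-good }) inner-nonempty })
            (ℕ.≤-trans (s≤s z≤n) twist-size≥2)

          twist-weight : 2 * size (c 0F) + (1 * size (c 1F) + 0) ≡ 1 * size p
          twist-weight = sym (trans (ℕ.+-identityʳ _) (trans (size-sum outer-inf)
            (trans (cong (λ m → a + (m + 0)) (size-sum inner-inf)) (arithmetic a (size (c 1F))))))
            where
            a = size (c 0F)
            open import Data.Nat.Solver using (module +-*-Solver)
            open +-*-Solver
            arithmetic : ∀ a γ → a + ((γ + (a + 0)) + 0) ≡ 2 * a + (1 * γ + 0)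
            arithmetic = solve 2 (λ a γ → a :+ ((γ :+ (a :+ con 0)) :+ con 0) := con 2 :* a :+ (con 1 :* γ :+ con 0)) refl

        module _ {c c' p p'} (t : Twist Good c p) (t' : Twist Good c' p') where
          private
            module T = Twist t
            module T' = Twist t'

          twist-ty : (∀ i → ty (c i) ≡ ty (c' i)) → ty p ≡ ty p'
          twist-ty f = ty-inflate (indecomposable₂ {perm21} refl) (s≤s (s≤s z≤n)) T.outer-inf T'.outer-inf
            (outer-nonempty t) (outer-nonempty t')
            λ { zero → f 0F
              ; (suc _) → ty-inflate (indecomposable₂ {perm21} refl) (s≤s (s≤s z≤n)) T.inner-inf T'.inner-inf
                  (inner-blocks-nonempty t) (inner-blocks-nonempty t')
                  λ { zero → f 1F ; (suc _) → ty-inverse (f 0F) } }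

          twist-cong : (∀ i → c i ≅ c' i) → p ≅ p'
          twist-cong f = inflation-≅ T.outer-inf T'.outer-inf
            λ { zero → f 0F
              ; (suc _) → inflation-≅ T.inner-inf T'.inner-inf λ { zero → f 1F ; (suc _) → ≅-inverse (f 0F) } }

          twist-injective : p ≅ p' → ∀ i → c i ≅ c' i
          twist-injective e = λ { zero → proj₁ outer ; (suc zero) → inner′ }
            where
            outer = unique21 T.outer-inf T'.outer-inf e (T.α-good .nonempty) (inner-nonempty t) (T'.α-good .nonempty)
                      (inner-nonempty t') T.α-normal T'.α-normal
            inner′ : c 1F ≅ c' 1F
            inner′ = unique21ʳ T.inner-inf T'.inner-inf (proj₂ outer) (T.α-good .nonempty) (T.γ-good .nonempty)
                       (T'.α-good .nonempty) (T'.γ-good .nonempty) T.α-normal T'.α-normal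

        Types : (Fin 2 → Fin K) → Set
        Types t = ∃₂ λ c p → Twist Good c p × ty p ≡ s × ∀ i → ty (c i) ≡ t i

        types-≗ : ∀ {t t'} → (∀ i → t i ≡ t' i) → Types t → Types t'
        types-≗ t≗ (c , p , T , h , f) = c , p , T , h , λ i → trans (f i) (t≗ i)

        twist : ∀ {c} → (∀ i → P i (c i)) × Types (ty ∘ c) → ∃ λ p → Twist Good c p
        twist {c} (Pc , (c' , p' , T' , _ , f)) = proj₁ outer , record
          { α-good = Pc 0F ; γ-good = proj₁ (Pc 1F) ; γ-self = proj₂ (Pc 1F)
          ; α-normal = λ Q → Twist.α-normal T' (ty-quotient refl (sym (f 0F)) Q)
          ; inner = proj₁ inner ; inner-inf = proj₂ inner ; outer-inf = proj₂ outer }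
          where
          inner = inflate perm21 (pair (c 1F) (inverse (c 0F)))
          outer = inflate perm21 (pair (c 0F) (proj₁ inner))

        twistExpr : Expr K'
        twistExpr = tupleExpr ty ty-≅ y 2 e Types

        gf-twist : HasGF _≅_ (λ p → (∃ λ c → Twist Good c p) × ty p ≡ s) w (series twistExpr y)
        gf-twist = gf-transfer tuple-isEquivalence ≅-isEquivalence correspondence
          (λ c≅ (Pc , t) → (λ i → P-≅ i (c≅ i) (Pc i)) , types-≗ (λ i → ty-≅ (c≅ i)) t)
          (λ c≅ → sum-cong-≗ {2} (λ i → weight-≅ i (c≅ i))) (λ _ _ T → twist-weight T)
          (gf-tuple ty ty-≅ y 2 P weight′ e Types (λ {i} → P-≅ i) (λ {i} → weight-≅ i) types-≗ e-gf)
          where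
          correspondence : Correspondence Tuple≅ _≅_ (λ c → (∀ i → P i (c i)) × Types (ty ∘ c))
                             (λ p → (∃ λ c → Twist Good c p) × ty p ≡ s) (Twist Good)
          correspondence = record
            { to = λ {c} h → let (p , T) = twist h ; (_ , (c' , p' , T' , e' , f)) = h in
                p , ((c , T) , trans (twist-ty T T' (sym ∘ f)) e') , T
            ; from = λ {p} ((c , T) , h) → c ,
                ((λ { zero → Twist.α-good T ; (suc zero) → Twist.γ-good T , Twist.γ-self T }) ,
                 (c , p , T , h , λ _ → refl)) , T
            ; to-cong = λ _ _ _ _ T T' → twist-cong T T'
            ; to-inj = λ _ _ _ _ T T' → twist-injective T T' }

        twist-proper : (∀ t → Proper (g t)) → Proper twistExpr
        twist-proper g-proper = tuple-proper₁ ty ty-≅ y 2 e Types 0F g-proper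

      private
        module SN = SymmetricNodes
        module TW = Twists

      -- In a symmetric inflation of `21` the second block is the inverse of the first. For a twist
      -- this would identify 21[γ, α⁻¹] with α⁻¹, making α divisible by `21`.
      symmetric-not-twist : ∀ {n σ b p c q} → Indecomposable (n , σ) → 2 ℕ.≤ n → (∀ i → Good (b i)) →
        Normal (n , σ) b → Inflation (n , σ) b p → Symmetric (n , σ) b → Twist Good c q → ¬ p ≅ q
      symmetric-not-twist {σ = σ} {b} {p} {c} {q} ind n≥2 good normal I (_ , pairs) T p≅q
        with unique-skeleton (TW.twist-quotient (ty p) T)
               (quotient-resp p≅q ≅-refl (proj₁ (inflation⇒quotient I (λ i → good i .nonempty))))
               (indecomposable₂ {perm21} refl) ind (s≤s (s≤s z≤n)) n≥2
      ... | s≅@(same e) = T.α-normal (quotient21-inverse (quotient-resp inner≅ ≅-refl (TW.inner-quotient (ty p) T)))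
        where
        module T = Twist T
        I21 : Inflation perm21 (pair (b zero) (b (suc zero))) p
        I21 = inflation-blocks (λ { zero → ≅-refl ; (suc zero) → ≅-refl }) (inflation-skeleton (≅-sym s≅) I)
        blocks : b zero ≅ c 0F × b (suc zero) ≅ T.inner
        blocks = unique21 I21 T.outer-inf p≅q (good zero .nonempty) (good (suc zero) .nonempty) (T.α-good .nonempty)
          (TW.inner-nonempty (ty p) T)
          (λ H → normal refl zero refl (quotient-resp ≅-refl s≅ H)) T.α-normal
        inner≅ : T.inner ≅ inverse (c 0F)
        inner≅ = ≅-trans (≅-sym (proj₂ blocks))
          (≅-trans (subst (λ i → b i ≅ inverse (b zero)) (sym (e zero)) (pairs zero)) (≅-inverse (proj₁ blocks)))

      selfExpr : Fin K → Expr K'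
      selfExpr s = singleExpr Sk Ty 0 s ⊹ (ΣE (λ l → SN.nodeExpr′ s l) ⊹ TW.twistExpr s)

      gf-self : ∀ s → HasGF _≅_ (SelfClass s) w (series (selfExpr s) y)
      gf-self s = gf-resp from to (gf-⊎ apart₁ (λ q p e → apart₁ p q (≅-sym e)) (gf-single Sk Ty 0 y s)
        (gf-⊎ apart₂ (λ q p e → apart₂ p q (≅-sym e))
          (gf-Σ y (λ l p → ∃ λ b → SN.SymmetricNode s l b p)
            (λ (_ , n) (_ , n') e → decomposition-skeleton Sk Ty (proj₁ (proj₁ n)) (proj₁ (proj₁ n')) e)
            (λ l → SN.gf-symmetric s l))
          (TW.gf-twist s)))
        where
        Nodes Twisted : Perm → Set
        Nodes p = ∃ λ l → ∃ λ b → SN.SymmetricNode s l b p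
        Twisted p = (∃ λ c → Twist Good c p) × ty p ≡ s
        apart₁ : ∀ {p q} → Single Sk Ty s p → Nodes q ⊎ Twisted q → ¬ p ≅ q
        apart₁ p (inj₁ (l , b , n)) = single-or-node Sk Ty p (proj₁ n)
        apart₁ (e , _) (inj₂ ((c , T) , _)) p≅q = ℕ.<⇒≢ (TW.twist-size≥2 s T) (trans (sym e) (≅-size p≅q))
        apart₂ : ∀ {p q} → Nodes p → Twisted q → ¬ p ≅ q
        apart₂ (l , b , ((D , _) , sym-b)) ((c , T) , _) = symmetric-not-twist D.simple D.size≥2 D.good D.normal D.inflation sym-b T
          where module D = Decomposition′ D
        from : ∀ {p} → Single Sk Ty s p ⊎ (Nodes p ⊎ Twisted p) → SelfClass s p
        from (inj₁ (e , t)) = (generated-single Sk e , t) , single-≅ Sk Ty e e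
        from (inj₂ (inj₁ (l , b , ((D , t) , sym-b)))) =
          (Decomposition′.good-p D , t) , symmetric-self (Decomposition′.inflation D) sym-b
        from (inj₂ (inj₂ ((c , T) , t))) = (TW.twist-good s T , t) , twist-self T
        to : ∀ {p} → SelfClass s p → Single Sk Ty s p ⊎ (Nodes p ⊎ Twisted p)
        to (h , self) with class-cases Sk Ty h
        ... | inj₁ single = inj₁ single
        ... | inj₂ (l , b , (D , t)) with self-inverse-cases nonempty-good (generated-inverse Sk) (generated-pattern Sk)
                                            D.simple D.size≥2 D.good D.normal D.inflation self
          where module D = Decomposition′ D
        ...   | inj₁ sym-b = inj₂ (inj₁ (l , b , ((D , t) , sym-b)))
        ...   | inj₂ T     = inj₂ (inj₂ (T , t))

      self-proper : (∀ t → Positive (v t)) → (∀ t → Proper (g t)) → ∀ s → Proper (selfExpr s)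
      self-proper v-pos g-proper s = single-proper Sk Ty 0 s ⊹
        (ΣE-proper (λ l → when-proper _ (λ (S , invol) → SN.expr-proper s l invol v-pos g-proper (Skeleton.size≥2 S)))
         ⊹ TW.twist-proper s g-proper)

-- Algebraicity of the counts

module AlgebraicCounts (em : ExcludedMiddle 0ℓ) where
  open import Data.Fin.Base using (Fin; zero; suc; splitAt; _↑ˡ_; _↑ʳ_)
  open import Data.Fin.Permutation using (Permutation′; _⟨$⟩ʳ_; inverseˡ; inverseʳ)
  open import Data.Fin.Properties using (splitAt-↑ˡ; splitAt-↑ʳ)
  open import Data.Fin.Subset using (⊤)
  open import Data.Fin.Subset.Properties using (∈⊤)
  open import Data.List.Base using (List; []; _∷_; _++_; map; length; lookup)
  open import Data.List.Relation.Unary.All as All using (All; []; _∷_)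
  open import Data.List.Relation.Unary.Any as Any using (Any; here; there)
  open import Data.List.Relation.Unary.Any.Properties as Any using (lookup-index; ++⁺ˡ; ++⁺ʳ; map⁺)
  open import Data.Nat.Base as ℕ using (ℕ; zero; suc; s≤s; z≤n; _+_; _*_)
  open import Data.Nat.Properties as ℕ using ()
  open import Data.Rational.Base as ℚ using (ℚ; 0ℚ)
  open import Data.Rational.Properties as ℚ using ()
  open import Data.Unit.Base as Unit using (tt)
  open import Function.Bundles using (Inverse)
  open ConditionCongruences em using (NonInvolutive; conditions-congruence; Saturates)
  open FiniteBasis em using (finite-basis)
  open InvolutionSeries em

  involution⇒self : ∀ {n} {π : Permutation′ n} → Involution π → SelfInverse (n , π)
  involution⇒self {n} {π} h = same λ i → trans (cong (val⁻¹ (n , π)) (sym (h i))) (inverseˡ π)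

  self⇒involution : ∀ {n} {π : Permutation′ n} → SelfInverse (n , π) → Involution π
  self⇒involution {n} {π} e i = trans (cong (π ⟨$⟩ʳ_) (sym (≅-val e i))) (inverseʳ π)

  satisfies-split : ∀ cs p → SatisfiesAll cs (proj₂ p) →
                    All (λ c → NonInvolutive c p) cs × (Any (involution ≡_) cs → SelfInverse p)
  satisfies-split []       p []       = [] , λ ()
  satisfies-split (c ∷ cs) p (h ∷ hs) with satisfies-split cs p hs
  ... | ns , f = forget c h ∷ ns , λ { (here refl) → involution⇒self h ; (there i) → f i }
    where
    forget : ∀ c → Satisfies (proj₂ p) c → NonInvolutive c p
    forget alternating  h = h
    forget evenPerm     h = h
    forget dumont₁      h = h
    forget involution   h = tt
    forget (avoiding B) h = h

  satisfies-join : ∀ cs p → All (λ c → NonInvolutive c p) cs → (Any (involution ≡_) cs → SelfInverse p) →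
                   SatisfiesAll cs (proj₂ p)
  satisfies-join []       p []       f = []
  satisfies-join (c ∷ cs) p (h ∷ hs) f = recall c h (f ∘ here) ∷ satisfies-join cs p hs (f ∘ there)
    where
    recall : ∀ c → NonInvolutive c p → (involution ≡ c → SelfInverse p) → Satisfies (proj₂ p) c
    recall alternating  h _ = h
    recall evenPerm     h _ = h
    recall dumont₁      h _ = h
    recall involution   _ f = self⇒involution (f refl)
    recall (avoiding B) h _ = h

  -- Containment of β, as a pattern all of whose gaps carry dashes.
  dashed : Perm → Pattern
  dashed (k , β) = blocked (record { size = k ; perm = β ; dashes = ⊤ })

  avoids-dashed : ∀ {p} β → ¬ Embedding β p → Avoids (proj₂ p) (dashed β)
  avoids-dashed β none (f , occ , _) = none (contains⇒embedding (f , occ))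

  dashed-avoids : ∀ {p} β → Avoids (proj₂ p) (dashed β) → ¬ Embedding β p
  dashed-avoids β avoids e = let (f , occ) = embedding⇒contains e in
    avoids (f , occ , λ g i j g∉⊤ _ _ → contradiction ∈⊤ g∉⊤)

  count-enumerates : ∀ {n k} {P : Permutation′ n → Set} → HasCount P k → {Q : Perm → Set} →
                     (∀ π → P π → Q (n , π)) → (∀ π → Q (n , π) → P π) →
                     Enumerates _≅_ (λ p → Q p × 1 * size p ≡ n) k
  count-enumerates {n} {k} {P} count {Q} f g = record
    { at = λ a → n , proj₁ (from a)
    ; sound = λ a → f _ (proj₂ (from a)) , ℕ.+-identityʳ n
    ; distinct = λ {a} {b} e → trans (sym (strictlyInverseˡ a)) (trans (to-cong (≅-val e)) (strictlyInverseˡ b))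
    ; complete = λ { {m , π} (q , e) → found π q (trans (sym (ℕ.+-identityʳ m)) e) } }
    where
    open Inverse count
    found : ∀ {m} (π : Permutation′ m) → Q (m , π) → m ≡ n → ∃ λ a → (n , proj₁ (from a)) ≅ (m , π)
    found π q refl = to (π , g π q) , same (strictlyInverseʳ (π , g π q))

  module _ {K : ℕ} (e : Fin K → Expr K) (proper : ∀ s → Proper (e s)) (y : Fin K → Series)
           (y-0 : ∀ s → y s 0 ≡ 0ℚ) (fixed : ∀ s → y s ≋ series (e s) y) where

    -- The systems concern nonempty permutations only, so `a 0` is added as a constant and only
    -- positive lengths are compared.
    algebraic-count : ∀ (P : Perm → Set) (z : Expr K) → (∀ {p} → P p → Nonempty p) →
                      HasGF _≅_ P (λ p → 1 * size p) (series z y) →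
                      (a : ℕ → ℕ) → (∀ n → Enumerates _≅_ (λ p → P p × 1 * size p ≡ suc n) (a (suc n))) →
                      Algebraic (generatingFunction a)
    algebraic-count P z P-ne z-gf a counts = algebraic-resp agree
      (algebraic-solution em e proper y y-0 fixed (con (fromℕ (a 0)) ⊹ z))
      where
      agree : series (con (fromℕ (a 0)) ⊹ z) y ≋ generatingFunction a
      agree zero with z-gf 0
      ... | k , E , eq = trans (cong (fromℕ (a 0) ℚ.+_) (trans eq (cong fromℕ
        (enumerates-unique ≅-isEquivalence E (enumerates-∅ λ p (h , e) →
          contradiction (P-ne h) (ℕ.<⇒≱ (s≤s (ℕ.≤-reflexive (trans (sym (ℕ.+-identityʳ _)) e)))))))))
        (ℚ.+-identityʳ _)
      agree (suc n) with z-gf (suc n)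
      ... | k , E , eq = trans (ℚ.+-identityˡ _) (trans eq (cong fromℕ (enumerates-unique ≅-isEquivalence E (counts n))))

  zero-constant : ∀ {P F d} → (∀ {p} → P p → Nonempty p) → HasGF _≅_ P (λ p → suc d * size p) F → F 0 ≡ 0ℚ
  zero-constant {P} ne H with H 0
  ... | k , E , eq = trans eq (cong fromℕ (enumerates-unique ≅-isEquivalence E (enumerates-∅ λ p (h , e) →
    contradiction (ne h) (ℕ.<⇒≱ (s≤s (subst (size p ℕ.≤_) e (ℕ.m≤m+n (size p) _)))))))

  module _ {K : ℕ} (F G : Fin K → Series) where

    -- Two families of unknowns side by side: in the application `F` counts all generated
    -- permutations of each type with doubled weights, and `G` the involutions among them.
    joined : Fin (K + K) → Series
    joined = [ F , G ]′ ∘ splitAt K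

    joinedˡ : ∀ s → joined (s ↑ˡ K) ≡ F s
    joinedˡ s = cong [ F , G ]′ (splitAt-↑ˡ K s K)

    joinedʳ : ∀ s → joined (K ↑ʳ s) ≡ G s
    joinedʳ s = cong [ F , G ]′ (splitAt-↑ʳ K K s)

    algebraic-joined : (e f : Fin K → Expr (K + K)) → (∀ s → Proper (e s)) → (∀ s → Proper (f s)) →
                       (∀ s → F s 0 ≡ 0ℚ) → (∀ s → G s 0 ≡ 0ℚ) →
                       (∀ s → F s ≋ series (e s) joined) → (∀ s → G s ≋ series (f s) joined) →
                       ∀ (P : Perm → Set) (z : Expr (K + K)) → (∀ {p} → P p → Nonempty p) →
                       HasGF _≅_ P (λ p → 1 * size p) (series z joined) →
                       (a : ℕ → ℕ) → (∀ n → Enumerates _≅_ (λ p → P p × 1 * size p ≡ suc n) (a (suc n))) →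
                       Algebraic (generatingFunction a)
    algebraic-joined e f e-proper f-proper F-0 G-0 F-fixed G-fixed =
      algebraic-count ([ e , f ]′ ∘ splitAt K) proper joined y-0 fixed
      where
      proper : ∀ s → Proper ([ e , f ]′ (splitAt K s))
      proper s with splitAt K s
      ... | inj₁ i = e-proper i
      ... | inj₂ i = f-proper i
      y-0 : ∀ s → joined s 0 ≡ 0ℚ
      y-0 s with splitAt K s
      ... | inj₁ i = F-0 i
      ... | inj₂ i = G-0 i
      fixed : ∀ s → joined s ≋ series ([ e , f ]′ (splitAt K s)) joined
      fixed s with splitAt K s
      ... | inj₁ i = F-fixed i
      ... | inj₂ i = G-fixed i

  module _ (Sk : Skeletons) {C : Congruence} (Ty : Typing C) (Q : Perm → Set) (Q-saturated : Saturates C Q) where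
    open Typing Ty

    -- `Q` is a union of classes of `C`, so one witness decides for its whole type.
    Accepted : Fin K → Set
    Accepted s = ∃ λ p → ty p ≡ s × Q p

    accepted-sound : ∀ {s p} → Accepted s → ty p ≡ s → Q p
    accepted-sound (q , e , h) e' = Q-saturated (ty-refines (trans e (sym e'))) h

    gf-accepted : ∀ {K'} (y : Fin K' → Series) (v : Fin K → Expr K') (R : Perm → Set) {w} →
                  (∀ s → HasGF _≅_ (λ p → Class Sk Ty s p × R p) w (series (v s) y)) →
                  HasGF _≅_ (λ p → (Generated Sk p × Q p) × R p) w (series (ΣE λ s → when (Accepted s) (v s)) y)
    gf-accepted y v R H = gf-resp
      (λ (s , accepted , (g , t) , r) → (g , accepted-sound accepted t) , r)
      (λ {p} ((g , q) , r) → ty p , (p , refl , q) , (g , refl) , r)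
      (gf-Σ y (λ s p → Accepted s × (Class Sk Ty s p × R p))
        (λ (_ , (_ , t) , _) (_ , (_ , t') , _) e → trans (sym t) (trans (ty-≅ e) t'))
        (λ s → gf-when y (λ _ → H s)))

    Counted : (Perm → Set) → Perm → Set
    Counted R p = (Generated Sk p × Q p) × R p

    AlgebraicFor : (Perm → Set) → Set
    AlgebraicFor R = (a : ℕ → ℕ) →
      (∀ n → Enumerates _≅_ (λ p → Counted R p × 1 * size p ≡ suc n) (a (suc n))) →
      Algebraic (generatingFunction a)

    acceptedExpr : ∀ {K'} → (Fin K → Expr K') → Expr K'
    acceptedExpr v = ΣE λ s → when (Accepted s) (v s)

    private
      ne : ∀ R {p} → Counted R p → Nonempty p
      ne R ((g , _) , _) = Generated.nonempty g

    algebraic-classes : AlgebraicFor (λ _ → Unit.⊤)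
    algebraic-classes = algebraic-count (classExpr Sk Ty 0 y var H) (class-proper Sk Ty 0 y var H (λ s → var s)) y
      (λ s → zero-constant {d = 0} (Generated.nonempty ∘ proj₁) (H s))
      (λ s → gf-unique ≅-isEquivalence (H s) (gf-class Sk Ty 0 y var H s))
      (Counted (λ _ → Unit.⊤)) (acceptedExpr var) (ne (λ _ → Unit.⊤)) (gf-accepted y var (λ _ → Unit.⊤) (λ s → gf-resp (_, _) proj₁ (H s)))
      where
      y : Fin K → Series
      y s = proj₁ (series-exists (Class Sk Ty s) 1)
      H : ∀ s → HasGF _≅_ (Class Sk Ty s) (λ p → 1 * size p) (y s)
      H s = proj₂ (series-exists (Class Sk Ty s) 1)

    module _ (F G : Fin K → Series)
             (F-gf : ∀ s → HasGF _≅_ (Class Sk Ty s) (λ p → 2 * size p) (F s))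
             (G-gf : ∀ s → HasGF _≅_ (SelfClass Sk Ty s) (λ p → 1 * size p) (G s)) where
      private
        y : Fin (K + K) → Series
        y = joined F G
        u v : Fin K → Expr (K + K)
        u s = var (s ↑ˡ K)
        v s = var (K ↑ʳ s)
        u-gf : ∀ s → HasGF _≅_ (Class Sk Ty s) (λ p → 2 * size p) (series (u s) y)
        u-gf s = subst (HasGF _≅_ (Class Sk Ty s) (λ p → 2 * size p)) (sym (joinedˡ F G s)) (F-gf s)
        v-gf : ∀ s → HasGF _≅_ (SelfClass Sk Ty s) (λ p → 1 * size p) (series (v s) y)
        v-gf s = subst (HasGF _≅_ (SelfClass Sk Ty s) (λ p → 1 * size p)) (sym (joinedʳ F G s)) (G-gf s)

      algebraic-involutions′ : AlgebraicFor SelfInverse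
      algebraic-involutions′ = coupled (classExpr Sk Ty 1 y u u-gf) (gf-class Sk Ty 1 y u u-gf)
          (class-proper Sk Ty 1 y u u-gf (λ s → var (s ↑ˡ K)))
        where
        -- The involution equations receive the right-hand sides `e` of the class equations in place
        -- of the unknowns `u`: a bare unknown is not proper, and a skeleton with a single 2-cycle
        -- may contribute nothing else.
        coupled : (e : Fin K → Expr (K + K)) → (∀ s → HasGF _≅_ (Class Sk Ty s) (λ p → 2 * size p) (series (e s) y)) →
                  (∀ s → Proper (e s)) → AlgebraicFor SelfInverse
        coupled e e-gf e-proper = algebraic-joined F G e (selfExpr Sk Ty y v e v-gf e-gf) e-proper
          (self-proper Sk Ty y v e v-gf e-gf (λ s → var (K ↑ʳ s)) e-proper)
          (λ s → zero-constant {d = 1} (λ h → Generated.nonempty (proj₁ h)) (F-gf s))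
          (λ s → zero-constant {d = 0} (λ h → Generated.nonempty (proj₁ (proj₁ h))) (G-gf s))
          (λ s → gf-unique ≅-isEquivalence (F-gf s) (e-gf s))
          (λ s → gf-unique ≅-isEquivalence (G-gf s) (gf-self Sk Ty y v e v-gf e-gf s))
          (Counted SelfInverse) (acceptedExpr v) (ne SelfInverse) (gf-accepted y v SelfInverse v-gf)

    algebraic-involutions : AlgebraicFor SelfInverse
    algebraic-involutions = algebraic-involutions′ (λ s → proj₁ (series-exists (Class Sk Ty s) 2))
      (λ s → proj₁ (series-exists (SelfClass Sk Ty s) 1)) (λ s → proj₂ (series-exists (Class Sk Ty s) 2))
      (λ s → proj₂ (series-exists (SelfClass Sk Ty s) 1))

  module _ (𝒞 : PermClass) (finite : FinitelyManySimples 𝒞) where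
    open PermClass 𝒞

    InClass : Perm → Set
    InClass p = Member (proj₂ p)

    inClass-pattern : ∀ {p q} → Embedding p q → InClass q → InClass p
    inClass-pattern f = closed _ _ (embedding⇒contains f)

    classSkeletons : Skeletons
    classSkeletons = record
      { Allowed = Allowed
      ; closed = λ f s≥2 → λ
          { (inj₁ t≤2) → inj₁ (ℕ.≤-trans (embedding-size f) t≤2)
          ; (inj₂ (inj₁ h)) → inj₂ (inj₁ (inClass-pattern f h))
          ; (inj₂ (inj₂ h)) → inj₂ (inj₂ (inClass-pattern (embedding-inverse f) h)) }
      ; inverse-closed = λ {s} → λ
          { (inj₁ s≤2) → inj₁ s≤2
          ; (inj₂ (inj₁ h)) → inj₂ (inj₂ (inClass-pattern (≅⇒embedding (inverse-inverse s)) h))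
          ; (inj₂ (inj₂ h)) → inj₂ (inj₁ h) }
      ; two = λ e → inj₁ (ℕ.≤-reflexive e)
      ; count = length skeletons ; list = lookup skeletons
      ; listed = λ {s} allowed ind s≥2 → let i = listed {s} allowed ind s≥2 in Any.index i , lookup-index i }
      where
      Allowed : Perm → Set
      Allowed s = size s ℕ.≤ 2 ⊎ InClass s ⊎ InClass (inverse s)
      simples skeletons : List Perm
      simples = proj₁ finite
      skeletons = perm12 ∷ perm21 ∷ simples ++ map inverse simples
      listed : ∀ {s} → Allowed s → Indecomposable s → 2 ℕ.≤ size s → Any (s ≅_) skeletons
      listed {s} (inj₁ s≤2) ind s≥2 with size-2 {s} (ℕ.≤-antisym s≤2 s≥2)
      ... | inj₁ e = here (≅-sym e)
      ... | inj₂ e = there (here (≅-sym e))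
      listed {s} (inj₂ (inj₁ h)) ind s≥2 = there (there (++⁺ˡ (proj₂ finite (proj₂ s) h (indecomposable⇒simple ind))))
      listed {s} (inj₂ (inj₂ h)) ind s≥2 = there (there (++⁺ʳ simples (map⁺ (Any.map
        (λ e → ≅-trans (≅-sym (inverse-inverse s)) (≅-inverse e))
        (proj₂ finite (proj₂ (inverse s)) h (indecomposable⇒simple (indecomposable-inverse {s} ind)))))))

    inClass⇒generated : ∀ {p} → Nonempty p → InClass p → Generated classSkeletons p
    inClass⇒generated ne h = record { nonempty = ne ; skeletons = λ s _ _ f → inj₂ (inj₁ (inClass-pattern f h)) }

    basis : List Pattern
    basis = map dashed (proj₁ (finite-basis classSkeletons InClass))

    inClass⇒avoids : ∀ {p} → InClass p → AvoidsAll basis (proj₂ p)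
    inClass⇒avoids {p} h = go (proj₁ (proj₂ (finite-basis classSkeletons InClass)))
      where
      go : ∀ {B} → All (¬_ ∘ InClass) B → AvoidsAll (map dashed B) (proj₂ p)
      go []               = []
      go {β ∷ _} (b ∷ bs) = avoids-dashed {p} β (λ f → b (inClass-pattern f h)) ∷ go bs

    avoids⇒inClass : ∀ {p} → Generated classSkeletons p → AvoidsAll basis (proj₂ p) → InClass p
    avoids⇒inClass {p} g avoids = decidable-stable em λ ¬h →
      go avoids (proj₂ (proj₂ (finite-basis classSkeletons InClass)) p g ¬h)
      where
      go : ∀ {B} → AvoidsAll (map dashed B) (proj₂ p) → ¬ Any (λ β → Embedding β p) B
      go {β ∷ _} (b ∷ bs) (here f)  = dashed-avoids {p} β b f
      go (b ∷ bs)         (there i) = go bs i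

    module _ (cs : List Condition) (P : ∀ {n} → Permutation′ n → Set)
             (to : ∀ {n} {π : Permutation′ n} → P π → SatisfiesAll cs π)
             (from : ∀ {n} {π : Permutation′ n} → SatisfiesAll cs π → P π) where
      private
        Q : Perm → Set
        -- Membership in the class is imposed as one further avoidance condition.
        Q p = All (λ c → NonInvolutive c p) (avoiding basis ∷ cs)

        Target : Perm → Set
        Target p = InClass p × P (proj₂ p)

        Restricted : (Perm → Set) → Perm → Set
        Restricted R p = (Generated classSkeletons p × Q p) × R p

        counted : ∀ {R : Perm → Set} → (∀ {p} → SatisfiesAll cs (proj₂ p) → R p) →
                  (∀ {p} → R p → Any (involution ≡_) cs → SelfInverse p) →
                  ∀ {n k} → Enumerates _≅_ (λ p → Target p × 1 * size p ≡ suc n) k →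
                  Enumerates _≅_ (λ p → Restricted R p × 1 * size p ≡ suc n) k
        counted {R} f g {n} = enumerates-resp (λ (h , e) → forth h e , e) (λ (h , e) → back h , e)
          where
          forth : ∀ {p} → Target p → 1 * size p ≡ suc n → Restricted R p
          forth {p} (h , q) e =
            (inClass⇒generated (subst (1 ℕ.≤_) (trans (sym e) (ℕ.+-identityʳ _)) (s≤s z≤n)) h ,
             inClass⇒avoids {p} h ∷ proj₁ (satisfies-split cs p (to q))) , f {p} (to q)
          back : ∀ {p} → Restricted R p → Target p
          back {p} ((gen , avoids ∷ ns) , r) = avoids⇒inClass gen avoids , from (satisfies-join cs p ns (g {p} r))

        counts′ : ∀ {a : ℕ → ℕ} → (∀ n → HasCount {n} (λ π → Member π × P π) (a n)) →
                  ∀ n → Enumerates _≅_ (λ p → Target p × 1 * size p ≡ suc n) (a (suc n))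
        counts′ counts n = count-enumerates (counts (suc n)) {Target} (λ _ → id) (λ _ → id)

        -- An involution condition anywhere in the list switches to the system for involutions; all
        -- other conditions only select types.
        algebraic : (∃ λ C → Saturates C Q) → Dec (Any (involution ≡_) cs) → AlgebraicCount 𝒞 P
        algebraic (C , saturated) (yes has) a counts =
          algebraic-involutions classSkeletons (typing C) Q saturated a
            (λ n → counted (λ {p} h → proj₂ (satisfies-split cs p h) has) (λ self _ → self) (counts′ counts n))
        algebraic (C , saturated) (no none) a counts =
          algebraic-classes classSkeletons (typing C) Q saturated a
            (λ n → counted (λ _ → tt) (λ _ has → contradiction has none) (counts′ counts n))

      algebraicCount : AlgebraicCount 𝒞 P
      algebraicCount = algebraic (conditions-congruence (avoiding basis ∷ cs)) em

    algebraicCount₁ : ∀ c → AlgebraicCount 𝒞 (λ π → Satisfies π c)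
    algebraicCount₁ c = algebraicCount (c ∷ []) (λ π → Satisfies π c) (_∷ []) All.head

theorem1p1 : ExcludedMiddle 0ℓ →
    (C : PermClass) → FinitelyManySimples C →
    AlgebraicCount C Alternating
    × AlgebraicCount C EvenPerm
    × AlgebraicCount C Dumont₁
    × ((B : List Pattern) → AlgebraicCount C (AvoidsAll B))
    × AlgebraicCount C Involution
    × ((cs : List Condition) → AlgebraicCount C (SatisfiesAll cs))
theorem1p1 em C finite =
    algebraicCount₁ C finite alternating
  , algebraicCount₁ C finite evenPerm
  , algebraicCount₁ C finite dumont₁
  , (λ B → algebraicCount₁ C finite (avoiding B))
  , algebraicCount₁ C finite involution
  , (λ cs → algebraicCount C finite cs (SatisfiesAll cs) id id)
  where
  open AlgebraicCounts em
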